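{- For any Turing degree $\mathbf d$ with $\mathbf 0<\mathbf d<\mathbf 0'$, there is a theory $U$ such that $\mathsf{G1}$ holds for $U$, $U<_T\mathbf R$, and $U$ has Turing degree $\mathbf d$.
   Context: Theories are identified with the sets of Gödel numbers of their (provable) sentences, so they have Turing degrees; $U<_T V$ means $U\le_T V$ but $V\not\le_T U$. $\mathbf R$ is Robinson's theory in language $\{\mathbf 0,\mathbf S,+,\cdot,\le\}$ ($\le$ primitive, $\overline n=\mathbf S^n\mathbf 0$) with schemes $\overline m+\overline n=\overline{m+n}$; $\overline m\cdot\overline n=\overline{m\cdot n}$; $\overline m\neq\overline n$ for $m\neq n$; $\forall x(x\le\overline n\to x=\overline 0\vee\dots\vee x=\overline n)$; $\forall x(x\le\overline n\vee\overline n\le x)$. "$\mathsf{G1}$ holds for $U$": $U$ is recursively axiomatizable and consistent, and for every recursively axiomatizable consistent theory $S$, if $U$ is interpretable in $S$ then $S$ is incomplete. $\mathbf 0'$ is the degree of the halting problem.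
   Formalization: The degree d is additionally assumed to be a recursively enumerable degree; this is necessary, since a recursively axiomatizable U has r.e. degree and there are non-r.e. degrees strictly between 0 and 0′ (e.g. minimal degrees below 0′). -}

module Defs where

open import Data.Fin.Base using (Fin; zero; suc; toℕ; _↑ˡ_; _↑ʳ_)
open import Data.List.Base using (List; []; _∷_; map)
open import Data.List.Membership.Propositional using (_∈_)
open import Data.Nat.Base using (ℕ; zero; suc; _+_; _*_; _<_)
open import Data.Product.Base using (Σ; ∃-syntax; _×_)
open import Data.Vec.Base using (Vec; []; _∷_; lookup)
open import Function.Base using (_∘_)
open import Function.Bundles using (_⇔_)
open import Level using (0ℓ)
open import Relation.Binary.PropositionalEquality using (_≡_; _≢_; refl)
open import Relation.Nullary.Negation.Core using (¬_)
open import Relation.Unary using (Pred; ∅)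

------------------------------------------------------------------------
-- Codings of finite data by numbers

triangular : ℕ → ℕ
triangular zero    = zero
triangular (suc n) = suc n + triangular n

-- The Cantor pairing bijection.
pair : ℕ → ℕ → ℕ
pair m n = triangular (m + n) + n

nil : ℕ
nil = 0

cons : ℕ → ℕ → ℕ
cons x xs = suc (pair x xs)

------------------------------------------------------------------------
-- Oracle computability: partial recursive functions relative to an
-- oracle, generated by composition, primitive recursion and
-- minimisation.

data Program : ℕ → Set where
  zero   : Program 0
  succ   : Program 1
  proj   : ∀ {k} → Fin k → Program k
  oracle : Program 1
  comp   : ∀ {k m} → Program m → Vec (Program k) m → Program k
  prec   : ∀ {k} → Program k → Program (suc (suc k)) → Program (suc k)
  mu     : ∀ {k} → Program (suc k) → Program k

mutual

  -- Eval A p xs y: with oracle (the characteristic function of) A, the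
  -- program p halts on xs with output y.
  data Eval (A : Pred ℕ 0ℓ) : ∀ {k} → Program k → Vec ℕ k → ℕ → Set where
    zero      : Eval A zero [] 0
    succ      : ∀ {x} → Eval A succ (x ∷ []) (suc x)
    proj      : ∀ {k} {i : Fin k} {xs} → Eval A (proj i) xs (lookup xs i)
    oracle-∈  : ∀ {x} → A x → Eval A oracle (x ∷ []) 1
    oracle-∉  : ∀ {x} → ¬ A x → Eval A oracle (x ∷ []) 0
    comp      : ∀ {k m} {f : Program m} {gs : Vec (Program k) m} {xs ys y} →
                Evals A gs xs ys → Eval A f ys y → Eval A (comp f gs) xs y
    prec-zero : ∀ {k} {f : Program k} {g xs y} →
                Eval A f xs y → Eval A (prec f g) (0 ∷ xs) y
    prec-suc  : ∀ {k} {f : Program k} {g n xs r y} →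
                Eval A (prec f g) (n ∷ xs) r → Eval A g (n ∷ r ∷ xs) y →
                Eval A (prec f g) (suc n ∷ xs) y
    mu        : ∀ {k} {f : Program (suc k)} {xs y} →
                (∀ i → i < y → ∃[ z ] Eval A f (i ∷ xs) (suc z)) →
                Eval A f (y ∷ xs) 0 → Eval A (mu f) xs y

  data Evals (A : Pred ℕ 0ℓ) {k : ℕ} :
             ∀ {m} → Vec (Program k) m → Vec ℕ k → Vec ℕ m → Set where
    []  : ∀ {xs} → Evals A [] xs []
    _∷_ : ∀ {m g} {gs : Vec (Program k) m} {xs y ys} →
          Eval A g xs y → Evals A gs xs ys → Evals A (g ∷ gs) xs (y ∷ ys)

infix 4 _≤ᵀ_ _<ᵀ_ _≡ᵀ_

_≤ᵀ_ : Pred ℕ 0ℓ → Pred ℕ 0ℓ → Set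
A ≤ᵀ B = Σ (Program 1) λ p → ∀ n →
  (A n → Eval B p (n ∷ []) 1) × (¬ A n → Eval B p (n ∷ []) 0)

_<ᵀ_ : Pred ℕ 0ℓ → Pred ℕ 0ℓ → Set
A <ᵀ B = A ≤ᵀ B × ¬ (B ≤ᵀ A)

_≡ᵀ_ : Pred ℕ 0ℓ → Pred ℕ 0ℓ → Set
A ≡ᵀ B = A ≤ᵀ B × B ≤ᵀ A

-- Calls to the oracle ∅ always return 0, so these are the absolute
-- notions.

Recursive : Pred ℕ 0ℓ → Set
Recursive A = A ≤ᵀ ∅

RecursivelyEnumerable : Pred ℕ 0ℓ → Set
RecursivelyEnumerable A = Σ (Program 1) λ p → ∀ n →
  A n ⇔ (∃[ y ] Eval ∅ p (n ∷ []) y)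

HasREDegree : Pred ℕ 0ℓ → Set₁
HasREDegree D = ∃[ W ] (RecursivelyEnumerable W × W ≡ᵀ D)

-- Injective on programs of any given arity.
mutual

  ⌜_⌝ᵖ : ∀ {k} → Program k → ℕ
  ⌜ zero ⌝ᵖ      = pair 0 0
  ⌜ succ ⌝ᵖ      = pair 1 0
  ⌜ proj i ⌝ᵖ    = pair 2 (toℕ i)
  ⌜ oracle ⌝ᵖ    = pair 3 0
  ⌜ comp f gs ⌝ᵖ = pair 4 (pair ⌜ f ⌝ᵖ ⌜ gs ⌝ᵖˢ)
  ⌜ prec f g ⌝ᵖ  = pair 5 (pair ⌜ f ⌝ᵖ ⌜ g ⌝ᵖ)
  ⌜ mu f ⌝ᵖ      = pair 6 ⌜ f ⌝ᵖ

  ⌜_⌝ᵖˢ : ∀ {k m} → Vec (Program k) m → ℕ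
  ⌜ [] ⌝ᵖˢ     = nil
  ⌜ p ∷ ps ⌝ᵖˢ = cons ⌜ p ⌝ᵖ ⌜ ps ⌝ᵖˢ

-- The diagonal halting problem; its degree is 𝟎′.
Halting : Pred ℕ 0ℓ
Halting e = Σ (Program 1) λ p → ⌜ p ⌝ᵖ ≡ e × ∃[ y ] Eval ∅ p (e ∷ []) y

------------------------------------------------------------------------
-- First-order languages and syntax

-- A countable language, with its symbols numbered injectively within
-- each arity.
record Language : Set₁ where
  field
    Func : ℕ → Set
    Rel  : ℕ → Set
    ⌜_⌝ᶠ : ∀ {k} → Func k → ℕ
    ⌜_⌝ʳ : ∀ {k} → Rel k → ℕ
    ⌜⌝ᶠ-injective : ∀ {k} {f g : Func k} → ⌜ f ⌝ᶠ ≡ ⌜ g ⌝ᶠ → f ≡ g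
    ⌜⌝ʳ-injective : ∀ {k} {r s : Rel k} → ⌜ r ⌝ʳ ≡ ⌜ s ⌝ʳ → r ≡ s

open Language public

RecursiveLanguage : Language → Set
RecursiveLanguage L =
  Recursive (λ n → ∃[ k ] Σ (Func L k) λ f → pair k (⌜_⌝ᶠ L f) ≡ n) ×
  Recursive (λ n → ∃[ k ] Σ (Rel L k) λ r → pair k (⌜_⌝ʳ L r) ≡ n)

-- Terms and formulas with (de Bruijn) free variables in Fin n.

data Term (L : Language) (n : ℕ) : Set where
  var  : Fin n → Term L n
  func : ∀ {k} → Func L k → Vec (Term L n) k → Term L n

infix  7 _≐_
infixr 4 _⇒_

data Formula (L : Language) : ℕ → Set where
  _≐_ : ∀ {n} → Term L n → Term L n → Formula L n
  rel : ∀ {n k} → Rel L k → Vec (Term L n) k → Formula L n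
  ⊥′  : ∀ {n} → Formula L n
  _⇒_ : ∀ {n} → Formula L n → Formula L n → Formula L n
  ∀′  : ∀ {n} → Formula L (suc n) → Formula L n

Sentence : Language → Set
Sentence L = Formula L 0

module _ {L : Language} where

  infix  8 ¬′_
  infixr 6 _∧′_
  infixr 5 _∨′_

  ¬′_ : ∀ {n} → Formula L n → Formula L n
  ¬′ φ = φ ⇒ ⊥′

  ⊤′ : ∀ {n} → Formula L n
  ⊤′ = ¬′ ⊥′

  _∧′_ : ∀ {n} → Formula L n → Formula L n → Formula L n
  φ ∧′ ψ = ¬′ (φ ⇒ ¬′ ψ)

  _∨′_ : ∀ {n} → Formula L n → Formula L n → Formula L n
  φ ∨′ ψ = ¬′ φ ⇒ ψ

  ∃′ : ∀ {n} → Formula L (suc n) → Formula L n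
  ∃′ φ = ¬′ (∀′ (¬′ φ))

  mutual

    ⌜_⌝ᵗ : ∀ {n} → Term L n → ℕ
    ⌜ var i ⌝ᵗ         = pair 0 (toℕ i)
    ⌜ func {k} f ts ⌝ᵗ = pair 1 (pair (pair k (⌜_⌝ᶠ L f)) ⌜ ts ⌝ᵗˢ)

    ⌜_⌝ᵗˢ : ∀ {n k} → Vec (Term L n) k → ℕ
    ⌜ [] ⌝ᵗˢ     = nil
    ⌜ t ∷ ts ⌝ᵗˢ = cons ⌜ t ⌝ᵗ ⌜ ts ⌝ᵗˢ

  ⌜_⌝ : ∀ {n} → Formula L n → ℕ
  ⌜ t ≐ s ⌝            = pair 0 (pair ⌜ t ⌝ᵗ ⌜ s ⌝ᵗ)
  ⌜ rel {_} {k} r ts ⌝ = pair 1 (pair (pair k (⌜_⌝ʳ L r)) ⌜ ts ⌝ᵗˢ)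
  ⌜ ⊥′ ⌝               = pair 2 0
  ⌜ φ ⇒ ψ ⌝            = pair 3 (pair ⌜ φ ⌝ ⌜ ψ ⌝)
  ⌜ ∀′ φ ⌝             = pair 4 ⌜ φ ⌝

  mutual

    substᵗ : ∀ {n m} → (Fin n → Term L m) → Term L n → Term L m
    substᵗ σ (var i)     = σ i
    substᵗ σ (func f ts) = func f (substᵗˢ σ ts)

    substᵗˢ : ∀ {n m k} → (Fin n → Term L m) → Vec (Term L n) k → Vec (Term L m) k
    substᵗˢ σ []       = []
    substᵗˢ σ (t ∷ ts) = substᵗ σ t ∷ substᵗˢ σ ts

  lift : ∀ {n m} → (Fin n → Term L m) → Fin (suc n) → Term L (suc m)
  lift σ zero    = var zero
  lift σ (suc i) = substᵗ (var ∘ suc) (σ i)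

  subst : ∀ {n m} → (Fin n → Term L m) → Formula L n → Formula L m
  subst σ (t ≐ s)    = substᵗ σ t ≐ substᵗ σ s
  subst σ (rel r ts) = rel r (substᵗˢ σ ts)
  subst σ ⊥′         = ⊥′
  subst σ (φ ⇒ ψ)    = subst σ φ ⇒ subst σ ψ
  subst σ (∀′ φ)     = ∀′ (subst (lift σ) φ)

  rename : ∀ {n m} → (Fin n → Fin m) → Formula L n → Formula L m
  rename ρ = subst (var ∘ ρ)

  weaken : ∀ {n} → Formula L n → Formula L (suc n)
  weaken = rename suc

  instantiation : ∀ {n} → Term L n → Fin (suc n) → Term L n
  instantiation t zero    = t
  instantiation t (suc i) = var i

  _[_] : ∀ {n} → Formula L (suc n) → Term L n → Formula L n
  φ [ t ] = subst (instantiation t) φ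

------------------------------------------------------------------------
-- Theories and provability

record Theory : Set₁ where
  field
    language : Language
    Axiom    : Pred (Sentence language) 0ℓ

open Theory public

infix 3 _∣_⊢_ _⊢_

-- Classical natural deduction with equality.  Since free variables are
-- tracked by n, non-emptiness of the domain is not implied by the
-- quantifier rules when n = 0, hence the rule inhabited.
data _∣_⊢_ {L : Language} (T : Pred (Sentence L) 0ℓ) :
           ∀ {n} → List (Formula L n) → Formula L n → Set where
  axiom     : ∀ {n} {Γ : List (Formula L n)} {φ : Sentence L} →
              T φ → T ∣ Γ ⊢ rename (λ ()) φ
  hyp       : ∀ {n} {Γ : List (Formula L n)} {φ} → φ ∈ Γ → T ∣ Γ ⊢ φ
  ⇒-intro   : ∀ {n} {Γ : List (Formula L n)} {φ ψ} →
              T ∣ φ ∷ Γ ⊢ ψ → T ∣ Γ ⊢ φ ⇒ ψ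
  ⇒-elim    : ∀ {n} {Γ : List (Formula L n)} {φ ψ} →
              T ∣ Γ ⊢ φ ⇒ ψ → T ∣ Γ ⊢ φ → T ∣ Γ ⊢ ψ
  raa       : ∀ {n} {Γ : List (Formula L n)} {φ} →
              T ∣ ¬′ φ ∷ Γ ⊢ ⊥′ → T ∣ Γ ⊢ φ
  ∀-intro   : ∀ {n} {Γ : List (Formula L n)} {φ} →
              T ∣ map weaken Γ ⊢ φ → T ∣ Γ ⊢ ∀′ φ
  ∀-elim    : ∀ {n} {Γ : List (Formula L n)} {φ} (t : Term L n) →
              T ∣ Γ ⊢ ∀′ φ → T ∣ Γ ⊢ φ [ t ]
  ≐-refl    : ∀ {n} {Γ : List (Formula L n)} {t} → T ∣ Γ ⊢ t ≐ t
  ≐-subst   : ∀ {n} {Γ : List (Formula L n)} {t s} (φ : Formula L (suc n)) →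
              T ∣ Γ ⊢ t ≐ s → T ∣ Γ ⊢ φ [ t ] → T ∣ Γ ⊢ φ [ s ]
  inhabited : ∀ {n} {Γ : List (Formula L n)} →
              T ∣ Γ ⊢ ∃′ (var zero ≐ var zero)

_⊢_ : (T : Theory) → Sentence (language T) → Set
T ⊢ φ = Axiom T ∣ [] ⊢ φ

codes : ∀ {L} → Pred (Sentence L) 0ℓ → Pred ℕ 0ℓ
codes {L} P n = Σ (Sentence L) λ φ → ⌜ φ ⌝ ≡ n × P φ

-- The set of numbers whose Turing degree is the degree of T.
Theorems : Theory → Pred ℕ 0ℓ
Theorems T = codes (T ⊢_)

Consistent : Theory → Set
Consistent T = ¬ (T ⊢ ⊥′)

Incomplete : Theory → Set
Incomplete T = Σ (Sentence (language T)) λ φ → ¬ (T ⊢ φ) × ¬ (T ⊢ ¬′ φ)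

RecursivelyAxiomatizable : Theory → Set₁
RecursivelyAxiomatizable T =
  RecursiveLanguage (language T) ×
  (Σ (Pred (Sentence (language T)) 0ℓ) λ Ax →
    Recursive (codes Ax) × (∀ φ → (T ⊢ φ) ⇔ (Ax ∣ [] ⊢ φ)))

------------------------------------------------------------------------
-- Interpretations (one-dimensional, parameter-free, relativised to a
-- domain formula, and not assumed to preserve identity)

record Translation (L L′ : Language) : Set where
  field
    domain   : Formula L′ 1
    equality : Formula L′ 2
    relation : ∀ {k} → Rel L k → Formula L′ k
    -- Variable 0 stands for the value, variables 1, …, k for the
    -- arguments.
    graph    : ∀ {k} → Func L k → Formula L′ (suc k)

module _ {L L′ : Language} (I : Translation L L′) where
  open Translation I

  ∃ⁿ : ∀ k {m} → Formula L′ (k + m) → Formula L′ m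
  ∃ⁿ zero    φ = φ
  ∃ⁿ (suc k) φ = ∃ⁿ k (∃′ φ)

  relativise : ∀ {m} → Fin m → Formula L′ m
  relativise x = rename (λ _ → x) domain

  pairᵛ : ∀ {m} → Fin m → Fin m → Fin 2 → Fin m
  pairᵛ x y zero    = x
  pairᵛ x y (suc _) = y

  consᵛ : ∀ {k m} → Fin m → (Fin k → Fin m) → Fin (suc k) → Fin m
  consᵛ x ys zero    = x
  consᵛ x ys (suc i) = ys i

  mutual

    -- value t ρ y: "the value of t is y", where the variable i of t is
    -- read as ρ i.
    value : ∀ {n m} → Term L n → (Fin n → Fin m) → Fin m → Formula L′ m
    value (var i) ρ y = rename (pairᵛ (ρ i) y) equality
    value {m = m} (func {k} f ts) ρ y =
      ∃ⁿ k (values ts (λ i → k ↑ʳ ρ i) (λ j → j ↑ˡ m)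
            ∧′ rename (consᵛ (k ↑ʳ y) (λ j → j ↑ˡ m)) (graph f))

    values : ∀ {n m k} → Vec (Term L n) k → (Fin n → Fin m) →
             (Fin k → Fin m) → Formula L′ m
    values []       ρ ys = ⊤′
    values (t ∷ ts) ρ ys =
      (relativise (ys zero) ∧′ value t ρ (ys zero)) ∧′ values ts ρ (ys ∘ suc)

  -- ∃ y₁ … yₖ in the domain, the values of t₁, …, tₖ, with ψ(y₁, …, yₖ).
  atom : ∀ {n k} → Vec (Term L n) k → Formula L′ k → Formula L′ n
  atom {n} {k} ts ψ =
    ∃ⁿ k (values ts (k ↑ʳ_) (_↑ˡ n) ∧′ rename (_↑ˡ n) ψ)

  translate : ∀ {n} → Formula L n → Formula L′ n
  translate (t ≐ s)    = atom (t ∷ s ∷ []) equality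
  translate (rel r ts) = atom ts (relation r)
  translate ⊥′         = ⊥′
  translate (φ ⇒ ψ)    = translate φ ⇒ translate ψ
  translate (∀′ φ)     = ∀′ (relativise zero ⇒ translate φ)

-- All theorems of T are considered, including those of pure logic with
-- equality; so S proves that the domain is non-empty, that equality is
-- interpreted as a congruence and function symbols as total functions.
_InterpretableIn_ : Theory → Theory → Set
T InterpretableIn S = Σ (Translation (language T) (language S)) λ I →
  ∀ φ → T ⊢ φ → S ⊢ translate I φ

G1 : Theory → Set₁
G1 U = RecursivelyAxiomatizable U × Consistent U ×
  (∀ S → RecursivelyAxiomatizable S → Consistent S →
    U InterpretableIn S → Incomplete S)

------------------------------------------------------------------------
-- Robinson's theory 𝐑

data ArithFunc : ℕ → Set where
  `0      : ArithFunc 0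
  `S      : ArithFunc 1
  `+ `·   : ArithFunc 2

data ArithRel : ℕ → Set where
  `≤ : ArithRel 2

codeᶠ : ∀ {k} → ArithFunc k → ℕ
codeᶠ `0 = 0
codeᶠ `S = 1
codeᶠ `+ = 2
codeᶠ `· = 3

codeᶠ-injective : ∀ {k} {f g : ArithFunc k} → codeᶠ f ≡ codeᶠ g → f ≡ g
codeᶠ-injective {f = `0} {`0} _ = refl
codeᶠ-injective {f = `S} {`S} _ = refl
codeᶠ-injective {f = `+} {`+} _ = refl
codeᶠ-injective {f = `·} {`·} _ = refl

codeʳ : ∀ {k} → ArithRel k → ℕ
codeʳ `≤ = 0

codeʳ-injective : ∀ {k} {r s : ArithRel k} → codeʳ r ≡ codeʳ s → r ≡ s
codeʳ-injective {r = `≤} {`≤} _ = refl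

Arith : Language
Arith = record
  { Func = ArithFunc
  ; Rel  = ArithRel
  ; ⌜_⌝ᶠ = codeᶠ
  ; ⌜_⌝ʳ = codeʳ
  ; ⌜⌝ᶠ-injective = codeᶠ-injective
  ; ⌜⌝ʳ-injective = codeʳ-injective
  }

infixl 9 _⊕_
infixl 10 _⊙_
infix  7 _≤′_

_⊕_ _⊙_ : ∀ {n} → Term Arith n → Term Arith n → Term Arith n
t ⊕ s = func `+ (t ∷ s ∷ [])
t ⊙ s = func `· (t ∷ s ∷ [])

_≤′_ : ∀ {n} → Term Arith n → Term Arith n → Formula Arith n
t ≤′ s = rel `≤ (t ∷ s ∷ [])

numeral : ∀ {n} → ℕ → Term Arith n
numeral zero    = func `0 []
numeral (suc m) = func `S (numeral m ∷ [])

-- t ≐ 0 ∨ … ∨ t ≐ m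
oneOfUpTo : ∀ {n} → Term Arith n → ℕ → Formula Arith n
oneOfUpTo t zero    = t ≐ numeral 0
oneOfUpTo t (suc m) = oneOfUpTo t m ∨′ t ≐ numeral (suc m)

data RAxiom : Pred (Sentence Arith) 0ℓ where
  R1 : ∀ m n → RAxiom (numeral m ⊕ numeral n ≐ numeral (m + n))
  R2 : ∀ m n → RAxiom (numeral m ⊙ numeral n ≐ numeral (m * n))
  R3 : ∀ m n → m ≢ n → RAxiom (¬′ (numeral m ≐ numeral n))
  R4 : ∀ n → RAxiom (∀′ (var zero ≤′ numeral n ⇒ oneOfUpTo (var zero) n))
  R5 : ∀ n → RAxiom (∀′ (var zero ≤′ numeral n ∨′ numeral n ≤′ var zero))

𝐑 : Theory
𝐑 = record { language = Arith ; Axiom = RAxiom }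

{-# OPTIONS --safe #-}
module Submission where

-- Let W be an enumerable set of degree 𝐝.  Delaying the enumeration of a
-- diagonal pair until elements enter W gives disjoint enumerable sets A
-- and B that are decided by W, code W, and are recursively inseparable
-- because W is not recursive (Shoenfield).
--
-- U speaks about an equivalence relation.  For X ⊆ ℕ let M(X) have
-- classes c = 0, 1, 2, …, the class c being of size c + 1 if c ∈ X and
-- infinite otherwise; the theorems of U are the sentences true in M(X)
-- for all X that contain A and are disjoint from B.  By an
-- Ehrenfeucht–Fraïssé argument a sentence of quantifier depth k only
-- depends on X below k and may be evaluated in a finite structure, so
-- that U is recursively axiomatizable and has the degree of W.  The
-- sentence "some class has n + 1 elements" is provable for n ∈ A and
-- refutable for n ∈ B, so a complete recursively axiomatizable theory
-- interpreting U would separate A from B recursively.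
--
-- Finally, 𝐑 has degree 𝟎′, as it proves exactly the true sentences
-- among those expressing that a given program halts.

open import Defs renaming (subst to substᶠ)
open import Axiom.ExcludedMiddle using (ExcludedMiddle)
open import Data.Bool.Base using (Bool; true; false; T; _∧_; _∨_; not; if_then_else_)
open import Data.Empty using (⊥; ⊥-elim)
open import Data.Fin using () renaming (#_ to fin)
open import Data.Fin.Base using (Fin; zero; suc; toℕ; fromℕ<; _↑ˡ_; _↑ʳ_)
open import Data.Fin.Patterns using (0F; 1F; 2F; 3F; 4F; 5F; 6F)
open import Data.Fin.Properties using (toℕ-injective; toℕ<n; toℕ-fromℕ<; pigeonhole; any?; all?; injective⇒≤)
open import Data.List.Base using (List; []; _∷_; map)
open import Data.List.Membership.Propositional using (_∈_)
open import Data.List.Membership.Propositional.Properties using (∈-lookup)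
open import Data.List.Relation.Unary.All using (All; []; _∷_)
open import Data.List.Relation.Unary.Any using (here; there)
open import Data.Nat.Base hiding (_≤′_)
open import Data.Nat.Coprimality using (Coprime; coprime-divisor)
open import Data.Nat.Divisibility using (divides; ∣-refl; ∣-trans; ∣1⇒≡1; ∣m+n∣m⇒∣n; ∣n⇒∣m*n; m∣m*n; m≤n⇒m!∣n!) renaming (_∣_ to _∣ₙ_)
open import Data.Nat.Induction using (<-rec)
open import Data.Nat.Properties
open import Data.Product.Base using (Σ; ∃-syntax; _×_; _,_; proj₁; proj₂)
open import Data.Sum.Base using (_⊎_; inj₁; inj₂)
open import Data.Unit.Base using (⊤)
open import Data.Vec.Base using (Vec; []; _∷_; _++_; lookup; tabulate; tail)
open import Data.Vec.Properties using (tabulate∘lookup; lookup-++ʳ)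
open import Data.Vec.Relation.Binary.Pointwise.Inductive using (Pointwise; []; _∷_)
open import Function.Base using (_∘_; id; case_of_)
open import Function.Bundles using (mk⇔; Equivalence)
open import Level using (0ℓ)
open import Relation.Binary.Definitions using (tri<; tri≈; tri>)
open import Relation.Binary.PropositionalEquality using (_≡_; _≢_; refl; sym; trans; cong; cong₂; subst; subst₂)
open import Relation.Binary.PropositionalEquality.Properties using () renaming (isEquivalence to ≡-isEquivalence)
open import Relation.Binary.Structures using (IsEquivalence)
open import Relation.Nullary using (¬_; yes; no; does; contradiction)
open import Relation.Nullary.Decidable using (decidable-stable; ¬?)
open import Relation.Unary using (Pred; ∅)

-- The obstacle is to control the degree of the whole theorem set: deductive closure can raise the
-- degree far above that of the information put into the axioms. The theory of an equivalence
-- relation is tame enough to prevent this, since provability of a sentence becomes a bounded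
-- question about `A` and `B` below its code. Sizes of classes are suitable markers because each
-- finite size occurs at most once in `M(X)`, while a sentence of depth `k` cannot tell a class with
-- more than `k` elements from an infinite one. The usual inseparable pair, the programs with output
-- 0 and those with output 1 on their own code, has degree `𝟎′`; it is the permission by `W` that
-- keeps the present pair below `W`. Since `U` has to be recursively axiomatizable, its theorem set
-- is enumerable, so that the degree of `U` contains an enumerable set; this is the condition
-- `HasREDegree`. Enumerations of computations, proofs and truth values all come from one notion of
-- finite rule system, which supplies computable stages together with an induction principle.

-- Programs for computable functions, search and Turing reducibility

module Computability where

  record Comp (O : Pred ℕ 0ℓ) {k : ℕ} (f : Vec ℕ k → ℕ) : Set where
    constructor computes
    field
      program : Program k
      runs    : ∀ xs → Eval O program xs (f xs)

  open Comp public

  record Comp₁ (O : Pred ℕ 0ℓ) (f : ℕ → ℕ) : Set where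
    constructor comp₁
    field body₁ : Comp O (λ xs → f (lookup {n = 1} xs 0F))

  record Comp₂ (O : Pred ℕ 0ℓ) (f : ℕ → ℕ → ℕ) : Set where
    constructor comp₂
    field body₂ : Comp O (λ xs → f (lookup {n = 2} xs 0F) (lookup xs 1F))

  record Comp₃ (O : Pred ℕ 0ℓ) (f : ℕ → ℕ → ℕ → ℕ) : Set where
    constructor comp₃
    field body₃ : Comp O (λ xs → f (lookup {n = 3} xs 0F) (lookup xs 1F) (lookup xs 2F))

  record Comp₄ (O : Pred ℕ 0ℓ) (f : ℕ → ℕ → ℕ → ℕ → ℕ) : Set where
    constructor comp₄
    field body₄ : Comp O (λ xs → f (lookup {n = 4} xs 0F) (lookup xs 1F) (lookup xs 2F) (lookup xs 3F))

  open Comp₁ public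
  open Comp₂ public
  open Comp₃ public
  open Comp₄ public

  private variable
    O : Pred ℕ 0ℓ
    k : ℕ

  ext : {f g : Vec ℕ k → ℕ} → (∀ xs → f xs ≡ g xs) → Comp O f → Comp O g
  ext f≗g (computes p r) = computes p (λ xs → subst (Eval _ p xs) (f≗g xs) (r xs))

  v : (i : Fin k) → Comp O (λ xs → lookup xs i)
  v i = computes (proj i) (λ _ → proj)

  ap₁ : ∀ {h} {f : Vec ℕ k → ℕ} → Comp₁ O h → Comp O f → Comp O (λ xs → h (f xs))
  ap₁ (comp₁ (computes p r)) (computes q s) =
    computes (comp p (q ∷ [])) (λ xs → comp (s xs ∷ []) (r _))

  ap₂ : ∀ {h} {f g : Vec ℕ k → ℕ} → Comp₂ O h → Comp O f → Comp O g →
        Comp O (λ xs → h (f xs) (g xs))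
  ap₂ (comp₂ (computes p r)) (computes q s) (computes q′ s′) =
    computes (comp p (q ∷ q′ ∷ [])) (λ xs → comp (s xs ∷ s′ xs ∷ []) (r _))

  ap₃ : ∀ {h} {f g e : Vec ℕ k → ℕ} → Comp₃ O h → Comp O f → Comp O g → Comp O e →
        Comp O (λ xs → h (f xs) (g xs) (e xs))
  ap₃ (comp₃ (computes p r)) (computes q s) (computes q′ s′) (computes q″ s″) =
    computes (comp p (q ∷ q′ ∷ q″ ∷ [])) (λ xs → comp (s xs ∷ s′ xs ∷ s″ xs ∷ []) (r _))

  ap₄ : ∀ {h} {f g e d : Vec ℕ k → ℕ} → Comp₄ O h → Comp O f → Comp O g → Comp O e → Comp O d →
        Comp O (λ xs → h (f xs) (g xs) (e xs) (d xs))
  ap₄ (comp₄ (computes p r)) (computes q s) (computes q′ s′) (computes q″ s″) (computes q‴ s‴) =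
    computes (comp p (q ∷ q′ ∷ q″ ∷ q‴ ∷ []))
             (λ xs → comp (s xs ∷ s′ xs ∷ s″ xs ∷ s‴ xs ∷ []) (r _))

  c-suc : Comp₁ O suc
  c-suc = comp₁ (computes succ (λ { (x ∷ []) → succ }))

  const : (n : ℕ) → Comp O {k} (λ _ → n)
  const zero    = computes (comp zero []) (λ xs → comp [] zero)
  const (suc n) = ap₁ c-suc (const n)

  natrec : ℕ → (ℕ → ℕ → ℕ) → ℕ → ℕ
  natrec z s zero    = z
  natrec z s (suc n) = s n (natrec z s n)

  evals-proj : ∀ {m} (is : Fin m → Fin k) (xs : Vec ℕ k) →
               Evals O (tabulate (proj ∘ is)) xs (tabulate (lookup xs ∘ is))
  evals-proj {m = zero}  is xs = []
  evals-proj {m = suc m} is xs = proj ∷ evals-proj (is ∘ suc) xs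

  -- `prec` takes its bound as first argument, whereas here the bound is itself a function of the
  -- parameters; hence the composition with the bound followed by all projections.
  c-rec : {z b : Vec ℕ k → ℕ} {s : Vec ℕ (2 + k) → ℕ} → Comp O z → Comp O s → Comp O b →
          Comp O (λ xs → natrec (z xs) (λ n r → s (n ∷ r ∷ xs)) (b xs))
  c-rec {k} {O} {z} {b} {s} cz cs cb = computes (comp f (program cb ∷ tabulate proj)) run
    where
    f = prec (program cz) (program cs)

    iterate : ∀ xs n → Eval O f (n ∷ xs) (natrec (z xs) (λ n r → s (n ∷ r ∷ xs)) n)
    iterate xs zero    = prec-zero (runs cz xs)
    iterate xs (suc n) = prec-suc (iterate xs n) (runs cs _)

    run : ∀ xs → Eval O (comp f (program cb ∷ tabulate proj)) xs _
    run xs = comp (runs cb xs ∷ subst (Evals O _ xs) (tabulate∘lookup xs) (evals-proj id xs))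
                  (iterate xs (b xs))

  c-pred : Comp₁ O pred
  c-pred = comp₁ (ext (λ { (zero ∷ []) → refl ; (suc x ∷ []) → refl })
                      (c-rec (const 0) (v 0F) (v 0F)))

  c-+ : Comp₂ O _+_
  c-+ = comp₂ (ext (λ { (x ∷ y ∷ []) → eq x y }) (c-rec (v 1F) (ap₁ c-suc (v 1F)) (v 0F)))
    where
    eq : ∀ x y → natrec y (λ _ r → suc r) x ≡ x + y
    eq zero    y = refl
    eq (suc x) y = cong suc (eq x y)

  c-* : Comp₂ O _*_
  c-* = comp₂ (ext (λ { (x ∷ y ∷ []) → eq x y }) (c-rec (const 0) (ap₂ c-+ (v 3F) (v 1F)) (v 0F)))
    where
    eq : ∀ x y → natrec 0 (λ _ r → y + r) x ≡ x * y
    eq zero    y = refl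
    eq (suc x) y = cong (y +_) (eq x y)

  c-∸ : Comp₂ O _∸_
  c-∸ = comp₂ (ext (λ { (x ∷ y ∷ []) → eq x y }) (c-rec (v 0F) (ap₁ c-pred (v 1F)) (v 1F)))
    where
    eq : ∀ x y → natrec x (λ _ r → pred r) y ≡ x ∸ y
    eq x zero    = refl
    eq x (suc y) = trans (cong pred (eq x y)) (pred[m∸n]≡m∸[1+n] x y)

  ⟨_⟩ : Bool → ℕ
  ⟨ true ⟩  = 1
  ⟨ false ⟩ = 0

  ⟨⟩-injective : ∀ {a b} → ⟨ a ⟩ ≡ ⟨ b ⟩ → a ≡ b
  ⟨⟩-injective {true}  {true}  _ = refl
  ⟨⟩-injective {false} {false} _ = refl

  record CompB (O : Pred ℕ 0ℓ) {k : ℕ} (b : Vec ℕ k → Bool) : Set where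
    constructor compᵇ
    field bodyᵇ : Comp O (λ xs → ⟨ b xs ⟩)

  open CompB public

  choose : ℕ → ℕ → ℕ → ℕ
  choose zero    x y = y
  choose (suc _) x y = x

  c-choose : Comp₃ O choose
  c-choose = comp₃ (ext (λ { (zero ∷ y ∷ z ∷ []) → refl ; (suc x ∷ y ∷ z ∷ []) → refl })
                        (c-rec (v 2F) (v 3F) (v 0F)))

  choose-if : ∀ b {x y} → choose ⟨ b ⟩ x y ≡ (if b then x else y)
  choose-if true  = refl
  choose-if false = refl

  c-if : {b : Vec ℕ k → Bool} {f g : Vec ℕ k → ℕ} → CompB O b → Comp O f → Comp O g →
         Comp O (λ xs → if b xs then f xs else g xs)
  c-if {b = b} cb cf cg = ext (λ xs → choose-if (b xs)) (ap₃ c-choose (bodyᵇ cb) cf cg)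

  c-not : {b : Vec ℕ k → Bool} → CompB O b → CompB O (λ xs → not (b xs))
  c-not {b = b} cb = compᵇ (ext (λ xs → eq (b xs)) (ap₂ c-∸ (const 1) (bodyᵇ cb)))
    where
    eq : ∀ b → 1 ∸ ⟨ b ⟩ ≡ ⟨ not b ⟩
    eq true  = refl
    eq false = refl

  c-∧ : {b c : Vec ℕ k → Bool} → CompB O b → CompB O c → CompB O (λ xs → b xs ∧ c xs)
  c-∧ {b = b} {c} cb cc = compᵇ (ext (λ xs → eq (b xs) (c xs)) (ap₂ c-* (bodyᵇ cb) (bodyᵇ cc)))
    where
    eq : ∀ b c → ⟨ b ⟩ * ⟨ c ⟩ ≡ ⟨ b ∧ c ⟩
    eq true  c = +-identityʳ ⟨ c ⟩
    eq false c = refl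

  c-∨ : {b c : Vec ℕ k → Bool} → CompB O b → CompB O c → CompB O (λ xs → b xs ∨ c xs)
  c-∨ {b = b} {c} cb cc = compᵇ (ext (λ xs → eq (b xs) (c xs)) (bodyᵇ (c-not (c-∧ (c-not cb) (c-not cc)))))
    where
    eq : ∀ b c → ⟨ not (not b ∧ not c) ⟩ ≡ ⟨ b ∨ c ⟩
    eq true  c     = refl
    eq false true  = refl
    eq false false = refl

  c-≡ᵇ : {f g : Vec ℕ k → ℕ} → Comp O f → Comp O g → CompB O (λ xs → f xs ≡ᵇ g xs)
  c-≡ᵇ {f = f} {g} cf cg = compᵇ (ext (λ xs → eq (f xs) (g xs))
      -- Both truncated differences vanish exactly when the numbers agree.
      (ap₂ c-∸ (const 1) (ap₂ c-+ (ap₂ c-∸ cf cg) (ap₂ c-∸ cg cf))))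
    where
    eq : ∀ m n → 1 ∸ (m ∸ n + (n ∸ m)) ≡ ⟨ m ≡ᵇ n ⟩
    eq zero    zero    = refl
    eq zero    (suc n) = 0∸n≡0 n
    eq (suc m) zero    = 0∸n≡0 (m + 0)
    eq (suc m) (suc n) = eq m n

  ≡ᵇ-true : ∀ {m n} → (m ≡ᵇ n) ≡ true → m ≡ n
  ≡ᵇ-true {m} {n} e = ≡ᵇ⇒≡ m n (subst T (sym e) _)

  ≡ᵇ-refl : ∀ n → (n ≡ᵇ n) ≡ true
  ≡ᵇ-refl zero    = refl
  ≡ᵇ-refl (suc n) = ≡ᵇ-refl n

  ≡ᵇ-false : ∀ {m n} → m ≢ n → (m ≡ᵇ n) ≡ false
  ≡ᵇ-false {m} {n} m≢n with m ≡ᵇ n in e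
  ... | true  = contradiction (≡ᵇ-true e) m≢n
  ... | false = refl

  allᵇ : (ℕ → Bool) → ℕ → Bool
  allᵇ p zero    = true
  allᵇ p (suc n) = p n ∧ allᵇ p n

  anyᵇ : (ℕ → Bool) → ℕ → Bool
  anyᵇ p zero    = false
  anyᵇ p (suc n) = p n ∨ anyᵇ p n

  -- The bounded quantifier is a product of truth values, computed by recursion on the bound.
  c-all : {b : Vec ℕ (suc k) → Bool} {n : Vec ℕ k → ℕ} → CompB O b → Comp O n →
          CompB O (λ xs → allᵇ (λ i → b (i ∷ xs)) (n xs))
  c-all {k} {O} {b} {n} cb cn = compᵇ (ext (λ xs → eq xs (n xs)) (c-rec (const 1) cstep cn))
    where
    -- The recursion step sees `i ∷ r ∷ xs`; the accumulated value `r` is left out, as the test does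
    -- not depend on it.
    drop : Fin (suc k) → Fin (suc (suc k))
    drop zero    = zero
    drop (suc i) = suc (suc i)

    cb′ : Comp O (λ xs → ⟨ b (lookup {n = suc (suc k)} xs 0F ∷ tabulate (λ i → lookup xs (suc (suc i)))) ⟩)
    cb′ = computes (comp (program (bodyᵇ cb)) (tabulate (proj ∘ drop)))
                   (λ xs → comp (evals-proj drop xs) (runs (bodyᵇ cb) _))

    cstep : Comp O {suc (suc k)} _
    cstep = ap₂ c-* cb′ (v 1F)

    eq : ∀ xs m → natrec 1 (λ i r → ⟨ b (i ∷ tabulate (lookup xs)) ⟩ * r) m ≡ ⟨ allᵇ (λ i → b (i ∷ xs)) m ⟩
    eq xs zero = refl
    eq xs (suc m) rewrite eq xs m | tabulate∘lookup xs with b (m ∷ xs)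
    ... | true  = +-identityʳ _
    ... | false = refl

  allᵇ-not : ∀ p n → not (allᵇ (not ∘ p) n) ≡ anyᵇ p n
  allᵇ-not p zero = refl
  allᵇ-not p (suc n) with p n
  ... | true  = refl
  ... | false = allᵇ-not p n

  c-any : {b : Vec ℕ (suc k) → Bool} {n : Vec ℕ k → ℕ} → CompB O b → Comp O n →
          CompB O (λ xs → anyᵇ (λ i → b (i ∷ xs)) (n xs))
  c-any {b = b} {n} cb cn = compᵇ (ext (λ xs → cong ⟨_⟩ (allᵇ-not (λ i → b (i ∷ xs)) (n xs)))
                                       (bodyᵇ (c-not (c-all (c-not cb) cn))))

  ∧-trueˡ : ∀ {a b} → a ∧ b ≡ true → a ≡ true
  ∧-trueˡ {true} _ = refl

  ∧-trueʳ : ∀ {a b} → a ∧ b ≡ true → b ≡ true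
  ∧-trueʳ {true} e = e

  ∧-intro : ∀ {a b} → a ≡ true → b ≡ true → a ∧ b ≡ true
  ∧-intro refl refl = refl

  ∨-true : ∀ {a b} → a ∨ b ≡ true → a ≡ true ⊎ b ≡ true
  ∨-true {true}  _ = inj₁ refl
  ∨-true {false} e = inj₂ e

  ∨-introˡ : ∀ {a b} → a ≡ true → a ∨ b ≡ true
  ∨-introˡ refl = refl

  ∨-introʳ : ∀ a {b} → b ≡ true → a ∨ b ≡ true
  ∨-introʳ true  _ = refl
  ∨-introʳ false e = e

  not-true : ∀ {a} → not a ≡ true → a ≢ true
  not-true {false} _ ()

  not-intro : ∀ {a} → a ≢ true → not a ≡ true
  not-intro {true}  h = contradiction refl h
  not-intro {false} h = refl

  allᵇ-elim : ∀ p {n i} → allᵇ p n ≡ true → i < n → p i ≡ true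
  allᵇ-elim p {suc n} {i} e i<1+n with m≤n⇒m<n∨m≡n (s≤s⁻¹ i<1+n)
  ... | inj₁ i<n  = allᵇ-elim p (∧-trueʳ {p n} e) i<n
  ... | inj₂ refl = ∧-trueˡ e

  allᵇ-intro : ∀ p n → (∀ i → i < n → p i ≡ true) → allᵇ p n ≡ true
  allᵇ-intro p zero    h = refl
  allᵇ-intro p (suc n) h = ∧-intro (h n ≤-refl) (allᵇ-intro p n (λ i i<n → h i (m<n⇒m<1+n i<n)))

  anyᵇ-elim : ∀ p n → anyᵇ p n ≡ true → ∃[ i ] i < n × p i ≡ true
  anyᵇ-elim p (suc n) e with ∨-true {p n} e
  ... | inj₁ h = n , ≤-refl , h
  ... | inj₂ h with anyᵇ-elim p n h
  ...   | i , i<n , pi = i , m<n⇒m<1+n i<n , pi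

  anyᵇ-intro : ∀ p {n i} → i < n → p i ≡ true → anyᵇ p n ≡ true
  anyᵇ-intro p {suc n} {i} i<1+n pi with m≤n⇒m<n∨m≡n (s≤s⁻¹ i<1+n)
  ... | inj₁ i<n  = ∨-introʳ (p n) (anyᵇ-intro p i<n pi)
  ... | inj₂ refl = ∨-introˡ pi

  least : (p : ℕ → Bool) → ∃[ n ] p n ≡ true →
          ∃[ n ] p n ≡ true × (∀ i → i < n → p i ≡ false)
  least p (n , pn) = go n 0 (trans (cong p (+-identityʳ n)) pn) (λ _ ())
    where
    -- `d` is the distance from `i` to the known witness and decreases with each failed test.
    go : ∀ d i → p (d + i) ≡ true → (∀ j → j < i → p j ≡ false) →
         ∃[ n ] p n ≡ true × (∀ j → j < n → p j ≡ false)
    go d i h below with p i in e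
    ... | true = i , e , below
    go zero    i h below | false = case trans (sym e) h of λ ()
    go (suc d) i h below | false = go d (suc i) (trans (cong p (+-suc d i)) h) below′
      where
      below′ : ∀ j → j < suc i → p j ≡ false
      below′ j j<1+i with m≤n⇒m<n∨m≡n (s≤s⁻¹ j<1+i)
      ... | inj₁ j<i  = below j j<i
      ... | inj₂ refl = e

  record Search (O : Pred ℕ 0ℓ) {k : ℕ} (b : Vec ℕ (suc k) → Bool) : Set where
    field
      found     : Vec ℕ k → ℕ
      c-found   : Comp O found
      satisfies : ∀ xs → b (found xs ∷ xs) ≡ true

  open Search public

  -- Minimisation looks for the value 0, so it is run on the negated test. A mere proof that every
  -- argument has a witness makes the resulting function total.
  search : {b : Vec ℕ (suc k) → Bool} → CompB O b → (∀ xs → ∃[ n ] b (n ∷ xs) ≡ true) → Search O b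
  search {k} {O} {b} cb total = record
    { found     = λ xs → proj₁ (first xs)
    ; c-found   = computes (mu (program c¬b)) run
    ; satisfies = λ xs → proj₁ (proj₂ (first xs))
    }
    where
    first = λ xs → least (λ n → b (n ∷ xs)) (total xs)

    c¬b : Comp O (λ xs → ⟨ not (b xs) ⟩)
    c¬b = bodyᵇ (c-not cb)

    run : ∀ xs → Eval O (mu (program c¬b)) xs (proj₁ (first xs))
    run xs with first xs
    ... | n , bn , below = mu
      (λ i i<n → 0 , subst (λ c → Eval O _ (i ∷ xs) ⟨ not c ⟩) (below i i<n) (runs c¬b (i ∷ xs)))
      (subst (λ c → Eval O _ (n ∷ xs) ⟨ not c ⟩) bn (runs c¬b (n ∷ xs)))

  record Decides (O A : Pred ℕ 0ℓ) (χ : ℕ → Bool) : Set where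
    field
      computable : CompB O {1} (λ xs → χ (lookup xs 0F))
      ∈⇒true     : ∀ {n} → A n → χ n ≡ true
      true⇒∈     : ∀ {n} → χ n ≡ true → A n

  decides⇒≤ᵀ : ∀ {A χ} → Decides O A χ → A ≤ᵀ O
  decides⇒≤ᵀ {O} {A} {χ} d = program (bodyᵇ computable) , λ n →
      (λ a → subst (λ c → Eval O _ (n ∷ []) ⟨ c ⟩) (∈⇒true a) (runs (bodyᵇ computable) (n ∷ []))) ,
      (λ ¬a → subst (λ c → Eval O _ (n ∷ []) ⟨ c ⟩) (false′ n ¬a) (runs (bodyᵇ computable) (n ∷ [])))
    where
    open Decides d
    false′ : ∀ n → ¬ A n → χ n ≡ false
    false′ n ¬a with χ n in e
    ... | true  = contradiction (true⇒∈ e) ¬a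
    ... | false = refl

  module _ {A B : Pred ℕ 0ℓ} (q : Program 1)
           (spec : ∀ n → (A n → Eval B q (n ∷ []) 1) × (¬ A n → Eval B q (n ∷ []) 0)) where

    mutual
      -- Transitivity of reducibility on the level of programs: a program deciding `A` from `B`
      -- stands in for every call to the oracle `A`.
      replaceOracle : ∀ {k} → Program k → Program k
      replaceOracle zero        = zero
      replaceOracle succ        = succ
      replaceOracle (proj i)    = proj i
      replaceOracle oracle      = q
      replaceOracle (comp f gs) = comp (replaceOracle f) (replaceOracles gs)
      replaceOracle (prec f g)  = prec (replaceOracle f) (replaceOracle g)
      replaceOracle (mu f)      = mu (replaceOracle f)

      replaceOracles : ∀ {k m} → Vec (Program k) m → Vec (Program k) m
      replaceOracles []       = []
      replaceOracles (g ∷ gs) = replaceOracle g ∷ replaceOracles gs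

    mutual
      replaceOracle-runs : ∀ {k} {p : Program k} {xs y} →
                           Eval A p xs y → Eval B (replaceOracle p) xs y
      replaceOracle-runs zero           = zero
      replaceOracle-runs succ           = succ
      replaceOracle-runs proj           = proj
      replaceOracle-runs (oracle-∈ a)   = proj₁ (spec _) a
      replaceOracle-runs (oracle-∉ ¬a)  = proj₂ (spec _) ¬a
      replaceOracle-runs (comp es e)    = comp (replaceOracles-run es) (replaceOracle-runs e)
      replaceOracle-runs (prec-zero e)  = prec-zero (replaceOracle-runs e)
      replaceOracle-runs (prec-suc d e) = prec-suc (replaceOracle-runs d) (replaceOracle-runs e)
      replaceOracle-runs (mu h e)       =
        mu (λ i i<y → proj₁ (h i i<y) , replaceOracle-runs (proj₂ (h i i<y))) (replaceOracle-runs e)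

      replaceOracles-run : ∀ {k m} {ps : Vec (Program k) m} {xs ys} →
                           Evals A ps xs ys → Evals B (replaceOracles ps) xs ys
      replaceOracles-run []       = []
      replaceOracles-run (e ∷ es) = replaceOracle-runs e ∷ replaceOracles-run es

  comp-trans : ∀ {A B} {f : Vec ℕ k → ℕ} → Comp A f → A ≤ᵀ B → Comp B f
  comp-trans (computes p r) (q , spec) =
    computes (replaceOracle q spec p) (λ xs → replaceOracle-runs q spec (r xs))

  ≤ᵀ-trans : ∀ {A B C} → A ≤ᵀ B → B ≤ᵀ C → A ≤ᵀ C
  ≤ᵀ-trans (p , r) (q , spec) = replaceOracle q spec p , λ n →
    (λ a → replaceOracle-runs q spec (proj₁ (r n) a)) ,
    (λ ¬a → replaceOracle-runs q spec (proj₂ (r n) ¬a))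

  ∅≤ᵀ : ∀ {A} → ∅ ≤ᵀ A
  ∅≤ᵀ {A} = program zeroes , λ n → (λ ()) , λ _ → runs zeroes (n ∷ [])
    where
    zeroes : Comp A {1} (λ _ → 0)
    zeroes = const 0

  relativise-comp : {f : Vec ℕ k → ℕ} → Comp ∅ f → Comp O f
  relativise-comp c = comp-trans c ∅≤ᵀ

  mutual
    Eval-deterministic : ∀ {A k} {p : Program k} {xs y z} → Eval A p xs y → Eval A p xs z → y ≡ z
    Eval-deterministic zero zero = refl
    Eval-deterministic succ succ = refl
    Eval-deterministic proj proj = refl
    Eval-deterministic (oracle-∈ a)  (oracle-∈ _)  = refl
    Eval-deterministic (oracle-∈ a)  (oracle-∉ ¬a) = contradiction a ¬a
    Eval-deterministic (oracle-∉ ¬a) (oracle-∈ a)  = contradiction a ¬a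
    Eval-deterministic (oracle-∉ _)  (oracle-∉ _)  = refl
    Eval-deterministic (comp ds d) (comp es e) with Evals-deterministic ds es
    ... | refl = Eval-deterministic d e
    Eval-deterministic (prec-zero d) (prec-zero e) = Eval-deterministic d e
    Eval-deterministic (prec-suc d d′) (prec-suc e e′) with Eval-deterministic d e
    ... | refl = Eval-deterministic d′ e′
    Eval-deterministic {y = y} {z} (mu g d) (mu h e) with <-cmp y z
    ... | tri≈ _ y≡z _ = y≡z
    -- At the smaller of two stopping points the function would be both 0 and a successor.
    ... | tri< y<z _ _ = case Eval-deterministic d (proj₂ (h y y<z)) of λ ()
    ... | tri> _ _ z<y = case Eval-deterministic (proj₂ (g z z<y)) e of λ ()

    Evals-deterministic : ∀ {A k m} {ps : Vec (Program k) m} {xs ys zs} →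
                          Evals A ps xs ys → Evals A ps xs zs → ys ≡ zs
    Evals-deterministic [] [] = refl
    Evals-deterministic (d ∷ ds) (e ∷ es) =
      cong₂ _∷_ (Eval-deterministic d e) (Evals-deterministic ds es)

  module _ (em : ExcludedMiddle 0ℓ) where

    characteristic : Pred ℕ 0ℓ → ℕ → Bool
    characteristic A n = does (em {A n})

    characteristic-true : ∀ (A : Pred ℕ 0ℓ) {n} → A n → characteristic A n ≡ true
    characteristic-true A {n} a with em {A n}
    ... | yes _ = refl
    ... | no ¬a = contradiction a ¬a

    characteristic-∈ : ∀ (A : Pred ℕ 0ℓ) {n} → characteristic A n ≡ true → A n
    characteristic-∈ A {n} e with em {A n}
    ... | yes a = a

    -- `_≤ᵀ_` prescribes the output on `A` and on its complement separately; excluded middle joins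
    -- the two into a total Boolean function.
    ≤ᵀ⇒decides : ∀ {A O} → A ≤ᵀ O → Decides O A (characteristic A)
    ≤ᵀ⇒decides {A} {O} (p , spec) = record
      { computable = compᵇ (computes p (λ { (n ∷ []) → run n }))
      ; ∈⇒true     = characteristic-true A
      ; true⇒∈     = characteristic-∈ A
      }
      where
      run : ∀ n → Eval O p (n ∷ []) ⟨ characteristic A n ⟩
      run n with em {A n}
      ... | yes a = proj₁ (spec n) a
      ... | no ¬a = proj₂ (spec n) ¬a

-- The inverse of Cantor pairing and codes of lists

module Pairing where

  open Computability

  private variable
    O : Pred ℕ 0ℓ
    k : ℕ

  -- diagonal z is the d with triangular d ≤ z ≤ triangular d + d.
  diagonal : ℕ → ℕ
  diagonal zero    = zero
  diagonal (suc z) = if suc z ≡ᵇ triangular (suc (diagonal z)) then suc (diagonal z) else diagonal z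

  opaque
    -- Along a diagonal the pairs are ordered by their second component, which is therefore the
    -- offset from the triangular number.
    sndᶜ : ℕ → ℕ
    sndᶜ z = z ∸ triangular (diagonal z)

    fstᶜ : ℕ → ℕ
    fstᶜ z = diagonal z ∸ sndᶜ z

  -- Induction along the enumeration: the counter moves on only when the successor is the next
  -- triangular number, which no offset `n ≤ d` reaches.
  diagonal-triangular : ∀ d n → n ≤ d → diagonal (triangular d + n) ≡ d
  diagonal-triangular zero zero _ = refl
  diagonal-triangular (suc d) zero _
    rewrite +-identityʳ (d + triangular d) | +-comm d (triangular d)
          | diagonal-triangular d d ≤-refl | +-comm d (triangular d) | ≡ᵇ-refl (triangular d + d) = refl
  diagonal-triangular d (suc n) n<d
    rewrite +-suc (triangular d) n | diagonal-triangular d n (<⇒≤ n<d)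
          | ≡ᵇ-false {triangular d + n} {d + triangular d}
              (λ e → <⇒≢ n<d (+-cancelˡ-≡ (triangular d) n d (trans e (+-comm d (triangular d))))) = refl

  opaque
    unfolding fstᶜ

    sndᶜ-pair : ∀ m n → sndᶜ (pair m n) ≡ n
    sndᶜ-pair m n rewrite diagonal-triangular (m + n) n (m≤n+m n m) = m+n∸m≡n (triangular (m + n)) n

    fstᶜ-pair : ∀ m n → fstᶜ (pair m n) ≡ m
    fstᶜ-pair m n rewrite sndᶜ-pair m n | diagonal-triangular (m + n) n (m≤n+m n m) = m+n∸n≡m m n

  pair-injectiveˡ : ∀ {m n m′ n′} → pair m n ≡ pair m′ n′ → m ≡ m′
  pair-injectiveˡ {m} {n} {m′} {n′} e =
    trans (sym (fstᶜ-pair m n)) (trans (cong fstᶜ e) (fstᶜ-pair m′ n′))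

  pair-injectiveʳ : ∀ {m n m′ n′} → pair m n ≡ pair m′ n′ → n ≡ n′
  pair-injectiveʳ {m} {n} {m′} {n′} e =
    trans (sym (sndᶜ-pair m n)) (trans (cong sndᶜ e) (sndᶜ-pair m′ n′))

  -- The invariant behind surjectivity of `pair`: the offset either grows by one or, at the end of
  -- its diagonal, restarts at 0.
  diagonal-bounds : ∀ z → ∃[ n ] n ≤ diagonal z × z ≡ triangular (diagonal z) + n
  diagonal-bounds zero = 0 , z≤n , refl
  diagonal-bounds (suc z) with diagonal-bounds z
  ... | n , n≤d , z≡ with z ≡ᵇ diagonal z + triangular (diagonal z) in e
  ...   | true  = 0 , z≤n , trans (cong suc (≡ᵇ-true e)) (sym (+-identityʳ _))
  ...   | false = suc n , ≤∧≢⇒< n≤d n≢d , trans (cong suc z≡) (sym (+-suc _ n))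
    where
    n≢d : n ≢ diagonal z
    n≢d n≡d = case trans (sym e) (trans (cong (_≡ᵇ diagonal z + triangular (diagonal z))
      (trans z≡ (trans (cong (triangular (diagonal z) +_) n≡d) (+-comm (triangular (diagonal z)) _))))
      (≡ᵇ-refl (diagonal z + triangular (diagonal z)))) of λ ()

  opaque
    unfolding fstᶜ

    pair-surjective : ∀ z → pair (fstᶜ z) (sndᶜ z) ≡ z
    pair-surjective z with diagonal-bounds z
    ... | n , n≤d , z≡ = trans (cong₂ pair fst≡ snd≡) (trans (cong (λ d → triangular d + n) (m∸n+n≡m n≤d)) (sym z≡))
      where
      snd≡ : sndᶜ z ≡ n
      snd≡ = trans (cong (_∸ triangular (diagonal z)) z≡) (m+n∸m≡n (triangular (diagonal z)) n)
      fst≡ : fstᶜ z ≡ diagonal z ∸ n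
      fst≡ = cong (diagonal z ∸_) snd≡

    sndᶜ-≤ : ∀ z → sndᶜ z ≤ z
    sndᶜ-≤ z = m∸n≤m z (triangular (diagonal z))

  n≤triangular : ∀ n → n ≤ triangular n
  n≤triangular zero    = z≤n
  n≤triangular (suc n) = m≤m+n (suc n) (triangular n)

  m≤pair : ∀ m n → m ≤ pair m n
  m≤pair m n = ≤-trans (m≤m+n m n) (≤-trans (n≤triangular (m + n)) (m≤m+n _ n))

  n≤pair : ∀ m n → n ≤ pair m n
  n≤pair m n = m≤n+m n (triangular (m + n))

  n<pair-suc : ∀ m n → n < pair (suc m) n
  n<pair-suc m n = s≤s (m≤n+m n (m + n + triangular (m + n)))

  triangular-mono : ∀ {m n} → m ≤ n → triangular m ≤ triangular n
  triangular-mono z≤n       = z≤n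
  triangular-mono (s≤s m≤n) = +-mono-≤ (s≤s m≤n) (triangular-mono m≤n)

  pair-mono : ∀ {m n m′ n′} → m ≤ m′ → n ≤ n′ → pair m n ≤ pair m′ n′
  pair-mono p q = +-mono-≤ (triangular-mono (+-mono-≤ p q)) q

  cons-injectiveˡ : ∀ {x xs y ys} → cons x xs ≡ cons y ys → x ≡ y
  cons-injectiveˡ e = pair-injectiveˡ (suc-injective e)

  cons-injectiveʳ : ∀ {x xs y ys} → cons x xs ≡ cons y ys → xs ≡ ys
  cons-injectiveʳ {x} {xs} {y} {ys} e = pair-injectiveʳ {x} {xs} {y} (suc-injective e)

  c-triangular : Comp₁ O triangular
  c-triangular = comp₁ (ext (λ { (x ∷ []) → eq x })
      (c-rec (const 0) (ap₂ c-+ (ap₁ c-suc (v 0F)) (v 1F)) (v 0F)))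
    where
    eq : ∀ x → natrec 0 (λ n r → suc n + r) x ≡ triangular x
    eq zero    = refl
    eq (suc x) = cong (suc x +_) (eq x)

  c-pair : Comp₂ O pair
  c-pair = comp₂ (ap₂ c-+ (ap₁ c-triangular (ap₂ c-+ (v 0F) (v 1F))) (v 1F))

  c-cons : Comp₂ O cons
  c-cons = comp₂ (ap₁ c-suc (ap₂ c-pair (v 0F) (v 1F)))

  c-diagonal : Comp₁ O diagonal
  c-diagonal = comp₁ (ext (λ { (x ∷ []) → eq x })
      (c-rec (const 0)
             (c-if (c-≡ᵇ (ap₁ c-suc (v 0F)) (ap₁ c-triangular (ap₁ c-suc (v 1F)))) (ap₁ c-suc (v 1F)) (v 1F))
             (v 0F)))
    where
    step : ℕ → ℕ → ℕ
    step n r = if suc n ≡ᵇ triangular (suc r) then suc r else r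
    eq : ∀ x → natrec 0 step x ≡ diagonal x
    eq zero    = refl
    eq (suc x) = cong (step x) (eq x)

  opaque
    unfolding fstᶜ

    c-snd : Comp₁ O sndᶜ
    c-snd = comp₁ (ap₂ c-∸ (v 0F) (ap₁ c-triangular (ap₁ c-diagonal (v 0F))))

    c-fst : Comp₁ O fstᶜ
    c-fst = comp₁ (ap₂ c-∸ (ap₁ c-diagonal (v 0F)) (ap₁ c-snd (v 0F)))

  code : List ℕ → ℕ
  code []       = nil
  code (x ∷ xs) = cons x (code xs)

  code-injective : ∀ xs ys → code xs ≡ code ys → xs ≡ ys
  code-injective []       []       e = refl
  code-injective (x ∷ xs) (y ∷ ys) e =
    cong₂ _∷_ (cons-injectiveˡ {x} {code xs} {y} e) (code-injective xs ys (cons-injectiveʳ {x} {code xs} {y} e))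

  headᶜ : ℕ → ℕ
  headᶜ l = fstᶜ (pred l)

  tailᶜ : ℕ → ℕ
  tailᶜ l = sndᶜ (pred l)

  dropᶜ : ℕ → ℕ → ℕ
  dropᶜ zero    l = l
  dropᶜ (suc j) l = tailᶜ (dropᶜ j l)

  c-head : Comp₁ O headᶜ
  c-head = comp₁ (ap₁ c-fst (ap₁ c-pred (v 0F)))

  c-tail : Comp₁ O tailᶜ
  c-tail = comp₁ (ap₁ c-snd (ap₁ c-pred (v 0F)))

  c-drop : Comp₂ O dropᶜ
  c-drop = comp₂ (ext (λ { (x ∷ y ∷ []) → eq x y }) (c-rec (v 1F) (ap₁ c-tail (v 1F)) (v 0F)))
    where
    eq : ∀ j l → natrec l (λ _ r → tailᶜ r) j ≡ dropᶜ j l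
    eq zero    l = refl
    eq (suc j) l = cong tailᶜ (eq j l)

  head-cons : ∀ x l → headᶜ (cons x l) ≡ x
  head-cons = fstᶜ-pair

  tail-cons : ∀ x l → tailᶜ (cons x l) ≡ l
  tail-cons = sndᶜ-pair

  drop-cons : ∀ j x l → dropᶜ (suc j) (cons x l) ≡ dropᶜ j l
  drop-cons zero    x l = tail-cons x l
  drop-cons (suc j) x l = cong tailᶜ (drop-cons j x l)

  nonZeroᵇ : ℕ → Bool
  nonZeroᵇ zero    = false
  nonZeroᵇ (suc _) = true

  c-nonZero : {f : Vec ℕ k → ℕ} → Comp O f → CompB O (λ xs → nonZeroᵇ (f xs))
  c-nonZero {f = f} cf = compᵇ (ext (λ xs → eq (f xs)) (bodyᵇ (c-not (c-≡ᵇ cf (const 0)))))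
    where
    eq : ∀ n → ⟨ not (n ≡ᵇ 0) ⟩ ≡ ⟨ nonZeroᵇ n ⟩
    eq zero    = refl
    eq (suc n) = refl

  -- Each tail is smaller than its list, so `l` itself bounds the number of positions. Without the
  -- test for an empty rest, `headᶜ nil`, which is 0, would make 0 a member of every list.
  member : ℕ → ℕ → Bool
  member x l = anyᵇ (λ j → nonZeroᵇ (dropᶜ j l) ∧ (headᶜ (dropᶜ j l) ≡ᵇ x)) (suc l)

  c-member : {f g : Vec ℕ k → ℕ} → Comp O f → Comp O g → CompB O (λ xs → member (f xs) (g xs))
  c-member cf cg = compᵇ (ap₂ (comp₂ {f = λ x l → ⟨ member x l ⟩} (bodyᵇ
    (c-any {b = λ ys → nonZeroᵇ (dropᶜ (lookup ys 0F) (lookup ys 2F)) ∧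
                       (headᶜ (dropᶜ (lookup ys 0F) (lookup ys 2F)) ≡ᵇ lookup ys 1F)}
      (c-∧ (c-nonZero (ap₂ c-drop (v 0F) (v 2F)))
           (c-≡ᵇ (ap₁ c-head (ap₂ c-drop (v 0F) (v 2F))) (v 1F)))
      (ap₁ c-suc (v 1F))))) cf cg)

  member-here : ∀ x l → member x (cons x l) ≡ true
  member-here x l = anyᵇ-intro (λ j → nonZeroᵇ (dropᶜ j (cons x l)) ∧ (headᶜ (dropᶜ j (cons x l)) ≡ᵇ x))
    {suc (cons x l)} {0} (s≤s z≤n)
    (trans (cong (_≡ᵇ x) (head-cons x l)) (≡ᵇ-refl x))

  member-there : ∀ x y l → member x l ≡ true → member x (cons y l) ≡ true
  member-there x y l h with anyᵇ-elim (λ j → nonZeroᵇ (dropᶜ j l) ∧ (headᶜ (dropᶜ j l) ≡ᵇ x)) (suc l) h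
  ... | j , j≤l , hj = anyᵇ-intro (λ j → nonZeroᵇ (dropᶜ j (cons y l)) ∧ (headᶜ (dropᶜ j (cons y l)) ≡ᵇ x))
    {suc (cons y l)} {suc j} (s≤s (≤-trans j≤l (s≤s (n≤pair y l))))
    (trans (cong (λ m → nonZeroᵇ m ∧ (headᶜ m ≡ᵇ x)) (drop-cons j y l)) hj)

  tailᶜ-≤ : ∀ l → tailᶜ l ≤ pred l
  tailᶜ-≤ l = sndᶜ-≤ (pred l)

  dropᶜ-≤ : ∀ j l → dropᶜ j l ≤ l ∸ j
  dropᶜ-≤ zero    l = ≤-refl
  dropᶜ-≤ (suc j) l = ≤-trans (tailᶜ-≤ (dropᶜ j l))
    (≤-trans (pred-mono-≤ (dropᶜ-≤ j l)) (≤-reflexive (pred[m∸n]≡m∸[1+n] l j)))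

  member-cons : ∀ x y l → member x (cons y l) ≡ true → x ≡ y ⊎ member x l ≡ true
  member-cons x y l h
    with anyᵇ-elim (λ j → nonZeroᵇ (dropᶜ j (cons y l)) ∧ (headᶜ (dropᶜ j (cons y l)) ≡ᵇ x)) (suc (cons y l)) h
  ... | zero  , _ , hj = inj₁ (trans (sym (≡ᵇ-true hj)) (head-cons y l))
  ... | suc j , _ , hj = inj₂ (anyᵇ-intro (λ j → nonZeroᵇ (dropᶜ j l) ∧ (headᶜ (dropᶜ j l) ≡ᵇ x)) {suc l} {j} j≤l hj′)
    where
    hj′ : nonZeroᵇ (dropᶜ j l) ∧ (headᶜ (dropᶜ j l) ≡ᵇ x) ≡ true
    hj′ = trans (cong (λ m → nonZeroᵇ m ∧ (headᶜ m ≡ᵇ x)) (sym (drop-cons j y l))) hj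
    -- A position beyond `l` has an empty rest, so it cannot have passed the test.
    j≤l : j < suc l
    j≤l with j <? suc l
    ... | yes j<l = j<l
    ... | no  j≮l = case trans (sym (cong nonZeroᵇ (n≤0⇒n≡0 (≤-trans (dropᶜ-≤ j l)
            (≤-reflexive (m≤n⇒m∸n≡0 (<⇒≤ (≮⇒≥ j≮l)))))))) (∧-trueˡ hj′) of λ ()

-- Computable enumeration of the facts derivable from finitely many rules

module RuleSystems where

  open Computability
  open Pairing

  private variable
    O : Pred ℕ 0ℓ
    k m : ℕ

  c-∘ : {f : Vec ℕ k → ℕ} {h : Vec ℕ m → Vec ℕ k} → Comp O f →
        (∀ i → Comp O (λ xs → lookup (h xs) i)) → Comp O (λ xs → f (h xs))
  c-∘ {k} {m} {O} {f} {h} cf ch = computes (comp (program cf) (tabulate (program ∘ ch))) run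
    where
    evals : ∀ {l} (is : Fin l → Fin k) xs →
            Evals O (tabulate (program ∘ ch ∘ is)) xs (tabulate (lookup (h xs) ∘ is))
    evals {zero}  is xs = []
    evals {suc l} is xs = runs (ch (is zero)) xs ∷ evals (is ∘ suc) xs
    run : ∀ xs → Eval O _ xs (f (h xs))
    run xs = comp (subst (Evals O _ xs) (tabulate∘lookup (h xs)) (evals id xs)) (runs cf (h xs))

  -- Finite rule systems: derivability is enumerated by a computable
  -- sequence of finite sets of facts.

  -- An expression is any computable function of the environment, not just a term built from
  -- constructors; rules can thereby apply computable operations and test decidable conditions.
  record Exp (k : ℕ) : Set where
    constructor exp
    field
      {den} : Vec ℕ k → ℕ
      c-den : Comp ∅ den

  open Exp public

  Fact : Set
  Fact = List ℕ

  Pattern : ℕ → Set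
  Pattern k = List (Exp k)

  ⟦_⟧ : Pattern k → Vec ℕ k → Fact
  ⟦ p ⟧ ρ = map (λ e → den e ρ) p

  record Rule : Set where
    constructor rule
    field
      arity      : ℕ
      premises   : List (Pattern arity)
      conclusion : Pattern arity

  open Rule public

  instances : List (Pattern k) → Vec ℕ k → List Fact
  instances ps ρ = map (λ p → ⟦ p ⟧ ρ) ps

  decode : (k : ℕ) → ℕ → Vec ℕ k
  decode zero    e = []
  decode (suc k) e = fstᶜ e ∷ decode k (sndᶜ e)

  encode : Vec ℕ k → ℕ
  encode []       = 0
  encode (x ∷ ρ) = pair x (encode ρ)

  decode-encode : (ρ : Vec ℕ k) → decode k (encode ρ) ≡ ρ
  decode-encode []      = refl
  decode-encode (x ∷ ρ) = cong₂ _∷_ (fstᶜ-pair x _)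
    (trans (cong (decode _) (sndᶜ-pair x (encode ρ))) (decode-encode ρ))

  c-decode : {g : Vec ℕ m → ℕ} → Comp O g → (i : Fin k) → Comp O (λ xs → lookup (decode k (g xs)) i)
  c-decode cg zero    = ap₁ c-fst cg
  c-decode cg (suc i) = c-decode (ap₁ c-snd cg) i

  c-code : (p : Pattern k) → Comp ∅ (λ ρ → code (⟦ p ⟧ ρ))
  c-code []      = const 0
  c-code (e ∷ p) = ap₂ c-cons (c-den e) (c-code p)

  memberAll : List Fact → ℕ → Bool
  memberAll []       s = true
  memberAll (f ∷ fs) s = member (code f) s ∧ memberAll fs s

  fire : Rule → ℕ → ℕ → ℕ
  fire r e s =
    if memberAll (instances (premises r) (decode (arity r) e)) s
    then cons (code (⟦ conclusion r ⟧ (decode (arity r) e))) s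
    else s

  c-fire : ∀ r → Comp₂ ∅ (fire r)
  c-fire r = comp₂ (c-if (prems (premises r)) (ap₂ c-cons (fact (conclusion r)) (v 1F)) (v 1F))
    where
    fact : (p : Pattern (arity r)) →
           Comp ∅ (λ xs → code (⟦ p ⟧ (decode (arity r) (lookup {n = 2} xs 0F))))
    fact p = c-∘ {h = λ xs → decode (arity r) (lookup xs 0F)} (c-code p) (c-decode (v 0F))
    prems : (ps : List (Pattern (arity r))) →
            CompB ∅ (λ xs → memberAll (instances ps (decode (arity r) (lookup {n = 2} xs 0F))) (lookup xs 1F))
    prems []       = compᵇ (const 1)
    prems (p ∷ ps) = c-∧ (c-member (fact p) (v 1F)) (prems ps)

  memberAll-true : ∀ fs s → All (λ f → member (code f) s ≡ true) fs → memberAll fs s ≡ true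
  memberAll-true []       s []       = refl
  memberAll-true (f ∷ fs) s (h ∷ hs) = ∧-intro h (memberAll-true fs s hs)

  record System : Set₁ where
    field
      Label    : Set
      schema   : Label → Rule
      labels   : List Label
      complete : ∀ l → l ∈ labels

  module Derivation (S : System) where
    open System S

    data Der : Fact → Set where
      infer : ∀ l ρ → All Der (instances (premises (schema l)) ρ) → Der (⟦ conclusion (schema l) ⟧ ρ)

    module _ (M : Fact → Set)
             (closed : ∀ l ρ → All M (instances (premises (schema l)) ρ) → M (⟦ conclusion (schema l) ⟧ ρ)) where
      mutual
        Der-induction : ∀ {f} → Der f → M f
        Der-induction (infer l ρ ds) = closed l ρ (Der-inductions ds)

        Der-inductions : ∀ {fs} → All Der fs → All M fs
        Der-inductions []       = []
        Der-inductions (d ∷ ds) = Der-induction d ∷ Der-inductions ds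

    fireAll : List Label → ℕ → ℕ → ℕ
    fireAll []       e s = s
    fireAll (l ∷ ls) e s = fireAll ls e (fire (schema l) e s)

    -- Stage n applies all rules to the environment fstᶜ n, so every
    -- environment is treated at infinitely many stages.
    state : ℕ → ℕ
    state zero    = nil
    state (suc n) = fireAll labels (fstᶜ n) (state n)

    c-fireAll : ∀ ls → Comp₂ ∅ (fireAll ls)
    c-fireAll []       = comp₂ (v 1F)
    c-fireAll (l ∷ ls) = comp₂ (ap₂ (c-fireAll ls) (v 0F) (ap₂ (c-fire (schema l)) (v 0F) (v 1F)))

    c-state : Comp₁ ∅ state
    c-state = comp₁ (ext (λ { (x ∷ []) → eq x })
        (c-rec (const 0) (ap₂ (c-fireAll labels) (ap₁ c-fst (v 0F)) (v 1F)) (v 0F)))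
      where
      eq : ∀ n → natrec 0 (λ n r → fireAll labels (fstᶜ n) r) n ≡ state n
      eq zero    = refl
      eq (suc n) = cong (fireAll labels (fstᶜ n)) (eq n)

    opaque
      by : ℕ → Fact → Bool
      by n f = member (code f) (state n)

      by-unfold : ∀ n f → by n f ≡ member (code f) (state n)
      by-unfold n f = refl

    c-by : {n : Vec ℕ k → ℕ} → Comp ∅ n → (p : Pattern k) → CompB ∅ (λ ρ → by (n ρ) (⟦ p ⟧ ρ))
    c-by {n = n} cn p =
      compᵇ (ext (λ ρ → cong ⟨_⟩ (sym (by-unfold (n ρ) (⟦ p ⟧ ρ)))) (bodyᵇ (c-member (c-code p) (ap₁ c-state cn))))

    fire-grows : ∀ r e s x → member x s ≡ true → member x (fire r e s) ≡ true
    fire-grows r e s x h with memberAll (instances (premises r) (decode (arity r) e)) s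
    ... | true  = member-there x (code (⟦ conclusion r ⟧ (decode (arity r) e))) s h
    ... | false = h

    fireAll-grows : ∀ ls e s x → member x s ≡ true → member x (fireAll ls e s) ≡ true
    fireAll-grows []       e s x h = h
    fireAll-grows (l ∷ ls) e s x h = fireAll-grows ls e _ x (fire-grows (schema l) e s x h)

    by-mono : ∀ {m n} f → m ≤ n → by m f ≡ true → by n f ≡ true
    by-mono {m} {n} f m≤n h = subst (λ n → by n f ≡ true) (m∸n+n≡m m≤n) (go (n ∸ m))
      where
      go : ∀ d → by (d + m) f ≡ true
      go zero    = h
      go (suc d) = trans (by-unfold (suc (d + m)) f) (fireAll-grows labels (fstᶜ (d + m)) (state (d + m)) (code f)
        (trans (sym (by-unfold (d + m) f)) (go d)))

    fireAll-fires : ∀ ls e s {l} → l ∈ ls →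
      All (λ f → member (code f) s ≡ true) (instances (premises (schema l)) (decode _ e)) →
      member (code (⟦ conclusion (schema l) ⟧ (decode _ e))) (fireAll ls e s) ≡ true
    fireAll-fires (l ∷ ls) e s (here refl) hs
      rewrite memberAll-true (instances (premises (schema l)) (decode _ e)) s hs =
        fireAll-grows ls e _ _ (member-here (code (⟦ conclusion (schema l) ⟧ (decode _ e))) s)
    fireAll-fires (l′ ∷ ls) e s (there l∈) hs = fireAll-fires ls e _ l∈ (grow hs)
      where
      grow : ∀ {fs} → All (λ f → member (code f) s ≡ true) fs →
             All (λ f → member (code f) (fire (schema l′) e s) ≡ true) fs
      grow []       = []
      grow (h ∷ hs) = fire-grows (schema l′) e s _ h ∷ grow hs

    mutual
      Der⇒by : ∀ {f} → Der f → ∃[ n ] by n f ≡ true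
      Der⇒by (infer l ρ ds) with Ders⇒by ds
      -- This stage tries the environment `ρ`, and it is late enough for all premises because a pair
      -- bounds its second component.
      ... | n , hs = suc (pair (encode ρ) n) ,
        subst (λ σ → by (suc (pair (encode ρ) n)) (⟦ conclusion (schema l) ⟧ σ) ≡ true) decode≡
          (trans (by-unfold (suc (pair (encode ρ) n)) _)
            (fireAll-fires labels (fstᶜ (pair (encode ρ) n)) (state (pair (encode ρ) n)) (complete l)
              (subst (λ σ → All (λ f → member (code f) (state (pair (encode ρ) n)) ≡ true) (instances (premises (schema l)) σ))
                (sym decode≡) (unfolds (up (n≤pair (encode ρ) n) hs)))))
        where
        decode≡ : decode _ (fstᶜ (pair (encode ρ) n)) ≡ ρ
        decode≡ = trans (cong (decode _) (fstᶜ-pair (encode ρ) n)) (decode-encode ρ)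

      Ders⇒by : ∀ {fs} → All Der fs → ∃[ n ] All (λ f → by n f ≡ true) fs
      Ders⇒by []       = 0 , []
      Ders⇒by (d ∷ ds) with Der⇒by d | Ders⇒by ds
      ... | n , h | m , hs = n ⊔ m , by-mono _ (m≤m⊔n n m) h ∷ up (m≤n⊔m n m) hs

      unfolds : ∀ {n fs} → All (λ f → by n f ≡ true) fs → All (λ f → member (code f) (state n) ≡ true) fs
      unfolds []       = []
      unfolds {n} (_∷_ {f} h hs) = trans (sym (by-unfold n f)) h ∷ unfolds hs

      up : ∀ {m n fs} → m ≤ n → All (λ f → by m f ≡ true) fs → All (λ f → by n f ≡ true) fs
      up m≤n []       = []
      up m≤n (h ∷ hs) = by-mono _ m≤n h ∷ up m≤n hs

    Sound : ℕ → Set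
    Sound s = ∀ f → member (code f) s ≡ true → Der f

    memberAll-sound : ∀ s fs → Sound s → memberAll fs s ≡ true → All Der fs
    memberAll-sound s []       h e = []
    memberAll-sound s (f ∷ fs) h e =
      h f (∧-trueˡ e) ∷ memberAll-sound s fs h (∧-trueʳ {member (code f) s} e)

    fire-sound : ∀ l e s → Sound s → Sound (fire (schema l) e s)
    fire-sound l e s h f with memberAll (instances (premises (schema l)) (decode _ e)) s in eq
    ... | false = h f
    ... | true  = λ f∈ → case member-cons (code f) (code (⟦ conclusion (schema l) ⟧ (decode _ e))) s f∈ of λ where
      (inj₁ f≡) → subst Der (sym (code-injective f _ f≡))
                    (infer l (decode _ e) (memberAll-sound s _ h eq))
      (inj₂ f∈s) → h f f∈s

    fireAll-sound : ∀ ls e s → Sound s → Sound (fireAll ls e s)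
    fireAll-sound []       e s h = h
    fireAll-sound (l ∷ ls) e s h = fireAll-sound ls e _ (fire-sound l e s h)

    by⇒Der : ∀ n {f} → by n f ≡ true → Der f
    by⇒Der n {f} h = sound n f (trans (sym (by-unfold n f)) h)
      where
      sound : ∀ n → Sound (state n)
      sound zero    f ()
      sound (suc n) = fireAll-sound labels (fstᶜ n) (state n) (sound n)

  infixl 8 _ᵉ+_
  V : Fin k → Exp k
  V i = exp (v i)

  # : ℕ → Exp k
  # n = exp (const n)

  _ᵉ+_ : ℕ → Exp k → Exp k
  zero  ᵉ+ e = e
  suc n ᵉ+ e = exp (ap₁ c-suc (c-den (n ᵉ+ e)))

  ⟪_,_⟫ : Exp k → Exp k → Exp k
  ⟪ d , e ⟫ = exp (ap₂ c-pair (c-den d) (c-den e))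

  _∷ᵉ_ : Exp k → Exp k → Exp k
  d ∷ᵉ e = exp (ap₂ c-cons (c-den d) (c-den e))
  infixr 8 _∷ᵉ_

-- A universal machine given by rules of evaluation

module UniversalMachine where

  open Pairing
  open RuleSystems

  codeᵛ : ∀ {k} → Vec ℕ k → ℕ
  codeᵛ []       = nil
  codeᵛ (x ∷ xs) = cons x (codeᵛ xs)

  data ProgramView : ∀ {k} → Program k → ℕ → ℕ → Set where
    zero   : ProgramView zero 0 0
    succ   : ProgramView succ 1 0
    proj   : ∀ {k x} (i : Fin k) → toℕ i ≡ x → ProgramView (proj i) 2 x
    oracle : ProgramView oracle 3 0
    comp   : ∀ {k m x} (f : Program m) (gs : Vec (Program k) m) →
             pair ⌜ f ⌝ᵖ ⌜ gs ⌝ᵖˢ ≡ x → ProgramView (comp f gs) 4 x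
    prec   : ∀ {k x} (f : Program k) (g : Program (suc (suc k))) →
             pair ⌜ f ⌝ᵖ ⌜ g ⌝ᵖ ≡ x → ProgramView (prec f g) 5 x
    mu     : ∀ {k x} (f : Program (suc k)) → ⌜ f ⌝ᵖ ≡ x → ProgramView (mu f) 6 x

  -- By injectivity of `pair` the tag determines the constructor; the arity comes from the type, as
  -- the code does not record it.
  programView : ∀ {k} (p : Program k) t x → ⌜ p ⌝ᵖ ≡ pair t x → ProgramView p t x
  programView zero t x e with refl ← pair-injectiveˡ {0} {0} {t} e | refl ← pair-injectiveʳ {0} {0} {t} e = zero
  programView succ t x e with refl ← pair-injectiveˡ {1} {0} {t} e | refl ← pair-injectiveʳ {1} {0} {t} e = succ
  programView (proj i) t x e with refl ← pair-injectiveˡ {2} {toℕ i} {t} e = proj i (pair-injectiveʳ {2} {toℕ i} {t} e)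
  programView oracle t x e with refl ← pair-injectiveˡ {3} {0} {t} e | refl ← pair-injectiveʳ {3} {0} {t} e = oracle
  programView (comp f gs) t x e with refl ← pair-injectiveˡ {4} {pair ⌜ f ⌝ᵖ ⌜ gs ⌝ᵖˢ} {t} e =
    comp f gs (pair-injectiveʳ {4} {_} {t} e)
  programView (prec f g) t x e with refl ← pair-injectiveˡ {5} {pair ⌜ f ⌝ᵖ ⌜ g ⌝ᵖ} {t} e =
    prec f g (pair-injectiveʳ {5} {_} {t} e)
  programView (mu f) t x e with refl ← pair-injectiveˡ {6} {⌜ f ⌝ᵖ} {t} e = mu f (pair-injectiveʳ {6} {_} {t} e)

  data EvalLabel : Set where
    fin-zero fin-suc : EvalLabel
    prog-zero prog-succ prog-proj prog-oracle prog-comp prog-prec prog-mu progs-nil progs-cons : EvalLabel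
    look-zero look-suc : EvalLabel
    ev-zero ev-succ ev-proj ev-oracle ev-comp ev-prec-zero ev-prec-suc ev-mu : EvalLabel
    evs-nil evs-cons below-zero below-suc halt : EvalLabel

  module _ {k : ℕ} where
    isFin : Exp k → Exp k → Pattern k
    isFin i n = # 0 ∷ i ∷ n ∷ []
    isProg : Exp k → Exp k → Pattern k
    isProg n e = # 1 ∷ n ∷ e ∷ []
    areProgs : Exp k → Exp k → Exp k → Pattern k
    areProgs n m es = # 2 ∷ n ∷ m ∷ es ∷ []
    look : Exp k → Exp k → Exp k → Pattern k
    look xs i y = # 3 ∷ xs ∷ i ∷ y ∷ []
    ev : Exp k → Exp k → Exp k → Pattern k
    ev e xs y = # 4 ∷ e ∷ xs ∷ y ∷ []
    evs : Exp k → Exp k → Exp k → Pattern k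
    evs es xs ys = # 5 ∷ es ∷ xs ∷ ys ∷ []
    below : Exp k → Exp k → Exp k → Pattern k
    below f xs i = # 6 ∷ f ∷ xs ∷ i ∷ []
    halts : Exp k → Pattern k
    halts e = # 7 ∷ e ∷ []

  -- The rules for `ev` compute with bare numbers and never check arities. Well-formedness is
  -- derived separately through `isFin`, `isProg` and `areProgs`, and `halt` combines the two.
  evalRule : EvalLabel → Rule
  evalRule fin-zero    = rule 1 [] (isFin (# 0) (1 ᵉ+ V 0F))
  evalRule fin-suc     = rule 2 (isFin (V 0F) (V 1F) ∷ []) (isFin (1 ᵉ+ V 0F) (1 ᵉ+ V 1F))
  evalRule prog-zero   = rule 0 [] (isProg (# 0) ⟪ # 0 , # 0 ⟫)
  evalRule prog-succ   = rule 0 [] (isProg (# 1) ⟪ # 1 , # 0 ⟫)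
  evalRule prog-proj   = rule 2 (isFin (V 0F) (V 1F) ∷ []) (isProg (V 1F) ⟪ # 2 , V 0F ⟫)
  evalRule prog-oracle = rule 0 [] (isProg (# 1) ⟪ # 3 , # 0 ⟫)
  evalRule prog-comp   = rule 4 (isProg (V 1F) (V 2F) ∷ areProgs (V 0F) (V 1F) (V 3F) ∷ [])
                                (isProg (V 0F) ⟪ # 4 , ⟪ V 2F , V 3F ⟫ ⟫)
  evalRule prog-prec   = rule 3 (isProg (V 0F) (V 1F) ∷ isProg (2 ᵉ+ V 0F) (V 2F) ∷ [])
                                (isProg (1 ᵉ+ V 0F) ⟪ # 5 , ⟪ V 1F , V 2F ⟫ ⟫)
  evalRule prog-mu     = rule 2 (isProg (1 ᵉ+ V 0F) (V 1F) ∷ []) (isProg (V 0F) ⟪ # 6 , V 1F ⟫)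
  evalRule progs-nil   = rule 1 [] (areProgs (V 0F) (# 0) (# 0))
  evalRule progs-cons  = rule 4 (isProg (V 0F) (V 2F) ∷ areProgs (V 0F) (V 1F) (V 3F) ∷ [])
                                (areProgs (V 0F) (1 ᵉ+ V 1F) (V 2F ∷ᵉ V 3F))
  evalRule look-zero   = rule 2 [] (look (V 0F ∷ᵉ V 1F) (# 0) (V 0F))
  evalRule look-suc    = rule 4 (look (V 1F) (V 2F) (V 3F) ∷ []) (look (V 0F ∷ᵉ V 1F) (1 ᵉ+ V 2F) (V 3F))
  evalRule ev-zero     = rule 0 [] (ev ⟪ # 0 , # 0 ⟫ (# 0) (# 0))
  evalRule ev-succ     = rule 1 [] (ev ⟪ # 1 , # 0 ⟫ (V 0F ∷ᵉ # 0) (1 ᵉ+ V 0F))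
  evalRule ev-proj     = rule 3 (look (V 1F) (V 0F) (V 2F) ∷ []) (ev ⟪ # 2 , V 0F ⟫ (V 1F) (V 2F))
  -- The oracle is empty, so every call returns 0.
  evalRule ev-oracle   = rule 1 [] (ev ⟪ # 3 , # 0 ⟫ (V 0F ∷ᵉ # 0) (# 0))
  evalRule ev-comp     = rule 5 (evs (V 1F) (V 2F) (V 3F) ∷ ev (V 0F) (V 3F) (V 4F) ∷ [])
                                (ev ⟪ # 4 , ⟪ V 0F , V 1F ⟫ ⟫ (V 2F) (V 4F))
  evalRule ev-prec-zero = rule 4 (ev (V 0F) (V 2F) (V 3F) ∷ [])
                                 (ev ⟪ # 5 , ⟪ V 0F , V 1F ⟫ ⟫ (# 0 ∷ᵉ V 2F) (V 3F))
  evalRule ev-prec-suc = rule 6 (ev ⟪ # 5 , ⟪ V 0F , V 1F ⟫ ⟫ (V 2F ∷ᵉ V 3F) (V 4F)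
                                 ∷ ev (V 1F) (V 2F ∷ᵉ V 4F ∷ᵉ V 3F) (V 5F) ∷ [])
                                (ev ⟪ # 5 , ⟪ V 0F , V 1F ⟫ ⟫ ((1 ᵉ+ V 2F) ∷ᵉ V 3F) (V 5F))
  evalRule ev-mu       = rule 3 (below (V 0F) (V 1F) (V 2F) ∷ ev (V 0F) (V 2F ∷ᵉ V 1F) (# 0) ∷ [])
                                (ev ⟪ # 6 , V 0F ⟫ (V 1F) (V 2F))
  evalRule evs-nil     = rule 1 [] (evs (# 0) (V 0F) (# 0))
  evalRule evs-cons    = rule 5 (ev (V 0F) (V 2F) (V 3F) ∷ evs (V 1F) (V 2F) (V 4F) ∷ [])
                                (evs (V 0F ∷ᵉ V 1F) (V 2F) (V 3F ∷ᵉ V 4F))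
  evalRule below-zero  = rule 2 [] (below (V 0F) (V 1F) (# 0))
  evalRule below-suc   = rule 4 (below (V 0F) (V 1F) (V 2F) ∷ ev (V 0F) (V 2F ∷ᵉ V 1F) (1 ᵉ+ V 3F) ∷ [])
                                (below (V 0F) (V 1F) (1 ᵉ+ V 2F))
  evalRule halt        = rule 2 (isProg (# 1) (V 0F) ∷ ev (V 0F) (V 0F ∷ᵉ # 0) (V 1F) ∷ []) (halts (V 0F))

  evalLabels : List EvalLabel
  evalLabels = fin-zero ∷ fin-suc ∷ prog-zero ∷ prog-succ ∷ prog-proj ∷ prog-oracle ∷ prog-comp ∷ prog-prec
    ∷ prog-mu ∷ progs-nil ∷ progs-cons ∷ look-zero ∷ look-suc ∷ ev-zero ∷ ev-succ ∷ ev-proj ∷ ev-oracle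
    ∷ ev-comp ∷ ev-prec-zero ∷ ev-prec-suc ∷ ev-mu ∷ evs-nil ∷ evs-cons ∷ below-zero ∷ below-suc ∷ halt ∷ []

  evalLabels-complete : ∀ l → l ∈ evalLabels
  evalLabels-complete = λ where
    fin-zero     → ∈-lookup (fin 0)
    fin-suc      → ∈-lookup (fin 1)
    prog-zero    → ∈-lookup (fin 2)
    prog-succ    → ∈-lookup (fin 3)
    prog-proj    → ∈-lookup (fin 4)
    prog-oracle  → ∈-lookup (fin 5)
    prog-comp    → ∈-lookup (fin 6)
    prog-prec    → ∈-lookup (fin 7)
    prog-mu      → ∈-lookup (fin 8)
    progs-nil    → ∈-lookup (fin 9)
    progs-cons   → ∈-lookup (fin 10)
    look-zero    → ∈-lookup (fin 11)
    look-suc     → ∈-lookup (fin 12)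
    ev-zero      → ∈-lookup (fin 13)
    ev-succ      → ∈-lookup (fin 14)
    ev-proj      → ∈-lookup (fin 15)
    ev-oracle    → ∈-lookup (fin 16)
    ev-comp      → ∈-lookup (fin 17)
    ev-prec-zero → ∈-lookup (fin 18)
    ev-prec-suc  → ∈-lookup (fin 19)
    ev-mu        → ∈-lookup (fin 20)
    evs-nil      → ∈-lookup (fin 21)
    evs-cons     → ∈-lookup (fin 22)
    below-zero   → ∈-lookup (fin 23)
    below-suc    → ∈-lookup (fin 24)
    halt         → ∈-lookup (fin 25)

  evalSystem : System
  evalSystem = record
    { Label = EvalLabel ; schema = evalRule ; labels = evalLabels ; complete = evalLabels-complete }

  module Evaluation where
    open Derivation evalSystem public

    -- A computation fact is read conditionally, for every program and environment with the given
    -- codes, so it says nothing about numbers that code no program. Existence of programs is left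
    -- to the tags 1 and 2.
    Meaning : Fact → Set
    Meaning (0 ∷ i ∷ n ∷ [])       = Σ (Fin n) λ j → toℕ j ≡ i
    Meaning (1 ∷ n ∷ e ∷ [])       = Σ (Program n) λ p → ⌜ p ⌝ᵖ ≡ e
    Meaning (2 ∷ n ∷ m ∷ es ∷ [])  = Σ (Vec (Program n) m) λ ps → ⌜ ps ⌝ᵖˢ ≡ es
    Meaning (3 ∷ xs ∷ i ∷ y ∷ [])  = ∀ {k} (ρ : Vec ℕ k) (j : Fin k) → codeᵛ ρ ≡ xs → toℕ j ≡ i → lookup ρ j ≡ y
    Meaning (4 ∷ e ∷ xs ∷ y ∷ [])  = ∀ {k} (p : Program k) ρ → ⌜ p ⌝ᵖ ≡ e → codeᵛ ρ ≡ xs → Eval ∅ p ρ y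
    Meaning (5 ∷ es ∷ xs ∷ ys ∷ []) =
      ∀ {k m} (ps : Vec (Program k) m) ρ → ⌜ ps ⌝ᵖˢ ≡ es → codeᵛ ρ ≡ xs → ∃[ σ ] codeᵛ σ ≡ ys × Evals ∅ ps ρ σ
    Meaning (6 ∷ f ∷ xs ∷ n ∷ [])  =
      ∀ {k} (p : Program (suc k)) ρ → ⌜ p ⌝ᵖ ≡ f → codeᵛ ρ ≡ xs → ∀ i → i < n → ∃[ z ] Eval ∅ p (i ∷ ρ) (suc z)
    Meaning (7 ∷ e ∷ [])           = Halting e
    Meaning _                      = ⊤

    closed : ∀ l ρ → All Meaning (instances (premises (evalRule l)) ρ) → Meaning (⟦ conclusion (evalRule l) ⟧ ρ)
    closed fin-zero (n ∷ []) [] = zero , refl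
    closed fin-suc (i ∷ n ∷ []) ((j , e) ∷ []) = suc j , cong suc e
    closed prog-zero [] [] = zero , refl
    closed prog-succ [] [] = succ , refl
    closed prog-proj (i ∷ n ∷ []) ((j , e) ∷ []) = proj j , cong (pair 2) e
    closed prog-oracle [] [] = oracle , refl
    closed prog-comp (n ∷ m ∷ f ∷ gs ∷ []) ((p , e) ∷ (ps , es) ∷ []) =
      comp p ps , cong (pair 4) (cong₂ pair e es)
    closed prog-prec (n ∷ f ∷ g ∷ []) ((p , d) ∷ (q , e) ∷ []) = prec p q , cong (pair 5) (cong₂ pair d e)
    closed prog-mu (n ∷ f ∷ []) ((p , e) ∷ []) = mu p , cong (pair 6) e
    closed progs-nil (n ∷ []) [] = [] , refl
    closed progs-cons (n ∷ m ∷ p ∷ ps ∷ []) ((q , e) ∷ (qs , es) ∷ []) = q ∷ qs , cong₂ cons e es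
    closed look-zero (x ∷ xs ∷ []) [] (y ∷ ρ) zero e _ = cons-injectiveˡ {y} {codeᵛ ρ} {x} e
    closed look-suc (x ∷ xs ∷ i ∷ y ∷ []) (h ∷ []) (z ∷ ρ) (suc j) e e′ =
      h ρ j (cons-injectiveʳ {z} {codeᵛ ρ} {x} e) (suc-injective e′)
    closed ev-zero [] [] p [] e refl with zero ← programView p 0 0 e = zero
    closed ev-succ (x ∷ []) [] p ρ e e′ with succ ← programView p 1 0 e | (y ∷ []) ← ρ
      with refl ← cons-injectiveˡ {y} {nil} {x} e′ = succ
    closed ev-proj (i ∷ xs ∷ y ∷ []) (h ∷ []) p ρ e e′ with proj j j≡ ← programView p 2 i e =
      subst (Eval ∅ (proj j) ρ) (h ρ j e′ j≡) proj
    closed ev-oracle (x ∷ []) [] p ρ e e′ with oracle ← programView p 3 0 e | (y ∷ []) ← ρ = oracle-∉ (λ ())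
    closed ev-comp (f ∷ gs ∷ xs ∷ ys ∷ y ∷ []) (hs ∷ h ∷ []) p ρ e e′
      with comp q qs eq ← programView p 4 (pair f gs) e
      with σ , σ≡ , ds ← hs qs ρ (pair-injectiveʳ {⌜ q ⌝ᵖ} {_} {f} eq) e′ =
        comp ds (h q σ (pair-injectiveˡ {⌜ q ⌝ᵖ} {_} {f} eq) σ≡)
    closed ev-prec-zero (f ∷ g ∷ xs ∷ y ∷ []) (h ∷ []) p ρ e e′
      with prec q q′ eq ← programView p 5 (pair f g) e | (z ∷ ρ) ← ρ
      with refl ← cons-injectiveˡ {z} {codeᵛ ρ} {0} {xs} e′ =
        prec-zero (h q ρ (pair-injectiveˡ {⌜ q ⌝ᵖ} {_} {f} eq) (cons-injectiveʳ {z} {codeᵛ ρ} {0} {xs} e′))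
    closed ev-prec-suc (f ∷ g ∷ n ∷ xs ∷ r ∷ y ∷ []) (h ∷ h′ ∷ []) p ρ e e′
      with prec q q′ eq ← programView p 5 (pair f g) e | (z ∷ ρ) ← ρ
      with refl ← cons-injectiveˡ {z} {codeᵛ ρ} {suc n} e′ | refl ← cons-injectiveʳ {z} {codeᵛ ρ} {suc n} e′ =
        prec-suc (h (prec q q′) (n ∷ ρ) (cong (pair 5) eq) refl)
                 (h′ q′ (n ∷ r ∷ ρ) (pair-injectiveʳ {⌜ q ⌝ᵖ} {_} {f} eq) refl)
    closed ev-mu (f ∷ xs ∷ y ∷ []) (h ∷ h′ ∷ []) p ρ e e′ with mu q eq ← programView p 6 f e =
      mu (h q ρ eq e′) (h′ q (y ∷ ρ) eq (cong (cons y) e′))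
    closed evs-nil (xs ∷ []) [] [] ρ _ _ = [] , refl , []
    closed evs-cons (p ∷ ps ∷ xs ∷ y ∷ ys ∷ []) (h ∷ hs ∷ []) (q ∷ qs) ρ e e′
      with σ , σ≡ , ds ← hs qs ρ (cons-injectiveʳ {⌜ q ⌝ᵖ} {_} {p} e) e′ =
        y ∷ σ , cong (cons y) σ≡ , h q ρ (cons-injectiveˡ {⌜ q ⌝ᵖ} {_} {p} e) e′ ∷ ds
    closed below-zero (f ∷ xs ∷ []) [] p ρ _ _ i ()
    closed below-suc (f ∷ xs ∷ n ∷ z ∷ []) (h ∷ h′ ∷ []) p ρ e e′ i i<1+n with m≤n⇒m<n∨m≡n (s≤s⁻¹ i<1+n)
    ... | inj₁ i<n  = h p ρ e e′ i i<n
    ... | inj₂ refl = z , h′ p (i ∷ ρ) e (cong (cons i) e′)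
    closed halt (e ∷ y ∷ []) ((p , p≡) ∷ h ∷ []) = p , p≡ , y , h p (e ∷ []) p≡ refl

    sound : ∀ {f} → Der f → Meaning f
    sound = Der-induction Meaning closed

    derive-fin : ∀ {n} (i : Fin n) → Der (0 ∷ toℕ i ∷ n ∷ [])
    derive-fin zero    = infer fin-zero (_ ∷ []) []
    derive-fin (suc i) = infer fin-suc (toℕ i ∷ _ ∷ []) (derive-fin i ∷ [])

    mutual
      derive-prog : ∀ {n} (p : Program n) → Der (1 ∷ n ∷ ⌜ p ⌝ᵖ ∷ [])
      derive-prog zero        = infer prog-zero [] []
      derive-prog succ        = infer prog-succ [] []
      derive-prog (proj i)    = infer prog-proj (toℕ i ∷ _ ∷ []) (derive-fin i ∷ [])
      derive-prog oracle      = infer prog-oracle [] []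
      derive-prog (comp f gs) = infer prog-comp (_ ∷ _ ∷ ⌜ f ⌝ᵖ ∷ ⌜ gs ⌝ᵖˢ ∷ []) (derive-prog f ∷ derive-progs gs ∷ [])
      derive-prog (prec f g)  = infer prog-prec (_ ∷ ⌜ f ⌝ᵖ ∷ ⌜ g ⌝ᵖ ∷ []) (derive-prog f ∷ derive-prog g ∷ [])
      derive-prog (mu f)      = infer prog-mu (_ ∷ ⌜ f ⌝ᵖ ∷ []) (derive-prog f ∷ [])

      derive-progs : ∀ {n m} (ps : Vec (Program n) m) → Der (2 ∷ n ∷ m ∷ ⌜ ps ⌝ᵖˢ ∷ [])
      derive-progs []       = infer progs-nil (_ ∷ []) []
      derive-progs (p ∷ ps) = infer progs-cons (_ ∷ _ ∷ ⌜ p ⌝ᵖ ∷ ⌜ ps ⌝ᵖˢ ∷ []) (derive-prog p ∷ derive-progs ps ∷ [])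

    derive-lookup : ∀ {k} (ρ : Vec ℕ k) i → Der (3 ∷ codeᵛ ρ ∷ toℕ i ∷ lookup ρ i ∷ [])
    derive-lookup (x ∷ ρ) zero    = infer look-zero (x ∷ codeᵛ ρ ∷ []) []
    derive-lookup (x ∷ ρ) (suc i) = infer look-suc (x ∷ codeᵛ ρ ∷ toℕ i ∷ lookup ρ i ∷ []) (derive-lookup ρ i ∷ [])

    mutual
      derive : ∀ {k} {p : Program k} {ρ y} → Eval ∅ p ρ y → Der (4 ∷ ⌜ p ⌝ᵖ ∷ codeᵛ ρ ∷ y ∷ [])
      derive zero = infer ev-zero [] []
      derive (succ {x}) = infer ev-succ (x ∷ []) []
      derive {ρ = ρ} (proj {i = i}) = infer ev-proj (toℕ i ∷ codeᵛ ρ ∷ _ ∷ []) (derive-lookup ρ i ∷ [])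
      derive (oracle-∉ {x} _) = infer ev-oracle (x ∷ []) []
      derive {ρ = ρ} {y} (comp {f = f} {gs} {ys = σ} ds d) =
        infer ev-comp (⌜ f ⌝ᵖ ∷ ⌜ gs ⌝ᵖˢ ∷ codeᵛ ρ ∷ codeᵛ σ ∷ y ∷ []) (derives ds ∷ derive d ∷ [])
      derive {y = y} (prec-zero {f = f} {g} {ρ} d) =
        infer ev-prec-zero (⌜ f ⌝ᵖ ∷ ⌜ g ⌝ᵖ ∷ codeᵛ ρ ∷ y ∷ []) (derive d ∷ [])
      derive {y = y} (prec-suc {f = f} {g} {n} {ρ} {r} d e) =
        infer ev-prec-suc (⌜ f ⌝ᵖ ∷ ⌜ g ⌝ᵖ ∷ n ∷ codeᵛ ρ ∷ r ∷ y ∷ []) (derive d ∷ derive e ∷ [])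
      derive {ρ = ρ} {y} (mu {f = f} h d) =
        infer ev-mu (⌜ f ⌝ᵖ ∷ codeᵛ ρ ∷ y ∷ []) (derive-below y h ∷ derive d ∷ [])

      derive-below : ∀ {k} {f : Program (suc k)} {ρ} n → (∀ i → i < n → ∃[ z ] Eval ∅ f (i ∷ ρ) (suc z)) →
                     Der (6 ∷ ⌜ f ⌝ᵖ ∷ codeᵛ ρ ∷ n ∷ [])
      derive-below {f = f} {ρ} zero h = infer below-zero (⌜ f ⌝ᵖ ∷ codeᵛ ρ ∷ []) []
      derive-below {f = f} {ρ} (suc n) h = infer below-suc (⌜ f ⌝ᵖ ∷ codeᵛ ρ ∷ n ∷ proj₁ (h n ≤-refl) ∷ [])
        (derive-below n (λ i i<n → h i (m<n⇒m<1+n i<n)) ∷ derive (proj₂ (h n ≤-refl)) ∷ [])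

      derives : ∀ {k m} {ps : Vec (Program k) m} {ρ σ} → Evals ∅ ps ρ σ → Der (5 ∷ ⌜ ps ⌝ᵖˢ ∷ codeᵛ ρ ∷ codeᵛ σ ∷ [])
      derives {ρ = ρ} [] = infer evs-nil (codeᵛ ρ ∷ []) []
      derives {ps = p ∷ ps} {ρ} {y ∷ σ} (d ∷ ds) =
        infer evs-cons (⌜ p ⌝ᵖ ∷ ⌜ ps ⌝ᵖˢ ∷ codeᵛ ρ ∷ y ∷ codeᵛ σ ∷ []) (derive d ∷ derives ds ∷ [])

    derive-halting : ∀ {e} → Halting e → Der (7 ∷ e ∷ [])
    derive-halting {e} (p , refl , y , d) = infer halt (e ∷ y ∷ []) (derive-prog p ∷ derive d ∷ [])

    halting⇔stage : (∀ {e} → Halting e → ∃[ n ] by n (7 ∷ e ∷ []) ≡ true) × (∀ {e} n → by n (7 ∷ e ∷ []) ≡ true → Halting e)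
    halting⇔stage = (λ h → Der⇒by (derive-halting h)) , (λ {e} n h → sound (by⇒Der n {7 ∷ e ∷ []} h))

-- Codes, substitution and soundness for first-order logic

module FirstOrderLogic where

  open Pairing

  module _ {L : Language} where

    data TermView {n} : Term L n → ℕ → ℕ → Set where
      asVar  : ∀ {x} i → toℕ i ≡ x → TermView (var i) 0 x
      asFunc : ∀ {k x} (f : Func L k) ts → pair (pair k (⌜_⌝ᶠ L f)) ⌜ ts ⌝ᵗˢ ≡ x → TermView (func f ts) 1 x

    termView : ∀ {n} (t : Term L n) c x → ⌜ t ⌝ᵗ ≡ pair c x → TermView t c x
    termView (var i) c x e with refl ← pair-injectiveˡ {0} {toℕ i} {c} {x} e =
      asVar i (pair-injectiveʳ {0} {toℕ i} {c} {x} e)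
    termView (func {k} f ts) c x e
      with refl ← pair-injectiveˡ {1} {pair (pair k (⌜_⌝ᶠ L f)) ⌜ ts ⌝ᵗˢ} {c} {x} e =
        asFunc f ts (pair-injectiveʳ {1} {_} {c} {x} e)

    data FormulaView {n} : Formula L n → ℕ → ℕ → Set where
      _≐_ : ∀ {x} t s → pair ⌜ t ⌝ᵗ ⌜ s ⌝ᵗ ≡ x → FormulaView (t ≐ s) 0 x
      rel : ∀ {k x} (r : Rel L k) ts → pair (pair k (⌜_⌝ʳ L r)) ⌜ ts ⌝ᵗˢ ≡ x → FormulaView (rel r ts) 1 x
      ⊥′  : FormulaView ⊥′ 2 0
      _⇒_ : ∀ {x} φ ψ → pair ⌜ φ ⌝ ⌜ ψ ⌝ ≡ x → FormulaView (φ ⇒ ψ) 3 x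
      ∀′  : ∀ {x} φ → ⌜ φ ⌝ ≡ x → FormulaView (∀′ φ) 4 x

    formulaView : ∀ {n} (φ : Formula L n) c x → ⌜ φ ⌝ ≡ pair c x → FormulaView φ c x
    formulaView (t ≐ s) c x e with refl ← pair-injectiveˡ {0} {pair ⌜ t ⌝ᵗ ⌜ s ⌝ᵗ} {c} {x} e =
      (t ≐ s) (pair-injectiveʳ {0} {_} {c} {x} e)
    formulaView (rel {k = k} r ts) c x e
      with refl ← pair-injectiveˡ {1} {pair (pair k (⌜_⌝ʳ L r)) ⌜ ts ⌝ᵗˢ} {c} {x} e =
        rel r ts (pair-injectiveʳ {1} {_} {c} {x} e)
    formulaView ⊥′ c x e
      with refl ← pair-injectiveˡ {2} {0} {c} {x} e | refl ← pair-injectiveʳ {2} {0} {c} {x} e = ⊥′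
    formulaView (φ ⇒ ψ) c x e with refl ← pair-injectiveˡ {3} {pair ⌜ φ ⌝ ⌜ ψ ⌝} {c} {x} e =
      (φ ⇒ ψ) (pair-injectiveʳ {3} {_} {c} {x} e)
    formulaView (∀′ φ) c x e with refl ← pair-injectiveˡ {4} {⌜ φ ⌝} {c} {x} e =
      ∀′ φ (pair-injectiveʳ {4} {_} {c} {x} e)

    mutual
      ⌜⌝ᵗ-injective : ∀ {n} (t s : Term L n) → ⌜ t ⌝ᵗ ≡ ⌜ s ⌝ᵗ → t ≡ s
      ⌜⌝ᵗ-injective t (var i) e with asVar j j≡ ← termView t 0 (toℕ i) e = cong var (toℕ-injective j≡)
      ⌜⌝ᵗ-injective t (func {k} g ss) e
        with asFunc {j} f ts eq ← termView t 1 (pair (pair k (⌜_⌝ᶠ L g)) ⌜ ss ⌝ᵗˢ) e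
        with eq₁ ← pair-injectiveˡ {pair j (⌜_⌝ᶠ L f)} {⌜ ts ⌝ᵗˢ} {pair k (⌜_⌝ᶠ L g)} {⌜ ss ⌝ᵗˢ} eq
        with refl ← pair-injectiveˡ {j} {⌜_⌝ᶠ L f} {k} {⌜_⌝ᶠ L g} eq₁ =
          cong₂ func (⌜⌝ᶠ-injective L (pair-injectiveʳ {j} {⌜_⌝ᶠ L f} {k} {⌜_⌝ᶠ L g} eq₁))
            (⌜⌝ᵗˢ-injective ts ss (pair-injectiveʳ {pair j (⌜_⌝ᶠ L f)} {⌜ ts ⌝ᵗˢ} {pair k (⌜_⌝ᶠ L g)} {⌜ ss ⌝ᵗˢ} eq))

      ⌜⌝ᵗˢ-injective : ∀ {n k} (ts ss : Vec (Term L n) k) → ⌜ ts ⌝ᵗˢ ≡ ⌜ ss ⌝ᵗˢ → ts ≡ ss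
      ⌜⌝ᵗˢ-injective []       []       e = refl
      ⌜⌝ᵗˢ-injective (t ∷ ts) (s ∷ ss) e = cong₂ _∷_
        (⌜⌝ᵗ-injective t s (cons-injectiveˡ {⌜ t ⌝ᵗ} {⌜ ts ⌝ᵗˢ} {⌜ s ⌝ᵗ} {⌜ ss ⌝ᵗˢ} e))
        (⌜⌝ᵗˢ-injective ts ss (cons-injectiveʳ {⌜ t ⌝ᵗ} {⌜ ts ⌝ᵗˢ} {⌜ s ⌝ᵗ} {⌜ ss ⌝ᵗˢ} e))

    -- Theorem sets speak only about codes; this recovers the sentence that is meant. Injectivity of
    -- the numbering of symbols within each arity suffices because codes store the arity.
    ⌜⌝-injective : ∀ {n} (φ ψ : Formula L n) → ⌜ φ ⌝ ≡ ⌜ ψ ⌝ → φ ≡ ψ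
    ⌜⌝-injective φ (t ≐ s) e with (t′ ≐ s′) eq ← formulaView φ 0 (pair ⌜ t ⌝ᵗ ⌜ s ⌝ᵗ) e = cong₂ _≐_
      (⌜⌝ᵗ-injective t′ t (pair-injectiveˡ {⌜ t′ ⌝ᵗ} {⌜ s′ ⌝ᵗ} {⌜ t ⌝ᵗ} {⌜ s ⌝ᵗ} eq))
      (⌜⌝ᵗ-injective s′ s (pair-injectiveʳ {⌜ t′ ⌝ᵗ} {⌜ s′ ⌝ᵗ} {⌜ t ⌝ᵗ} {⌜ s ⌝ᵗ} eq))
    ⌜⌝-injective φ (rel {k = k} r ss) e
      with rel {j} q ts eq ← formulaView φ 1 (pair (pair k (⌜_⌝ʳ L r)) ⌜ ss ⌝ᵗˢ) e
      with eq₁ ← pair-injectiveˡ {pair j (⌜_⌝ʳ L q)} {⌜ ts ⌝ᵗˢ} {pair k (⌜_⌝ʳ L r)} {⌜ ss ⌝ᵗˢ} eq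
      with refl ← pair-injectiveˡ {j} {⌜_⌝ʳ L q} {k} {⌜_⌝ʳ L r} eq₁ =
        cong₂ rel (⌜⌝ʳ-injective L (pair-injectiveʳ {j} {⌜_⌝ʳ L q} {k} {⌜_⌝ʳ L r} eq₁))
          (⌜⌝ᵗˢ-injective ts ss (pair-injectiveʳ {pair j (⌜_⌝ʳ L q)} {⌜ ts ⌝ᵗˢ} {pair k (⌜_⌝ʳ L r)} {⌜ ss ⌝ᵗˢ} eq))
    ⌜⌝-injective φ ⊥′ e with ⊥′ ← formulaView φ 2 0 e = refl
    ⌜⌝-injective φ (ψ ⇒ χ) e with (ψ′ ⇒ χ′) eq ← formulaView φ 3 (pair ⌜ ψ ⌝ ⌜ χ ⌝) e = cong₂ _⇒_
      (⌜⌝-injective ψ′ ψ (pair-injectiveˡ {⌜ ψ′ ⌝} {⌜ χ′ ⌝} {⌜ ψ ⌝} {⌜ χ ⌝} eq))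
      (⌜⌝-injective χ′ χ (pair-injectiveʳ {⌜ ψ′ ⌝} {⌜ χ′ ⌝} {⌜ ψ ⌝} {⌜ χ ⌝} eq))
    ⌜⌝-injective φ (∀′ ψ) e with ∀′ ψ′ eq ← formulaView φ 4 ⌜ ψ ⌝ e = cong ∀′ (⌜⌝-injective ψ′ ψ eq)

    -- The code of a renamed formula depends only on the numbers of the
    -- variables, not on the size of the context.

    liftᶜ : ∀ {n} → (Fin n → ℕ) → Fin (suc n) → ℕ
    liftᶜ f zero    = zero
    liftᶜ f (suc i) = suc (f i)

    mutual
      renameᶜᵗ : ∀ {n} → (Fin n → ℕ) → Term L n → ℕ
      renameᶜᵗ f (var i)         = pair 0 (f i)
      renameᶜᵗ f (func {k} g ts) = pair 1 (pair (pair k (⌜_⌝ᶠ L g)) (renameᶜᵗˢ f ts))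

      renameᶜᵗˢ : ∀ {n k} → (Fin n → ℕ) → Vec (Term L n) k → ℕ
      renameᶜᵗˢ f []       = nil
      renameᶜᵗˢ f (t ∷ ts) = cons (renameᶜᵗ f t) (renameᶜᵗˢ f ts)

    renameᶜ : ∀ {n} → (Fin n → ℕ) → Formula L n → ℕ
    renameᶜ f (t ≐ s)            = pair 0 (pair (renameᶜᵗ f t) (renameᶜᵗ f s))
    renameᶜ f (rel {k = k} r ts) = pair 1 (pair (pair k (⌜_⌝ʳ L r)) (renameᶜᵗˢ f ts))
    renameᶜ f ⊥′                 = pair 2 0
    renameᶜ f (φ ⇒ ψ)            = pair 3 (pair (renameᶜ f φ) (renameᶜ f ψ))
    renameᶜ f (∀′ φ)             = pair 4 (renameᶜ (liftᶜ f) φ)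

    mutual
      renameᵗ-code : ∀ {n m} (σ : Fin n → Term L m) (f : Fin n → ℕ) → (∀ i → ⌜ σ i ⌝ᵗ ≡ pair 0 (f i)) →
                     ∀ t → ⌜ substᵗ σ t ⌝ᵗ ≡ renameᶜᵗ f t
      renameᵗ-code σ f h (var i)         = h i
      renameᵗ-code σ f h (func {k} g ts) = cong (λ c → pair 1 (pair (pair k (⌜_⌝ᶠ L g)) c)) (renameᵗˢ-code σ f h ts)

      renameᵗˢ-code : ∀ {n m k} (σ : Fin n → Term L m) (f : Fin n → ℕ) → (∀ i → ⌜ σ i ⌝ᵗ ≡ pair 0 (f i)) →
                      ∀ (ts : Vec _ k) → ⌜ substᵗˢ σ ts ⌝ᵗˢ ≡ renameᶜᵗˢ f ts
      renameᵗˢ-code σ f h []       = refl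
      renameᵗˢ-code σ f h (t ∷ ts) = cong₂ cons (renameᵗ-code σ f h t) (renameᵗˢ-code σ f h ts)

    lift-code : ∀ {n m} (σ : Fin n → Term L m) (f : Fin n → ℕ) → (∀ i → ⌜ σ i ⌝ᵗ ≡ pair 0 (f i)) →
                ∀ i → ⌜ lift σ i ⌝ᵗ ≡ pair 0 (liftᶜ f i)
    lift-code σ f h zero    = refl
    lift-code σ f h (suc i) with σ i | h i
    -- A term whose code has tag 0 is a variable, so weakening adds 1 to its number.
    ... | t | e with asVar j j≡ ← termView t 0 (f i) e = cong (λ x → pair 0 (suc x)) j≡

    subst-code : ∀ {n m} (σ : Fin n → Term L m) (f : Fin n → ℕ) → (∀ i → ⌜ σ i ⌝ᵗ ≡ pair 0 (f i)) →
                 ∀ φ → ⌜ substᶠ σ φ ⌝ ≡ renameᶜ f φ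
    subst-code σ f h (t ≐ s)            = cong (pair 0) (cong₂ pair (renameᵗ-code σ f h t) (renameᵗ-code σ f h s))
    subst-code σ f h (rel {k = k} r ts) = cong (λ c → pair 1 (pair (pair k (⌜_⌝ʳ L r)) c)) (renameᵗˢ-code σ f h ts)
    subst-code σ f h ⊥′                 = refl
    subst-code σ f h (φ ⇒ ψ)            = cong (pair 3) (cong₂ pair (subst-code σ f h φ) (subst-code σ f h ψ))
    subst-code σ f h (∀′ φ)             = cong (pair 4) (subst-code (lift σ) (liftᶜ f) (lift-code σ f h) φ)

    rename-code : ∀ {n m} (ρ : Fin n → Fin m) (f : Fin n → ℕ) → (∀ i → toℕ (ρ i) ≡ f i) →
                  ∀ φ → ⌜ rename ρ φ ⌝ ≡ renameᶜ f φ
    rename-code ρ f h = subst-code (var ∘ ρ) f (λ i → cong (pair 0) (h i))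

    mutual
      renameᶜᵗ-id : ∀ {n} (f : Fin n → ℕ) → (∀ i → f i ≡ toℕ i) → ∀ t → renameᶜᵗ f t ≡ ⌜ t ⌝ᵗ
      renameᶜᵗ-id f h (var i)         = cong (pair 0) (h i)
      renameᶜᵗ-id f h (func {k} g ts) = cong (λ c → pair 1 (pair (pair k (⌜_⌝ᶠ L g)) c)) (renameᶜᵗˢ-id f h ts)

      renameᶜᵗˢ-id : ∀ {n k} (f : Fin n → ℕ) → (∀ i → f i ≡ toℕ i) → ∀ (ts : Vec _ k) → renameᶜᵗˢ f ts ≡ ⌜ ts ⌝ᵗˢ
      renameᶜᵗˢ-id f h []       = refl
      renameᶜᵗˢ-id f h (t ∷ ts) = cong₂ cons (renameᶜᵗ-id f h t) (renameᶜᵗˢ-id f h ts)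

    renameᶜ-id : ∀ {n} (f : Fin n → ℕ) → (∀ i → f i ≡ toℕ i) → ∀ φ → renameᶜ f φ ≡ ⌜ φ ⌝
    renameᶜ-id f h (t ≐ s)            = cong (pair 0) (cong₂ pair (renameᶜᵗ-id f h t) (renameᶜᵗ-id f h s))
    renameᶜ-id f h (rel {k = k} r ts) = cong (λ c → pair 1 (pair (pair k (⌜_⌝ʳ L r)) c)) (renameᶜᵗˢ-id f h ts)
    renameᶜ-id f h ⊥′                 = refl
    renameᶜ-id f h (φ ⇒ ψ)            = cong (pair 3) (cong₂ pair (renameᶜ-id f h φ) (renameᶜ-id f h ψ))
    renameᶜ-id f h (∀′ φ)             = cong (pair 4) (renameᶜ-id (liftᶜ f) h′ φ)
      where
      h′ : ∀ i → liftᶜ f i ≡ toℕ i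
      h′ zero    = refl
      h′ (suc i) = cong suc (h i)

    rename-closed-code : ∀ {m} (φ : Sentence L) → ⌜ rename {m = m} (λ ()) φ ⌝ ≡ ⌜ φ ⌝
    rename-closed-code φ = trans (rename-code (λ ()) (λ ()) (λ ()) φ) (renameᶜ-id (λ ()) (λ ()) φ)

    -- Comparison of codes replaces an induction on formulas: without free variables a renaming
    -- leaves every variable number unchanged.
    rename-closed : ∀ (φ : Sentence L) → rename (λ ()) φ ≡ φ
    rename-closed φ = ⌜⌝-injective _ φ (rename-closed-code φ)

    mutual
      substᵗ-cong : ∀ {n m} {σ τ : Fin n → Term L m} → (∀ i → σ i ≡ τ i) → ∀ t → substᵗ σ t ≡ substᵗ τ t
      substᵗ-cong h (var i)     = h i
      substᵗ-cong h (func f ts) = cong (func f) (substᵗˢ-cong h ts)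

      substᵗˢ-cong : ∀ {n m k} {σ τ : Fin n → Term L m} → (∀ i → σ i ≡ τ i) →
                     (ts : Vec _ k) → substᵗˢ σ ts ≡ substᵗˢ τ ts
      substᵗˢ-cong h []       = refl
      substᵗˢ-cong h (t ∷ ts) = cong₂ _∷_ (substᵗ-cong h t) (substᵗˢ-cong h ts)

    lift-cong : ∀ {n m} {σ τ : Fin n → Term L m} → (∀ i → σ i ≡ τ i) → ∀ i → lift σ i ≡ lift τ i
    lift-cong h zero    = refl
    lift-cong h (suc i) = cong (substᵗ _) (h i)

    subst-cong : ∀ {n m} {σ τ : Fin n → Term L m} → (∀ i → σ i ≡ τ i) → ∀ φ → substᶠ σ φ ≡ substᶠ τ φ
    subst-cong h (t ≐ s)    = cong₂ _≐_ (substᵗ-cong h t) (substᵗ-cong h s)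
    subst-cong h (rel r ts) = cong (rel r) (substᵗˢ-cong h ts)
    subst-cong h ⊥′         = refl
    subst-cong h (φ ⇒ ψ)    = cong₂ _⇒_ (subst-cong h φ) (subst-cong h ψ)
    subst-cong h (∀′ φ)     = cong ∀′ (subst-cong (lift-cong h) φ)

    mutual
      substᵗ-substᵗ : ∀ {n m l} (τ : Fin m → Term L l) (σ : Fin n → Term L m) t →
                      substᵗ τ (substᵗ σ t) ≡ substᵗ (substᵗ τ ∘ σ) t
      substᵗ-substᵗ τ σ (var i)     = refl
      substᵗ-substᵗ τ σ (func f ts) = cong (func f) (substᵗˢ-substᵗˢ τ σ ts)

      substᵗˢ-substᵗˢ : ∀ {n m l k} (τ : Fin m → Term L l) (σ : Fin n → Term L m) (ts : Vec _ k) →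
                        substᵗˢ τ (substᵗˢ σ ts) ≡ substᵗˢ (substᵗ τ ∘ σ) ts
      substᵗˢ-substᵗˢ τ σ []       = refl
      substᵗˢ-substᵗˢ τ σ (t ∷ ts) = cong₂ _∷_ (substᵗ-substᵗ τ σ t) (substᵗˢ-substᵗˢ τ σ ts)

    lift-∘ : ∀ {n m l} (τ : Fin m → Term L l) (σ : Fin n → Term L m) i →
             substᵗ (lift τ) (lift σ i) ≡ lift (substᵗ τ ∘ σ) i
    lift-∘ τ σ zero    = refl
    lift-∘ τ σ (suc i) = trans (substᵗ-substᵗ (lift τ) (var ∘ suc) (σ i))
                               (sym (substᵗ-substᵗ (var ∘ suc) τ (σ i)))

    subst-subst : ∀ {n m l} (τ : Fin m → Term L l) (σ : Fin n → Term L m) φ →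
                  substᶠ τ (substᶠ σ φ) ≡ substᶠ (substᵗ τ ∘ σ) φ
    subst-subst τ σ (t ≐ s)    = cong₂ _≐_ (substᵗ-substᵗ τ σ t) (substᵗ-substᵗ τ σ s)
    subst-subst τ σ (rel r ts) = cong (rel r) (substᵗˢ-substᵗˢ τ σ ts)
    subst-subst τ σ ⊥′         = refl
    subst-subst τ σ (φ ⇒ ψ)    = cong₂ _⇒_ (subst-subst τ σ φ) (subst-subst τ σ ψ)
    subst-subst τ σ (∀′ φ)     = cong ∀′ (trans (subst-subst (lift τ) (lift σ) φ) (subst-cong (lift-∘ τ σ) φ))

  infixr 5 _▸_
  _▸_ : ∀ {n} {C : Set} → C → (Fin n → C) → Fin (suc n) → C
  (x ▸ ρ) zero    = x
  (x ▸ ρ) (suc i) = ρ i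

  -- Equality is interpreted by a congruence, so that elements of a class can later be identified
  -- without forming a quotient.
  record Model (L : Language) : Set₁ where
    infix 4 _≈_
    field
      Carrier       : Set
      _≈_           : Carrier → Carrier → Set
      isEquivalence : IsEquivalence _≈_
      funcᴹ         : ∀ {k} → Func L k → Vec Carrier k → Carrier
      relᴹ          : ∀ {k} → Rel L k → Vec Carrier k → Set
      func-cong     : ∀ {k} (f : Func L k) {xs ys} → Pointwise _≈_ xs ys → funcᴹ f xs ≈ funcᴹ f ys
      rel-cong      : ∀ {k} (r : Rel L k) {xs ys} → Pointwise _≈_ xs ys → relᴹ r xs → relᴹ r ys
      point         : Carrier

    open IsEquivalence isEquivalence renaming (refl to ≈-refl; sym to ≈-sym; trans to ≈-trans) public

  module Satisfaction {L : Language} (M : Model L) where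
    open Model M

    mutual
      evalᵗ : ∀ {n} → Term L n → (Fin n → Carrier) → Carrier
      evalᵗ (var i)     ρ = ρ i
      evalᵗ (func f ts) ρ = funcᴹ f (evalᵗˢ ts ρ)

      evalᵗˢ : ∀ {n k} → Vec (Term L n) k → (Fin n → Carrier) → Vec Carrier k
      evalᵗˢ []       ρ = []
      evalᵗˢ (t ∷ ts) ρ = evalᵗ t ρ ∷ evalᵗˢ ts ρ

    Sat : ∀ {n} → Formula L n → (Fin n → Carrier) → Set
    Sat (t ≐ s)    ρ = evalᵗ t ρ ≈ evalᵗ s ρ
    Sat (rel r ts) ρ = relᴹ r (evalᵗˢ ts ρ)
    Sat ⊥′         ρ = ⊥
    Sat (φ ⇒ ψ)    ρ = Sat φ ρ → Sat ψ ρ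
    Sat (∀′ φ)     ρ = ∀ x → Sat φ (x ▸ ρ)

    mutual
      evalᵗ-cong : ∀ {n} (t : Term L n) {ρ ρ′} → (∀ i → ρ i ≈ ρ′ i) → evalᵗ t ρ ≈ evalᵗ t ρ′
      evalᵗ-cong (var i)     h = h i
      evalᵗ-cong (func f ts) h = func-cong f (evalᵗˢ-cong ts h)

      evalᵗˢ-cong : ∀ {n k} (ts : Vec (Term L n) k) {ρ ρ′} → (∀ i → ρ i ≈ ρ′ i) →
                    Pointwise _≈_ (evalᵗˢ ts ρ) (evalᵗˢ ts ρ′)
      evalᵗˢ-cong []       h = []
      evalᵗˢ-cong (t ∷ ts) h = evalᵗ-cong t h ∷ evalᵗˢ-cong ts h

    ▸-cong : ∀ {n} {ρ ρ′ : Fin n → Carrier} x → (∀ i → ρ i ≈ ρ′ i) → ∀ i → (x ▸ ρ) i ≈ (x ▸ ρ′) i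
    ▸-cong x h zero    = ≈-refl
    ▸-cong x h (suc i) = h i

    Sat-cong : ∀ {n} (φ : Formula L n) {ρ ρ′} → (∀ i → ρ i ≈ ρ′ i) → Sat φ ρ → Sat φ ρ′
    Sat-cong (t ≐ s)    h p   = ≈-trans (evalᵗ-cong t (≈-sym ∘ h)) (≈-trans p (evalᵗ-cong s h))
    Sat-cong (rel r ts) h p   = rel-cong r (evalᵗˢ-cong ts h) p
    Sat-cong (φ ⇒ ψ)    h p q = Sat-cong ψ h (p (Sat-cong φ (≈-sym ∘ h) q))
    Sat-cong (∀′ φ)     h p x = Sat-cong φ (▸-cong x h) (p x)

    mutual
      evalᵗ-subst : ∀ {n m} (σ : Fin n → Term L m) t ρ → evalᵗ (substᵗ σ t) ρ ≡ evalᵗ t (λ i → evalᵗ (σ i) ρ)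
      evalᵗ-subst σ (var i)     ρ = refl
      evalᵗ-subst σ (func f ts) ρ = cong (funcᴹ f) (evalᵗˢ-subst σ ts ρ)

      evalᵗˢ-subst : ∀ {n m k} (σ : Fin n → Term L m) (ts : Vec _ k) ρ →
                     evalᵗˢ (substᵗˢ σ ts) ρ ≡ evalᵗˢ ts (λ i → evalᵗ (σ i) ρ)
      evalᵗˢ-subst σ []       ρ = refl
      evalᵗˢ-subst σ (t ∷ ts) ρ = cong₂ _∷_ (evalᵗ-subst σ t ρ) (evalᵗˢ-subst σ ts ρ)

    eval-lift : ∀ {n m} (σ : Fin n → Term L m) x ρ i →
                evalᵗ (lift σ i) (x ▸ ρ) ≡ (x ▸ (λ i → evalᵗ (σ i) ρ)) i
    eval-lift σ x ρ zero    = refl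
    eval-lift σ x ρ (suc i) = evalᵗ-subst (var ∘ suc) (σ i) (x ▸ ρ)

    ≡⇒≈ : ∀ {x y} → x ≡ y → x ≈ y
    ≡⇒≈ refl = ≈-refl

    mutual
      Sat-subst⁺ : ∀ {n m} (σ : Fin n → Term L m) φ ρ → Sat φ (λ i → evalᵗ (σ i) ρ) → Sat (substᶠ σ φ) ρ
      Sat-subst⁺ σ (t ≐ s)    ρ p   = subst₂ _≈_ (sym (evalᵗ-subst σ t ρ)) (sym (evalᵗ-subst σ s ρ)) p
      Sat-subst⁺ σ (rel r ts) ρ p   = subst (relᴹ r) (sym (evalᵗˢ-subst σ ts ρ)) p
      Sat-subst⁺ σ (φ ⇒ ψ)    ρ p q = Sat-subst⁺ σ ψ ρ (p (Sat-subst⁻ σ φ ρ q))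
      Sat-subst⁺ σ (∀′ φ)     ρ p x =
        Sat-subst⁺ (lift σ) φ (x ▸ ρ) (Sat-cong φ (λ i → ≡⇒≈ (sym (eval-lift σ x ρ i))) (p x))

      Sat-subst⁻ : ∀ {n m} (σ : Fin n → Term L m) φ ρ → Sat (substᶠ σ φ) ρ → Sat φ (λ i → evalᵗ (σ i) ρ)
      Sat-subst⁻ σ (t ≐ s)    ρ p   = subst₂ _≈_ (evalᵗ-subst σ t ρ) (evalᵗ-subst σ s ρ) p
      Sat-subst⁻ σ (rel r ts) ρ p   = subst (relᴹ r) (evalᵗˢ-subst σ ts ρ) p
      Sat-subst⁻ σ (φ ⇒ ψ)    ρ p q = Sat-subst⁻ σ ψ ρ (p (Sat-subst⁺ σ φ ρ q))
      Sat-subst⁻ σ (∀′ φ)     ρ p x =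
        Sat-cong φ (λ i → ≡⇒≈ (eval-lift σ x ρ i)) (Sat-subst⁻ (lift σ) φ (x ▸ ρ) (p x))

    eval-instantiation : ∀ {n} (t : Term L n) ρ i → (evalᵗ t ρ ▸ ρ) i ≡ evalᵗ (instantiation t i) ρ
    eval-instantiation t ρ zero    = refl
    eval-instantiation t ρ (suc i) = refl

    Sat-[]⁺ : ∀ {n} φ (t : Term L n) ρ → Sat φ (evalᵗ t ρ ▸ ρ) → Sat (φ [ t ]) ρ
    Sat-[]⁺ φ t ρ p = Sat-subst⁺ (instantiation t) φ ρ
      (Sat-cong φ (λ i → ≡⇒≈ (eval-instantiation t ρ i)) p)

    Sat-[]⁻ : ∀ {n} φ (t : Term L n) ρ → Sat (φ [ t ]) ρ → Sat φ (evalᵗ t ρ ▸ ρ)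
    Sat-[]⁻ φ t ρ p = Sat-cong φ (λ i → ≡⇒≈ (sym (eval-instantiation t ρ i)))
      (Sat-subst⁻ (instantiation t) φ ρ p)

    Sat-closed : ∀ {n} (φ : Sentence L) (ρ : Fin n → Carrier) → Sat φ (λ ()) → Sat (rename (λ ()) φ) ρ
    Sat-closed φ ρ p = Sat-subst⁺ _ φ ρ (Sat-cong φ (λ ()) p)

    module _ (em : ExcludedMiddle 0ℓ) {T : Pred (Sentence L) 0ℓ} (T-true : ∀ {φ} → T φ → Sat φ (λ ())) where

      SatAll : ∀ {n} → List (Formula L n) → (Fin n → Carrier) → Set
      SatAll Γ ρ = ∀ {ψ} → ψ ∈ Γ → Sat ψ ρ

      SatAll-∷ : ∀ {n} {Γ : List (Formula L n)} {φ} {ρ} → Sat φ ρ → SatAll Γ ρ → SatAll (φ ∷ Γ) ρ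
      SatAll-∷ p h (here refl) = p
      SatAll-∷ p h (there ∈Γ)  = h ∈Γ

      SatAll-weaken : ∀ {n} (Γ : List (Formula L n)) {ρ} x → SatAll Γ ρ → SatAll (map weaken Γ) (x ▸ ρ)
      SatAll-weaken (φ ∷ Γ) x h (here refl) = Sat-subst⁺ (var ∘ suc) φ (x ▸ _) (h (here refl))
      SatAll-weaken (φ ∷ Γ) x h (there ∈Γ)  = SatAll-weaken Γ x (h ∘ there) ∈Γ

      -- Excluded middle validates `raa`; `inhabited` holds because a model comes with a point, and
      -- `≐-subst` because satisfaction respects the congruence.
      soundness : ∀ {n} {Γ : List (Formula L n)} {φ} → T ∣ Γ ⊢ φ → ∀ ρ → SatAll Γ ρ → Sat φ ρ
      soundness (axiom {φ = φ} t) ρ h = Sat-closed φ ρ (T-true t)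
      soundness (hyp φ∈Γ)         ρ h = h φ∈Γ
      soundness (⇒-intro d)       ρ h = λ p → soundness d ρ (SatAll-∷ p h)
      soundness (⇒-elim d e)      ρ h = soundness d ρ h (soundness e ρ h)
      soundness (raa d)           ρ h = decidable-stable em (λ ¬p → soundness d ρ (SatAll-∷ ¬p h))
      soundness (∀-intro {Γ = Γ} d) ρ h = λ x → soundness d (x ▸ ρ) (SatAll-weaken Γ x h)
      soundness (∀-elim {φ = φ} t d) ρ h = Sat-[]⁺ φ t ρ (soundness d ρ h (evalᵗ t ρ))
      soundness ≐-refl            ρ h = ≈-refl
      soundness (≐-subst {t = t} {s} φ d e) ρ h = Sat-[]⁺ φ s ρ
        (Sat-cong φ (λ { zero → soundness d ρ h ; (suc i) → ≈-refl }) (Sat-[]⁻ φ t ρ (soundness e ρ h)))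
      soundness inhabited         ρ h = λ p → p point ≈-refl

-- Enumeration of the theorems of an axiomatizable theory

module ProofEnumeration where

  open Computability
  open Pairing
  open RuleSystems
  open FirstOrderLogic

  data ProofLabel : Set where
    truth fin-zero fin-suc : ProofLabel
    tm-var tm-func tms-nil tms-cons : ProofLabel
    fm-≐ fm-rel fm-⊥ fm-⇒ fm-∀ : ProofLabel
    look-shift look-inst-zero look-inst-suc look-lift-zero look-lift-suc : ProofLabel
    subT-var subT-func subTs-nil subTs-cons : ProofLabel
    subF-≐ subF-rel subF-⊥ subF-⇒ subF-∀ : ProofLabel
    mem-here mem-there weak-nil weak-cons : ProofLabel
    pr-axiom pr-hyp pr-⇒-intro pr-⇒-elim pr-raa pr-∀-intro pr-∀-elim pr-refl pr-subst pr-inhabited : ProofLabel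

  proofLabels : List ProofLabel
  proofLabels = truth ∷ fin-zero ∷ fin-suc ∷ tm-var ∷ tm-func ∷ tms-nil ∷ tms-cons
    ∷ fm-≐ ∷ fm-rel ∷ fm-⊥ ∷ fm-⇒ ∷ fm-∀
    ∷ look-shift ∷ look-inst-zero ∷ look-inst-suc ∷ look-lift-zero ∷ look-lift-suc
    ∷ subT-var ∷ subT-func ∷ subTs-nil ∷ subTs-cons ∷ subF-≐ ∷ subF-rel ∷ subF-⊥ ∷ subF-⇒ ∷ subF-∀
    ∷ mem-here ∷ mem-there ∷ weak-nil ∷ weak-cons
    ∷ pr-axiom ∷ pr-hyp ∷ pr-⇒-intro ∷ pr-⇒-elim ∷ pr-raa ∷ pr-∀-intro ∷ pr-∀-elim ∷ pr-refl ∷ pr-subst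
    ∷ pr-inhabited ∷ []

  proofLabels-complete : ∀ l → l ∈ proofLabels
  proofLabels-complete = λ where
    truth          → ∈-lookup (fin 0)
    fin-zero       → ∈-lookup (fin 1)
    fin-suc        → ∈-lookup (fin 2)
    tm-var         → ∈-lookup (fin 3)
    tm-func        → ∈-lookup (fin 4)
    tms-nil        → ∈-lookup (fin 5)
    tms-cons       → ∈-lookup (fin 6)
    fm-≐           → ∈-lookup (fin 7)
    fm-rel         → ∈-lookup (fin 8)
    fm-⊥           → ∈-lookup (fin 9)
    fm-⇒           → ∈-lookup (fin 10)
    fm-∀           → ∈-lookup (fin 11)
    look-shift     → ∈-lookup (fin 12)
    look-inst-zero → ∈-lookup (fin 13)
    look-inst-suc  → ∈-lookup (fin 14)
    look-lift-zero → ∈-lookup (fin 15)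
    look-lift-suc  → ∈-lookup (fin 16)
    subT-var       → ∈-lookup (fin 17)
    subT-func      → ∈-lookup (fin 18)
    subTs-nil      → ∈-lookup (fin 19)
    subTs-cons     → ∈-lookup (fin 20)
    subF-≐         → ∈-lookup (fin 21)
    subF-rel       → ∈-lookup (fin 22)
    subF-⊥         → ∈-lookup (fin 23)
    subF-⇒         → ∈-lookup (fin 24)
    subF-∀         → ∈-lookup (fin 25)
    mem-here       → ∈-lookup (fin 26)
    mem-there      → ∈-lookup (fin 27)
    weak-nil       → ∈-lookup (fin 28)
    weak-cons      → ∈-lookup (fin 29)
    pr-axiom       → ∈-lookup (fin 30)
    pr-hyp         → ∈-lookup (fin 31)
    pr-⇒-intro     → ∈-lookup (fin 32)
    pr-⇒-elim      → ∈-lookup (fin 33)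
    pr-raa         → ∈-lookup (fin 34)
    pr-∀-intro     → ∈-lookup (fin 35)
    pr-∀-elim      → ∈-lookup (fin 36)
    pr-refl        → ∈-lookup (fin 37)
    pr-subst       → ∈-lookup (fin 38)
    pr-inhabited   → ∈-lookup (fin 39)

  module Provability (em : ExcludedMiddle 0ℓ) {L : Language} (recL : RecursiveLanguage L)
                     (Ax : Pred (Sentence L) 0ℓ) (recAx : Recursive (codes Ax)) where

    isFunc isRel : Pred ℕ 0ℓ
    isFunc n = ∃[ k ] Σ (Func L k) λ f → pair k (⌜_⌝ᶠ L f) ≡ n
    isRel n  = ∃[ k ] Σ (Rel L k) λ r → pair k (⌜_⌝ʳ L r) ≡ n

    module _ {k : ℕ} where
      -- Turns a decidable side condition into a premise: the only fact with tag 0 that the rules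
      -- derive is the one for the value 1.
      test : {A : Pred ℕ 0ℓ} → Recursive A → Exp k → Pattern k
      test {A} rec e = # 0 ∷ exp (ap₁ (comp₁ {f = λ n → ⟨ characteristic em A n ⟩} (bodyᵇ (Decides.computable (≤ᵀ⇒decides em rec)))) (c-den e)) ∷ []
      isEqual : Exp k → Exp k → Pattern k
      isEqual d e = # 0 ∷ exp (bodyᵇ (c-≡ᵇ (c-den d) (c-den e))) ∷ []
      isFin : Exp k → Exp k → Pattern k
      isFin i n = # 1 ∷ i ∷ n ∷ []
      tm : Exp k → Exp k → Pattern k
      tm n t = # 2 ∷ n ∷ t ∷ []
      tms : Exp k → Exp k → Exp k → Pattern k
      tms n m ts = # 3 ∷ n ∷ m ∷ ts ∷ []
      fm : Exp k → Exp k → Pattern k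
      fm n φ = # 4 ∷ n ∷ φ ∷ []
      look : Exp k → Exp k → Exp k → Exp k → Pattern k
      look c x i t = # 5 ∷ c ∷ x ∷ i ∷ t ∷ []
      subT subTs subF : Exp k → Exp k → Exp k → Pattern k
      subT s t t′    = # 6 ∷ s ∷ t ∷ t′ ∷ []
      subTs s ts ts′ = # 7 ∷ s ∷ ts ∷ ts′ ∷ []
      subF s φ φ′    = # 8 ∷ s ∷ φ ∷ φ′ ∷ []
      mem weak : Exp k → Exp k → Pattern k
      mem Γ φ  = # 9 ∷ Γ ∷ φ ∷ []
      weak Γ Δ = # 10 ∷ Γ ∷ Δ ∷ []
      pr : Exp k → Exp k → Exp k → Pattern k
      pr n Γ φ = # 11 ∷ n ∷ Γ ∷ φ ∷ []

      infixr 7 _⇒ᵉ_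
      shiftᵉ ⊥ᵉ : Exp k
      shiftᵉ = ⟪ # 0 , # 0 ⟫
      ⊥ᵉ     = ⟪ # 2 , # 0 ⟫
      varᵉ ∀ᵉ instᵉ liftᵉ : Exp k → Exp k
      varᵉ i  = ⟪ # 0 , i ⟫
      ∀ᵉ φ    = ⟪ # 4 , φ ⟫
      instᵉ t = ⟪ # 1 , t ⟫
      liftᵉ s = ⟪ # 2 , s ⟫
      _⇒ᵉ_ _≐ᵉ_ : Exp k → Exp k → Exp k
      φ ⇒ᵉ ψ = ⟪ # 3 , ⟪ φ , ψ ⟫ ⟫
      t ≐ᵉ s = ⟪ # 0 , ⟪ t , s ⟫ ⟫

    -- A formula or term that occurs in premises without being determined by the conclusion is
    -- checked by `fm` or `tm`; the remaining ones are supplied together with the conclusion when a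
    -- fact is interpreted.
    proofRule : ProofLabel → Rule
    proofRule truth          = rule 0 [] (# 0 ∷ # 1 ∷ [])
    proofRule fin-zero       = rule 1 [] (isFin (# 0) (1 ᵉ+ V 0F))
    proofRule fin-suc        = rule 2 (isFin (V 0F) (V 1F) ∷ []) (isFin (1 ᵉ+ V 0F) (1 ᵉ+ V 1F))
    proofRule tm-var         = rule 2 (isFin (V 0F) (V 1F) ∷ []) (tm (V 1F) (varᵉ (V 0F)))
    proofRule tm-func        = rule 4 (test (proj₁ recL) ⟪ V 1F , V 2F ⟫ ∷ tms (V 0F) (V 1F) (V 3F) ∷ [])
                                      (tm (V 0F) ⟪ # 1 , ⟪ ⟪ V 1F , V 2F ⟫ , V 3F ⟫ ⟫)
    proofRule tms-nil        = rule 1 [] (tms (V 0F) (# 0) (# 0))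
    proofRule tms-cons       = rule 4 (tm (V 0F) (V 2F) ∷ tms (V 0F) (V 1F) (V 3F) ∷ [])
                                      (tms (V 0F) (1 ᵉ+ V 1F) (V 2F ∷ᵉ V 3F))
    proofRule fm-≐           = rule 3 (tm (V 0F) (V 1F) ∷ tm (V 0F) (V 2F) ∷ []) (fm (V 0F) (V 1F ≐ᵉ V 2F))
    proofRule fm-rel         = rule 4 (test (proj₂ recL) ⟪ V 1F , V 2F ⟫ ∷ tms (V 0F) (V 1F) (V 3F) ∷ [])
                                      (fm (V 0F) ⟪ # 1 , ⟪ ⟪ V 1F , V 2F ⟫ , V 3F ⟫ ⟫)
    proofRule fm-⊥           = rule 1 [] (fm (V 0F) ⊥ᵉ)
    proofRule fm-⇒           = rule 3 (fm (V 0F) (V 1F) ∷ fm (V 0F) (V 2F) ∷ []) (fm (V 0F) (V 1F ⇒ᵉ V 2F))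
    proofRule fm-∀           = rule 2 (fm (1 ᵉ+ V 0F) (V 1F) ∷ []) (fm (V 0F) (∀ᵉ (V 1F)))
    proofRule look-shift     = rule 1 [] (look (# 0) (# 0) (V 0F) (varᵉ (1 ᵉ+ V 0F)))
    proofRule look-inst-zero = rule 1 [] (look (# 1) (V 0F) (# 0) (V 0F))
    proofRule look-inst-suc  = rule 2 [] (look (# 1) (V 0F) (1 ᵉ+ V 1F) (varᵉ (V 1F)))
    proofRule look-lift-zero = rule 1 [] (look (# 2) (V 0F) (# 0) (varᵉ (# 0)))
    proofRule look-lift-suc  = rule 5 (look (V 0F) (V 1F) (V 2F) (V 3F) ∷ subT shiftᵉ (V 3F) (V 4F) ∷ [])
                                      (look (# 2) ⟪ V 0F , V 1F ⟫ (1 ᵉ+ V 2F) (V 4F))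
    proofRule subT-var       = rule 4 (look (V 0F) (V 1F) (V 2F) (V 3F) ∷ [])
                                      (subT ⟪ V 0F , V 1F ⟫ (varᵉ (V 2F)) (V 3F))
    proofRule subT-func      = rule 4 (subTs (V 0F) (V 2F) (V 3F) ∷ [])
                                      (subT (V 0F) ⟪ # 1 , ⟪ V 1F , V 2F ⟫ ⟫ ⟪ # 1 , ⟪ V 1F , V 3F ⟫ ⟫)
    proofRule subTs-nil      = rule 1 [] (subTs (V 0F) (# 0) (# 0))
    proofRule subTs-cons     = rule 5 (subT (V 0F) (V 1F) (V 2F) ∷ subTs (V 0F) (V 3F) (V 4F) ∷ [])
                                      (subTs (V 0F) (V 1F ∷ᵉ V 3F) (V 2F ∷ᵉ V 4F))
    proofRule subF-≐         = rule 5 (subT (V 0F) (V 1F) (V 2F) ∷ subT (V 0F) (V 3F) (V 4F) ∷ [])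
                                      (subF (V 0F) (V 1F ≐ᵉ V 3F) (V 2F ≐ᵉ V 4F))
    proofRule subF-rel       = rule 4 (subTs (V 0F) (V 2F) (V 3F) ∷ [])
                                      (subF (V 0F) ⟪ # 1 , ⟪ V 1F , V 2F ⟫ ⟫ ⟪ # 1 , ⟪ V 1F , V 3F ⟫ ⟫)
    proofRule subF-⊥         = rule 1 [] (subF (V 0F) ⊥ᵉ ⊥ᵉ)
    proofRule subF-⇒         = rule 5 (subF (V 0F) (V 1F) (V 2F) ∷ subF (V 0F) (V 3F) (V 4F) ∷ [])
                                      (subF (V 0F) (V 1F ⇒ᵉ V 3F) (V 2F ⇒ᵉ V 4F))
    proofRule subF-∀         = rule 3 (subF (liftᵉ (V 0F)) (V 1F) (V 2F) ∷ []) (subF (V 0F) (∀ᵉ (V 1F)) (∀ᵉ (V 2F)))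
    proofRule mem-here       = rule 2 [] (mem (V 0F ∷ᵉ V 1F) (V 0F))
    proofRule mem-there      = rule 3 (mem (V 1F) (V 2F) ∷ []) (mem (V 0F ∷ᵉ V 1F) (V 2F))
    proofRule weak-nil       = rule 0 [] (weak (# 0) (# 0))
    proofRule weak-cons      = rule 4 (subF shiftᵉ (V 0F) (V 1F) ∷ weak (V 2F) (V 3F) ∷ [])
                                      (weak (V 0F ∷ᵉ V 2F) (V 1F ∷ᵉ V 3F))
    proofRule pr-axiom       = rule 3 (test recAx (V 2F) ∷ []) (pr (V 0F) (V 1F) (V 2F))
    proofRule pr-hyp         = rule 3 (mem (V 1F) (V 2F) ∷ []) (pr (V 0F) (V 1F) (V 2F))
    proofRule pr-⇒-intro     = rule 4 (pr (V 0F) (V 2F ∷ᵉ V 1F) (V 3F) ∷ []) (pr (V 0F) (V 1F) (V 2F ⇒ᵉ V 3F))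
    proofRule pr-⇒-elim      = rule 4 (fm (V 0F) (V 2F) ∷ pr (V 0F) (V 1F) (V 2F ⇒ᵉ V 3F) ∷ pr (V 0F) (V 1F) (V 2F) ∷ [])
                                      (pr (V 0F) (V 1F) (V 3F))
    proofRule pr-raa         = rule 3 (pr (V 0F) ((V 2F ⇒ᵉ ⊥ᵉ) ∷ᵉ V 1F) ⊥ᵉ ∷ []) (pr (V 0F) (V 1F) (V 2F))
    proofRule pr-∀-intro     = rule 4 (weak (V 1F) (V 2F) ∷ pr (1 ᵉ+ V 0F) (V 2F) (V 3F) ∷ [])
                                      (pr (V 0F) (V 1F) (∀ᵉ (V 3F)))
    proofRule pr-∀-elim      = rule 5 (fm (1 ᵉ+ V 0F) (V 2F) ∷ tm (V 0F) (V 3F) ∷ subF (instᵉ (V 3F)) (V 2F) (V 4F)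
                                       ∷ pr (V 0F) (V 1F) (∀ᵉ (V 2F)) ∷ [])
                                      (pr (V 0F) (V 1F) (V 4F))
    proofRule pr-refl        = rule 3 [] (pr (V 0F) (V 1F) (V 2F ≐ᵉ V 2F))
    proofRule pr-subst       = rule 7 (fm (1 ᵉ+ V 0F) (V 2F) ∷ tm (V 0F) (V 3F) ∷ tm (V 0F) (V 4F)
                                       ∷ subF (instᵉ (V 3F)) (V 2F) (V 5F) ∷ subF (instᵉ (V 4F)) (V 2F) (V 6F)
                                       ∷ pr (V 0F) (V 1F) (V 3F ≐ᵉ V 4F) ∷ pr (V 0F) (V 1F) (V 5F) ∷ [])
                                      (pr (V 0F) (V 1F) (V 6F))
    -- Split by equations, to avoid unfolding nested applications of pair.
    proofRule pr-inhabited   = rule 6 (isEqual (V 2F) (# 0) ∷ isEqual (V 3F) (# 3)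
                                       ∷ isEqual (V 4F) (V 2F ⇒ᵉ V 3F) ∷ isEqual (V 5F) (∀ᵉ (V 4F)) ∷ [])
                                      (pr (V 0F) (V 1F) (V 5F ⇒ᵉ V 3F))

    proofSystem : System
    proofSystem = record
      { Label = ProofLabel ; schema = proofRule ; labels = proofLabels ; complete = proofLabels-complete }

    open Derivation proofSystem public

    -- The proof rules substitute only by weakening and instantiation, and quantifiers lift these;
    -- so three constructors give every substitution that occurs a finite code.
    data Represents : ∀ {n m} → ℕ → ℕ → (Fin n → Term L m) → Set where
      shiftᴿ : ∀ {n} → Represents 0 0 (λ (i : Fin n) → var (suc i))
      instᴿ  : ∀ {n x} (t : Term L n) → ⌜ t ⌝ᵗ ≡ x → Represents 1 x (instantiation t)
      liftᴿ  : ∀ {n m c y x} {σ : Fin n → Term L m} → pair c y ≡ x → Represents c y σ → Represents 2 x (lift σ)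

    ⌜_⌝ˡ : ∀ {n} → List (Formula L n) → ℕ
    ⌜ [] ⌝ˡ    = nil
    ⌜ φ ∷ Γ ⌝ˡ = cons ⌜ φ ⌝ ⌜ Γ ⌝ˡ

    -- Facts about substitution, contexts and proofs are conditional on their arguments being codes,
    -- whereas those about terms and formulas assert existence. This division is what the
    -- well-formedness premises of `proofRule` rely on.
    Meaning : Fact → Set
    Meaning (0 ∷ b ∷ [])                = b ≡ 1
    Meaning (1 ∷ i ∷ n ∷ [])            = Σ (Fin n) λ j → toℕ j ≡ i
    Meaning (2 ∷ n ∷ t ∷ [])            = Σ (Term L n) λ u → ⌜ u ⌝ᵗ ≡ t
    Meaning (3 ∷ n ∷ k ∷ ts ∷ [])       = Σ (Vec (Term L n) k) λ us → ⌜ us ⌝ᵗˢ ≡ ts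
    Meaning (4 ∷ n ∷ φ ∷ [])            = Σ (Formula L n) λ ψ → ⌜ ψ ⌝ ≡ φ
    Meaning (5 ∷ c ∷ x ∷ i ∷ t ∷ [])    = ∀ {n m} (σ : Fin n → Term L m) → Represents c x σ →
                                          ∀ j → toℕ j ≡ i → ⌜ σ j ⌝ᵗ ≡ t
    Meaning (6 ∷ s ∷ t ∷ t′ ∷ [])       = ∀ {n m} c x (σ : Fin n → Term L m) → pair c x ≡ s → Represents c x σ →
                                          ∀ u → ⌜ u ⌝ᵗ ≡ t → ⌜ substᵗ σ u ⌝ᵗ ≡ t′
    Meaning (7 ∷ s ∷ ts ∷ ts′ ∷ [])     = ∀ {n m k} c x (σ : Fin n → Term L m) → pair c x ≡ s → Represents c x σ →
                                          ∀ (us : Vec _ k) → ⌜ us ⌝ᵗˢ ≡ ts → ⌜ substᵗˢ σ us ⌝ᵗˢ ≡ ts′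
    Meaning (8 ∷ s ∷ φ ∷ φ′ ∷ [])       = ∀ {n m} c x (σ : Fin n → Term L m) → pair c x ≡ s → Represents c x σ →
                                          ∀ ψ → ⌜ ψ ⌝ ≡ φ → ⌜ substᶠ σ ψ ⌝ ≡ φ′
    Meaning (9 ∷ Γ ∷ φ ∷ [])            = ∀ {n} (Δ : List (Formula L n)) ψ → ⌜ Δ ⌝ˡ ≡ Γ → ⌜ ψ ⌝ ≡ φ → ψ ∈ Δ
    Meaning (10 ∷ Γ ∷ Γ′ ∷ [])          = ∀ {n} (Δ : List (Formula L n)) → ⌜ Δ ⌝ˡ ≡ Γ → ⌜ map weaken Δ ⌝ˡ ≡ Γ′
    Meaning (11 ∷ n ∷ Γ ∷ φ ∷ [])       = ∀ (Δ : List (Formula L n)) ψ → ⌜ Δ ⌝ˡ ≡ Γ → ⌜ ψ ⌝ ≡ φ → Ax ∣ Δ ⊢ ψ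
    Meaning _                           = ⊤

    test-∈ : ∀ {A} (rec : Recursive A) {n} → ⟨ characteristic em A n ⟩ ≡ 1 → A n
    test-∈ {A} rec e = characteristic-∈ em A (⟨⟩-injective e)

    test-≡ : ∀ {m n} → ⟨ m ≡ᵇ n ⟩ ≡ 1 → m ≡ n
    test-≡ e = ≡ᵇ-true (⟨⟩-injective e)

    code-⊥ : ∀ {n} {φ : Formula L n} → ⌜ φ ⌝ ≡ 3 → φ ≡ ⊥′
    code-⊥ {φ = φ} e with ⊥′ ← formulaView φ 2 0 e = refl

    code-trivial : ∀ {n} {φ : Formula L (suc n)} → ⌜ φ ⌝ ≡ 0 → φ ≡ (var zero ≐ var zero)
    code-trivial {φ = φ} e with (t ≐ s) eq ← formulaView φ 0 0 e
      with asVar zero refl ← termView t 0 0 (pair-injectiveˡ {⌜ t ⌝ᵗ} {⌜ s ⌝ᵗ} {0} {0} eq)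
         | asVar zero refl ← termView s 0 0 (pair-injectiveʳ {⌜ t ⌝ᵗ} {⌜ s ⌝ᵗ} {0} {0} eq) = refl

    code-inhabited : ∀ {n} {φ : Formula L n} {a b c d} → a ≡ 0 → b ≡ 3 → d ≡ pair 3 (pair a b) → c ≡ pair 4 d →
                     ⌜ φ ⌝ ≡ pair 3 (pair c b) → ∃′ (var zero ≐ var zero) ≡ φ
    code-inhabited {φ = φ} {a} {b} {c} {d} a≡ b≡ d≡ c≡ e
      with (ψ ⇒ χ) eq ← formulaView φ 3 (pair c b) e
      with ∀′ θ eq₁ ← formulaView ψ 4 d (trans (pair-injectiveˡ {⌜ ψ ⌝} {⌜ χ ⌝} {c} {b} eq) c≡)
      with (φ₁ ⇒ φ₂) eq₂ ← formulaView θ 3 (pair a b) (trans eq₁ d≡) = cong₂ _⇒_ (cong ∀′ (cong₂ _⇒_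
        (sym (code-trivial (trans (pair-injectiveˡ {⌜ φ₁ ⌝} {⌜ φ₂ ⌝} {a} {b} eq₂) a≡)))
        (sym (code-⊥ (trans (pair-injectiveʳ {⌜ φ₁ ⌝} {⌜ φ₂ ⌝} {a} {b} eq₂) b≡)))))
        (sym (code-⊥ (trans (pair-injectiveʳ {⌜ ψ ⌝} {⌜ χ ⌝} {c} {b} eq) b≡)))

    closed : ∀ l ρ → All Meaning (instances (premises (proofRule l)) ρ) → Meaning (⟦ conclusion (proofRule l) ⟧ ρ)
    closed truth [] [] = refl
    closed fin-zero (n ∷ []) [] = zero , refl
    closed fin-suc (i ∷ n ∷ []) ((j , e) ∷ []) = suc j , cong suc e
    closed tm-var (i ∷ n ∷ []) ((j , e) ∷ []) = var j , cong (pair 0) e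
    closed tm-func (n ∷ k ∷ f ∷ ts ∷ []) (h ∷ (us , e) ∷ [])
      with j , g , eq ← test-∈ (proj₁ recL) {pair k f} h
      with refl ← pair-injectiveˡ {j} {⌜_⌝ᶠ L g} {k} {f} eq =
        func g us , cong (pair 1) (cong₂ pair eq e)
    closed tms-nil (n ∷ []) [] = [] , refl
    closed tms-cons (n ∷ k ∷ t ∷ ts ∷ []) ((u , e) ∷ (us , es) ∷ []) = u ∷ us , cong₂ cons e es
    closed fm-≐ (n ∷ t ∷ s ∷ []) ((u , e) ∷ (w , e′) ∷ []) = u ≐ w , cong (pair 0) (cong₂ pair e e′)
    closed fm-rel (n ∷ k ∷ r ∷ ts ∷ []) (h ∷ (us , e) ∷ [])
      with j , q , eq ← test-∈ (proj₂ recL) {pair k r} h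
      with refl ← pair-injectiveˡ {j} {⌜_⌝ʳ L q} {k} {r} eq =
        rel q us , cong (pair 1) (cong₂ pair eq e)
    closed fm-⊥ (n ∷ []) [] = ⊥′ , refl
    closed fm-⇒ (n ∷ a ∷ b ∷ []) ((φ , e) ∷ (ψ , e′) ∷ []) = (φ ⇒ ψ) , cong (pair 3) (cong₂ pair e e′)
    closed fm-∀ (n ∷ a ∷ []) ((φ , e) ∷ []) = ∀′ φ , cong (pair 4) e
    closed look-shift (i ∷ []) [] σ shiftᴿ j e = cong (λ x → pair 0 (suc x)) e
    closed look-inst-zero (x ∷ []) [] σ (instᴿ t t≡) zero _ = t≡
    closed look-inst-suc (x ∷ i ∷ []) [] σ (instᴿ t t≡) (suc j) e = cong (pair 0) (suc-injective e)
    closed look-lift-zero (s ∷ []) [] σ (liftᴿ _ _) zero _ = refl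
    closed look-lift-suc (c ∷ x ∷ i ∷ t ∷ t′ ∷ []) (h ∷ h′ ∷ []) _ (liftᴿ {c = c′} {y} {σ = σ} eq R) (suc j) e
      with refl ← pair-injectiveˡ {c′} {y} {c} {x} eq | refl ← pair-injectiveʳ {c′} {y} {c} {x} eq =
        h′ 0 0 (λ i → var (suc i)) refl shiftᴿ (σ j) (h σ R j (suc-injective e))
    closed subT-var (c ∷ x ∷ i ∷ t ∷ []) (h ∷ []) c′ y σ eq R u e
      with refl ← pair-injectiveˡ {c′} {y} {c} {x} eq | refl ← pair-injectiveʳ {c′} {y} {c} {x} eq
      with asVar j j≡ ← termView u 0 i e = h σ R j j≡
    closed subT-func (s ∷ f ∷ ts ∷ ts′ ∷ []) (h ∷ []) c x σ eq R u e
      with asFunc {k} g us eq′ ← termView u 1 (pair f ts) e =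
        cong (pair 1) (cong₂ pair (pair-injectiveˡ {pair k (⌜_⌝ᶠ L g)} {⌜ us ⌝ᵗˢ} {f} {ts} eq′)
          (h c x σ eq R us (pair-injectiveʳ {pair k (⌜_⌝ᶠ L g)} {⌜ us ⌝ᵗˢ} {f} {ts} eq′)))
    closed subTs-nil (s ∷ []) [] c x σ eq R [] _ = refl
    closed subTs-cons (s ∷ t ∷ t′ ∷ ts ∷ ts′ ∷ []) (h ∷ hs ∷ []) c x σ eq R (u ∷ us) e = cong₂ cons
      (h c x σ eq R u (cons-injectiveˡ {⌜ u ⌝ᵗ} {⌜ us ⌝ᵗˢ} {t} {ts} e))
      (hs c x σ eq R us (cons-injectiveʳ {⌜ u ⌝ᵗ} {⌜ us ⌝ᵗˢ} {t} {ts} e))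
    closed subF-≐ (s ∷ t ∷ t′ ∷ r ∷ r′ ∷ []) (h ∷ h′ ∷ []) c x σ eq R φ e
      with (u ≐ w) eq′ ← formulaView φ 0 (pair t r) e = cong (pair 0) (cong₂ pair
        (h c x σ eq R u (pair-injectiveˡ {⌜ u ⌝ᵗ} {⌜ w ⌝ᵗ} {t} {r} eq′))
        (h′ c x σ eq R w (pair-injectiveʳ {⌜ u ⌝ᵗ} {⌜ w ⌝ᵗ} {t} {r} eq′)))
    closed subF-rel (s ∷ r ∷ ts ∷ ts′ ∷ []) (h ∷ []) c x σ eq R φ e
      with rel {k} q us eq′ ← formulaView φ 1 (pair r ts) e =
        cong (pair 1) (cong₂ pair (pair-injectiveˡ {pair k (⌜_⌝ʳ L q)} {⌜ us ⌝ᵗˢ} {r} {ts} eq′)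
          (h c x σ eq R us (pair-injectiveʳ {pair k (⌜_⌝ʳ L q)} {⌜ us ⌝ᵗˢ} {r} {ts} eq′)))
    closed subF-⊥ (s ∷ []) [] c x σ eq R φ e with ⊥′ ← formulaView φ 2 0 e = refl
    closed subF-⇒ (s ∷ a ∷ a′ ∷ b ∷ b′ ∷ []) (h ∷ h′ ∷ []) c x σ eq R φ e
      with (ψ ⇒ χ) eq′ ← formulaView φ 3 (pair a b) e = cong (pair 3) (cong₂ pair
        (h c x σ eq R ψ (pair-injectiveˡ {⌜ ψ ⌝} {⌜ χ ⌝} {a} {b} eq′))
        (h′ c x σ eq R χ (pair-injectiveʳ {⌜ ψ ⌝} {⌜ χ ⌝} {a} {b} eq′)))
    closed subF-∀ (s ∷ a ∷ a′ ∷ []) (h ∷ []) c x σ eq R φ e with ∀′ ψ eq′ ← formulaView φ 4 a e =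
      cong (pair 4) (h 2 s (lift σ) refl (liftᴿ eq R) ψ eq′)
    closed mem-here (a ∷ Γ ∷ []) [] (φ ∷ Δ) ψ e e′ =
      here (⌜⌝-injective ψ φ (trans e′ (sym (cons-injectiveˡ {⌜ φ ⌝} {⌜ Δ ⌝ˡ} {a} {Γ} e))))
    closed mem-there (a ∷ Γ ∷ b ∷ []) (h ∷ []) (φ ∷ Δ) ψ e e′ =
      there (h Δ ψ (cons-injectiveʳ {⌜ φ ⌝} {⌜ Δ ⌝ˡ} {a} {Γ} e) e′)
    closed weak-nil [] [] [] _ = refl
    closed weak-cons (a ∷ a′ ∷ Γ ∷ Γ′ ∷ []) (h ∷ hs ∷ []) (φ ∷ Δ) e = cong₂ cons
      (h 0 0 (λ i → var (suc i)) refl shiftᴿ φ (cons-injectiveˡ {⌜ φ ⌝} {⌜ Δ ⌝ˡ} {a} {Γ} e))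
      (hs Δ (cons-injectiveʳ {⌜ φ ⌝} {⌜ Δ ⌝ˡ} {a} {Γ} e))
    closed pr-axiom (n ∷ Γ ∷ a ∷ []) (h ∷ []) Δ ψ e e′ with φ , eq , ax ← test-∈ recAx {a} h =
      subst (Ax ∣ Δ ⊢_) (⌜⌝-injective (rename (λ ()) φ) ψ (trans (rename-closed-code φ) (trans eq (sym e′)))) (axiom ax)
    closed pr-hyp (n ∷ Γ ∷ a ∷ []) (h ∷ []) Δ ψ e e′ = hyp (h Δ ψ e e′)
    closed pr-⇒-intro (n ∷ Γ ∷ a ∷ b ∷ []) (h ∷ []) Δ φ e e′ with (ψ ⇒ χ) eq ← formulaView φ 3 (pair a b) e′ =
      ⇒-intro (h (ψ ∷ Δ) χ (cong₂ cons (pair-injectiveˡ {⌜ ψ ⌝} {⌜ χ ⌝} {a} {b} eq) e)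
                           (pair-injectiveʳ {⌜ ψ ⌝} {⌜ χ ⌝} {a} {b} eq))
    closed pr-⇒-elim (n ∷ Γ ∷ a ∷ b ∷ []) ((φ , φ≡) ∷ h ∷ h′ ∷ []) Δ ψ e e′ =
      ⇒-elim (h Δ (φ ⇒ ψ) e (cong (pair 3) (cong₂ pair φ≡ e′))) (h′ Δ φ e φ≡)
    closed pr-raa (n ∷ Γ ∷ a ∷ []) (h ∷ []) Δ ψ e e′ =
      raa (h (¬′ ψ ∷ Δ) ⊥′ (cong₂ cons (cong (λ c → pair 3 (pair c (pair 2 0))) e′) e) refl)
    closed pr-∀-intro (n ∷ Γ ∷ Γ′ ∷ a ∷ []) (h ∷ h′ ∷ []) Δ φ e e′ with ∀′ ψ eq ← formulaView φ 4 a e′ =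
      ∀-intro (h′ (map weaken Δ) ψ (h Δ e) eq)
    closed pr-∀-elim (n ∷ Γ ∷ a ∷ t ∷ b ∷ []) ((φ , φ≡) ∷ (u , u≡) ∷ h ∷ h′ ∷ []) Δ ψ e e′ =
      subst (Ax ∣ Δ ⊢_)
        (⌜⌝-injective (φ [ u ]) ψ (trans (h 1 t (instantiation u) refl (instᴿ u u≡) φ φ≡) (sym e′)))
        (∀-elim u (h′ Δ (∀′ φ) e (cong (pair 4) φ≡)))
    closed pr-refl (n ∷ Γ ∷ t ∷ []) [] Δ φ e e′ with (u ≐ w) eq ← formulaView φ 0 (pair t t) e′
      with refl ← ⌜⌝ᵗ-injective u w (trans (pair-injectiveˡ {⌜ u ⌝ᵗ} {⌜ w ⌝ᵗ} {t} {t} eq)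
                                           (sym (pair-injectiveʳ {⌜ u ⌝ᵗ} {⌜ w ⌝ᵗ} {t} {t} eq))) = ≐-refl
    closed pr-subst (n ∷ Γ ∷ a ∷ t ∷ s ∷ b ∷ b′ ∷ [])
           ((φ , φ≡) ∷ (u , u≡) ∷ (w , w≡) ∷ h ∷ h′ ∷ p ∷ p′ ∷ []) Δ ψ e e′ =
      subst (Ax ∣ Δ ⊢_)
        (⌜⌝-injective (φ [ w ]) ψ (trans (h′ 1 s (instantiation w) refl (instᴿ w w≡) φ φ≡) (sym e′)))
        (≐-subst φ (p Δ (u ≐ w) e (cong (pair 0) (cong₂ pair u≡ w≡)))
                   (p′ Δ (φ [ u ]) e (h 1 t (instantiation u) refl (instᴿ u u≡) φ φ≡)))
    closed pr-inhabited (n ∷ Γ ∷ a ∷ b ∷ d ∷ c ∷ []) (h ∷ h₁ ∷ h₂ ∷ h₃ ∷ []) Δ φ e e′ =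
      subst (Ax ∣ Δ ⊢_) (code-inhabited {a = a} {b} {c} {d} (test-≡ {a} {0} h) (test-≡ {b} {3} h₁)
        (test-≡ {d} {pair 3 (pair a b)} h₂) (test-≡ {c} {pair 4 d} h₃) e′) inhabited

    sound : ∀ {f} → Der f → Meaning f
    sound = Der-induction Meaning closed

    derive-test : ∀ {A} (rec : Recursive A) {n} → A n → Der (0 ∷ ⟨ characteristic em A n ⟩ ∷ [])
    derive-test {A} rec {n} a = subst (λ b → Der (0 ∷ ⟨ b ⟩ ∷ [])) (sym (characteristic-true em A a)) (infer truth [] [])

    derive-fin : ∀ {n} (i : Fin n) → Der (1 ∷ toℕ i ∷ n ∷ [])
    derive-fin zero    = infer fin-zero (_ ∷ []) []
    derive-fin (suc i) = infer fin-suc (toℕ i ∷ _ ∷ []) (derive-fin i ∷ [])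

    mutual
      derive-tm : ∀ {n} (t : Term L n) → Der (2 ∷ n ∷ ⌜ t ⌝ᵗ ∷ [])
      derive-tm (var i)         = infer tm-var (toℕ i ∷ _ ∷ []) (derive-fin i ∷ [])
      derive-tm (func {k} f ts) = infer tm-func (_ ∷ k ∷ ⌜_⌝ᶠ L f ∷ ⌜ ts ⌝ᵗˢ ∷ [])
        (derive-test {isFunc} (proj₁ recL) (k , f , refl) ∷ derive-tms ts ∷ [])

      derive-tms : ∀ {n k} (ts : Vec (Term L n) k) → Der (3 ∷ n ∷ k ∷ ⌜ ts ⌝ᵗˢ ∷ [])
      derive-tms []       = infer tms-nil (_ ∷ []) []
      derive-tms (t ∷ ts) = infer tms-cons (_ ∷ _ ∷ ⌜ t ⌝ᵗ ∷ ⌜ ts ⌝ᵗˢ ∷ []) (derive-tm t ∷ derive-tms ts ∷ [])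

    derive-fm : ∀ {n} (φ : Formula L n) → Der (4 ∷ n ∷ ⌜ φ ⌝ ∷ [])
    derive-fm (t ≐ s)            = infer fm-≐ (_ ∷ ⌜ t ⌝ᵗ ∷ ⌜ s ⌝ᵗ ∷ []) (derive-tm t ∷ derive-tm s ∷ [])
    derive-fm (rel {k = k} r ts) = infer fm-rel (_ ∷ k ∷ ⌜_⌝ʳ L r ∷ ⌜ ts ⌝ᵗˢ ∷ [])
      (derive-test {isRel} (proj₂ recL) (k , r , refl) ∷ derive-tms ts ∷ [])
    derive-fm ⊥′                 = infer fm-⊥ (_ ∷ []) []
    derive-fm (φ ⇒ ψ)            = infer fm-⇒ (_ ∷ ⌜ φ ⌝ ∷ ⌜ ψ ⌝ ∷ []) (derive-fm φ ∷ derive-fm ψ ∷ [])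
    derive-fm (∀′ φ)             = infer fm-∀ (_ ∷ ⌜ φ ⌝ ∷ []) (derive-fm φ ∷ [])

    mutual
      derive-look : ∀ {n m c x} {σ : Fin n → Term L m} → Represents c x σ →
                    ∀ i → Der (5 ∷ c ∷ x ∷ toℕ i ∷ ⌜ σ i ⌝ᵗ ∷ [])
      derive-look shiftᴿ         i       = infer look-shift (toℕ i ∷ []) []
      derive-look (instᴿ t refl) zero    = infer look-inst-zero (⌜ t ⌝ᵗ ∷ []) []
      derive-look (instᴿ t refl) (suc i) = infer look-inst-suc (⌜ t ⌝ᵗ ∷ toℕ i ∷ []) []
      derive-look (liftᴿ {c = c} {y} refl R) zero = infer look-lift-zero (pair c y ∷ []) []
      derive-look (liftᴿ {c = c} {y} {σ = σ} refl R) (suc i) =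
        infer look-lift-suc (c ∷ y ∷ toℕ i ∷ ⌜ σ i ⌝ᵗ ∷ ⌜ substᵗ (λ i → var (suc i)) (σ i) ⌝ᵗ ∷ [])
          (derive-look R i ∷ derive-subT shiftᴿ (σ i) ∷ [])

      derive-subT : ∀ {n m c x} {σ : Fin n → Term L m} → Represents c x σ →
                    ∀ t → Der (6 ∷ pair c x ∷ ⌜ t ⌝ᵗ ∷ ⌜ substᵗ σ t ⌝ᵗ ∷ [])
      derive-subT {c = c} {x} {σ} R (var i) =
        infer subT-var (c ∷ x ∷ toℕ i ∷ ⌜ σ i ⌝ᵗ ∷ []) (derive-look R i ∷ [])
      derive-subT {c = c} {x} {σ} R (func {k} f ts) =
        infer subT-func (pair c x ∷ pair k (⌜_⌝ᶠ L f) ∷ ⌜ ts ⌝ᵗˢ ∷ ⌜ substᵗˢ σ ts ⌝ᵗˢ ∷ []) (derive-subTs R ts ∷ [])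

      derive-subTs : ∀ {n m k c x} {σ : Fin n → Term L m} → Represents c x σ →
                     ∀ (ts : Vec _ k) → Der (7 ∷ pair c x ∷ ⌜ ts ⌝ᵗˢ ∷ ⌜ substᵗˢ σ ts ⌝ᵗˢ ∷ [])
      derive-subTs {c = c} {x} R [] = infer subTs-nil (pair c x ∷ []) []
      derive-subTs {c = c} {x} {σ} R (t ∷ ts) =
        infer subTs-cons (pair c x ∷ ⌜ t ⌝ᵗ ∷ ⌜ substᵗ σ t ⌝ᵗ ∷ ⌜ ts ⌝ᵗˢ ∷ ⌜ substᵗˢ σ ts ⌝ᵗˢ ∷ [])
          (derive-subT R t ∷ derive-subTs R ts ∷ [])

    derive-subF : ∀ {n m c x} {σ : Fin n → Term L m} → Represents c x σ →
                  ∀ φ → Der (8 ∷ pair c x ∷ ⌜ φ ⌝ ∷ ⌜ substᶠ σ φ ⌝ ∷ [])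
    derive-subF {c = c} {x} {σ} R (t ≐ s) =
      infer subF-≐ (pair c x ∷ ⌜ t ⌝ᵗ ∷ ⌜ substᵗ σ t ⌝ᵗ ∷ ⌜ s ⌝ᵗ ∷ ⌜ substᵗ σ s ⌝ᵗ ∷ [])
        (derive-subT R t ∷ derive-subT R s ∷ [])
    derive-subF {c = c} {x} {σ} R (rel {k = k} r ts) =
      infer subF-rel (pair c x ∷ pair k (⌜_⌝ʳ L r) ∷ ⌜ ts ⌝ᵗˢ ∷ ⌜ substᵗˢ σ ts ⌝ᵗˢ ∷ []) (derive-subTs R ts ∷ [])
    derive-subF {c = c} {x} R ⊥′ = infer subF-⊥ (pair c x ∷ []) []
    derive-subF {c = c} {x} {σ} R (φ ⇒ ψ) =
      infer subF-⇒ (pair c x ∷ ⌜ φ ⌝ ∷ ⌜ substᶠ σ φ ⌝ ∷ ⌜ ψ ⌝ ∷ ⌜ substᶠ σ ψ ⌝ ∷ [])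
        (derive-subF R φ ∷ derive-subF R ψ ∷ [])
    derive-subF {c = c} {x} {σ} R (∀′ φ) =
      infer subF-∀ (pair c x ∷ ⌜ φ ⌝ ∷ ⌜ substᶠ (lift σ) φ ⌝ ∷ []) (derive-subF (liftᴿ refl R) φ ∷ [])

    derive-mem : ∀ {n} {Γ : List (Formula L n)} {φ} → φ ∈ Γ → Der (9 ∷ ⌜ Γ ⌝ˡ ∷ ⌜ φ ⌝ ∷ [])
    derive-mem {Γ = φ ∷ Γ} (here refl) = infer mem-here (⌜ φ ⌝ ∷ ⌜ Γ ⌝ˡ ∷ []) []
    derive-mem {Γ = ψ ∷ Γ} {φ} (there ∈Γ) = infer mem-there (⌜ ψ ⌝ ∷ ⌜ Γ ⌝ˡ ∷ ⌜ φ ⌝ ∷ []) (derive-mem ∈Γ ∷ [])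

    derive-weak : ∀ {n} (Γ : List (Formula L n)) → Der (10 ∷ ⌜ Γ ⌝ˡ ∷ ⌜ map weaken Γ ⌝ˡ ∷ [])
    derive-weak []      = infer weak-nil [] []
    derive-weak (φ ∷ Γ) = infer weak-cons (⌜ φ ⌝ ∷ ⌜ weaken φ ⌝ ∷ ⌜ Γ ⌝ˡ ∷ ⌜ map weaken Γ ⌝ˡ ∷ [])
      (derive-subF shiftᴿ φ ∷ derive-weak Γ ∷ [])

    derive-equal : ∀ {m n} → m ≡ n → Der (0 ∷ ⟨ m ≡ᵇ n ⟩ ∷ [])
    derive-equal {m} refl = subst (λ b → Der (0 ∷ ⟨ b ⟩ ∷ [])) (sym (≡ᵇ-refl m)) (infer truth [] [])

    derive-inhabited : ∀ {n} (Γ : List (Formula L n)) {χ : Formula L n} φ ψ ψ′ → χ ≡ (∀′ (φ ⇒ ψ) ⇒ ψ′) →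
                       ⌜ φ ⌝ ≡ 0 → ⌜ ψ ⌝ ≡ 3 → ⌜ ψ′ ⌝ ≡ 3 → Der (11 ∷ n ∷ ⌜ Γ ⌝ˡ ∷ ⌜ χ ⌝ ∷ [])
    derive-inhabited {n} Γ φ ψ ψ′ refl e e′ e″ =
      infer pr-inhabited (n ∷ ⌜ Γ ⌝ˡ ∷ ⌜ φ ⌝ ∷ ⌜ ψ′ ⌝ ∷ ⌜ φ ⇒ ψ ⌝ ∷ ⌜ ∀′ (φ ⇒ ψ) ⌝ ∷ [])
        (derive-equal {⌜ φ ⌝} {0} e ∷ derive-equal {⌜ ψ′ ⌝} {3} e″
         ∷ derive-equal {⌜ φ ⇒ ψ ⌝} {pair 3 (pair ⌜ φ ⌝ ⌜ ψ′ ⌝)} (cong (λ b → pair 3 (pair ⌜ φ ⌝ b)) (trans e′ (sym e″)))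
         ∷ derive-equal {⌜ ∀′ (φ ⇒ ψ) ⌝} {pair 4 ⌜ φ ⇒ ψ ⌝} refl ∷ [])

    -- The equation keeps the code of ∃′ (var zero ≐ var zero), a huge
    -- numeral, from being computed.
    derive : ∀ {n} {Γ : List (Formula L n)} {φ χ} → Ax ∣ Γ ⊢ φ → φ ≡ χ → Der (11 ∷ n ∷ ⌜ Γ ⌝ˡ ∷ ⌜ χ ⌝ ∷ [])
    derive {n} {Γ} (axiom {φ = φ} ax) refl = infer pr-axiom (n ∷ ⌜ Γ ⌝ˡ ∷ ⌜ rename (λ ()) φ ⌝ ∷ [])
      (derive-test {codes Ax} recAx (φ , sym (rename-closed-code φ) , ax) ∷ [])
    derive {n} {Γ} {φ} (hyp φ∈Γ) refl = infer pr-hyp (n ∷ ⌜ Γ ⌝ˡ ∷ ⌜ φ ⌝ ∷ []) (derive-mem φ∈Γ ∷ [])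
    derive {n} {Γ} (⇒-intro {φ = φ} {ψ} d) refl = infer pr-⇒-intro (n ∷ ⌜ Γ ⌝ˡ ∷ ⌜ φ ⌝ ∷ ⌜ ψ ⌝ ∷ []) (derive d refl ∷ [])
    derive {n} {Γ} (⇒-elim {φ = φ} {ψ} d e) refl = infer pr-⇒-elim (n ∷ ⌜ Γ ⌝ˡ ∷ ⌜ φ ⌝ ∷ ⌜ ψ ⌝ ∷ [])
      (derive-fm φ ∷ derive d refl ∷ derive e refl ∷ [])
    derive {n} {Γ} {φ} (raa d) refl = infer pr-raa (n ∷ ⌜ Γ ⌝ˡ ∷ ⌜ φ ⌝ ∷ []) (derive d refl ∷ [])
    derive {n} {Γ} (∀-intro {φ = φ} d) refl = infer pr-∀-intro (n ∷ ⌜ Γ ⌝ˡ ∷ ⌜ map weaken Γ ⌝ˡ ∷ ⌜ φ ⌝ ∷ [])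
      (derive-weak Γ ∷ derive d refl ∷ [])
    derive {n} {Γ} (∀-elim {φ = φ} t d) refl = infer pr-∀-elim (n ∷ ⌜ Γ ⌝ˡ ∷ ⌜ φ ⌝ ∷ ⌜ t ⌝ᵗ ∷ ⌜ φ [ t ] ⌝ ∷ [])
      (derive-fm φ ∷ derive-tm t ∷ derive-subF (instᴿ t refl) φ ∷ derive d refl ∷ [])
    derive {n} {Γ} (≐-refl {t = t}) refl = infer pr-refl (n ∷ ⌜ Γ ⌝ˡ ∷ ⌜ t ⌝ᵗ ∷ []) []
    derive {n} {Γ} (≐-subst {t = t} {s} φ d e) refl =
      infer pr-subst (n ∷ ⌜ Γ ⌝ˡ ∷ ⌜ φ ⌝ ∷ ⌜ t ⌝ᵗ ∷ ⌜ s ⌝ᵗ ∷ ⌜ φ [ t ] ⌝ ∷ ⌜ φ [ s ] ⌝ ∷ [])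
        (derive-fm φ ∷ derive-tm t ∷ derive-tm s ∷ derive-subF (instᴿ t refl) φ ∷ derive-subF (instᴿ s refl) φ
         ∷ derive d refl ∷ derive e refl ∷ [])
    derive {n} {Γ} {χ = χ} inhabited eq = derive-inhabited Γ {χ} (var zero ≐ var zero) ⊥′ ⊥′ (sym eq) refl refl refl

    -- The first 0 is the number of free variables, the second the code of the empty context.
    provedBy : ℕ → ℕ → Bool
    provedBy s c = by s (11 ∷ 0 ∷ 0 ∷ c ∷ [])

    c-provedBy : ∀ {k} {f g : Vec ℕ k → ℕ} → Comp ∅ f → Comp ∅ g → CompB ∅ (λ xs → provedBy (f xs) (g xs))
    c-provedBy cf cg = c-by cf (pr (# 0) (# 0) (exp cg))

    provedBy-sound : ∀ s (φ : Sentence L) → provedBy s ⌜ φ ⌝ ≡ true → Ax ∣ [] ⊢ φ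
    provedBy-sound s φ h = sound (by⇒Der s {11 ∷ 0 ∷ 0 ∷ ⌜ φ ⌝ ∷ []} h) [] φ refl refl

    provedBy-complete : ∀ {φ : Sentence L} → Ax ∣ [] ⊢ φ → ∃[ s ] provedBy s ⌜ φ ⌝ ≡ true
    provedBy-complete d = Der⇒by (derive d refl)

-- Codes of finite sequences by pairwise coprime moduli

module FiniteSets where

  -- Finite sets are coded by divisibility by pairwise coprime moduli,
  -- which needs less than Gödel's β function.

  modulus : ℕ → ℕ → ℕ
  modulus b p = suc (suc p * b)

  Member : ℕ → ℕ → ℕ → Set
  Member a b p = ∃[ q ] q * modulus b p ≡ a

  coprime-*ʳ : ∀ {m a b} → Coprime m a → Coprime m b → Coprime m (a * b)
  coprime-*ʳ {m} {a} {b} m⊥a m⊥b {d} (d∣m , d∣ab) =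
    m⊥b (d∣m , coprime-divisor (λ (c∣d , c∣a) → m⊥a (∣-trans c∣d d∣m , c∣a)) d∣ab)

  n∣N! : ∀ {n N} → 0 < n → n ≤ N → n ∣ₙ N !
  n∣N! {suc n} _ n≤N = ∣-trans (m∣m*n (n !)) (m≤n⇒m!∣n! n≤N)

  -- A common divisor of the moduli divides their difference `(p′ ∸ p) * b`. It is coprime to `b`,
  -- because the moduli are 1 modulo `b`, so it divides `p′ ∸ p`, hence the factorial `b`, hence it
  -- is 1.
  modulus-coprime-< : ∀ {N p p′} → p′ ≤ N → p < p′ → Coprime (modulus (N !) p) (modulus (N !) p′)
  modulus-coprime-< {N} {p} {p′} p′≤N p<p′ {d} (d∣m , d∣m′) = d⊥b (∣-refl , d∣b)
    where
    b = N !
    d⊥b : Coprime d b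
    d⊥b {c} (c∣d , c∣b) = ∣1⇒≡1 (∣m+n∣m⇒∣n
      (subst (c ∣ₙ_) (+-comm 1 (suc p * b)) (∣-trans c∣d d∣m)) (∣n⇒∣m*n (suc p) c∣b))
    m′≡ : modulus b p′ ≡ modulus b p + (p′ ∸ p) * b
    m′≡ = cong suc (trans (cong (λ x → suc x * b) (sym (m+[n∸m]≡n (<⇒≤ p<p′)))) (*-distribʳ-+ b (suc p) (p′ ∸ p)))
    d∣diff : d ∣ₙ b * (p′ ∸ p)
    d∣diff = subst (d ∣ₙ_) (*-comm (p′ ∸ p) b) (∣m+n∣m⇒∣n (subst (d ∣ₙ_) m′≡ d∣m′) d∣m)
    d∣b : d ∣ₙ b
    d∣b = ∣-trans (coprime-divisor d⊥b d∣diff) (n∣N! (m<n⇒0<n∸m p<p′) (≤-trans (m∸n≤m p′ p) p′≤N))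

  modulus-coprime : ∀ {N p p′} → p ≤ N → p′ ≤ N → p ≢ p′ → Coprime (modulus (N !) p) (modulus (N !) p′)
  modulus-coprime {N} {p} {p′} p≤N p′≤N p≢p′ with <-cmp p p′
  ... | tri< p<p′ _ _ = modulus-coprime-< {N} {p} {p′} p′≤N p<p′
  ... | tri≈ _ p≡p′ _ = contradiction p≡p′ p≢p′
  ... | tri> _ _ p′<p = λ (d∣m , d∣m′) → modulus-coprime-< {N} {p′} {p} p≤N p′<p (d∣m′ , d∣m)

  product : (ℕ → ℕ) → ℕ → ℕ
  product f zero    = 1
  product f (suc n) = f n * product f n

  ∣product : ∀ f {n i} → i < n → f i ∣ₙ product f n
  ∣product f {suc n} {i} i<1+n with m≤n⇒m<n∨m≡n (s≤s⁻¹ i<1+n)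
  ... | inj₁ i<n  = ∣n⇒∣m*n (f n) (∣product f i<n)
  ... | inj₂ refl = m∣m*n (product f n)

  coprime-product : ∀ m f n → (∀ i → i < n → Coprime m (f i)) → Coprime m (product f n)
  coprime-product m f zero    h (_ , d∣1) = ∣1⇒≡1 d∣1
  coprime-product m f (suc n) h =
    coprime-*ʳ (h n ≤-refl) (coprime-product m f n (λ i i<n → h i (m<n⇒m<1+n i<n)))

  -- A polynomial, unlike pair; injective because its value lies between
  -- (m + n)² and (m + n + 1)².
  pairing : ℕ → ℕ → ℕ
  pairing m n = (m + n) * (m + n) + m

  pairing-<-sum : ∀ m n m′ n′ → m + n < m′ + n′ → pairing m n < pairing m′ n′
  pairing-<-sum m n m′ n′ lt = begin-strict
    s * s + m            ≤⟨ +-monoʳ-≤ (s * s) (m≤m+n m n) ⟩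
    s * s + s            ≡⟨ +-comm (s * s) s ⟩
    suc s * s            ≤⟨ *-monoˡ-≤ s lt ⟩
    (m′ + n′) * s        <⟨ *-monoʳ-< (m′ + n′) {{>-nonZero (≤-trans (s≤s z≤n) lt)}} lt ⟩
    (m′ + n′) * (m′ + n′) ≤⟨ m≤m+n _ m′ ⟩
    pairing m′ n′        ∎
    where
    open ≤-Reasoning
    s = m + n

  pairing-injective : ∀ m n m′ n′ → pairing m n ≡ pairing m′ n′ → m ≡ m′ × n ≡ n′
  pairing-injective m n m′ n′ e with <-cmp (m + n) (m′ + n′)
  ... | tri< lt _ _ = contradiction e (<⇒≢ (pairing-<-sum m n m′ n′ lt))
  ... | tri> _ _ gt = contradiction (sym e) (<⇒≢ (pairing-<-sum m′ n′ m n gt))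
  ... | tri≈ _ s≡ _ = m≡ , +-cancelˡ-≡ m n n′ (trans s≡ (cong (_+ n′) (sym m≡)))
    where
    m≡ : m ≡ m′
    m≡ = +-cancelˡ-≡ ((m + n) * (m + n)) m m′ (trans e (cong (λ s → s * s + m′) (sym s≡)))

  pairing-mono : ∀ {m n m′ n′} → m ≤ m′ → n ≤ n′ → pairing m n ≤ pairing m′ n′
  pairing-mono p q = +-mono-≤ (*-mono-≤ (+-mono-≤ p q) (+-mono-≤ p q)) p

  -- `N` bounds all pairs that can be asked about, so the moduli for `b = N !` are pairwise coprime;
  -- `a` is the product of those on the graph of `r`. A modulus off the graph is coprime to `a` and
  -- greater than 1, hence does not divide it.
  sequence-code : (r : ℕ → ℕ) (n c : ℕ) → (∀ i → i ≤ n → r i ≤ c) → ∃[ a ] ∃[ b ]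
    (∀ i → i ≤ n → Member a b (pairing i (r i))) ×
    (∀ i x → i ≤ n → x ≤ c → Member a b (pairing i x) → x ≡ r i)
  sequence-code r n c r≤c = product m (suc n) , N ! , isMember , isValue
    where
    N = pairing n c
    m : ℕ → ℕ
    m i = modulus (N !) (pairing i (r i))
    isMember : ∀ i → i ≤ n → Member (product m (suc n)) (N !) (pairing i (r i))
    isMember i i≤n with ∣product m (s≤s i≤n)
    ... | divides q e = q , sym e
    isValue : ∀ i x → i ≤ n → x ≤ c → Member (product m (suc n)) (N !) (pairing i x) → x ≡ r i
    isValue i x i≤n x≤c (q , e) with x ≟ r i
    ... | yes x≡ = x≡
    ... | no  x≢ = contradiction (coprime (∣-refl , divides q (sym e))) (λ e → <⇒≢ 1<modulus (sym e))
      where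
      coprime : Coprime (modulus (N !) (pairing i x)) (product m (suc n))
      coprime = coprime-product _ m (suc n) λ j j<1+n → modulus-coprime {N}
        (pairing-mono i≤n x≤c) (pairing-mono (s≤s⁻¹ j<1+n) (r≤c j (s≤s⁻¹ j<1+n)))
        (λ eq → x≢ (trans (proj₂ (pairing-injective i x j (r j) eq))
                          (cong r (sym (proj₁ (pairing-injective i x j (r j) eq))))))
      1<modulus : 1 < modulus (N !) (pairing i x)
      1<modulus = s≤s (≤-trans (1≤n! N) (m≤m+n (N !) _))

-- Σ₁ definitions of the graphs of programs

module Arithmetic where

  open Computability
  open FirstOrderLogic
  open FiniteSets

  ℕ-model : Model Arith
  ℕ-model = record
    { Carrier       = ℕ
    ; _≈_           = _≡_
    ; isEquivalence = ≡-isEquivalence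
    ; funcᴹ         = λ where
        `0 []           → 0
        `S (x ∷ [])     → suc x
        `+ (x ∷ y ∷ []) → x + y
        `· (x ∷ y ∷ []) → x * y
    ; relᴹ          = λ { `≤ (x ∷ y ∷ []) → x ≤ y }
    ; func-cong     = λ where
        `0 []                    → refl
        `S (refl ∷ [])           → refl
        `+ (refl ∷ refl ∷ [])    → refl
        `· (refl ∷ refl ∷ [])    → refl
    ; rel-cong      = λ { `≤ (refl ∷ refl ∷ []) p → p }
    ; point         = 0
    }

  module ℕ-Sat = Satisfaction ℕ-model
  open ℕ-Sat public using () renaming (evalᵗ to ⟦_⟧ᵗ)

  -- Negation is confined to equations, and the bound of a universal quantifier is a variable, which
  -- becomes a numeral on substitution; this shape is what makes every true instance provable in
  -- `𝐑`.
  data Σ₁ : ℕ → Set where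
    equal unequal  : ∀ {n} → Term Arith n → Term Arith n → Σ₁ n
    and or  : ∀ {n} → Σ₁ n → Σ₁ n → Σ₁ n
    ex      : ∀ {n} → Σ₁ (suc n) → Σ₁ n
    all     : ∀ {n} → Fin n → Σ₁ (suc n) → Σ₁ n

  True : ∀ {n} → Σ₁ n → Vec ℕ n → Set
  True (equal t s)  ρ = ⟦ t ⟧ᵗ (lookup ρ) ≡ ⟦ s ⟧ᵗ (lookup ρ)
  True (unequal t s) ρ = ⟦ t ⟧ᵗ (lookup ρ) ≢ ⟦ s ⟧ᵗ (lookup ρ)
  True (and φ ψ) ρ = True φ ρ × True ψ ρ
  True (or φ ψ)  ρ = True φ ρ ⊎ True ψ ρ
  True (ex φ)    ρ = ∃[ x ] True φ (x ∷ ρ)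
  True (all i φ) ρ = ∀ x → x ≤ lookup ρ i → True φ (x ∷ ρ)

  formula : ∀ {n} → Σ₁ n → Formula Arith n
  formula (equal t s)  = t ≐ s
  formula (unequal t s) = ¬′ (t ≐ s)
  formula (and φ ψ) = formula φ ∧′ formula ψ
  formula (or φ ψ)  = formula φ ∨′ formula ψ
  formula (ex φ)    = ∃′ (formula φ)
  formula (all i φ) = ∀′ (var zero ≤′ var (suc i) ⇒ formula φ)

  lookup-∷ : ∀ {n} x (ρ : Vec ℕ n) i → (x ▸ lookup ρ) i ≡ lookup (x ∷ ρ) i
  lookup-∷ x ρ zero    = refl
  lookup-∷ x ρ (suc i) = refl

  module _ (em : ExcludedMiddle 0ℓ) where
    -- The connectives of `formula` are classical abbreviations, so the constructive reading has to
    -- be recovered by excluded middle.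
    formula-true : ∀ {n} (φ : Σ₁ n) ρ → ℕ-Sat.Sat (formula φ) (lookup ρ) → True φ ρ
    formula-true (equal t s)  ρ h = h
    formula-true (unequal t s) ρ h = h
    formula-true (and φ ψ) ρ h =
      formula-true φ ρ (decidable-stable em (λ ¬p → h (λ p → ⊥-elim (¬p p)))) ,
      formula-true ψ ρ (decidable-stable em (λ ¬q → h (λ _ → ¬q)))
    formula-true (or φ ψ)  ρ h with em {ℕ-Sat.Sat (formula φ) (lookup ρ)}
    ... | yes p = inj₁ (formula-true φ ρ p)
    ... | no ¬p = inj₂ (formula-true ψ ρ (h ¬p))
    formula-true (ex φ)    ρ h with em {∃[ x ] ℕ-Sat.Sat (formula φ) (x ▸ lookup ρ)}
    ... | yes (x , p) = x , formula-true φ (x ∷ ρ) (ℕ-Sat.Sat-cong (formula φ) (lookup-∷ x ρ) p)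
    ... | no ¬p       = ⊥-elim (h (λ x p → ¬p (x , p)))
    formula-true (all i φ) ρ h x x≤ =
      formula-true φ (x ∷ ρ) (ℕ-Sat.Sat-cong (formula φ) (lookup-∷ x ρ) (h x x≤))

  renameΣ₁ : ∀ {n m} → (Fin n → Fin m) → Σ₁ n → Σ₁ m
  renameΣ₁ r (equal t s)  = equal (substᵗ (var ∘ r) t) (substᵗ (var ∘ r) s)
  renameΣ₁ r (unequal t s) = unequal (substᵗ (var ∘ r) t) (substᵗ (var ∘ r) s)
  renameΣ₁ r (and φ ψ) = and (renameΣ₁ r φ) (renameΣ₁ r ψ)
  renameΣ₁ r (or φ ψ)  = or (renameΣ₁ r φ) (renameΣ₁ r ψ)
  renameΣ₁ r (ex φ)    = ex (renameΣ₁ (zero ▸ (suc ∘ r)) φ)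
  renameΣ₁ r (all i φ) = all (r i) (renameΣ₁ (zero ▸ (suc ∘ r)) φ)

  Matches : ∀ {n m} → (Fin n → Fin m) → Vec ℕ n → Vec ℕ m → Set
  Matches r σ ρ = ∀ i → lookup σ i ≡ lookup ρ (r i)

  Matches-∷ : ∀ {n m} {r : Fin n → Fin m} {σ ρ} x → Matches r σ ρ → Matches (zero ▸ (suc ∘ r)) (x ∷ σ) (x ∷ ρ)
  Matches-∷ x h zero    = refl
  Matches-∷ x h (suc i) = h i

  renameᵗ-eval : ∀ {n m} {r : Fin n → Fin m} σ ρ → Matches r σ ρ → ∀ t →
                 ⟦ substᵗ (var ∘ r) t ⟧ᵗ (lookup ρ) ≡ ⟦ t ⟧ᵗ (lookup σ)
  renameᵗ-eval {r = r} σ ρ h t = trans (ℕ-Sat.evalᵗ-subst (var ∘ r) t _) (ℕ-Sat.evalᵗ-cong t (sym ∘ h))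

  renameΣ₁-true : ∀ {n m} {r : Fin n → Fin m} {σ ρ} → Matches r σ ρ → ∀ φ →
                  (True (renameΣ₁ r φ) ρ → True φ σ) × (True φ σ → True (renameΣ₁ r φ) ρ)
  renameΣ₁-true {σ = σ} {ρ} h (equal t s)  = (λ e → trans (sym (renameᵗ-eval σ ρ h t)) (trans e (renameᵗ-eval σ ρ h s))) ,
                              (λ e → trans (renameᵗ-eval σ ρ h t) (trans e (sym (renameᵗ-eval σ ρ h s))))
  renameΣ₁-true {σ = σ} {ρ} h (unequal t s) = (λ ne e → ne (trans (renameᵗ-eval σ ρ h t) (trans e (sym (renameᵗ-eval σ ρ h s))))) ,
                              (λ ne e → ne (trans (sym (renameᵗ-eval σ ρ h t)) (trans e (renameᵗ-eval σ ρ h s))))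
  renameΣ₁-true {σ = σ} {ρ} h (and φ ψ) = (λ (p , q) → proj₁ (renameΣ₁-true {σ = σ} {ρ} h φ) p , proj₁ (renameΣ₁-true {σ = σ} {ρ} h ψ) q) ,
                              (λ (p , q) → proj₂ (renameΣ₁-true {σ = σ} {ρ} h φ) p , proj₂ (renameΣ₁-true {σ = σ} {ρ} h ψ) q)
  renameΣ₁-true {σ = σ} {ρ} h (or φ ψ)  =
    (λ { (inj₁ p) → inj₁ (proj₁ (renameΣ₁-true {σ = σ} {ρ} h φ) p) ; (inj₂ q) → inj₂ (proj₁ (renameΣ₁-true {σ = σ} {ρ} h ψ) q) }) ,
    (λ { (inj₁ p) → inj₁ (proj₂ (renameΣ₁-true {σ = σ} {ρ} h φ) p) ; (inj₂ q) → inj₂ (proj₂ (renameΣ₁-true {σ = σ} {ρ} h ψ) q) })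
  renameΣ₁-true {σ = σ} {ρ} h (ex φ)    = (λ (x , p) → x , proj₁ (renameΣ₁-true {σ = x ∷ σ} {x ∷ ρ} (Matches-∷ {σ = σ} {ρ} x h) φ) p) ,
                              (λ (x , p) → x , proj₂ (renameΣ₁-true {σ = x ∷ σ} {x ∷ ρ} (Matches-∷ {σ = σ} {ρ} x h) φ) p)
  renameΣ₁-true {σ = σ} {ρ} h (all i φ) =
    (λ p x x≤ → proj₁ (renameΣ₁-true {σ = x ∷ σ} {x ∷ ρ} (Matches-∷ {σ = σ} {ρ} x h) φ) (p x (subst (x ≤_) (h i) x≤))) ,
    (λ p x x≤ → proj₂ (renameΣ₁-true {σ = x ∷ σ} {x ∷ ρ} (Matches-∷ {σ = σ} {ρ} x h) φ) (p x (subst (x ≤_) (sym (h i)) x≤)))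

  record Def {n : ℕ} (P : Vec ℕ n → Set) : Set where
    constructor defines
    field
      defn     : Σ₁ n
      defn⇒    : ∀ ρ → True defn ρ → P ρ
      defn⇐    : ∀ ρ → P ρ → True defn ρ

  open Def

  private variable
    n m : ℕ
    P Q : Vec ℕ n → Set

  d-iff : (∀ ρ → P ρ → Q ρ) → (∀ ρ → Q ρ → P ρ) → Def P → Def Q
  d-iff f g (defines φ to from) = defines φ (λ ρ p → f ρ (to ρ p)) (λ ρ q → from ρ (g ρ q))

  d-eq : ∀ (t s : Term Arith n) → Def (λ ρ → ⟦ t ⟧ᵗ (lookup ρ) ≡ ⟦ s ⟧ᵗ (lookup ρ))
  d-eq t s = defines (equal t s) (λ _ p → p) (λ _ p → p)

  d-neq : ∀ (t s : Term Arith n) → Def (λ ρ → ⟦ t ⟧ᵗ (lookup ρ) ≢ ⟦ s ⟧ᵗ (lookup ρ))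
  d-neq t s = defines (unequal t s) (λ _ p → p) (λ _ p → p)

  d-and : Def P → Def Q → Def (λ ρ → P ρ × Q ρ)
  d-and (defines φ f g) (defines ψ f′ g′) =
    defines (and φ ψ) (λ ρ (p , q) → f ρ p , f′ ρ q) (λ ρ (p , q) → g ρ p , g′ ρ q)

  d-or : Def P → Def Q → Def (λ ρ → P ρ ⊎ Q ρ)
  d-or (defines φ f g) (defines ψ f′ g′) = defines (or φ ψ)
    (λ { ρ (inj₁ p) → inj₁ (f ρ p) ; ρ (inj₂ q) → inj₂ (f′ ρ q) })
    (λ { ρ (inj₁ p) → inj₁ (g ρ p) ; ρ (inj₂ q) → inj₂ (g′ ρ q) })

  d-ex : {P : Vec ℕ (suc n) → Set} → Def P → Def (λ ρ → ∃[ x ] P (x ∷ ρ))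
  d-ex (defines φ f g) = defines (ex φ) (λ ρ (x , p) → x , f _ p) (λ ρ (x , p) → x , g _ p)

  d-all : {P : Vec ℕ (suc n) → Set} (i : Fin n) → Def P → Def (λ ρ → ∀ x → x ≤ lookup ρ i → P (x ∷ ρ))
  d-all i (defines φ f g) = defines (all i φ) (λ ρ h x x≤ → f _ (h x x≤)) (λ ρ h x x≤ → g _ (h x x≤))

  d-ren : {P : Vec ℕ n → Set} (h : Vec ℕ m → Vec ℕ n) (r : Fin n → Fin m) → (∀ ρ → Matches r (h ρ) ρ) →
          Def P → Def (λ ρ → P (h ρ))
  d-ren h r match (defines φ f g) = defines (renameΣ₁ r φ)
    (λ ρ p → f (h ρ) (proj₁ (renameΣ₁-true {σ = h ρ} {ρ} (match ρ) φ) p))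
    (λ ρ p → proj₂ (renameΣ₁-true {σ = h ρ} {ρ} (match ρ) φ) (g (h ρ) p))

  S′ : Term Arith n → Term Arith n
  S′ t = func `S (t ∷ [])

  memberEquation : Vec ℕ 5 → Set
  memberEquation (q ∷ a ∷ b ∷ i ∷ r ∷ []) = q * modulus b (pairing i r) ≡ a

  modulusTerm : (b i r : Fin n) → Term Arith n
  modulusTerm b i r =
    S′ (S′ ((var i ⊕ var r) ⊙ (var i ⊕ var r) ⊕ var i) ⊙ var b)

  d-member : Def {4} (λ { (a ∷ b ∷ i ∷ r ∷ []) → Member a b (pairing i r) })
  d-member = d-iff (λ { (a ∷ b ∷ i ∷ r ∷ []) p → p }) (λ { (a ∷ b ∷ i ∷ r ∷ []) p → p })
    (d-ex (d-iff {Q = memberEquation} (λ { (q ∷ a ∷ b ∷ i ∷ r ∷ []) e → e }) (λ { (q ∷ a ∷ b ∷ i ∷ r ∷ []) e → e })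
      (d-eq (var 0F ⊙ modulusTerm 2F 3F 4F) (var 1F))))

  -- A quotient of `a` by a nonzero modulus is at most `a`, so the negated existential becomes a
  -- bounded universal quantifier.
  d-nonmember : Def {4} (λ { (a ∷ b ∷ i ∷ r ∷ []) → ¬ Member a b (pairing i r) })
  d-nonmember = d-iff to from
    (d-all 0F (d-iff {Q = ¬_ ∘ memberEquation} (λ { (q ∷ a ∷ b ∷ i ∷ r ∷ []) e → e }) (λ { (q ∷ a ∷ b ∷ i ∷ r ∷ []) e → e })
      (d-neq (var 0F ⊙ modulusTerm 2F 3F 4F) (var 1F))))
    where
    to : ∀ ρ → (∀ q → q ≤ lookup ρ 0F → ¬ memberEquation (q ∷ ρ)) → _
    to (a ∷ b ∷ i ∷ r ∷ []) h (q , e) = h q (subst (q ≤_) e (m≤m*n q (modulus b (pairing i r)))) e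
    from : ∀ ρ → _ → ∀ q → q ≤ lookup ρ 0F → ¬ memberEquation (q ∷ ρ)
    from (a ∷ b ∷ i ∷ r ∷ []) h q _ e = h (q , e)

  d-≤ : Def {2} (λ { (x ∷ y ∷ []) → x ≤ y })
  d-≤ = d-iff to from (d-ex (d-eq (var 1F ⊕ var 0F) (var 2F)))
    where
    to : ∀ ρ → ∃[ d ] (lookup ρ 0F + d ≡ lookup ρ 1F) → _
    to (x ∷ y ∷ []) (d , e) = subst (x ≤_) e (m≤m+n x d)
    from : ∀ ρ → _ → ∃[ d ] (lookup ρ 0F + d ≡ lookup ρ 1F)
    from (x ∷ y ∷ []) x≤y = y ∸ x , m+[n∸m]≡n x≤y

  Graph : ∀ {k} → Program k → Vec ℕ (suc k) → Set
  Graph p (y ∷ xs) = Eval ∅ p xs y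

  d-exⁿ : ∀ m {P : Vec ℕ (m + n) → Set} → Def P → Def (λ ρ → Σ (Vec ℕ m) λ ys → P (ys ++ ρ))
  d-exⁿ zero    d = d-iff (λ ρ p → [] , p) (λ { ρ ([] , p) → p }) d
  d-exⁿ {n} (suc m) {P} d = d-iff
    (λ { ρ (ys , y , p) → y ∷ ys , p }) (λ { ρ (y ∷ ys , p) → ys , y , p }) (d-exⁿ m (d-ex d))

  Recorded : Vec ℕ 5 → Set
  Recorded (a ∷ b ∷ c ∷ i ∷ r ∷ []) = r ≤ c × Member a b (pairing i r)

  d-recorded : Def Recorded
  d-recorded = d-iff (λ { (a ∷ b ∷ c ∷ i ∷ r ∷ []) p → p }) (λ { (a ∷ b ∷ c ∷ i ∷ r ∷ []) p → p })
    (d-and (d-ren (λ ρ → lookup ρ 4F ∷ lookup ρ 2F ∷ []) (λ { 0F → 4F ; 1F → 2F }) (λ { ρ 0F → refl ; ρ 1F → refl }) d-≤)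
           (d-ren (λ ρ → lookup ρ 0F ∷ lookup ρ 1F ∷ lookup ρ 3F ∷ lookup ρ 4F ∷ [])
                  (λ { 0F → 0F ; 1F → 1F ; 2F → 3F ; 3F → 4F })
                  (λ { ρ 0F → refl ; ρ 1F → refl ; ρ 2F → refl ; ρ 3F → refl }) d-member))

  module _ {k : ℕ} (f : Program k) (g : Program (suc (suc k))) where

    Step : Vec ℕ (9 + k) → Set
    Step (r′ ∷ i′ ∷ x ∷ i ∷ a ∷ b ∷ c ∷ y ∷ n ∷ xs) =
      i ≡ suc i′ × Recorded (a ∷ b ∷ c ∷ i′ ∷ r′ ∷ []) × Eval ∅ g (i′ ∷ r′ ∷ xs) x

    -- To be imposed on every pair in the coded set, not just on one intended sequence: the set may
    -- fail to be functional, yet each recorded value can be traced back to the start of the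
    -- recursion.
    Justified : Vec ℕ (7 + k) → Set
    Justified (x ∷ i ∷ a ∷ b ∷ c ∷ y ∷ n ∷ xs) =
      ¬ Member a b (pairing i x) ⊎ (i ≡ 0 × Eval ∅ f xs x)
        ⊎ ∃[ i′ ] ∃[ r′ ] Step (r′ ∷ i′ ∷ x ∷ i ∷ a ∷ b ∷ c ∷ y ∷ n ∷ xs)

    Trace : Vec ℕ (5 + k) → Set
    Trace (a ∷ b ∷ c ∷ y ∷ n ∷ xs) = Recorded (a ∷ b ∷ c ∷ n ∷ y ∷ []) ×
      (∀ i → i ≤ n → ∀ x → x ≤ c → Justified (x ∷ i ∷ a ∷ b ∷ c ∷ y ∷ n ∷ xs))

    -- Induction on `i`: the predecessor provided by a justification is again recorded and within
    -- the bound `c`, so its own justification applies.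
    trace⇒eval : ∀ {a b c n xs} {y₀ n₀} →
      (∀ i → i ≤ n → ∀ x → x ≤ c → Justified (x ∷ i ∷ a ∷ b ∷ c ∷ y₀ ∷ n₀ ∷ xs)) →
      ∀ i → i ≤ n → ∀ y → Recorded (a ∷ b ∷ c ∷ i ∷ y ∷ []) → Eval ∅ (prec f g) (i ∷ xs) y
    trace⇒eval h zero i≤n y (y≤c , m) with h zero i≤n y y≤c
    ... | inj₁ ¬m = contradiction m ¬m
    ... | inj₂ (inj₁ (_ , e)) = prec-zero e
    trace⇒eval {y₀ = y₀} {n₀} h (suc i) i<n y (y≤c , m) with h (suc i) i<n y y≤c
    ... | inj₁ ¬m = contradiction m ¬m
    ... | inj₂ (inj₂ (.i , r , refl , rec , e)) = prec-suc (trace⇒eval {y₀ = y₀} {n₀} h i (<⇒≤ i<n) r rec) e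

    recursionValues : ∀ {xs y} n → Eval ∅ (prec f g) (n ∷ xs) y →
             Σ (ℕ → ℕ) λ r → r n ≡ y × Eval ∅ f xs (r 0) × (∀ i → i < n → Eval ∅ g (i ∷ r i ∷ xs) (r (suc i)))
    recursionValues {y = y} zero (prec-zero e) = (λ _ → y) , refl , e , λ _ ()
    recursionValues {xs} {y} (suc n) (prec-suc {r = z} d e) with recursionValues n d
    ... | r , rn≡ , e₀ , step = r′ , r′-last , subst (Eval ∅ f xs) (sym (r′-old 0 z≤n)) e₀ , step′
      where
      r′ : ℕ → ℕ
      r′ i = if i ≡ᵇ suc n then y else r i
      r′-last : r′ (suc n) ≡ y
      r′-last rewrite ≡ᵇ-refl n = refl
      r′-old : ∀ i → i ≤ n → r′ i ≡ r i
      r′-old i i≤n rewrite ≡ᵇ-false {i} {suc n} (<⇒≢ (s≤s i≤n)) = refl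
      step′ : ∀ i → i < suc n → Eval ∅ g (i ∷ r′ i ∷ xs) (r′ (suc i))
      step′ i i<1+n with m≤n⇒m<n∨m≡n (s≤s⁻¹ i<1+n)
      ... | inj₁ i<n  = subst₂ (λ a b → Eval ∅ g (i ∷ a ∷ xs) b) (sym (r′-old i (<⇒≤ i<n))) (sym (r′-old (suc i) i<n)) (step i i<n)
      ... | inj₂ refl = subst₂ (λ a b → Eval ∅ g (i ∷ a ∷ xs) b)
              (sym (trans (r′-old i ≤-refl) rn≡)) (sym r′-last) e

    maximum : ∀ (r : ℕ → ℕ) n → ∃[ c ] ∀ i → i ≤ n → r i ≤ c
    maximum r zero    = r 0 , λ { .0 z≤n → ≤-refl }
    maximum r (suc n) with maximum r n
    ... | c , h = r (suc n) ⊔ c , λ i i≤ → case m≤n⇒m<n∨m≡n i≤ of λ where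
      (inj₁ i<) → ≤-trans (h i (s≤s⁻¹ i<)) (m≤n⊔m (r (suc n)) c)
      (inj₂ refl) → m≤m⊔n (r (suc n)) c

    -- The graph of the intermediate values is coded, with their maximum as the bound `c`; every
    -- other pair within the bounds fails membership and falls under the first alternative of
    -- `Justified`.
    eval⇒trace : ∀ {xs y} n → Eval ∅ (prec f g) (n ∷ xs) y → ∃[ c ] ∃[ b ] ∃[ a ] Trace (a ∷ b ∷ c ∷ y ∷ n ∷ xs)
    eval⇒trace {xs} n d with recursionValues n d
    ... | r , refl , e₀ , step with maximum r n
    ...   | c , r≤c with sequence-code r n c r≤c
    ...     | a , b , members , unique = c , b , a , (r≤c n ≤-refl , members n ≤-refl) , justify
      where
      value-justified : ∀ i → i ≤ n → Justified (r i ∷ i ∷ a ∷ b ∷ c ∷ r n ∷ n ∷ xs)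
      value-justified zero    i≤n = inj₂ (inj₁ (refl , e₀))
      value-justified (suc i) i<n =
        inj₂ (inj₂ (i , r i , refl , (r≤c i (<⇒≤ i<n) , members i (<⇒≤ i<n)) , step i i<n))
      justify : ∀ i → i ≤ n → ∀ x → x ≤ c → Justified (x ∷ i ∷ a ∷ b ∷ c ∷ r n ∷ n ∷ xs)
      justify i i≤n x x≤c with x ≟ r i
      ... | yes refl = value-justified i i≤n
      ... | no  x≢   = inj₁ (λ m → x≢ (unique i x i≤n x≤c m))

    d-step : Def (Graph g) → Def Step
    d-step dg = d-iff (λ { (r′ ∷ i′ ∷ x ∷ i ∷ a ∷ b ∷ c ∷ y ∷ n ∷ xs) p → p })
                      (λ { (r′ ∷ i′ ∷ x ∷ i ∷ a ∷ b ∷ c ∷ y ∷ n ∷ xs) p → p })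
      (d-and (d-eq (var 3F) (S′ (var 1F)))
      (d-and (d-ren (λ { (r′ ∷ i′ ∷ x ∷ i ∷ a ∷ b ∷ c ∷ y ∷ n ∷ xs) → a ∷ b ∷ c ∷ i′ ∷ r′ ∷ [] })
                    (λ { 0F → 4F ; 1F → 5F ; 2F → 6F ; 3F → 1F ; 4F → 0F })
                    (λ { (r′ ∷ i′ ∷ x ∷ i ∷ a ∷ b ∷ c ∷ y ∷ n ∷ xs) → λ { 0F → refl ; 1F → refl ; 2F → refl ; 3F → refl ; 4F → refl } })
                    d-recorded)
             (d-ren (λ { (r′ ∷ i′ ∷ x ∷ i ∷ a ∷ b ∷ c ∷ y ∷ n ∷ xs) → x ∷ i′ ∷ r′ ∷ xs })
                    (λ { 0F → 2F ; 1F → 1F ; 2F → 0F ; (suc (suc (suc i))) → 9 ↑ʳ i })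
                    (λ { (r′ ∷ i′ ∷ x ∷ i ∷ a ∷ b ∷ c ∷ y ∷ n ∷ xs) → λ { 0F → refl ; 1F → refl ; 2F → refl ; (suc (suc (suc i))) → refl } })
                    dg)))

    d-justified : Def (Graph f) → Def (Graph g) → Def Justified
    d-justified df dg = d-iff (λ { (x ∷ i ∷ a ∷ b ∷ c ∷ y ∷ n ∷ xs) p → p }) (λ { (x ∷ i ∷ a ∷ b ∷ c ∷ y ∷ n ∷ xs) p → p })
      (d-or (d-ren (λ { (x ∷ i ∷ a ∷ b ∷ c ∷ y ∷ n ∷ xs) → a ∷ b ∷ i ∷ x ∷ [] })
                   (λ { 0F → 2F ; 1F → 3F ; 2F → 1F ; 3F → 0F })
                   (λ { (x ∷ i ∷ a ∷ b ∷ c ∷ y ∷ n ∷ xs) → λ { 0F → refl ; 1F → refl ; 2F → refl ; 3F → refl } })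
                   d-nonmember)
      (d-or (d-and (d-eq (var 1F) (numeral 0))
                   (d-ren (λ { (x ∷ i ∷ a ∷ b ∷ c ∷ y ∷ n ∷ xs) → x ∷ xs }) (λ { 0F → 0F ; (suc i) → 7 ↑ʳ i })
                          (λ { (x ∷ i ∷ a ∷ b ∷ c ∷ y ∷ n ∷ xs) → λ { 0F → refl ; (suc i) → refl } }) df))
            (d-ex (d-ex (d-step dg)))))

    d-trace : Def (Graph f) → Def (Graph g) → Def Trace
    d-trace df dg = d-iff (λ { (a ∷ b ∷ c ∷ y ∷ n ∷ xs) p → p }) (λ { (a ∷ b ∷ c ∷ y ∷ n ∷ xs) p → p })
      (d-and (d-ren (λ { (a ∷ b ∷ c ∷ y ∷ n ∷ xs) → a ∷ b ∷ c ∷ n ∷ y ∷ [] })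
                    (λ { 0F → 0F ; 1F → 1F ; 2F → 2F ; 3F → 4F ; 4F → 3F })
                    (λ { (a ∷ b ∷ c ∷ y ∷ n ∷ xs) → λ { 0F → refl ; 1F → refl ; 2F → refl ; 3F → refl ; 4F → refl } })
                    d-recorded)
             (d-all 4F (d-all 3F (d-justified df dg))))

    d-prec : Def (Graph f) → Def (Graph g) → Def (Graph (prec f g))
    d-prec df dg = d-iff to from (d-ex (d-ex (d-ex (d-trace df dg))))
      where
      to : ∀ ρ → ∃[ c ] ∃[ b ] ∃[ a ] Trace (a ∷ b ∷ c ∷ ρ) → Graph (prec f g) ρ
      to (y ∷ n ∷ xs) (c , b , a , rec , just) = trace⇒eval {y₀ = y} {n} just n ≤-refl y rec
      from : ∀ ρ → Graph (prec f g) ρ → ∃[ c ] ∃[ b ] ∃[ a ] Trace (a ∷ b ∷ c ∷ ρ)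
      from (y ∷ n ∷ xs) d = eval⇒trace n d

  module _ {k : ℕ} (f : Program (suc k)) where

    NonZeroAt : Vec ℕ (4 + k) → Set
    NonZeroAt (z ∷ y ∷ i ∷ o ∷ xs) = y ≡ suc z × Eval ∅ f (i ∷ xs) y

    d-mu : Def (Graph f) → Def (Graph (mu f))
    d-mu df = d-iff to from
      -- The bounded quantifier includes the bound itself, which the alternative of equality exempts
      -- from having a nonzero value.
      (d-and (d-all 0F (d-or (d-eq (var 0F) (var 1F)) (d-ex (d-ex
               (d-iff {Q = NonZeroAt} (λ { (z ∷ y ∷ i ∷ o ∷ xs) p → p }) (λ { (z ∷ y ∷ i ∷ o ∷ xs) p → p })
                 (d-and (d-eq (var 1F) (S′ (var 0F)))
                        (d-ren (λ { (z ∷ y ∷ i ∷ o ∷ xs) → y ∷ i ∷ xs })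
                               (λ { 0F → 1F ; 1F → 2F ; (suc (suc j)) → 4 ↑ʳ j })
                               (λ { (z ∷ y ∷ i ∷ o ∷ xs) → λ { 0F → refl ; 1F → refl ; (suc (suc j)) → refl } }) df)))))))
             (d-ex (d-and (d-eq (var 0F) (numeral 0)) df)))
      where
      to : ∀ ρ → (∀ i → i ≤ lookup ρ 0F → i ≡ lookup ρ 0F ⊎ ∃[ y ] ∃[ z ] NonZeroAt (z ∷ y ∷ i ∷ ρ)) ×
                 ∃[ y ] (y ≡ 0 × Graph f (y ∷ ρ)) → Graph (mu f) ρ
      to (o ∷ xs) (h , .0 , refl , e) = mu below e
        where
        below : ∀ i → i < o → ∃[ z ] Eval ∅ f (i ∷ xs) (suc z)
        below i i<o with h i (<⇒≤ i<o)
        ... | inj₁ i≡o = contradiction i≡o (<⇒≢ i<o)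
        ... | inj₂ (_ , z , refl , e) = z , e
      from : ∀ ρ → Graph (mu f) ρ →
             (∀ i → i ≤ lookup ρ 0F → i ≡ lookup ρ 0F ⊎ ∃[ y ] ∃[ z ] NonZeroAt (z ∷ y ∷ i ∷ ρ)) ×
             ∃[ y ] (y ≡ 0 × Graph f (y ∷ ρ))
      from (o ∷ xs) (mu h e) = below , 0 , refl , e
        where
        below : ∀ i → i ≤ o → i ≡ o ⊎ ∃[ y ] ∃[ z ] NonZeroAt (z ∷ y ∷ i ∷ o ∷ xs)
        below i i≤o with m≤n⇒m<n∨m≡n i≤o
        ... | inj₁ i<o = inj₂ (suc (proj₁ (h i i<o)) , proj₁ (h i i<o) , refl , proj₂ (h i i<o))
        ... | inj₂ i≡o = inj₁ i≡o

  prefix : ∀ m → Vec ℕ (m + n) → Vec ℕ m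
  prefix zero    ρ       = []
  prefix (suc m) (x ∷ ρ) = x ∷ prefix m ρ

  suffix : ∀ m → Vec ℕ (m + n) → Vec ℕ n
  suffix zero    ρ       = ρ
  suffix (suc m) (x ∷ ρ) = suffix m ρ

  prefix-++ : (ys : Vec ℕ m) (ρ : Vec ℕ n) → prefix m (ys ++ ρ) ≡ ys
  prefix-++ []       ρ = refl
  prefix-++ (y ∷ ys) ρ = cong (y ∷_) (prefix-++ ys ρ)

  suffix-++ : (ys : Vec ℕ m) (ρ : Vec ℕ n) → suffix m (ys ++ ρ) ≡ ρ
  suffix-++ []       ρ = refl
  suffix-++ (y ∷ ys) ρ = suffix-++ ys ρ

  lookup-prefix : ∀ m (ρ : Vec ℕ (m + n)) i → lookup (prefix m ρ) i ≡ lookup ρ (i ↑ˡ n)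
  lookup-prefix (suc m) (x ∷ ρ) zero    = refl
  lookup-prefix (suc m) (x ∷ ρ) (suc i) = lookup-prefix m ρ i

  lookup-suffix : ∀ m (ρ : Vec ℕ (m + n)) i → lookup (suffix m ρ) i ≡ lookup ρ (m ↑ʳ i)
  lookup-suffix zero    ρ       i = refl
  lookup-suffix (suc m) (x ∷ ρ) i = lookup-suffix m ρ i

  lookup-tail : (ρ : Vec ℕ (suc n)) (i : Fin n) → lookup (tail ρ) i ≡ lookup ρ (suc i)
  lookup-tail (x ∷ ρ) i = refl

  -- The environment consists of the `m` intermediate values, the final output and the arguments;
  -- `tail` removes the output.
  splitGraphs : ∀ {k m} (gs : Vec (Program k) m) → Vec ℕ (m + suc k) → Set
  splitGraphs {k} {m} gs ρ = Evals ∅ gs (tail (suffix m ρ)) (prefix m ρ)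

  mutual
    d-graph : ∀ {k} (p : Program k) → Def (Graph p)
    d-graph zero = d-iff (λ { (_ ∷ []) refl → zero }) (λ { (_ ∷ []) zero → refl }) (d-eq (var 0F) (numeral 0))
    d-graph succ = d-iff (λ { (_ ∷ x ∷ []) refl → succ }) (λ { (_ ∷ x ∷ []) succ → refl }) (d-eq (var 0F) (S′ (var 1F)))
    d-graph (proj i) = d-iff (λ { (_ ∷ xs) refl → proj }) (λ { (_ ∷ xs) proj → refl }) (d-eq (var 0F) (var (suc i)))
    d-graph oracle = d-iff (λ { (_ ∷ x ∷ []) refl → oracle-∉ (λ ()) }) (λ { (_ ∷ x ∷ []) (oracle-∉ _) → refl })
                           (d-eq (var 0F) (numeral 0))
    d-graph (prec f g) = d-prec f g (d-graph f) (d-graph g)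
    d-graph (mu f) = d-mu f (d-graph f)
    d-graph {k} (comp {m = m} f gs) = d-iff to from
      (d-exⁿ m (d-and (d-graphs gs)
        (d-ren outputs r match (d-graph f))))
      where
      outputs : Vec ℕ (m + suc k) → Vec ℕ (suc m)
      outputs ρ = lookup ρ (m ↑ʳ zero) ∷ prefix m ρ
      r : Fin (suc m) → Fin (m + suc k)
      r zero    = m ↑ʳ zero
      r (suc i) = i ↑ˡ suc k
      match : ∀ ρ → Matches r (outputs ρ) ρ
      match ρ zero    = refl
      match ρ (suc i) = lookup-prefix m ρ i
      to : ∀ ρ → ∃[ ys ] (splitGraphs gs (ys ++ ρ) × Graph f (outputs (ys ++ ρ))) → Graph (comp f gs) ρ
      to (y ∷ xs) (ys , es , e) rewrite prefix-++ ys (y ∷ xs) | suffix-++ ys (y ∷ xs) | lookup-++ʳ ys (y ∷ xs) zero = comp es e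
      from : ∀ ρ → Graph (comp f gs) ρ → ∃[ ys ] (splitGraphs gs (ys ++ ρ) × Graph f (outputs (ys ++ ρ)))
      from (y ∷ xs) (comp {ys = ys} es e) = ys , claim
        where
        claim : splitGraphs gs (ys ++ y ∷ xs) × Graph f (outputs (ys ++ y ∷ xs))
        claim rewrite prefix-++ ys (y ∷ xs) | suffix-++ ys (y ∷ xs) | lookup-++ʳ ys (y ∷ xs) zero = es , e

    d-graphs : ∀ {k m} (gs : Vec (Program k) m) → Def (splitGraphs gs)
    d-graphs [] = d-iff (λ ρ _ → []) (λ ρ _ → refl) (d-eq (numeral 0) (numeral 0))
    d-graphs {k} {suc m} (g ∷ gs) = d-iff to from
      (d-and (d-ren headGraph r match (d-graph g)) (d-ren tail suc (λ { (_ ∷ ρ) i → refl }) (d-graphs gs)))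
      where
      headGraph : Vec ℕ (suc m + suc k) → Vec ℕ (suc k)
      headGraph (y ∷ ρ) = y ∷ tail (suffix m ρ)
      r : Fin (suc k) → Fin (suc m + suc k)
      r zero    = zero
      r (suc i) = suc (m ↑ʳ suc i)
      match : ∀ ρ → Matches r (headGraph ρ) ρ
      match (y ∷ ρ) zero    = refl
      match (y ∷ ρ) (suc i) = trans (lookup-tail (suffix m ρ) i) (lookup-suffix m ρ (suc i))
      to : ∀ ρ → Graph g (headGraph ρ) × splitGraphs gs (tail ρ) → splitGraphs (g ∷ gs) ρ
      to (y ∷ ρ) (e , es) = e ∷ es
      from : ∀ ρ → splitGraphs (g ∷ gs) ρ → Graph g (headGraph ρ) × splitGraphs gs (tail ρ)
      from (y ∷ ρ) (e ∷ es) = e , es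

-- Operations on formula codes, many-one reductions and enumerators

module FormulaCodes where

  open Computability
  open Pairing

  -- Opaque, since unfolding nested applications of pair is infeasible.

  opaque
    impᶜ eqᶜ : ℕ → ℕ → ℕ
    impᶜ a b = pair 3 (pair a b)
    eqᶜ a b  = pair 0 (pair a b)

    allᶜ : ℕ → ℕ
    allᶜ a = pair 4 a

    botᶜ : ℕ
    -- This is `pair 2 0`, the code of falsity.
    botᶜ = 3

    impᶜ-<ˡ : ∀ a b → a < impᶜ a b
    impᶜ-<ˡ a b = ≤-<-trans (m≤pair a b) (n<pair-suc 2 (pair a b))

    impᶜ-<ʳ : ∀ a b → b < impᶜ a b
    impᶜ-<ʳ a b = ≤-<-trans (n≤pair a b) (n<pair-suc 2 (pair a b))

  notᶜ exᶜ : ℕ → ℕ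
  notᶜ a = impᶜ a botᶜ
  exᶜ a  = notᶜ (allᶜ (notᶜ a))

  andᶜ orᶜ : ℕ → ℕ → ℕ
  andᶜ a b = notᶜ (impᶜ a (notᶜ b))
  orᶜ a b  = impᶜ (notᶜ a) b

  module _ {L : Language} {n : ℕ} where
    opaque
      unfolding impᶜ
      ⌜⇒⌝ : ∀ (χ : Formula L n) {φ ψ} → χ ≡ (φ ⇒ ψ) → ⌜ χ ⌝ ≡ impᶜ ⌜ φ ⌝ ⌜ ψ ⌝
      ⌜⇒⌝ χ refl = refl

      ⌜≐⌝ : ∀ (t s : Term L n) → ⌜ t ≐ s ⌝ ≡ eqᶜ ⌜ t ⌝ᵗ ⌜ s ⌝ᵗ
      ⌜≐⌝ t s = refl

      ⌜∀⌝ : ∀ (φ : Formula L (suc n)) → ⌜ ∀′ φ ⌝ ≡ allᶜ ⌜ φ ⌝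
      ⌜∀⌝ φ = refl

      ⌜⊥⌝ : ⌜ ⊥′ {L} {n} ⌝ ≡ botᶜ
      ⌜⊥⌝ = refl

    ⌜¬⌝ : ∀ (φ : Formula L n) → ⌜ ¬′ φ ⌝ ≡ notᶜ ⌜ φ ⌝
    ⌜¬⌝ φ = trans (⌜⇒⌝ (¬′ φ) {φ} {⊥′} refl) (cong (impᶜ ⌜ φ ⌝) ⌜⊥⌝)

    ⌜∧⌝ : ∀ (φ ψ : Formula L n) → ⌜ φ ∧′ ψ ⌝ ≡ andᶜ ⌜ φ ⌝ ⌜ ψ ⌝
    ⌜∧⌝ φ ψ = trans (⌜⇒⌝ (φ ∧′ ψ) {φ ⇒ ¬′ ψ} {⊥′} refl)
      (cong₂ impᶜ (trans (⌜⇒⌝ (φ ⇒ ¬′ ψ) refl) (cong (impᶜ ⌜ φ ⌝) (⌜¬⌝ ψ))) ⌜⊥⌝)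

  ⌜∃⌝ : ∀ {L n} (φ : Formula L (suc n)) → ⌜ ∃′ φ ⌝ ≡ exᶜ ⌜ φ ⌝
  ⌜∃⌝ {L} {n} φ = trans (⌜⇒⌝ (∃′ φ) {∀′ (¬′ φ)} {⊥′} refl)
    (cong₂ impᶜ (trans (⌜∀⌝ (¬′ φ)) (cong allᶜ (⌜¬⌝ φ))) (⌜⊥⌝ {L} {n}))

  module _ {O : Pred ℕ 0ℓ} where
    opaque
      unfolding impᶜ
      c-imp : Comp₂ O impᶜ
      c-imp = comp₂ (ap₂ c-pair (const 3) (ap₂ c-pair (v 0F) (v 1F)))
      c-eqᶜ : Comp₂ O eqᶜ
      c-eqᶜ = comp₂ (ap₂ c-pair (const 0) (ap₂ c-pair (v 0F) (v 1F)))
      c-allᶜ : Comp₁ O allᶜ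
      c-allᶜ = comp₁ (ap₂ c-pair (const 4) (v 0F))

    c-notᶜ : Comp₁ O notᶜ
    c-notᶜ = comp₁ (ap₂ c-imp (v 0F) (const botᶜ))
    c-exᶜ : Comp₁ O exᶜ
    c-exᶜ = comp₁ (ap₁ c-notᶜ (ap₁ c-allᶜ (ap₁ c-notᶜ (v 0F))))
    c-andᶜ : Comp₂ O andᶜ
    c-andᶜ = comp₂ (ap₁ c-notᶜ (ap₂ c-imp (v 0F) (ap₁ c-notᶜ (v 1F))))
    c-orᶜ : Comp₂ O orᶜ
    c-orᶜ = comp₂ (ap₂ c-imp (ap₁ c-notᶜ (v 0F)) (v 1F))

  ≤ᵐ⇒≤ᵀ : ∀ {A B : Pred ℕ 0ℓ} {f} → Comp₁ B f → (∀ {n} → A n → B (f n)) → (∀ {n} → B (f n) → A n) → A ≤ᵀ B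
  ≤ᵐ⇒≤ᵀ (comp₁ (computes p r)) to from = comp oracle (p ∷ []) , λ n →
    (λ a → comp (r (n ∷ []) ∷ []) (oracle-∈ (to a))) ,
    (λ ¬a → comp (r (n ∷ []) ∷ []) (oracle-∉ (λ b → ¬a (from b))))

  module _ {k : ℕ} {b : Vec ℕ (suc k) → Bool} (cb : CompB ∅ b) where

    enumerator : Program k
    enumerator = mu (program (bodyᵇ (c-not cb)))

    enumerator-halts : ∀ {xs} → ∃[ n ] b (n ∷ xs) ≡ true → ∃[ y ] Eval ∅ enumerator xs y
    enumerator-halts {xs} h with least (λ n → b (n ∷ xs)) h
    ... | n , bn , below = n , mu
      (λ i i<n → 0 , subst (λ c → Eval ∅ _ (i ∷ xs) ⟨ not c ⟩) (below i i<n) (runs (bodyᵇ (c-not cb)) (i ∷ xs)))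
      (subst (λ c → Eval ∅ _ (n ∷ xs) ⟨ not c ⟩) bn (runs (bodyᵇ (c-not cb)) (n ∷ xs)))

    enumerator-sound : ∀ {xs} → ∃[ y ] Eval ∅ enumerator xs y → ∃[ n ] b (n ∷ xs) ≡ true
    enumerator-sound {xs} (n , mu _ e) = n , zero⇒true (Eval-deterministic (runs (bodyᵇ (c-not cb)) (n ∷ xs)) e)
      where
      zero⇒true : ∀ {c} → ⟨ not c ⟩ ≡ 0 → c ≡ true
      zero⇒true {true} _ = refl

-- Σ₁-completeness of `𝐑` and the reduction of the halting problem

module RobinsonArithmetic where

  open Computability
  open Pairing
  open RuleSystems
  open UniversalMachine
  open FirstOrderLogic
  open Arithmetic
  open FormulaCodes

  numeral-closed : ∀ {n m} (σ : Fin n → Term Arith m) k → substᵗ σ (numeral k) ≡ numeral k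
  numeral-closed σ zero    = refl
  numeral-closed σ (suc k) = cong (λ t → func `S (t ∷ [])) (numeral-closed σ k)

  weaken-instantiate : ∀ {n} (s t : Term Arith n) → substᵗ (instantiation s) (substᵗ (λ i → var (suc i)) t) ≡ t
  weaken-instantiate s t = trans (substᵗ-substᵗ (instantiation s) (λ i → var (suc i)) t) (substᵗ-var t)
    where
    mutual
      substᵗ-var : ∀ {n} (t : Term Arith n) → substᵗ var t ≡ t
      substᵗ-var (var i)     = refl
      substᵗ-var (func f ts) = cong (func f) (substᵗˢ-var ts)
      substᵗˢ-var : ∀ {n k} (ts : Vec (Term Arith n) k) → substᵗˢ var ts ≡ ts
      substᵗˢ-var []       = refl
      substᵗˢ-var (t ∷ ts) = cong₂ _∷_ (substᵗ-var t) (substᵗˢ-var ts)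

  infix 3 R⊢_
  -- Quantifying over the context does the work of a weakening rule.
  R⊢_ : ∀ {m} → Formula Arith m → Set
  R⊢_ {m} φ = ∀ {Γ : List (Formula Arith m)} → RAxiom ∣ Γ ⊢ φ

  module _ {m : ℕ} where

    private variable
      Γ : List (Formula Arith m)
      t s u : Term Arith m
      φ ψ : Formula Arith m

    ≐-sym : RAxiom ∣ Γ ⊢ t ≐ s → RAxiom ∣ Γ ⊢ s ≐ t
    ≐-sym {Γ} {t} {s} d = subst (λ t′ → RAxiom ∣ Γ ⊢ s ≐ t′) (weaken-instantiate s t)
      (≐-subst (var zero ≐ substᵗ (λ i → var (suc i)) t) d
        (subst (λ t′ → RAxiom ∣ Γ ⊢ t ≐ t′) (sym (weaken-instantiate t t)) ≐-refl))

    ≐-trans : RAxiom ∣ Γ ⊢ t ≐ s → RAxiom ∣ Γ ⊢ s ≐ u → RAxiom ∣ Γ ⊢ t ≐ u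
    ≐-trans {Γ} {t} {s} {u} d e = subst (λ t′ → RAxiom ∣ Γ ⊢ t′ ≐ u) (weaken-instantiate u t)
      (≐-subst (substᵗ (λ i → var (suc i)) t ≐ var zero) e
        (subst (λ t′ → RAxiom ∣ Γ ⊢ t′ ≐ s) (sym (weaken-instantiate s t)) d))

    ∧-introᴿ : R⊢ φ → R⊢ ψ → R⊢ φ ∧′ ψ
    ∧-introᴿ p q = ⇒-intro (⇒-elim (⇒-elim (hyp (here refl)) p) q)

    ∨-introˡᴿ : R⊢ φ → R⊢ φ ∨′ ψ
    ∨-introˡᴿ p = ⇒-intro (raa (⇒-elim (hyp (there (here refl))) p))

    ∨-introʳᴿ : R⊢ ψ → R⊢ φ ∨′ ψ
    ∨-introʳᴿ q = ⇒-intro q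

    ∃-introᴿ : ∀ {φ : Formula Arith (suc m)} t → R⊢ φ [ t ] → R⊢ ∃′ φ
    ∃-introᴿ t p = ⇒-intro (⇒-elim (∀-elim t (hyp (here refl))) p)

    rename-axiom : ∀ {φ} {ψ : Formula Arith m} → RAxiom φ → rename (λ ()) φ ≡ ψ → R⊢ ψ
    rename-axiom ax e {Γ} = subst (RAxiom ∣ Γ ⊢_) e (axiom ax)

    provable-+ : ∀ k l → R⊢ numeral {m} k ⊕ numeral l ≐ numeral (k + l)
    provable-+ k l = rename-axiom (R1 k l) (cong₂ _≐_
      (cong₂ _⊕_ (numeral-closed _ k) (numeral-closed _ l)) (numeral-closed _ (k + l)))

    provable-* : ∀ k l → R⊢ numeral {m} k ⊙ numeral l ≐ numeral (k * l)
    provable-* k l = rename-axiom (R2 k l) (cong₂ _≐_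
      (cong₂ _⊙_ (numeral-closed _ k) (numeral-closed _ l)) (numeral-closed _ (k * l)))

    provable-≢ : ∀ {k l} → k ≢ l → R⊢ ¬′ (numeral {m} k ≐ numeral l)
    provable-≢ {k} {l} k≢l = rename-axiom (R3 k l k≢l) (cong ¬′_
      (cong₂ _≐_ (numeral-closed _ k) (numeral-closed _ l)))

    oneOfUpTo-subst : ∀ {n} (σ : Fin n → Term Arith m) t k → substᶠ σ (oneOfUpTo t k) ≡ oneOfUpTo (substᵗ σ t) k
    oneOfUpTo-subst σ t zero    = refl
    oneOfUpTo-subst σ t (suc k) = cong₂ _∨′_ (oneOfUpTo-subst σ t k)
      (cong (substᵗ σ t ≐_) (numeral-closed σ (suc k)))

    ≐-replaceˡ : ∀ {l r : Term Arith m} (φ : Term Arith m → Formula Arith m) (C : Formula Arith (suc m)) →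
                 (∀ x → C [ x ] ≡ φ x) → R⊢ l ≐ r → R⊢ φ r → R⊢ φ l
    ≐-replaceˡ {l} {r} φ C C≡ d p {Γ} = subst (RAxiom ∣ Γ ⊢_) (C≡ l)
      (≐-subst C (≐-sym d) (subst (RAxiom ∣ Γ ⊢_) (sym (C≡ r)) p))

    mutual
      provable-eval : ∀ {n} (t : Term Arith n) (ρ : Vec ℕ n) →
                      R⊢ substᵗ (λ i → numeral (lookup ρ i)) t ≐ numeral {m} (⟦ t ⟧ᵗ (lookup ρ))
      provable-eval (var i) ρ = ≐-refl
      provable-eval (func `0 []) ρ = ≐-refl
      provable-eval (func `S (t ∷ [])) ρ =
        ≐-replaceˡ (λ x → func `S (x ∷ []) ≐ numeral (suc k)) (func `S (var zero ∷ []) ≐ numeral (suc k))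
          (λ x → cong (func `S (x ∷ []) ≐_) (numeral-closed _ (suc k))) (provable-eval t ρ) ≐-refl
        where k = ⟦ t ⟧ᵗ (lookup ρ)
      provable-eval (func `+ (t ∷ s ∷ [])) ρ =
        provable-eval₂ _⊕_ _⊕_ (λ _ _ _ → refl) t s ρ (_+_) provable-+
      provable-eval (func `· (t ∷ s ∷ [])) ρ =
        provable-eval₂ _⊙_ _⊙_ (λ _ _ _ → refl) t s ρ (_*_) provable-*

      provable-eval₂ : ∀ {n} (_∘₁_ : Term Arith m → Term Arith m → Term Arith m)
        (_∘₂_ : Term Arith (suc m) → Term Arith (suc m) → Term Arith (suc m)) →
        (∀ x t s → substᵗ (instantiation x) (t ∘₂ s) ≡ substᵗ (instantiation x) t ∘₁ substᵗ (instantiation x) s) →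
        (t s : Term Arith n) (ρ : Vec ℕ n) (_∘₃_ : ℕ → ℕ → ℕ) →
        (∀ k l → R⊢ numeral k ∘₁ numeral l ≐ numeral (k ∘₃ l)) →
        R⊢ substᵗ (λ i → numeral (lookup ρ i)) t ∘₁ substᵗ (λ i → numeral (lookup ρ i)) s
           ≐ numeral (⟦ t ⟧ᵗ (lookup ρ) ∘₃ ⟦ s ⟧ᵗ (lookup ρ))
      provable-eval₂ _∘₁_ _∘₂_ subst-∘ t s ρ _∘₃_ compute =
        ≐-replaceˡ (λ x → x ∘₁ s′ ≐ numeral (k ∘₃ l)) (var zero ∘₂ substᵗ (λ i → var (suc i)) s′ ≐ numeral (k ∘₃ l))
          (λ x → cong₂ _≐_ (trans (subst-∘ x _ _) (cong (x ∘₁_) (weaken-instantiate x s′))) (numeral-closed _ (k ∘₃ l)))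
          (provable-eval t ρ)
          (≐-replaceˡ (λ x → numeral k ∘₁ x ≐ numeral (k ∘₃ l)) (numeral k ∘₂ var zero ≐ numeral (k ∘₃ l))
            (λ x → cong₂ _≐_ (trans (subst-∘ x _ _) (cong (_∘₁ x) (numeral-closed _ k))) (numeral-closed _ (k ∘₃ l)))
            (provable-eval s ρ) (compute k l))
        where
        k = ⟦ t ⟧ᵗ (lookup ρ)
        l = ⟦ s ⟧ᵗ (lookup ρ)
        s′ = substᵗ (λ i → numeral (lookup ρ i)) s

    -- Combined with axiom `R4` this reduces a bounded quantifier to finitely many numeral
    -- instances.
    oneOfUpTo-elim : (C : Formula Arith (suc m)) (t : Term Arith m) → ∀ k → (∀ i → i ≤ k → R⊢ C [ numeral i ]) →
                     R⊢ oneOfUpTo t k ⇒ C [ t ]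
    oneOfUpTo-elim C t zero h = ⇒-intro (≐-subst C (≐-sym (hyp (here refl))) (h 0 z≤n))
    oneOfUpTo-elim C t (suc k) h = ⇒-intro (raa (⇒-elim (hyp (here refl))
      (≐-subst C (≐-sym (⇒-elim (hyp (there (here refl)))
        (⇒-intro (⇒-elim (hyp (there (here refl)))
          (⇒-elim (oneOfUpTo-elim C t k (λ i i≤k → h i (m≤n⇒m≤1+n i≤k))) (hyp (here refl)))))))
        (h (suc k) ≤-refl))))

  numerals : ∀ {n m} → Vec ℕ n → Fin n → Term Arith m
  numerals ρ i = numeral (lookup ρ i)

  lift-numerals : ∀ {n m} (ρ : Vec ℕ n) (t : Term Arith m) φ →
                  substᶠ (lift (numerals ρ)) φ [ t ] ≡ substᶠ (t ▸ numerals ρ) φ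
  lift-numerals ρ t φ = trans (subst-subst (instantiation t) (lift (numerals ρ)) φ) (subst-cong eq φ)
    where
    eq : ∀ i → substᵗ (instantiation t) (lift (numerals ρ) i) ≡ (t ▸ numerals ρ) i
    eq zero    = refl
    eq (suc i) = weaken-instantiate t (numerals ρ i)

  lift-numerals-var : ∀ {n m} (ρ : Vec ℕ n) φ →
                      substᶠ (var zero ▸ numerals ρ) φ ≡ substᶠ (lift (numerals {m = m} ρ)) φ
  lift-numerals-var ρ = subst-cong λ { zero → refl ; (suc i) → sym (numeral-closed _ (lookup ρ i)) }

  numerals-∷ : ∀ {n m} x (ρ : Vec ℕ n) φ → substᶠ (numeral x ▸ numerals {m = m} ρ) φ ≡ substᶠ (numerals (x ∷ ρ)) φ
  numerals-∷ x ρ = subst-cong λ { zero → refl ; (suc i) → refl }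

  -- Once `R1` and `R2` have evaluated terms to numerals, `R3` settles the negated equations; `R4`
  -- settles the bounded quantifiers.
  Σ₁-complete : ∀ {n m} (φ : Σ₁ n) ρ → True φ ρ → R⊢ substᶠ {m = m} (numerals ρ) (formula φ)
  Σ₁-complete (equal t s) ρ e = ≐-trans (provable-eval t ρ)
    (subst (λ k → RAxiom ∣ _ ⊢ numeral k ≐ _) (sym e) (≐-sym (provable-eval s ρ)))
  Σ₁-complete (unequal t s) ρ ne = ⇒-intro (⇒-elim (provable-≢ ne)
    (≐-trans (≐-sym (provable-eval t ρ)) (≐-trans (hyp (here refl)) (provable-eval s ρ))))
  Σ₁-complete (and φ ψ) ρ (p , q) = ∧-introᴿ (Σ₁-complete φ ρ p) (Σ₁-complete ψ ρ q)
  Σ₁-complete (or φ ψ) ρ (inj₁ p) = ∨-introˡᴿ (Σ₁-complete φ ρ p)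
  Σ₁-complete (or φ ψ) ρ (inj₂ q) = ∨-introʳᴿ (Σ₁-complete ψ ρ q)
  Σ₁-complete (ex φ) ρ (x , p) = ∃-introᴿ (numeral x)
    (subst (RAxiom ∣ _ ⊢_) (sym (trans (lift-numerals ρ (numeral x) (formula φ)) (numerals-∷ x ρ (formula φ))))
      (Σ₁-complete φ (x ∷ ρ) p))
  Σ₁-complete {m = m} (all i φ) ρ h = ∀-intro (⇒-intro
      (subst (RAxiom ∣ _ ⊢_) (trans (lift-numerals ρ (var zero) (formula φ)) (lift-numerals-var ρ (formula φ)))
        (⇒-elim (oneOfUpTo-elim C (var zero) k cases) oneOf)))
    where
    k = lookup ρ i
    C : Formula Arith (suc (suc m))
    C = substᶠ (lift (numerals ρ)) (formula φ)
    cases : ∀ x → x ≤ k → R⊢ C [ numeral x ]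
    cases x x≤k = subst (RAxiom ∣ _ ⊢_)
      (sym (trans (lift-numerals ρ (numeral x) (formula φ)) (numerals-∷ x ρ (formula φ)))) (Σ₁-complete φ (x ∷ ρ) (h x x≤k))
    bounded : R⊢ ∀′ (var zero ≤′ numeral k ⇒ oneOfUpTo {suc (suc m)} (var zero) k)
    bounded = rename-axiom (R4 k) (cong ∀′ (cong₂ _⇒_
      (cong (var zero ≤′_) (numeral-closed _ k)) (oneOfUpTo-subst _ (var zero) k)))
    oneOf : ∀ {Γ} → RAxiom ∣ var zero ≤′ substᵗ (λ i → var (suc i)) (numeral k) ∷ Γ ⊢ oneOfUpTo {suc m} (var zero) k
    oneOf {Γ} = subst (λ ψ → RAxiom ∣ var zero ≤′ substᵗ (λ i → var (suc i)) (numeral k) ∷ Γ ⊢ ψ)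
      (oneOfUpTo-subst (instantiation (var zero)) (var zero) k)
      (⇒-elim (∀-elim (var zero) bounded) (hyp (here (cong (var zero ≤′_)
        (trans (numeral-closed (instantiation (var zero)) k) (sym (numeral-closed (λ i → var (suc i)) k)))))))

  numeral-value : ∀ {n} k (ρ : Fin n → ℕ) → ⟦ numeral k ⟧ᵗ ρ ≡ k
  numeral-value zero    ρ = refl
  numeral-value (suc k) ρ = cong suc (numeral-value k ρ)

  oneOfUpTo-true : ∀ {n} (t : Term Arith n) k ρ → ⟦ t ⟧ᵗ ρ ≤ k → ℕ-Sat.Sat (oneOfUpTo t k) ρ
  oneOfUpTo-true t zero    ρ h = n≤0⇒n≡0 h
  oneOfUpTo-true t (suc k) ρ h ¬p with m≤n⇒m<n∨m≡n h
  ... | inj₁ lt = ⊥-elim (¬p (oneOfUpTo-true t k ρ (s≤s⁻¹ lt)))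
  ... | inj₂ e  = trans e (sym (numeral-value (suc k) ρ))

  RAxiom-true : ∀ {φ} → RAxiom φ → ℕ-Sat.Sat φ (λ ())
  RAxiom-true (R1 m n) = trans (cong₂ _+_ (numeral-value m _) (numeral-value n _)) (sym (numeral-value (m + n) _))
  RAxiom-true (R2 m n) = trans (cong₂ _*_ (numeral-value m _) (numeral-value n _)) (sym (numeral-value (m * n) _))
  RAxiom-true (R3 m n m≢n) e = m≢n (trans (sym (numeral-value m _)) (trans e (numeral-value n _)))
  RAxiom-true (R4 n) x x≤ = oneOfUpTo-true (var zero) n (x ▸ (λ ())) (subst (x ≤_) (numeral-value n _) x≤)
  RAxiom-true (R5 n) x x≰ with ≤-total x n
  ... | inj₁ x≤n = ⊥-elim (x≰ (subst (x ≤_) (sym (numeral-value n _)) x≤n))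
  ... | inj₂ n≤x = subst (_≤ x) (sym (numeral-value n _)) n≤x

  c-numeral : ∀ {O} → Comp₁ O (λ k → ⌜ numeral {0} k ⌝ᵗ)
  c-numeral = comp₁ (ext (λ { (k ∷ []) → eq′ k })
      -- 1 is the code of `numeral 0`, and 4 is `pair 1 1`, the arity and number of the successor
      -- symbol.
      (c-rec (const 1) (ap₂ c-pair (const 1) (ap₂ c-pair (const 4) (ap₂ c-cons (v 1F) (const 0)))) (v 0F)))
    where
    eq′ : ∀ k → natrec 1 (λ _ r → pair 1 (pair 4 (cons r 0))) k ≡ ⌜ numeral {0} k ⌝ᵗ
    eq′ zero    = refl
    eq′ (suc k) = cong (λ r → pair 1 (pair 4 (cons r 0))) (eq′ k)

  numeral-code : ∀ n k → ⌜ numeral {n} k ⌝ᵗ ≡ ⌜ numeral {0} k ⌝ᵗ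
  numeral-code n zero    = refl
  numeral-code n (suc k) = cong (λ r → pair 1 (pair 4 (cons r 0))) (numeral-code n k)

  module _ (em : ExcludedMiddle 0ℓ) where

    theorem-code : ∀ (φ : Sentence Arith) {c} → ⌜ φ ⌝ ≡ c → 𝐑 ⊢ φ → Theorems 𝐑 c
    theorem-code φ e d = φ , e , d

    code-theorem : ∀ (φ : Sentence Arith) {c} → ⌜ φ ⌝ ≡ c → Theorems 𝐑 c → 𝐑 ⊢ φ
    code-theorem φ e (ψ , ψ≡ , d) = subst (𝐑 ⊢_) (⌜⌝-injective ψ φ (trans ψ≡ (sym e))) d

    module _ (φ : Σ₁ 1) where
      -- The argument is fixed by an equation instead of being substituted into `φ`; thus only the
      -- code of the numeral varies with `e`, and no substitution has to be computed on codes.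
      instanceΣ₁ : ℕ → Σ₁ 0
      instanceΣ₁ e = ex (and (equal (var zero) (numeral e)) φ)

      instanceᶜ : ℕ → ℕ
      instanceᶜ e = exᶜ (andᶜ (eqᶜ 0 ⌜ numeral {0} e ⌝ᵗ) ⌜ formula φ ⌝)

      instance-code : ∀ e → ⌜ formula (instanceΣ₁ e) ⌝ ≡ instanceᶜ e
      instance-code e = trans (⌜∃⌝ ((var zero ≐ numeral e) ∧′ formula φ))
        (cong exᶜ (trans (⌜∧⌝ (var zero ≐ numeral e) (formula φ))
          (cong (λ c → andᶜ c ⌜ formula φ ⌝) (trans (⌜≐⌝ (var zero) (numeral e)) (cong (eqᶜ 0) (numeral-code 1 e))))))

      c-instance : ∀ {O} → Comp₁ O instanceᶜ
      c-instance = comp₁ (ap₁ c-exᶜ (ap₂ c-andᶜ (ap₂ c-eqᶜ (const 0) (ap₁ c-numeral (v 0F))) (const ⌜ formula φ ⌝)))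

      instance-complete : ∀ {e} → True φ (e ∷ []) → 𝐑 ⊢ formula (instanceΣ₁ e)
      instance-complete {e} p = subst (RAxiom ∣ [] ⊢_) (closed-id (formula (instanceΣ₁ e)))
        (Σ₁-complete (instanceΣ₁ e) [] (e , sym (numeral-value e _) , p))
        where
        closed-id : ∀ (ψ : Sentence Arith) → substᶠ (numerals []) ψ ≡ ψ
        closed-id ψ = ⌜⌝-injective _ _ (trans (subst-code (numerals []) (λ ()) (λ ()) ψ) (renameᶜ-id (λ ()) (λ ()) ψ))

      instance-sound : ∀ {e} → 𝐑 ⊢ formula (instanceΣ₁ e) → True φ (e ∷ [])
      instance-sound {e} d with formula-true em (instanceΣ₁ e) []
          (ℕ-Sat.Sat-cong (formula (instanceΣ₁ e)) (λ ()) (ℕ-Sat.soundness em RAxiom-true d (λ ()) (λ ())))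
      ... | x , x≡ , p = subst (λ y → True φ (y ∷ [])) (trans x≡ (numeral-value e _)) p

      -- Provability of the instances coincides with truth: one direction is Σ₁-completeness, the
      -- other soundness in the standard model.
      Σ₁≤𝐑 : (λ e → True φ (e ∷ [])) ≤ᵀ Theorems 𝐑
      Σ₁≤𝐑 = ≤ᵐ⇒≤ᵀ c-instance
        (λ {e} p → theorem-code (formula (instanceΣ₁ e)) (instance-code e) (instance-complete p))
        (λ {e} h → instance-sound (code-theorem (formula (instanceΣ₁ e)) (instance-code e) h))

    domain≤𝐑 : ∀ (p : Program 1) → (λ e → ∃[ y ] Eval ∅ p (e ∷ []) y) ≤ᵀ Theorems 𝐑
    domain≤𝐑 p = ≤ᵀ-trans (≤ᵐ⇒≤ᵀ {f = id} (comp₁ (v 0F)) to from) (Σ₁≤𝐑 (ex (Def.defn (d-graph p))))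
      where
      to : ∀ {e} → ∃[ y ] Eval ∅ p (e ∷ []) y → True (ex (Def.defn (d-graph p))) (e ∷ [])
      to (y , d) = y , Def.defn⇐ (d-graph p) _ d
      from : ∀ {e} → True (ex (Def.defn (d-graph p))) (e ∷ []) → ∃[ y ] Eval ∅ p (e ∷ []) y
      from (y , d) = y , Def.defn⇒ (d-graph p) _ d

    -- An unbounded search for a stage makes the set the domain of a program, and domains of
    -- programs are Σ₁.
    enumerable≤𝐑 : ∀ {A : Pred ℕ 0ℓ} (b : Vec ℕ 2 → Bool) → CompB ∅ b →
                   (∀ {e} → A e → ∃[ n ] b (n ∷ e ∷ []) ≡ true) → (∀ {e} n → b (n ∷ e ∷ []) ≡ true → A e) → A ≤ᵀ Theorems 𝐑
    enumerable≤𝐑 {A} b cb to from = ≤ᵀ-trans (≤ᵐ⇒≤ᵀ {A} {Domain} {id} (comp₁ (v 0F)) to′ from′) (domain≤𝐑 (enumerator cb))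
      where
      Domain : Pred ℕ 0ℓ
      Domain e = ∃[ y ] Eval ∅ (enumerator cb) (e ∷ []) y
      to′ : ∀ {e} → A e → Domain e
      to′ a = enumerator-halts cb (to a)
      from′ : ∀ {e} → Domain e → A e
      from′ h with enumerator-sound cb h
      ... | n , bn = from n bn

    halting≤𝐑 : Halting ≤ᵀ Theorems 𝐑
    halting≤𝐑 = enumerable≤𝐑 (λ xs → by (lookup xs 0F) (7 ∷ lookup xs 1F ∷ [])) (c-by (v 0F) (halts (V 1F)))
      (proj₁ halting⇔stage) (proj₂ halting⇔stage)
      where open Evaluation

-- Equivalence relations with prescribed class sizes and the Ehrenfeucht-Fraïssé game

module ClassSizes where

  open Pairing
  open FirstOrderLogic

  data ERel : ℕ → Set where
    E : ERel 2

  Lᴱ : Language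
  Lᴱ = record
    { Func          = λ _ → ⊥
    ; Rel           = ERel
    ; ⌜_⌝ᶠ          = λ ()
    ; ⌜_⌝ʳ          = λ _ → 0
    ; ⌜⌝ᶠ-injective = λ { {f = ()} }
    ; ⌜⌝ʳ-injective = λ { {r = E} {E} _ → refl }
    }

  -- Elements have a class and an index.  The class c is infinite when X c
  -- is false; when X c is true, indices beyond c are identified with c, so
  -- that the class has c + 1 elements.
  record Structure : Set₁ where
    field
      X       : ℕ → Bool
      Element : Set
      cls idx : Element → ℕ
      point   : Element

    index : Element → ℕ
    index x = if X (cls x) then idx x ⊓ cls x else idx x

    _~_ : Element → Element → Set
    x ~ y = cls x ≡ cls y × index x ≡ index y

    ~-sym : ∀ {x y} → x ~ y → y ~ x
    ~-sym (p , q) = sym p , sym q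

    ~-trans : ∀ {x y z} → x ~ y → y ~ z → x ~ z
    ~-trans (p , q) (p′ , q′) = trans p p′ , trans q q′

    model : Model Lᴱ
    model = record
      { Carrier       = Element
      ; _≈_           = _~_
      ; isEquivalence = record { refl = refl , refl ; sym = ~-sym ; trans = ~-trans }
      ; funcᴹ         = λ ()
      ; relᴹ          = λ { E (x ∷ y ∷ []) → cls x ≡ cls y }
      ; func-cong     = λ ()
      ; rel-cong      = λ { E (p ∷ q ∷ []) r → trans (sym (proj₁ p)) (trans r (proj₁ q)) }
      ; point         = point
      }

    open Satisfaction model public

    -- Enough elements for k rounds of the Ehrenfeucht–Fraïssé game.
    Rich : ℕ → Set
    Rich k = ∀ c i → c ≤ k + k ⊎ ∃[ e ] cls e ≡ c → i ≤ k + k → ∃[ d ] cls d ≡ c × idx d ≡ i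

    -- These classes have at most `k` elements and are recognisable by their size. In a rich
    -- structure all other classes have more than `k` elements, so `k` rounds never exhaust them.
    Rigid : ℕ → Element → Set
    Rigid k x = cls x < k × X (cls x) ≡ true

  -- Pigeonhole: otherwise choosing, for each number up to `n`, an argument of `f` that hits it
  -- would inject `n + 1` numbers into `n` arguments.
  fresh : ∀ {n} (f : Fin n → ℕ) → ∃[ i ] i ≤ n × (∀ l → f l ≢ i)
  fresh {n} f with any? (λ (i : Fin (suc n)) → all? (λ l → ¬? (f l ≟ toℕ i)))
  ... | yes (i , h) = toℕ i , s≤s⁻¹ (toℕ<n i) , h
  ... | no  none    = contradiction (proj₂ (proj₂ (proj₂ collision))) (λ e → distinct (proj₁ (proj₂ (proj₂ collision))) e)
    where
    hit : ∀ (i : Fin (suc n)) → ∃[ l ] f l ≡ toℕ i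
    hit i with any? (λ l → f l ≟ toℕ i)
    ... | yes h = h
    ... | no ¬h = contradiction (i , λ l e → ¬h (l , e)) none
    collision = pigeonhole (n<1+n n) (λ i → proj₁ (hit i))
    distinct : ∀ {i j} → toℕ i < toℕ j → proj₁ (hit i) ≢ proj₁ (hit j)
    distinct {i} {j} i<j e = <⇒≢ i<j (trans (sym (proj₂ (hit i))) (trans (cong f e) (proj₂ (hit j))))

  depth : ∀ {L n} → Formula L n → ℕ
  depth (t ≐ s)    = 0
  depth (rel r ts) = 0
  depth ⊥′         = 0
  depth (φ ⇒ ψ)    = depth φ ⊔ depth ψ
  depth (∀′ φ)     = suc (depth φ)

  -- Lets the code of a sentence serve as the number of rounds, which saves computing depths from
  -- codes.
  depth≤code : ∀ {L n} (φ : Formula L n) → depth φ ≤ ⌜ φ ⌝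
  depth≤code (t ≐ s)    = z≤n
  depth≤code (rel r ts) = z≤n
  depth≤code ⊥′         = z≤n
  depth≤code (φ ⇒ ψ)    = ≤-trans (⊔-lub (≤-trans (depth≤code φ) (m≤pair ⌜ φ ⌝ ⌜ ψ ⌝))
    (≤-trans (depth≤code ψ) (n≤pair ⌜ φ ⌝ ⌜ ψ ⌝))) (n≤pair 3 (pair ⌜ φ ⌝ ⌜ ψ ⌝))
  depth≤code (∀′ φ)     = ≤-trans (s≤s (depth≤code φ)) (n<pair-suc 3 ⌜ φ ⌝)

  module Game (em : ExcludedMiddle 0ℓ) (k : ℕ) where

    open Structure

    Alike : (S T : Structure) → Element S → Element T → Set
    Alike S T x y = cls S x ≡ cls T y × index S x ≡ index T y

    -- A partial isomorphism under which rigid elements keep class number and index. The class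
    -- number is forced, being visible as the size of the class; keeping the index makes the answer
    -- to a rigid move canonical.
    record Similar (S T : Structure) {n : ℕ} (a : Fin n → Element S) (b : Fin n → Element T) : Set where
      field
        class⇒ : ∀ i j → cls S (a i) ≡ cls S (a j) → cls T (b i) ≡ cls T (b j)
        class⇐ : ∀ i j → cls T (b i) ≡ cls T (b j) → cls S (a i) ≡ cls S (a j)
        equal⇒ : ∀ i j → _~_ S (a i) (a j) → _~_ T (b i) (b j)
        equal⇐ : ∀ i j → _~_ T (b i) (b j) → _~_ S (a i) (a j)
        rigid⇒ : ∀ i → Rigid S k (a i) → Alike S T (a i) (b i)
        rigid⇐ : ∀ i → Rigid T k (b i) → Alike S T (a i) (b i)

    similar-sym : ∀ {S T n} {a : Fin n → Element S} {b : Fin n → Element T} → Similar S T a b → Similar T S b a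
    similar-sym s = record
      { class⇒ = class⇐ ; class⇐ = class⇒ ; equal⇒ = equal⇐ ; equal⇐ = equal⇒
      ; rigid⇒ = λ i r → let (p , q) = rigid⇐ i r in sym p , sym q
      ; rigid⇐ = λ i r → let (p , q) = rigid⇒ i r in sym p , sym q
      }
      where open Similar s

    record Answer (S T : Structure) {n : ℕ} (a : Fin n → Element S) (b : Fin n → Element T)
                  (x : Element S) (y : Element T) : Set where
      field
        class⇒ : ∀ j → cls S x ≡ cls S (a j) → cls T y ≡ cls T (b j)
        class⇐ : ∀ j → cls T y ≡ cls T (b j) → cls S x ≡ cls S (a j)
        equal⇒ : ∀ j → _~_ S x (a j) → _~_ T y (b j)
        equal⇐ : ∀ j → _~_ T y (b j) → _~_ S x (a j)
        rigid⇒ : Rigid S k x → Alike S T x y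
        rigid⇐ : Rigid T k y → Alike S T x y

    extend : ∀ {S T n} {a : Fin n → Element S} {b : Fin n → Element T} {x y} →
             Similar S T a b → Answer S T a b x y → Similar S T (x ▸ a) (y ▸ b)
    extend {S} {T} s r = record
      { class⇒ = λ { zero zero _ → refl ; zero (suc j) → R.class⇒ j
                   ; (suc i) zero e → sym (R.class⇒ i (sym e)) ; (suc i) (suc j) → Q.class⇒ i j }
      ; class⇐ = λ { zero zero _ → refl ; zero (suc j) → R.class⇐ j
                   ; (suc i) zero e → sym (R.class⇐ i (sym e)) ; (suc i) (suc j) → Q.class⇐ i j }
      ; equal⇒ = λ { zero zero _ → refl , refl ; zero (suc j) → R.equal⇒ j
                   ; (suc i) zero e → ~-sym T (R.equal⇒ i (~-sym S e)) ; (suc i) (suc j) → Q.equal⇒ i j }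
      ; equal⇐ = λ { zero zero _ → refl , refl ; zero (suc j) → R.equal⇐ j
                   ; (suc i) zero e → ~-sym S (R.equal⇐ i (~-sym T e)) ; (suc i) (suc j) → Q.equal⇐ i j }
      ; rigid⇒ = λ { zero → R.rigid⇒ ; (suc i) → Q.rigid⇒ i }
      ; rigid⇐ = λ { zero → R.rigid⇐ ; (suc i) → Q.rigid⇐ i }
      }
      where
      module Q = Similar s
      module R = Answer r

    module _ {S T : Structure} (agree : ∀ c → c < k → X S c ≡ X T c) (rich : Rich T k) where

      rigid-transfer : ∀ {x y} → cls S x ≡ cls T y → Rigid S k x → Rigid T k y
      rigid-transfer {x} {y} e (lt , t) = subst (_< k) e lt , trans (sym (trans (agree _ lt) (cong (X T) e))) t

      rigid-transfer⁻ : ∀ {x y} → cls S x ≡ cls T y → Rigid T k y → Rigid S k x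
      rigid-transfer⁻ {x} {y} e (lt , t) = subst (_< k) (sym e) lt ,
        trans (agree _ (subst (_< k) (sym e) lt)) (trans (cong (X T) e) t)

      index-rigid : ∀ y {c} → cls T y ≡ c → X T c ≡ true → index T y ≡ idx T y ⊓ c
      index-rigid y refl t rewrite t = refl

      -- A class that is not rigid is infinite or has a number of at least `k`, so truncation does
      -- not affect indices below `k`.
      index-below : ∀ y → ¬ Rigid T k y → idx T y < k → index T y ≡ idx T y
      index-below y ¬r lt with X T (cls T y)
      ... | false = refl
      ... | true  = m≤n⇒m⊓n≡m (≤-trans (<⇒≤ lt) (≮⇒≥ (λ c<k → ¬r (c<k , refl))))

      forth : ∀ {n} {a : Fin n → Element S} {b : Fin n → Element T} → n < k → Similar S T a b →
              ∀ x → ∃[ y ] Answer S T a b x y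
      forth {n} {a} {b} n<k s x with em {Rigid S k x}
      -- In a rigid class the answer repeats class number and truncated index.
      ... | yes r@(c<k , Xc) = y , record
          { class⇒ = λ j e → trans y-cls (trans e (proj₁ (s.rigid⇒ j (rigid-cls (sym e) r))))
          ; class⇐ = λ j e → sym (trans (proj₁ (s.rigid⇐ j (rigid-cls′ e (rigid-transfer (sym y-cls) r)))) (trans (sym e) y-cls))
          ; equal⇒ = λ j (e , f) → let (p , q) = s.rigid⇒ j (rigid-cls (sym e) r) in
              trans y-cls (trans e p) , trans (sym x≡y) (trans f q)
          ; equal⇐ = λ j (e , f) → let (p , q) = s.rigid⇐ j (rigid-cls′ e (rigid-transfer (sym y-cls) r)) in
              trans (sym y-cls) (trans e (sym p)) , trans x≡y (trans f (sym q))
          ; rigid⇒ = λ _ → sym y-cls , x≡y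
          ; rigid⇐ = λ _ → sym y-cls , x≡y
          }
        where
        module s = Similar s
        c = cls S x
        Tc : X T c ≡ true
        Tc = trans (sym (agree c c<k)) Xc
        choice = rich c (idx S x ⊓ c) (inj₁ (≤-trans (<⇒≤ c<k) (m≤m+n k k)))
                      (≤-trans (m⊓n≤n (idx S x) c) (≤-trans (<⇒≤ c<k) (m≤m+n k k)))
        y = proj₁ choice
        y-cls : cls T y ≡ c
        y-cls = proj₁ (proj₂ choice)
        x≡y : index S x ≡ index T y
        x≡y = trans (cong (λ t → if t then idx S x ⊓ c else idx S x) Xc)
          (sym (trans (index-rigid y y-cls Tc)
            (trans (cong (_⊓ c) (proj₂ (proj₂ choice))) (trans (⊓-assoc (idx S x) c c) (cong (idx S x ⊓_) (⊓-idem c))))))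
        rigid-cls : ∀ {z w} → cls S z ≡ cls S w → Rigid S k w → Rigid S k z
        rigid-cls e (lt , t) = subst (_< k) (sym e) lt , trans (cong (X S) e) t
        rigid-cls′ : ∀ {z w} → cls T z ≡ cls T w → Rigid T k z → Rigid T k w
        rigid-cls′ e (lt , t) = subst (_< k) e lt , trans (cong (X T) (sym e)) t
      ... | no ¬r with em {∃[ j ] _~_ S x (a j)}
      ...   | yes (j , x~) = b j , record
          { class⇒ = λ l e → s.class⇒ j l (trans (sym (proj₁ x~)) e)
          ; class⇐ = λ l e → trans (proj₁ x~) (s.class⇐ j l e)
          ; equal⇒ = λ l e → s.equal⇒ j l (~-trans S (~-sym S x~) e)
          ; equal⇐ = λ l e → ~-trans S x~ (s.equal⇐ j l e)
          ; rigid⇒ = λ r → contradiction r ¬r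
          ; rigid⇐ = λ r → contradiction (rigid-transfer⁻ (trans (proj₁ x~) (proj₁ (s.rigid⇐ j r))) r) ¬r
          }
        where module s = Similar s
      ...   | no new with em {∃[ j ] cls S x ≡ cls S (a j)}
      -- A new element in an old class that is not rigid: some index below `k` differs from those of
      -- all earlier answers, and truncation does not change it.
      ...     | yes (j , x-cls) = y , record
          { class⇒ = λ l e → trans y-cls (s.class⇒ j l (trans (sym x-cls) e))
          ; class⇐ = λ l e → trans x-cls (s.class⇐ j l (trans (sym y-cls) e))
          ; equal⇒ = λ l e → contradiction (l , e) new
          ; equal⇐ = λ l (_ , f) → contradiction (sym (trans (sym y-index) f)) (proj₂ (proj₂ i) l)
          ; rigid⇒ = λ r → contradiction r ¬r
          ; rigid⇐ = λ r → contradiction r ¬r′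
          }
        where
        module s = Similar s
        i = fresh (λ l → index T (b l))
        choice = rich (cls T (b j)) (proj₁ i) (inj₂ (b j , refl))
                      (≤-trans (proj₁ (proj₂ i)) (≤-trans (<⇒≤ n<k) (m≤m+n k k)))
        y = proj₁ choice
        y-cls : cls T y ≡ cls T (b j)
        y-cls = proj₁ (proj₂ choice)
        ¬r′ : ¬ Rigid T k y
        ¬r′ (lt , t) = ¬r (rigid-transfer⁻ (trans x-cls (proj₁ (s.rigid⇐ j rb))) rb)
          where
          rb : Rigid T k (b j)
          rb = subst (_< k) y-cls lt , trans (cong (X T) (sym y-cls)) t
        y-index : index T y ≡ proj₁ i
        y-index = trans (index-below y ¬r′ (subst (_< k) (sym (proj₂ (proj₂ choice))) (≤-trans (s≤s (proj₁ (proj₂ i))) n<k)))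
                        (proj₂ (proj₂ choice))
      -- A class not met before: the shift by `k` avoids all rigid classes, and the fresh offset
      -- avoids the classes already used.
      ...     | no newClass = y , record
          { class⇒ = λ l e → contradiction (l , e) newClass
          ; class⇐ = λ l e → contradiction (cong (_∸ k) (sym e)) (λ f → proj₂ (proj₂ i) l (trans f y-cls∸))
          ; equal⇒ = λ l (e , _) → contradiction (l , e) newClass
          ; equal⇐ = λ l (e , _) → contradiction (cong (_∸ k) (sym e)) (λ f → proj₂ (proj₂ i) l (trans f y-cls∸))
          ; rigid⇒ = λ r → contradiction r ¬r
          ; rigid⇐ = λ (lt , _) → contradiction (subst (_< k) y-cls lt) (m+n≮m k (proj₁ i))
          }
        where
        i = fresh (λ l → cls T (b l) ∸ k)
        choice = rich (k + proj₁ i) 0 (inj₁ (+-monoʳ-≤ k (≤-trans (proj₁ (proj₂ i)) (<⇒≤ n<k)))) z≤n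
        y = proj₁ choice
        y-cls : cls T y ≡ k + proj₁ i
        y-cls = proj₁ (proj₂ choice)
        y-cls∸ : cls T y ∸ k ≡ proj₁ i
        y-cls∸ = trans (cong (_∸ k) y-cls) (m+n∸m≡n k (proj₁ i))

    -- `n` elements have been chosen and `depth φ` rounds remain. Both directions are proved
    -- together because implication exchanges them.
    transfer : ∀ {S T n} → (∀ c → c < k → X S c ≡ X T c) → Rich S k → Rich T k →
               {a : Fin n → Element S} {b : Fin n → Element T} → Similar S T a b →
               ∀ φ → n + depth φ ≤ k → (Sat S φ a → Sat T φ b) × (Sat T φ b → Sat S φ a)
    transfer agree _ _ s (var i ≐ var j) _ = Similar.equal⇒ s i j , Similar.equal⇐ s i j
    transfer agree _ _ s (rel E (var i ∷ var j ∷ [])) _ = Similar.class⇒ s i j , Similar.class⇐ s i j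
    transfer agree _ _ s ⊥′ _ = (λ ()) , (λ ())
    transfer {n = n} agree rs rt s (φ ⇒ ψ) h =
      (λ f p → proj₁ (transfer agree rs rt s ψ hψ) (f (proj₂ (transfer agree rs rt s φ hφ) p))) ,
      (λ f p → proj₂ (transfer agree rs rt s ψ hψ) (f (proj₁ (transfer agree rs rt s φ hφ) p)))
      where
      hφ = ≤-trans (+-monoʳ-≤ n (m≤m⊔n (depth φ) (depth ψ))) h
      hψ = ≤-trans (+-monoʳ-≤ n (m≤n⊔m (depth φ) (depth ψ))) h
    transfer {S} {T} {n} agree rs rt s (∀′ φ) h =
      (λ f y → let x , r = forth {T} {S} (λ c lt → sym (agree c lt)) rs n<k (similar-sym s) y in
         proj₁ (transfer agree rs rt (similar-sym (extend (similar-sym s) r)) φ h′) (f x)) ,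
      (λ f x → let y , r = forth agree rt n<k s x in
         proj₂ (transfer agree rs rt (extend s r) φ h′) (f y))
      where
      h′ : suc n + depth φ ≤ k
      h′ = subst (_≤ k) (+-suc n (depth φ)) h
      n<k : n < k
      n<k = ≤-trans (s≤s (m≤m+n n (depth φ))) h′

    similar-empty : ∀ {S T} {a : Fin 0 → Element S} {b : Fin 0 → Element T} → Similar S T a b
    similar-empty = record
      { class⇒ = λ () ; class⇐ = λ () ; equal⇒ = λ () ; equal⇐ = λ () ; rigid⇒ = λ () ; rigid⇐ = λ () }

  -- This is `M(X)`: a number stands for the pair of its class and its index before truncation.
  fullStructure : (ℕ → Bool) → Structure
  fullStructure X = record { X = X ; Element = ℕ ; cls = fstᶜ ; idx = sndᶜ ; point = 0 }

  fullStructure-rich : ∀ X k → Structure.Rich (fullStructure X) k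
  fullStructure-rich X k c i _ _ = pair c i , fstᶜ-pair c i , sndᶜ-pair c i

  finiteSize : ℕ → ℕ
  finiteSize k = suc (pair (k + k) (k + k))

  -- By monotonicity of `pair` the elements include all pairs of coordinates up to `k + k`. Larger
  -- coordinates also occur among them; the cap absorbs these, since their classes would be
  -- incomplete.
  finiteStructure : (ℕ → Bool) → ℕ → Structure
  finiteStructure X k = record
    { X = X ; Element = Fin (finiteSize k) ; point = zero
    ; cls = λ x → fstᶜ (toℕ x) ⊓ (k + k) ; idx = λ x → sndᶜ (toℕ x) ⊓ (k + k) }

  finiteStructure-rich : ∀ X k → Structure.Rich (finiteStructure X k) k
  finiteStructure-rich X k c i h i≤ = fromℕ< lt ,
      trans (cong (λ z → fstᶜ z ⊓ (k + k)) (toℕ-fromℕ< lt)) (trans (cong (_⊓ (k + k)) (fstᶜ-pair c i)) (m≤n⇒m⊓n≡m (c≤ h))) ,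
      trans (cong (λ z → sndᶜ z ⊓ (k + k)) (toℕ-fromℕ< lt)) (trans (cong (_⊓ (k + k)) (sndᶜ-pair c i)) (m≤n⇒m⊓n≡m i≤))
    where
    c≤ : c ≤ k + k ⊎ ∃[ e ] fstᶜ (toℕ {finiteSize k} e) ⊓ (k + k) ≡ c → c ≤ k + k
    c≤ (inj₁ c≤) = c≤
    c≤ (inj₂ (e , refl)) = m⊓n≤n (fstᶜ (toℕ e)) (k + k)
    lt : pair c i < finiteSize k
    lt = s≤s (pair-mono (c≤ h) i≤)

  -- The empty positions are trivially similar, so `transfer` applies with the code of `φ` as number
  -- of rounds.
  finite⇔full : ExcludedMiddle 0ℓ → ∀ X Y (φ : Sentence Lᴱ) → (∀ c → c < ⌜ φ ⌝ → X c ≡ Y c) →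
    (Structure.Sat (finiteStructure X ⌜ φ ⌝) φ (λ ()) → Structure.Sat (fullStructure Y) φ (λ ())) ×
    (Structure.Sat (fullStructure Y) φ (λ ()) → Structure.Sat (finiteStructure X ⌜ φ ⌝) φ (λ ()))
  finite⇔full em X Y φ agree = transfer agree (finiteStructure-rich X ⌜ φ ⌝) (fullStructure-rich Y ⌜ φ ⌝)
    similar-empty φ (depth≤code φ)
    where open Game em ⌜ φ ⌝

  related : ∀ {m} → Formula Lᴱ (suc (suc m))
  related = rel E (var zero ∷ var (suc zero) ∷ [])

  equalsOneOf : ∀ {m} k → k ≤ m → Formula Lᴱ (suc m)
  equalsOneOf zero    _   = ⊥′
  equalsOneOf (suc k) k<m = equalsOneOf k (<⇒≤ k<m) ∨′ (var zero ≐ var (suc (fromℕ< k<m)))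

  -- The class of the distinct elements x₀, …, xₘ has j more elements.
  remaining : (j m : ℕ) → Formula Lᴱ (suc m)
  remaining zero    m = ∀′ (related ⇒ equalsOneOf (suc m) ≤-refl)
  remaining (suc j) m = ∃′ (related ∧′ (¬′ equalsOneOf (suc m) ≤-refl ∧′ remaining j (suc m)))

  -- The size is n + 1, not n.
  classOfSize : ℕ → Sentence Lᴱ
  classOfSize n = ∃′ (remaining n 0)

  depth-remaining : ∀ j m → j < depth (remaining j m)
  depth-remaining zero    m = s≤s z≤n
  depth-remaining (suc j) m = s≤s (≤-trans (depth-remaining j (suc m)) (≤-trans
    (m≤m⊔n (depth (remaining j (suc m))) 0)
    (≤-trans (m≤n⊔m (depth (equalsOneOf {suc m} (suc m) ≤-refl) ⊔ 0) _)
    (≤-trans (m≤m⊔n _ 0) (≤-trans (m≤m⊔n _ 0) (≤-trans (m≤m⊔n _ 0) (m≤m⊔n _ 0)))))))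

  -- A sentence is tested against `X` only below its code, so the bit `n` has to lie in this range
  -- for `classOfSize n` to express it.
  n<classOfSize : ∀ n → n < ⌜ classOfSize n ⌝
  n<classOfSize n = ≤-trans (≤-trans (depth-remaining n 0)
    (≤-trans (m≤m⊔n _ 0) (≤-trans (n≤1+n _) (m≤m⊔n _ 0)))) (depth≤code (classOfSize n))

  module _ (em : ExcludedMiddle 0ℓ) (X : ℕ → Bool) where
    open Structure (fullStructure X) hiding (X)

    stable : ∀ {P : Set} → ¬ ¬ P → P
    stable = decidable-stable em

    Sat-∧ : ∀ {n} {φ ψ : Formula Lᴱ n} {a} → Sat (φ ∧′ ψ) a → Sat φ a × Sat ψ a
    Sat-∧ h = stable (λ ¬p → h (λ p → ⊥-elim (¬p p))) , stable (λ ¬q → h (λ _ → ¬q))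

    Sat-∃ : ∀ {n} {φ : Formula Lᴱ (suc n)} {a} → Sat (∃′ φ) a → ∃[ x ] Sat φ (x ▸ a)
    Sat-∃ h = stable (λ ¬p → h (λ x p → ¬p (x , p)))

    equalsOneOf-elim : ∀ {m} k (k≤m : k ≤ m) x (a : Fin m → ℕ) → Sat (equalsOneOf k k≤m) (x ▸ a) → ∃[ i ] x ~ a i
    equalsOneOf-elim (suc k) k<m x a h with em {Sat (equalsOneOf k (<⇒≤ k<m)) (x ▸ a)}
    ... | yes p = equalsOneOf-elim k (<⇒≤ k<m) x a p
    ... | no ¬p = fromℕ< k<m , h ¬p

    equalsOneOf-intro : ∀ {m} k (k≤m : k ≤ m) x (a : Fin m → ℕ) i → toℕ i < k → x ~ a i → Sat (equalsOneOf k k≤m) (x ▸ a)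
    equalsOneOf-intro (suc k) k<m x a i i<1+k p ¬q with m≤n⇒m<n∨m≡n (s≤s⁻¹ i<1+k)
    ... | inj₁ i<k = ⊥-elim (¬q (equalsOneOf-intro k (<⇒≤ k<m) x a i i<k p))
    ... | inj₂ i≡k = subst (λ j → x ~ a j) (toℕ-injective (trans i≡k (sym (toℕ-fromℕ< k<m)))) p

    record Enumerates {m : ℕ} (c : ℕ) (a : Fin m → ℕ) : Set where
      field
        sameClass : ∀ i → cls (a i) ≡ c
        distinct  : ∀ i j → a i ~ a j → i ≡ j

    -- Each existential quantifier contributes a new element of the class, prepended to the list;
    -- the final universal quantifier makes the list exhaustive.
    remaining-elim : ∀ j m c (a : Fin (suc m) → ℕ) → Enumerates c a → Sat (remaining j m) a →
      Σ (Fin (suc (j + m)) → ℕ) λ b → Enumerates c b × (∀ x → cls x ≡ c → ∃[ i ] x ~ b i)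
    remaining-elim zero m c a e h = a , e , λ x x-cls →
      equalsOneOf-elim (suc m) ≤-refl x a (h x (trans x-cls (sym (Enumerates.sameClass e zero))))
    remaining-elim (suc j) m c a e h
      with Sat-∃ {φ = related ∧′ (¬′ equalsOneOf (suc m) ≤-refl ∧′ remaining j (suc m))} {a} h
    ... | y , h′ with Sat-∧ {φ = related} {¬′ equalsOneOf (suc m) ≤-refl ∧′ remaining j (suc m)} h′
    ...   | y-related , h″ with Sat-∧ {φ = ¬′ equalsOneOf (suc m) ≤-refl} {remaining j (suc m)} h″
    ...     | y-new , rest = subst (λ n → Σ (Fin (suc n) → ℕ) λ b → Enumerates c b × (∀ x → cls x ≡ c → ∃[ i ] x ~ b i))
        (+-suc j m) (remaining-elim j (suc m) c (y ▸ a) e′ rest)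
      where
      open Enumerates e
      apart : ∀ i → ¬ (y ~ a i)
      apart i p = y-new (equalsOneOf-intro (suc m) ≤-refl y a i (toℕ<n i) p)
      e′ : Enumerates c (y ▸ a)
      e′ = record
        { sameClass = λ { zero → trans y-related (sameClass zero) ; (suc i) → sameClass i }
        ; distinct  = λ { zero zero _ → refl ; zero (suc j) p → contradiction p (apart j)
                        ; (suc i) zero p → contradiction (~-sym {a i} {y} p) (apart i)
                        ; (suc i) (suc j) p → cong suc (distinct i j p) }
        }

    index-pair : ∀ {c i} → X c ≡ false ⊎ i ≤ c → index (pair c i) ≡ i
    index-pair {c} {i} h rewrite fstᶜ-pair c i | sndᶜ-pair c i with X c in e | h
    ... | false | _        = refl
    ... | true  | inj₂ i≤c = m≤n⇒m⊓n≡m i≤c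

    index≤class : ∀ x {c} → cls x ≡ c → X c ≡ true → index x ≤ c
    index≤class x refl Xc rewrite Xc = m⊓n≤n (idx x) (cls x)

    -- An infinite class has a member whose index is missing from the list. In a finite class the
    -- `c + 1` indices inject into the list and the list into the indices, so the lengths agree.
    classSize : ∀ c N (b : Fin (suc N) → ℕ) → Enumerates c b → (∀ x → cls x ≡ c → ∃[ i ] x ~ b i) → c ≡ N × X c ≡ true
    classSize c N b e exhaustive with X c in Xc
    ... | false = contradiction (sym (trans (sym (index-pair (inj₁ Xc))) (proj₂ (proj₂ hit)))) (proj₂ (proj₂ i) (proj₁ hit))
      where
      i = fresh (λ l → index (b l))
      hit = exhaustive (pair c (proj₁ i)) (fstᶜ-pair c (proj₁ i))
    ... | true = ≤-antisym (s≤s⁻¹ (injective⇒≤ {f = λ i → proj₁ (hit i)} hit-injective))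
                           (s≤s⁻¹ (injective⇒≤ {f = place} place-injective)) , refl
      where
      open Enumerates e
      hit : ∀ (i : Fin (suc c)) → ∃[ l ] pair c (toℕ i) ~ b l
      hit i = exhaustive (pair c (toℕ i)) (fstᶜ-pair c (toℕ i))
      hit-injective : ∀ {i j} → proj₁ (hit i) ≡ proj₁ (hit j) → i ≡ j
      hit-injective {i} {j} eq = toℕ-injective (trans (sym (index-pair (inj₂ (s≤s⁻¹ (toℕ<n i)))))
        (trans (proj₂ (proj₂ (hit i))) (trans (cong (λ l → index (b l)) eq)
          (trans (sym (proj₂ (proj₂ (hit j)))) (index-pair (inj₂ (s≤s⁻¹ (toℕ<n j))))))))
      index≤ : ∀ l → index (b l) ≤ c
      index≤ l = index≤class (b l) (sameClass l) Xc
      place : Fin (suc N) → Fin (suc c)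
      place l = fromℕ< (s≤s (index≤ l))
      place-injective : ∀ {i j} → place i ≡ place j → i ≡ j
      place-injective {i} {j} eq = distinct i j (trans (sameClass i) (sym (sameClass j)) ,
        trans (sym (toℕ-fromℕ< (s≤s (index≤ i)))) (trans (cong toℕ eq) (toℕ-fromℕ< (s≤s (index≤ j)))))

    classOfSize⇒X : ∀ n → Sat (classOfSize n) (λ ()) → X n ≡ true
    classOfSize⇒X n h with Sat-∃ {φ = remaining n 0} {λ ()} h
    ... | x , h′ with remaining-elim n 0 (cls x) (x ▸ (λ ())) single h′
      where
      single : Enumerates (cls x) (x ▸ (λ ()))
      single = record { sameClass = λ { zero → refl } ; distinct = λ { zero zero _ → refl } }
    ...   | b , e , exhaustive with classSize (cls x) (n + 0) b e exhaustive
    ...     | c≡ , Xc = subst (λ c → X c ≡ true) (trans c≡ (+-identityʳ n)) Xc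

    module _ {n : ℕ} (Xn : X n ≡ true) where

      -- Lists the class `n` from index `m` down to 0, in the order in which `remaining` prepends
      -- its elements.
      canonical : ∀ m → Fin (suc m) → ℕ
      canonical zero    = pair n 0 ▸ (λ ())
      canonical (suc m) = pair n (suc m) ▸ canonical m

      canonical-form : ∀ m i → ∃[ v ] v ≤ m × canonical m i ≡ pair n v
      canonical-form zero    zero    = 0 , z≤n , refl
      canonical-form (suc m) zero    = suc m , ≤-refl , refl
      canonical-form (suc m) (suc i) with canonical-form m i
      ... | v , v≤m , e = v , m≤n⇒m≤1+n v≤m , e

      canonical-onto : ∀ m v → v ≤ m → ∃[ i ] canonical m i ≡ pair n v
      canonical-onto zero    .0 z≤n = zero , refl
      canonical-onto (suc m) v v≤ with m≤n⇒m<n∨m≡n v≤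
      ... | inj₂ refl = zero , refl
      ... | inj₁ v<   with canonical-onto m v (s≤s⁻¹ v<)
      ...   | i , e = suc i , e

      canonical-cls : ∀ m i → cls (canonical m i) ≡ n
      canonical-cls m i with canonical-form m i
      ... | v , _ , e = trans (cong fstᶜ e) (fstᶜ-pair n v)

      remaining-intro : ∀ j m → j + m ≡ n → Sat (remaining j m) (canonical m)
      remaining-intro zero m refl x x-related =
        equalsOneOf-intro (suc m) ≤-refl x (canonical m) (proj₁ i) (toℕ<n (proj₁ i))
          (trans x-cls (sym (canonical-cls m (proj₁ i))) ,
           sym (trans (cong index (proj₂ i)) (index-pair (inj₂ index≤))))
        where
        x-cls : cls x ≡ n
        x-cls = trans x-related (canonical-cls m zero)
        index≤ : index x ≤ m
        index≤ = index≤class x x-cls Xn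
        i = canonical-onto m (index x) index≤
      remaining-intro (suc j) m refl h = h (pair n (suc m)) λ f → f
          (trans (fstᶜ-pair n (suc m)) (sym (canonical-cls m zero)))
          λ g → g new (remaining-intro j (suc m) (+-suc j m))
        where
        new : ¬ Sat (equalsOneOf (suc m) ≤-refl) (pair n (suc m) ▸ canonical m)
        new p with equalsOneOf-elim (suc m) ≤-refl (pair n (suc m)) (canonical m) p
        ... | i , _ , q with canonical-form m i
        ...   | v , v≤m , e = contradiction
          (trans (sym (index-pair (inj₂ (≤-trans v≤m (m≤n+m m (suc j)))))) (trans (sym (trans q (cong index e)))
            (index-pair (inj₂ (s≤s (m≤n+m m j))))))
          (<⇒≢ (s≤s v≤m))

      X⇒classOfSize : Sat (classOfSize n) (λ ())
      X⇒classOfSize h = h (pair n 0) (Sat-cong (remaining n 0) {canonical 0} {pair n 0 ▸ (λ ())} (λ { zero → refl , refl }) (remaining-intro n 0 (+-identityʳ n)))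

-- Truth values in the finite structures, computed on codes

module FiniteEvaluation where

  open Computability
  open Pairing
  open ClassSizes

  -- A number codes a finite set as the list of its truth values; past the end of the list the
  -- answer is false, because `headᶜ nil` is 0.
  bit : ℕ → ℕ → Bool
  bit a c = headᶜ (dropᶜ c a) ≡ᵇ 1

  -- The code of a list of `k` ones bounds the codes of all lists of `k` truth values, by
  -- monotonicity of `pair`; thus quantification over subsets becomes bounded.
  setBound : ℕ → ℕ
  setBound zero    = 0
  setBound (suc k) = cons 1 (setBound k)

  headᶜ-cons-≡ : ∀ b l → (headᶜ (cons ⟨ b ⟩ l) ≡ᵇ 1) ≡ b
  headᶜ-cons-≡ true  l = cong (_≡ᵇ 1) (head-cons 1 l)
  headᶜ-cons-≡ false l = cong (_≡ᵇ 1) (head-cons 0 l)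

  bits-exist : ∀ (X : ℕ → Bool) k → ∃[ a ] a ≤ setBound k × (∀ c → c < k → bit a c ≡ X c)
  bits-exist X zero = 0 , z≤n , λ _ ()
  bits-exist X (suc k) with bits-exist (X ∘ suc) k
  ... | a , a≤ , h = cons ⟨ X 0 ⟩ a , s≤s (pair-mono (⟨⟩≤1 (X 0)) a≤) , λ where
        zero    _       → headᶜ-cons-≡ (X 0) a
        (suc c) (s≤s p) → trans (cong (λ l → headᶜ l ≡ᵇ 1) (drop-cons c ⟨ X 0 ⟩ a)) (h c p)
    where
    ⟨⟩≤1 : ∀ b → ⟨ b ⟩ ≤ 1
    ⟨⟩≤1 true  = ≤-refl
    ⟨⟩≤1 false = z≤n

  classᶜ : ℕ → ℕ → ℕ
  classᶜ k x = fstᶜ x ⊓ (k + k)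

  indexᶜ : ℕ → ℕ → ℕ → ℕ
  indexᶜ a k x = if bit a (classᶜ k x) then sndᶜ x ⊓ (k + k) ⊓ classᶜ k x else sndᶜ x ⊓ (k + k)

  -- A variable is in scope exactly when the environment list has not ended at its position.
  isVarᵇ : ℕ → ℕ → Bool
  isVarᵇ env t = (fstᶜ t ≡ᵇ 0) ∧ nonZeroᵇ (dropᶜ (sndᶜ t) env)

  valueᶜ : ℕ → ℕ → ℕ
  valueᶜ env t = headᶜ (dropᶜ (sndᶜ t) env)

  sameᵇ : ℕ → ℕ → ℕ → ℕ → Bool
  sameᵇ a k x y = (classᶜ k x ≡ᵇ classᶜ k y) ∧ (indexᶜ a k x ≡ᵇ indexᶜ a k y)

  relatedᵇ : ℕ → ℕ → ℕ → Bool
  relatedᵇ k x y = classᶜ k x ≡ᵇ classᶜ k y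

  -- The truth values are 0 and 1; the value 2 marks numbers that do not
  -- code a formula.

  equalityValueᵗ : ℕ → ℕ → ℕ → ℕ → ℕ → ℕ
  equalityValueᵗ a k env t s =
    if isVarᵇ env t ∧ isVarᵇ env s then ⟨ sameᵇ a k (valueᶜ env t) (valueᶜ env s) ⟩ else 2

  isPairᵇ : ℕ → ℕ → Bool
  isPairᵇ env ts = (nonZeroᵇ ts ∧ (nonZeroᵇ (tailᶜ ts) ∧ (tailᶜ (tailᶜ ts) ≡ᵇ 0)))
    ∧ (isVarᵇ env (headᶜ ts) ∧ isVarᵇ env (headᶜ (tailᶜ ts)))

  relationValueᵗ : ℕ → ℕ → ℕ → ℕ → ℕ
  -- 3 is `pair 2 0`, the arity and number of `E`.
  relationValueᵗ k env r ts = if (r ≡ᵇ 3) ∧ isPairᵇ env ts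
    then ⟨ relatedᵇ k (valueᶜ env (headᶜ ts)) (valueᶜ env (headᶜ (tailᶜ ts))) ⟩ else 2

  opaque
    equalityValue : ℕ → ℕ → ℕ → ℕ → ℕ
    equalityValue a k env x = equalityValueᵗ a k env (fstᶜ x) (sndᶜ x)

    relationValue : ℕ → ℕ → ℕ → ℕ
    relationValue k env x = relationValueᵗ k env (fstᶜ x) (sndᶜ x)

    falsityValue : ℕ → ℕ
    falsityValue x = if x ≡ᵇ 0 then 0 else 2

    -- The value 2 absorbs everything, so an implication gets a truth value only if both parts code
    -- formulas.
    impValue : ℕ → ℕ → ℕ
    impValue b c = if (b ≡ᵇ 2) ∨ (c ≡ᵇ 2) then 2 else (if b ≡ᵇ 0 then 1 else c)

    andValue : ℕ → ℕ → ℕ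
    andValue b c = if (b ≡ᵇ 2) ∨ (c ≡ᵇ 2) then 2 else (if b ≡ᵇ 0 then 0 else c)

  c-⊓ : ∀ {O} → Comp₂ O _⊓_
  c-⊓ = comp₂ (ext (λ { (x ∷ y ∷ []) → eq x y }) (ap₂ c-∸ (v 0F) (ap₂ c-∸ (v 0F) (v 1F))))
    where
    eq : ∀ x y → x ∸ (x ∸ y) ≡ x ⊓ y
    eq x y with ≤-total x y
    ... | inj₁ x≤y = trans (cong (x ∸_) (m≤n⇒m∸n≡0 x≤y)) (sym (m≤n⇒m⊓n≡m x≤y))
    ... | inj₂ y≤x = trans (m∸[m∸n]≡n y≤x) (sym (m≥n⇒m⊓n≡n y≤x))

  c-bit : ∀ {O k} {f g : Vec ℕ k → ℕ} → Comp O f → Comp O g → CompB O (λ xs → bit (f xs) (g xs))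
  c-bit cf cg = c-≡ᵇ (ap₁ c-head (ap₂ c-drop cg cf)) (const 1)

  c-class : ∀ {O} → Comp₂ O classᶜ
  c-class = comp₂ (ap₂ c-⊓ (ap₁ c-fst (v 1F)) (ap₂ c-+ (v 0F) (v 0F)))

  c-index : ∀ {O} → Comp₃ O indexᶜ
  c-index = comp₃ (c-if (c-bit (v 0F) (ap₂ c-class (v 1F) (v 2F)))
      (ap₂ c-⊓ clamped (ap₂ c-class (v 1F) (v 2F))) clamped)
    where
    clamped : ∀ {O} → Comp O (λ xs → sndᶜ (lookup {n = 3} xs 2F) ⊓ (lookup xs 1F + lookup xs 1F))
    clamped = ap₂ c-⊓ (ap₁ c-snd (v 2F)) (ap₂ c-+ (v 1F) (v 1F))

  c-isVar : ∀ {O k} {f g : Vec ℕ k → ℕ} → Comp O f → Comp O g → CompB O (λ xs → isVarᵇ (f xs) (g xs))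
  c-isVar cf cg = c-∧ (c-≡ᵇ (ap₁ c-fst cg) (const 0)) (c-nonZero (ap₂ c-drop (ap₁ c-snd cg) cf))

  c-value : ∀ {O} → Comp₂ O valueᶜ
  c-value = comp₂ (ap₁ c-head (ap₂ c-drop (ap₁ c-snd (v 1F)) (v 0F)))

  module _ {O : Pred ℕ 0ℓ} where
    opaque
      unfolding equalityValue relationValue falsityValue impValue andValue

      c-same : ∀ {n} {a k x y : Vec ℕ n → ℕ} → Comp O a → Comp O k → Comp O x → Comp O y →
               CompB O (λ xs → sameᵇ (a xs) (k xs) (x xs) (y xs))
      c-same ca ck cx cy = c-∧ (c-≡ᵇ (ap₂ c-class ck cx) (ap₂ c-class ck cy))
                               (c-≡ᵇ (ap₃ c-index ca ck cx) (ap₃ c-index ca ck cy))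

      c-related : ∀ {n} {k x y : Vec ℕ n → ℕ} → Comp O k → Comp O x → Comp O y →
                  CompB O (λ xs → relatedᵇ (k xs) (x xs) (y xs))
      c-related ck cx cy = c-≡ᵇ (ap₂ c-class ck cx) (ap₂ c-class ck cy)

      c-isPair : ∀ {n} {e ts : Vec ℕ n → ℕ} → Comp O e → Comp O ts → CompB O (λ xs → isPairᵇ (e xs) (ts xs))
      c-isPair ce cts =
        c-∧ (c-∧ (c-nonZero cts) (c-∧ (c-nonZero (ap₁ c-tail cts)) (c-≡ᵇ (ap₁ c-tail (ap₁ c-tail cts)) (const 0))))
            (c-∧ (c-isVar ce (ap₁ c-head cts)) (c-isVar ce (ap₁ c-head (ap₁ c-tail cts))))

      c-equalityValue : Comp₄ O equalityValue
      c-equalityValue = comp₄ (c-if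
          {b = λ xs → isVarᵇ (lookup xs 2F) (fstᶜ (lookup xs 3F)) ∧ isVarᵇ (lookup xs 2F) (sndᶜ (lookup xs 3F))}
          (c-∧ (c-isVar (v 2F) t) (c-isVar (v 2F) s))
          (bodyᵇ (c-same (v 0F) (v 1F) (ap₂ c-value (v 2F) t) (ap₂ c-value (v 2F) s)))
          (const 2))
        where
        t : Comp O {4} (λ xs → fstᶜ (lookup xs 3F))
        t = ap₁ c-fst (v 3F)
        s : Comp O {4} (λ xs → sndᶜ (lookup xs 3F))
        s = ap₁ c-snd (v 3F)

      c-relationValue : Comp₃ O relationValue
      c-relationValue = comp₃ (c-if
          {b = λ xs → (fstᶜ (lookup xs 2F) ≡ᵇ 3) ∧ isPairᵇ (lookup xs 1F) (sndᶜ (lookup xs 2F))}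
          (c-∧ (c-≡ᵇ (ap₁ c-fst (v 2F)) (const 3)) (c-isPair (v 1F) ts))
          (bodyᵇ (c-related (v 0F) (ap₂ c-value (v 1F) (ap₁ c-head ts)) (ap₂ c-value (v 1F) (ap₁ c-head (ap₁ c-tail ts)))))
          (const 2))
        where
        ts : Comp O {3} (λ xs → sndᶜ (lookup xs 2F))
        ts = ap₁ c-snd (v 2F)

      c-falsityValue : Comp₁ O falsityValue
      c-falsityValue = comp₁ (c-if (c-≡ᵇ (v 0F) (const 0)) (const 0) (const 2))

      c-impValue : Comp₂ O impValue
      c-impValue = comp₂ (c-if (c-∨ (c-≡ᵇ (v 0F) (const 2)) (c-≡ᵇ (v 1F) (const 2))) (const 2)
        (c-if (c-≡ᵇ (v 0F) (const 0)) (const 1) (v 1F)))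

      c-andValue : Comp₂ O andValue
      c-andValue = comp₂ (c-if (c-∨ (c-≡ᵇ (v 0F) (const 2)) (c-≡ᵇ (v 1F) (const 2))) (const 2)
        (c-if (c-≡ᵇ (v 0F) (const 0)) (const 0) (v 1F)))

  c-finiteSize : ∀ {O} → Comp₁ O finiteSize
  c-finiteSize = comp₁ (ap₁ c-suc (ap₂ c-pair (ap₂ c-+ (v 0F) (v 0F)) (ap₂ c-+ (v 0F) (v 0F))))

  envᶜ : ∀ {n} → (Fin n → ℕ) → ℕ
  envᶜ {zero}  ρ = nil
  envᶜ {suc n} ρ = cons (ρ zero) (envᶜ (ρ ∘ suc))

  env-lookup : ∀ {n} (ρ : Fin n → ℕ) i → ∃[ l ] dropᶜ (toℕ i) (envᶜ ρ) ≡ cons (ρ i) l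
  env-lookup ρ zero    = envᶜ (ρ ∘ suc) , refl
  env-lookup ρ (suc i) with env-lookup (ρ ∘ suc) i
  ... | l , e = l , trans (drop-cons (toℕ i) (ρ zero) (envᶜ (ρ ∘ suc))) e

  drop-nil : ∀ i → dropᶜ i nil ≡ nil
  drop-nil zero    = refl
  drop-nil (suc i) = trans (cong tailᶜ (drop-nil i)) (n≤0⇒n≡0 (tailᶜ-≤ nil))

  env-beyond : ∀ {n} (ρ : Fin n → ℕ) i → nonZeroᵇ (dropᶜ i (envᶜ ρ)) ≡ true → Σ (Fin n) λ j → toℕ j ≡ i
  env-beyond {zero}  ρ i h = case trans (sym (cong nonZeroᵇ (drop-nil i))) h of λ ()
  env-beyond {suc n} ρ zero h = zero , refl
  env-beyond {suc n} ρ (suc i) h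
    with j , e ← env-beyond (ρ ∘ suc) i (trans (sym (cong nonZeroᵇ (drop-cons i (ρ zero) (envᶜ (ρ ∘ suc))))) h) =
      suc j , cong suc e

  isVar-var : ∀ {n} (ρ : Fin n → ℕ) i → isVarᵇ (envᶜ ρ) (pair 0 (toℕ i)) ≡ true
  isVar-var ρ i rewrite fstᶜ-pair 0 (toℕ i) | sndᶜ-pair 0 (toℕ i) = cong nonZeroᵇ (proj₂ (env-lookup ρ i))

  isVar-elim : ∀ {n} (ρ : Fin n → ℕ) t → isVarᵇ (envᶜ ρ) t ≡ true → Σ (Fin n) λ i → pair 0 (toℕ i) ≡ t
  isVar-elim ρ t h with i , e ← env-beyond ρ (sndᶜ t) (∧-trueʳ {fstᶜ t ≡ᵇ 0} h) =
    i , trans (cong₂ pair {0} {fstᶜ t} (sym (≡ᵇ-true (∧-trueˡ h))) e) (pair-surjective t)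

  value-var : ∀ {n} (ρ : Fin n → ℕ) i → valueᶜ (envᶜ ρ) (pair 0 (toℕ i)) ≡ ρ i
  value-var ρ i rewrite sndᶜ-pair 0 (toℕ i) with env-lookup ρ i
  ... | l , e = trans (cong headᶜ e) (head-cons (ρ i) l)

  cons-surjective : ∀ l → nonZeroᵇ l ≡ true → cons (headᶜ l) (tailᶜ l) ≡ l
  cons-surjective (suc l) _ = cong suc (pair-surjective l)

  module Evaluator (em : ExcludedMiddle 0ℓ) where

    truthValue : Set → ℕ
    truthValue P = ⟨ does (em {P}) ⟩

    truthValue-true : ∀ {P} → P → truthValue P ≡ 1
    truthValue-true {P} p with em {P}
    ... | yes _ = refl
    ... | no ¬p = contradiction p ¬p

    truthValue-false : ∀ {P} → ¬ P → truthValue P ≡ 0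
    truthValue-false {P} ¬p with em {P}
    ... | yes p = contradiction p ¬p
    ... | no _  = refl

    truthValue-1 : ∀ {P} → truthValue P ≡ 1 → P
    truthValue-1 {P} e with em {P}
    ... | yes p = p

    truthValue-cong : ∀ {P Q} → (P → Q) → (Q → P) → truthValue P ≡ truthValue Q
    truthValue-cong {P} {Q} f g with em {P}
    ... | yes p = sym (truthValue-true (f p))
    ... | no ¬p = sym (truthValue-false (¬p ∘ g))

    truthValue-ᵇ : ∀ {P} b → (b ≡ true → P) → (P → b ≡ true) → ⟨ b ⟩ ≡ truthValue P
    truthValue-ᵇ true  f g = sym (truthValue-true (f refl))
    truthValue-ᵇ false f g = sym (truthValue-false (λ p → case g p of λ ()))

    opaque
      unfolding equalityValue relationValue falsityValue impValue andValue

      impValue-truth : ∀ P Q → impValue (truthValue P) (truthValue Q) ≡ truthValue (P → Q)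
      impValue-truth P Q with em {P} | em {Q}
      ... | yes p | yes q = sym (truthValue-true (λ _ → q))
      ... | yes p | no ¬q = sym (truthValue-false (λ f → ¬q (f p)))
      ... | no ¬p | yes q = sym (truthValue-true (λ _ → q))
      ... | no ¬p | no ¬q = sym (truthValue-true (λ p → ⊥-elim (¬p p)))

      andValue-truth : ∀ P Q → andValue (truthValue P) (truthValue Q) ≡ truthValue (P × Q)
      andValue-truth P Q with em {P} | em {Q}
      ... | yes p | yes q = sym (truthValue-true (p , q))
      ... | yes p | no ¬q = sym (truthValue-false (λ (_ , q) → ¬q q))
      ... | no ¬p | yes q = sym (truthValue-false (λ (p , _) → ¬p p))
      ... | no ¬p | no ¬q = sym (truthValue-false (λ (p , _) → ¬p p))

      impValue-≢2 : ∀ b c → impValue b c ≢ 2 → b ≢ 2 × c ≢ 2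
      impValue-≢2 b c h = (λ { refl → h refl }) ,
        (λ { refl → h (cong (λ d → if d then 2 else (if b ≡ᵇ 0 then 1 else 2)) (∨-introʳ (b ≡ᵇ 2) refl)) })

      andValue-≢2 : ∀ b c → andValue b c ≢ 2 → b ≢ 2 × c ≢ 2
      andValue-≢2 b c h = (λ { refl → h refl }) ,
        (λ { refl → h (cong (λ d → if d then 2 else (if b ≡ᵇ 0 then 0 else 2)) (∨-introʳ (b ≡ᵇ 2) refl)) })

      falsityValue-0 : falsityValue 0 ≡ 0
      falsityValue-0 = refl

      falsityValue-≢2 : ∀ x → falsityValue x ≢ 2 → x ≡ 0
      falsityValue-≢2 zero    _ = refl
      falsityValue-≢2 (suc x) h = contradiction refl h

      equalityValue-unfold : ∀ a k env x → equalityValue a k env x ≡ equalityValueᵗ a k env (fstᶜ x) (sndᶜ x)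
      equalityValue-unfold a k env x = refl

      relationValue-unfold : ∀ k env x → relationValue k env x ≡ relationValueᵗ k env (fstᶜ x) (sndᶜ x)
      relationValue-unfold k env x = refl

    equalityValueᵗ-≢2 : ∀ a k env t s → equalityValueᵗ a k env t s ≢ 2 → isVarᵇ env t ≡ true × isVarᵇ env s ≡ true
    equalityValueᵗ-≢2 a k env t s h with isVarᵇ env t | isVarᵇ env s
    ... | true  | true  = refl , refl
    ... | true  | false = contradiction refl h
    ... | false | _     = contradiction refl h

    equalityValue-≢2 : ∀ {n} a k (ρ : Fin n → ℕ) x → equalityValue a k (envᶜ ρ) x ≢ 2 →
                       Σ (Fin n) λ i → Σ (Fin n) λ j → pair (pair 0 (toℕ i)) (pair 0 (toℕ j)) ≡ x
    equalityValue-≢2 a k ρ x h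
      with vt , vs ← equalityValueᵗ-≢2 a k (envᶜ ρ) (fstᶜ x) (sndᶜ x) (h ∘ trans (equalityValue-unfold a k (envᶜ ρ) x))
      with i , i≡ ← isVar-elim ρ (fstᶜ x) vt | j , j≡ ← isVar-elim ρ (sndᶜ x) vs =
        i , j , trans (cong₂ pair i≡ j≡) (pair-surjective x)

    isPair-elim : ∀ {n} (ρ : Fin n → ℕ) ts → isPairᵇ (envᶜ ρ) ts ≡ true →
                  Σ (Fin n) λ i → Σ (Fin n) λ j → cons (pair 0 (toℕ i)) (cons (pair 0 (toℕ j)) nil) ≡ ts
    isPair-elim ρ ts h = i , j , trans (cong₂ cons i≡ (trans (cong₂ cons j≡ (sym tail≡)) (cons-surjective (tailᶜ ts) nz′)))
                                       (cons-surjective ts nz)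
      where
      shape : nonZeroᵇ ts ∧ (nonZeroᵇ (tailᶜ ts) ∧ (tailᶜ (tailᶜ ts) ≡ᵇ 0)) ≡ true
      shape = ∧-trueˡ h
      vars : isVarᵇ (envᶜ ρ) (headᶜ ts) ∧ isVarᵇ (envᶜ ρ) (headᶜ (tailᶜ ts)) ≡ true
      vars = ∧-trueʳ {nonZeroᵇ ts ∧ (nonZeroᵇ (tailᶜ ts) ∧ (tailᶜ (tailᶜ ts) ≡ᵇ 0))} h
      nz : nonZeroᵇ ts ≡ true
      nz = ∧-trueˡ shape
      rest : nonZeroᵇ (tailᶜ ts) ∧ (tailᶜ (tailᶜ ts) ≡ᵇ 0) ≡ true
      rest = ∧-trueʳ {nonZeroᵇ ts} shape
      nz′ : nonZeroᵇ (tailᶜ ts) ≡ true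
      nz′ = ∧-trueˡ rest
      tail≡ : tailᶜ (tailᶜ ts) ≡ 0
      tail≡ = ≡ᵇ-true (∧-trueʳ {nonZeroᵇ (tailᶜ ts)} rest)
      i = proj₁ (isVar-elim ρ (headᶜ ts) (∧-trueˡ vars))
      i≡ = proj₂ (isVar-elim ρ (headᶜ ts) (∧-trueˡ vars))
      j = proj₁ (isVar-elim ρ (headᶜ (tailᶜ ts)) (∧-trueʳ {isVarᵇ (envᶜ ρ) (headᶜ ts)} vars))
      j≡ = proj₂ (isVar-elim ρ (headᶜ (tailᶜ ts)) (∧-trueʳ {isVarᵇ (envᶜ ρ) (headᶜ ts)} vars))

    relationValueᵗ-≢2 : ∀ k env r ts → relationValueᵗ k env r ts ≢ 2 → r ≡ 3 × isPairᵇ env ts ≡ true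
    relationValueᵗ-≢2 k env r ts h with r ≡ᵇ 3 in e | isPairᵇ env ts
    ... | true  | true  = ≡ᵇ-true e , refl
    ... | true  | false = contradiction refl h
    ... | false | _     = contradiction refl h

    relationValue-≢2 : ∀ {n} k (ρ : Fin n → ℕ) x → relationValue k (envᶜ ρ) x ≢ 2 →
      Σ (Fin n) λ i → Σ (Fin n) λ j → pair 3 (cons (pair 0 (toℕ i)) (cons (pair 0 (toℕ j)) nil)) ≡ x
    relationValue-≢2 k ρ x h
      with r≡ , p ← relationValueᵗ-≢2 k (envᶜ ρ) (fstᶜ x) (sndᶜ x) (h ∘ trans (relationValue-unfold k (envᶜ ρ) x))
      with i , j , ts≡ ← isPair-elim ρ (sndᶜ x) p =
        i , j , trans (cong₂ pair (sym r≡) ts≡) (pair-surjective x)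

    equalityValueᵗ-var : ∀ {n} a k (ρ : Fin n → ℕ) {t s} i j → t ≡ pair 0 (toℕ i) → s ≡ pair 0 (toℕ j) →
                         equalityValueᵗ a k (envᶜ ρ) t s ≡ ⟨ sameᵇ a k (ρ i) (ρ j) ⟩
    equalityValueᵗ-var a k ρ {t} {s} i j t≡ s≡
      rewrite trans (cong (isVarᵇ (envᶜ ρ)) t≡) (isVar-var ρ i) | trans (cong (isVarᵇ (envᶜ ρ)) s≡) (isVar-var ρ j)
            | trans (cong (valueᶜ (envᶜ ρ)) t≡) (value-var ρ i) | trans (cong (valueᶜ (envᶜ ρ)) s≡) (value-var ρ j) = refl

    relationValueᵗ-var : ∀ {n} k (ρ : Fin n → ℕ) {ts l t s} i j → t ≡ pair 0 (toℕ i) → s ≡ pair 0 (toℕ j) →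
                         ts ≡ cons t l → l ≡ cons s nil → relationValueᵗ k (envᶜ ρ) 3 ts ≡ ⟨ relatedᵇ k (ρ i) (ρ j) ⟩
    relationValueᵗ-var k ρ {ts} {l} {t} {s} i j t≡ s≡ ts≡ l≡
      rewrite trans (cong headᶜ ts≡) (head-cons t l) | trans (cong tailᶜ ts≡) (tail-cons t l)
            | trans (cong headᶜ l≡) (head-cons s nil) | trans (cong tailᶜ l≡) (tail-cons s nil)
            | cong nonZeroᵇ ts≡ | cong nonZeroᵇ l≡
            | trans (cong (isVarᵇ (envᶜ ρ)) t≡) (isVar-var ρ i) | trans (cong (isVarᵇ (envᶜ ρ)) s≡) (isVar-var ρ j)
            | trans (cong (valueᶜ (envᶜ ρ)) t≡) (value-var ρ i) | trans (cong (valueᶜ (envᶜ ρ)) s≡) (value-var ρ j) = refl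

    module _ (a k : ℕ) where
      open Structure (finiteStructure (bit a) k)

      ≡⇒≡ᵇ-true : ∀ {m n} → m ≡ n → (m ≡ᵇ n) ≡ true
      ≡⇒≡ᵇ-true {m} refl = ≡ᵇ-refl m

      equalityValue-truth : ∀ {n} (ρ : Fin n → Fin (finiteSize k)) i j x → x ≡ pair (pair 0 (toℕ i)) (pair 0 (toℕ j)) →
        equalityValue a k (envᶜ (toℕ ∘ ρ)) x ≡ truthValue (ρ i ~ ρ j)
      equalityValue-truth ρ i j x x≡ = trans (equalityValue-unfold a k (envᶜ (toℕ ∘ ρ)) x)
        (trans (equalityValueᵗ-var a k (toℕ ∘ ρ) i j
                 (trans (cong fstᶜ x≡) (fstᶜ-pair (pair 0 (toℕ i)) (pair 0 (toℕ j))))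
                 (trans (cong sndᶜ x≡) (sndᶜ-pair (pair 0 (toℕ i)) (pair 0 (toℕ j)))))
          (truthValue-ᵇ (sameᵇ a k (toℕ (ρ i)) (toℕ (ρ j)))
            (λ e → ≡ᵇ-true (∧-trueˡ e) , ≡ᵇ-true (∧-trueʳ {classᶜ k (toℕ (ρ i)) ≡ᵇ classᶜ k (toℕ (ρ j))} e))
            (λ (p , q) → ∧-intro (≡⇒≡ᵇ-true p) (≡⇒≡ᵇ-true q))))

      relationValue-truth : ∀ {n} (ρ : Fin n → Fin (finiteSize k)) i j {ts} x →
        ts ≡ cons (pair 0 (toℕ i)) (cons (pair 0 (toℕ j)) nil) → x ≡ pair 3 ts →
        relationValue k (envᶜ (toℕ ∘ ρ)) x ≡ truthValue (cls (ρ i) ≡ cls (ρ j))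
      relationValue-truth ρ i j {ts} x ts≡ x≡ = trans (relationValue-unfold k (envᶜ (toℕ ∘ ρ)) x)
        (trans (cong₂ (relationValueᵗ k (envᶜ (toℕ ∘ ρ))) (trans (cong fstᶜ x≡) (fstᶜ-pair 3 ts)) (trans (cong sndᶜ x≡) (sndᶜ-pair 3 ts)))
        (trans (relationValueᵗ-var k (toℕ ∘ ρ) i j refl refl ts≡ refl)
          (truthValue-ᵇ (relatedᵇ k (toℕ (ρ i)) (toℕ (ρ j))) ≡ᵇ-true ≡⇒≡ᵇ-true)))

-- A total evaluator for sentence codes

module EvaluationSystem where

  open Computability
  open Pairing
  open RuleSystems
  open FirstOrderLogic
  open ClassSizes
  open FiniteEvaluation

  data ValueLabel : Set where
    val-≐ val-rel val-⊥ val-⇒ val-∀ val-other all-zero all-suc : ValueLabel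

  module _ {k : ℕ} where
    val : Exp k → Exp k → Exp k → Exp k → Exp k → Pattern k
    val a b φ env c = # 0 ∷ a ∷ b ∷ φ ∷ env ∷ c ∷ []
    allBelow : Exp k → Exp k → Exp k → Exp k → Exp k → Exp k → Pattern k
    allBelow a b φ env i c = # 1 ∷ a ∷ b ∷ φ ∷ env ∷ i ∷ c ∷ []

  -- Every number receives a value, even one that codes no formula; this totality turns the
  -- enumeration of values into a computable function.
  valueRule : ValueLabel → Rule
  valueRule val-≐     = rule 4 [] (val (V 0F) (V 1F) ⟪ # 0 , V 2F ⟫ (V 3F)
                                       (exp (ap₄ c-equalityValue (v 0F) (v 1F) (v 3F) (v 2F))))
  valueRule val-rel   = rule 4 [] (val (V 0F) (V 1F) ⟪ # 1 , V 2F ⟫ (V 3F)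
                                       (exp (ap₃ c-relationValue (v 1F) (v 3F) (v 2F))))
  valueRule val-⊥     = rule 4 [] (val (V 0F) (V 1F) ⟪ # 2 , V 2F ⟫ (V 3F) (exp (ap₁ c-falsityValue (v 2F))))
  valueRule val-⇒     = rule 7 (val (V 0F) (V 1F) (V 2F) (V 4F) (V 5F) ∷ val (V 0F) (V 1F) (V 3F) (V 4F) (V 6F) ∷ [])
                               (val (V 0F) (V 1F) ⟪ # 3 , ⟪ V 2F , V 3F ⟫ ⟫ (V 4F) (exp (ap₂ c-impValue (v 5F) (v 6F))))
  valueRule val-∀     = rule 5 (allBelow (V 0F) (V 1F) (V 2F) (V 3F) (exp (ap₁ c-finiteSize (v 1F))) (V 4F) ∷ [])
                               (val (V 0F) (V 1F) ⟪ # 4 , V 2F ⟫ (V 3F) (V 4F))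
  valueRule val-other = rule 5 [] (val (V 0F) (V 1F) ⟪ 5 ᵉ+ V 4F , V 2F ⟫ (V 3F) (# 2))
  valueRule all-zero  = rule 4 [] (allBelow (V 0F) (V 1F) (V 2F) (V 3F) (# 0) (# 1))
  valueRule all-suc   = rule 7 (allBelow (V 0F) (V 1F) (V 2F) (V 3F) (V 4F) (V 5F)
                                ∷ val (V 0F) (V 1F) (V 2F) (V 4F ∷ᵉ V 3F) (V 6F) ∷ [])
                               (allBelow (V 0F) (V 1F) (V 2F) (V 3F) (1 ᵉ+ V 4F) (exp (ap₂ c-andValue (v 5F) (v 6F))))

  valueSystem : System
  valueSystem = record
    { Label = ValueLabel ; schema = valueRule
    ; labels = val-≐ ∷ val-rel ∷ val-⊥ ∷ val-⇒ ∷ val-∀ ∷ val-other ∷ all-zero ∷ all-suc ∷ []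
    ; complete = λ where
        val-≐     → ∈-lookup (fin 0)
        val-rel   → ∈-lookup (fin 1)
        val-⊥     → ∈-lookup (fin 2)
        val-⇒     → ∈-lookup (fin 3)
        val-∀     → ∈-lookup (fin 4)
        val-other → ∈-lookup (fin 5)
        all-zero  → ∈-lookup (fin 6)
        all-suc   → ∈-lookup (fin 7)
    }

  module Values (em : ExcludedMiddle 0ℓ) where
    open Evaluator em
    open Derivation valueSystem

    _⊨_at_ : ∀ {n} ((a , k) : ℕ × ℕ) → Formula Lᴱ n → (Fin n → Fin (finiteSize k)) → Set
    (a , k) ⊨ φ at ρ = Structure.Sat (finiteStructure (bit a) k) φ ρ

    -- The second component makes evaluation double as a syntax check, which is how codes of axioms
    -- will be recognised.
    Correct : (a k φ env b : ℕ) → Set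
    Correct a k φ env b = ∀ {n} (ρ : Fin n → Fin (finiteSize k)) → envᶜ (toℕ ∘ ρ) ≡ env →
      (∀ (ψ : Formula Lᴱ n) → ⌜ ψ ⌝ ≡ φ → b ≡ truthValue ((a , k) ⊨ ψ at ρ)) ×
      (b ≢ 2 → Σ (Formula Lᴱ n) λ ψ → ⌜ ψ ⌝ ≡ φ)

    -- For `i = 0` nothing has been evaluated and the value 1 carries no information about `φ`, so
    -- well-formedness is claimed only for positive `i`. The domain is nonempty, which makes this
    -- enough for a quantifier.
    CorrectBelow : (a k φ env i b : ℕ) → Set
    CorrectBelow a k φ env i b = i ≤ finiteSize k → ∀ {n} (ρ : Fin n → Fin (finiteSize k)) → envᶜ (toℕ ∘ ρ) ≡ env →
      (∀ (ψ : Formula Lᴱ (suc n)) → ⌜ ψ ⌝ ≡ φ → b ≡ truthValue (∀ j → toℕ j < i → (a , k) ⊨ ψ at (j ▸ ρ))) ×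
      (b ≢ 2 → 0 < i → Σ (Formula Lᴱ (suc n)) λ ψ → ⌜ ψ ⌝ ≡ φ)

    Meaning : Fact → Set
    Meaning (0 ∷ a ∷ k ∷ φ ∷ env ∷ b ∷ [])     = Correct a k φ env b
    Meaning (1 ∷ a ∷ k ∷ φ ∷ env ∷ i ∷ b ∷ []) = CorrectBelow a k φ env i b
    Meaning _                                  = ⊤

    correct-≐ : ∀ a k x env → Correct a k (pair 0 x) env (equalityValue a k env x)
    correct-≐ a k x _ ρ refl = truth , coded
      where
      truth : ∀ ψ → ⌜ ψ ⌝ ≡ pair 0 x → equalityValue a k (envᶜ (toℕ ∘ ρ)) x ≡ truthValue ((a , k) ⊨ ψ at ρ)
      truth ψ e with (var i ≐ var j) eq ← formulaView ψ 0 x e = equalityValue-truth a k ρ i j x (sym eq)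
      coded : equalityValue a k (envᶜ (toℕ ∘ ρ)) x ≢ 2 → Σ (Formula Lᴱ _) λ ψ → ⌜ ψ ⌝ ≡ pair 0 x
      coded h with i , j , eq ← equalityValue-≢2 a k (toℕ ∘ ρ) x h = (var i ≐ var j) , cong (pair 0) eq

    correct-rel : ∀ a k x env → Correct a k (pair 1 x) env (relationValue k env x)
    correct-rel a k x _ ρ refl = truth , coded
      where
      truth : ∀ ψ → ⌜ ψ ⌝ ≡ pair 1 x → relationValue k (envᶜ (toℕ ∘ ρ)) x ≡ truthValue ((a , k) ⊨ ψ at ρ)
      truth ψ e with rel E (var i ∷ var j ∷ []) eq ← formulaView ψ 1 x e = relationValue-truth a k ρ i j x refl (sym eq)
      coded : relationValue k (envᶜ (toℕ ∘ ρ)) x ≢ 2 → Σ (Formula Lᴱ _) λ ψ → ⌜ ψ ⌝ ≡ pair 1 x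
      coded h with i , j , eq ← relationValue-≢2 k (toℕ ∘ ρ) x h = rel E (var i ∷ var j ∷ []) , cong (pair 1) eq

    correct-⊥ : ∀ a k x env → Correct a k (pair 2 x) env (falsityValue x)
    correct-⊥ a k x _ ρ refl = truth , coded
      where
      truth : ∀ ψ → ⌜ ψ ⌝ ≡ pair 2 x → falsityValue x ≡ truthValue ((a , k) ⊨ ψ at ρ)
      truth ψ e with ⊥′ ← formulaView ψ 2 x e = trans falsityValue-0 (sym (truthValue-false {⊥} (λ ())))
      coded : falsityValue x ≢ 2 → Σ (Formula Lᴱ _) λ ψ → ⌜ ψ ⌝ ≡ pair 2 x
      coded h = ⊥′ , cong (pair 2) (sym (falsityValue-≢2 x h))

    correct-⇒ : ∀ a k x y env b c → Correct a k x env b → Correct a k y env c →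
                Correct a k (pair 3 (pair x y)) env (impValue b c)
    correct-⇒ a k x y env b c hb hc ρ env≡ = truth , coded
      where
      truth : ∀ ψ → ⌜ ψ ⌝ ≡ pair 3 (pair x y) → impValue b c ≡ truthValue ((a , k) ⊨ ψ at ρ)
      truth ψ e with (ψ₁ ⇒ ψ₂) eq ← formulaView ψ 3 (pair x y) e = trans
        (cong₂ impValue (proj₁ (hb ρ env≡) ψ₁ (pair-injectiveˡ {⌜ ψ₁ ⌝} {⌜ ψ₂ ⌝} {x} {y} eq))
                        (proj₁ (hc ρ env≡) ψ₂ (pair-injectiveʳ {⌜ ψ₁ ⌝} {⌜ ψ₂ ⌝} {x} {y} eq)))
        (impValue-truth ((a , k) ⊨ ψ₁ at ρ) ((a , k) ⊨ ψ₂ at ρ))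
      coded : impValue b c ≢ 2 → Σ (Formula Lᴱ _) λ ψ → ⌜ ψ ⌝ ≡ pair 3 (pair x y)
      coded h with b≢ , c≢ ← impValue-≢2 b c h with ψ₁ , e₁ ← proj₂ (hb ρ env≡) b≢ | ψ₂ , e₂ ← proj₂ (hc ρ env≡) c≢ =
        (ψ₁ ⇒ ψ₂) , cong (pair 3) (cong₂ pair e₁ e₂)

    correct-∀ : ∀ a k x env b → CorrectBelow a k x env (finiteSize k) b → Correct a k (pair 4 x) env b
    correct-∀ a k x env b h ρ env≡ = truth , coded
      where
      truth : ∀ ψ → ⌜ ψ ⌝ ≡ pair 4 x → b ≡ truthValue ((a , k) ⊨ ψ at ρ)
      truth ψ e with ∀′ θ eq ← formulaView ψ 4 x e = trans (proj₁ (h ≤-refl ρ env≡) θ eq)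
        (truthValue-cong (λ f j → f j (toℕ<n j)) (λ f j _ → f j))
      coded : b ≢ 2 → Σ (Formula Lᴱ _) λ ψ → ⌜ ψ ⌝ ≡ pair 4 x
      coded b≢ with θ , eq ← proj₂ (h ≤-refl ρ env≡) b≢ (s≤s z≤n) = ∀′ θ , cong (pair 4) eq

    correctBelow-suc : ∀ a k x env i b c → CorrectBelow a k x env i b → Correct a k x (cons i env) c →
                       CorrectBelow a k x env (suc i) (andValue b c)
    correctBelow-suc a k x env i b c hb hc i<N ρ env≡ = truth , coded
      where
      here′ : envᶜ (toℕ ∘ (fromℕ< i<N ▸ ρ)) ≡ cons i env
      here′ = cong₂ cons (toℕ-fromℕ< i<N) env≡
      truth : ∀ ψ → ⌜ ψ ⌝ ≡ x → andValue b c ≡ truthValue (∀ j → toℕ j < suc i → (a , k) ⊨ ψ at (j ▸ ρ))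
      truth ψ e = trans (cong₂ andValue (proj₁ (hb (<⇒≤ i<N) ρ env≡) ψ e) (proj₁ (hc (fromℕ< i<N ▸ ρ) here′) ψ e))
        (trans (andValue-truth (∀ j → toℕ j < i → (a , k) ⊨ ψ at (j ▸ ρ)) ((a , k) ⊨ ψ at (fromℕ< i<N ▸ ρ)))
          (truthValue-cong to from))
        where
        to : (∀ j → toℕ j < i → (a , k) ⊨ ψ at (j ▸ ρ)) × (a , k) ⊨ ψ at (fromℕ< i<N ▸ ρ) →
             ∀ j → toℕ j < suc i → (a , k) ⊨ ψ at (j ▸ ρ)
        to (f , p) j j<1+i with m≤n⇒m<n∨m≡n (s≤s⁻¹ j<1+i)
        ... | inj₁ j<i = f j j<i
        ... | inj₂ j≡i = subst (λ j → (a , k) ⊨ ψ at (j ▸ ρ)) (toℕ-injective (trans (toℕ-fromℕ< i<N) (sym j≡i))) p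
        from : (∀ j → toℕ j < suc i → (a , k) ⊨ ψ at (j ▸ ρ)) →
               (∀ j → toℕ j < i → (a , k) ⊨ ψ at (j ▸ ρ)) × (a , k) ⊨ ψ at (fromℕ< i<N ▸ ρ)
        from f = (λ j j<i → f j (m<n⇒m<1+n j<i)) , f (fromℕ< i<N) (≤-reflexive (cong suc (toℕ-fromℕ< i<N)))
      coded : andValue b c ≢ 2 → 0 < suc i → Σ (Formula Lᴱ _) λ ψ → ⌜ ψ ⌝ ≡ x
      coded h _ = proj₂ (hc (fromℕ< i<N ▸ ρ) here′) (proj₂ (andValue-≢2 b c h))

    closed : ∀ l ρ → All Meaning (instances (premises (valueRule l)) ρ) → Meaning (⟦ conclusion (valueRule l) ⟧ ρ)
    closed val-≐ (a ∷ k ∷ x ∷ env ∷ []) [] = correct-≐ a k x env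
    closed val-rel (a ∷ k ∷ x ∷ env ∷ []) [] = correct-rel a k x env
    closed val-⊥ (a ∷ k ∷ x ∷ env ∷ []) [] = correct-⊥ a k x env
    closed val-⇒ (a ∷ k ∷ x ∷ y ∷ env ∷ b ∷ c ∷ []) (hb ∷ hc ∷ []) = correct-⇒ a k x y env b c hb hc
    closed val-∀ (a ∷ k ∷ x ∷ env ∷ b ∷ []) (h ∷ []) = correct-∀ a k x env b h
    closed val-other (a ∷ k ∷ x ∷ env ∷ t ∷ []) [] ρ _ =
      (λ ψ e → case formulaView ψ (5 + t) x e of λ ()) , (λ h → contradiction refl h)
    closed all-zero (a ∷ k ∷ x ∷ env ∷ []) [] _ ρ _ = (λ ψ _ → sym (truthValue-true (λ _ ()))) , (λ _ ())
    closed all-suc (a ∷ k ∷ x ∷ env ∷ i ∷ b ∷ c ∷ []) (hb ∷ hc ∷ []) = correctBelow-suc a k x env i b c hb hc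

    module _ (a k : ℕ) where

      totalAll : ∀ x → (∀ env → ∃[ b ] Der (0 ∷ a ∷ k ∷ x ∷ env ∷ b ∷ [])) →
                 ∀ env i → ∃[ b ] Der (1 ∷ a ∷ k ∷ x ∷ env ∷ i ∷ b ∷ [])
      totalAll x h env zero    = 1 , infer all-zero (a ∷ k ∷ x ∷ env ∷ []) []
      totalAll x h env (suc i) with totalAll x h env i | h (cons i env)
      ... | b , d | c , e = andValue b c , infer all-suc (a ∷ k ∷ x ∷ env ∷ i ∷ b ∷ c ∷ []) (d ∷ e ∷ [])

      Total : ℕ → Set
      Total φ = ∀ env → ∃[ b ] Der (0 ∷ a ∷ k ∷ φ ∷ env ∷ b ∷ [])

      -- Recursion on codes: subformulas have smaller codes, strictly because the tags of
      -- implication and quantifier are positive.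
      total-pair : ∀ t x → (∀ {y} → y < pair t x → Total y) → Total (pair t x)
      total-pair 0 x rec env = equalityValue a k env x , infer val-≐ (a ∷ k ∷ x ∷ env ∷ []) []
      total-pair 1 x rec env = relationValue k env x , infer val-rel (a ∷ k ∷ x ∷ env ∷ []) []
      total-pair 2 x rec env = falsityValue x , infer val-⊥ (a ∷ k ∷ x ∷ env ∷ []) []
      total-pair 3 x rec = subst (λ x → Total (pair 3 x)) (pair-surjective x) λ env →
        let (b , d) = rec (≤-<-trans (subst (fstᶜ x ≤_) (pair-surjective x) (m≤pair (fstᶜ x) (sndᶜ x))) (n<pair-suc 2 x)) env
            (c , e) = rec (≤-<-trans (sndᶜ-≤ x) (n<pair-suc 2 x)) env
        in impValue b c , infer val-⇒ (a ∷ k ∷ fstᶜ x ∷ sndᶜ x ∷ env ∷ b ∷ c ∷ []) (d ∷ e ∷ [])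
      total-pair 4 x rec env with totalAll x (rec (n<pair-suc 3 x)) env (finiteSize k)
      ... | b , d = b , infer val-∀ (a ∷ k ∷ x ∷ env ∷ b ∷ []) (d ∷ [])
      total-pair (suc (suc (suc (suc (suc t))))) x rec env = 2 , infer val-other (a ∷ k ∷ x ∷ env ∷ t ∷ []) []

      total : ∀ φ → Total φ
      total = <-rec Total λ φ rec → subst Total (pair-surjective φ)
        (total-pair (fstᶜ φ) (sndᶜ φ) λ lt → rec (subst (_ <_) (pair-surjective φ) lt))

    opaque
      -- The search is for a stage and a value together, packed into one number.
      valueSearch : Search ∅ (λ xs → by (fstᶜ (lookup {n = 4} xs 0F))
        (0 ∷ lookup xs 1F ∷ lookup xs 2F ∷ lookup xs 3F ∷ 0 ∷ sndᶜ (lookup xs 0F) ∷ []))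
      valueSearch = search (c-by (ap₁ c-fst (v 0F)) (val (V 1F) (V 2F) (V 3F) (# 0) (exp (ap₁ c-snd (v 0F)))))
        λ { (a ∷ k ∷ φ ∷ []) → exists a k φ }
        where
        exists : ∀ a k φ → ∃[ z ] by (fstᶜ z) (0 ∷ a ∷ k ∷ φ ∷ 0 ∷ sndᶜ z ∷ []) ≡ true
        exists a k φ with total a k φ 0
        ... | b , d with Der⇒by d
        ...   | s , h = pair s b ,
          subst₂ (λ s b → by s (0 ∷ a ∷ k ∷ φ ∷ 0 ∷ b ∷ []) ≡ true) (sym (fstᶜ-pair s b)) (sym (sndᶜ-pair s b)) h

      evaluate : ℕ → ℕ → ℕ → ℕ
      evaluate a k φ = sndᶜ (found valueSearch (a ∷ k ∷ φ ∷ []))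

      c-evaluate : Comp₃ ∅ evaluate
      c-evaluate = comp₃ (ext (λ { (a ∷ k ∷ φ ∷ []) → refl }) (ap₁ c-snd (c-found valueSearch)))

      value-derivable : ∀ a k φ → Der (0 ∷ a ∷ k ∷ φ ∷ 0 ∷ evaluate a k φ ∷ [])
      value-derivable a k φ = by⇒Der (fstᶜ (found valueSearch (a ∷ k ∷ φ ∷ []))) (satisfies valueSearch (a ∷ k ∷ φ ∷ []))

    -- `n` is both the code to be evaluated and the size parameter of the structure, which is large
    -- enough because the code bounds the depth.
    holds : ℕ → ℕ → Bool
    holds a n = evaluate a n n ≡ᵇ 1

    c-holds : ∀ {k} {f g : Vec ℕ k → ℕ} → Comp ∅ f → Comp ∅ g → CompB ∅ (λ xs → holds (f xs) (g xs))
    c-holds cf cg = c-≡ᵇ (ap₃ c-evaluate cf cg cg) (const 1)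

    value-correct : ∀ a k φ → Correct a k φ 0 (evaluate a k φ)
    value-correct a k φ = Der-induction Meaning closed (value-derivable a k φ)

    holds-elim : ∀ a n → holds a n ≡ true →
      Σ (Sentence Lᴱ) λ φ → ⌜ φ ⌝ ≡ n × Structure.Sat (finiteStructure (bit a) n) φ (λ ())
    holds-elim a n h with φ , e ← proj₂ (value-correct a n n {0} (λ ()) refl) (λ v≡2 → case trans (sym v≡2) (≡ᵇ-true h) of λ ()) =
      φ , e , truthValue-1 (trans (sym (proj₁ (value-correct a n n {0} (λ ()) refl) φ e)) (≡ᵇ-true h))

    holds-intro : ∀ a n (φ : Sentence Lᴱ) → ⌜ φ ⌝ ≡ n → Structure.Sat (finiteStructure (bit a) n) φ (λ ()) → holds a n ≡ true
    holds-intro a n φ e p = trans (cong (_≡ᵇ 1) (trans (proj₁ (value-correct a n n {0} (λ ()) refl) φ e) (truthValue-true p))) refl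

-- Recursively inseparable sets below a nonrecursive enumerable set

module InseparableSets where

  open Computability
  open Pairing
  open RuleSystems
  open UniversalMachine

  c-relativise : ∀ {O k} {b : Vec ℕ k → Bool} → CompB ∅ b → CompB O b
  c-relativise cb = compᵇ (relativise-comp (bodyᵇ cb))

  -- z = ⟨e, x⟩ enters one of the sets A and B only when x enters W, and
  -- only if the program e has halted on z by then; the output decides
  -- which set.  Moreover all ⟨0, x⟩ with x ∈ W are put into A, to make W
  -- reducible to A; the number 0 is not the code of a unary program.
  module Inseparable (em : ExcludedMiddle 0ℓ) (W : Pred ℕ 0ℓ) (re : RecursivelyEnumerable W) where

    open Evaluation

    -- Replacing the output by 0 makes membership in `W` a single fact, without a search for the
    -- output.
    normalised : Program 1
    normalised = comp (comp zero []) (proj₁ re ∷ [])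

    opaque
      index : ℕ
      index = ⌜ normalised ⌝ᵖ

      index-correct : ⌜ normalised ⌝ᵖ ≡ index
      index-correct = refl

    opaque
      inW : ℕ → ℕ → Bool
      inW s x = by s (4 ∷ index ∷ cons x 0 ∷ 0 ∷ [])

      inW⇒W : ∀ s {x} → inW s x ≡ true → W x
      inW⇒W s {x} h
        with sound (by⇒Der s {4 ∷ index ∷ cons x 0 ∷ 0 ∷ []} h) normalised (x ∷ []) index-correct refl
      ... | comp (e ∷ []) _ = Equivalence.from (proj₂ re x) (_ , e)

      W⇒inW : ∀ {x} → W x → ∃[ s ] inW s x ≡ true
      W⇒inW {x} w with Equivalence.to (proj₂ re x) w
      ... | y , e = Der⇒by (subst (λ i → Der (4 ∷ i ∷ cons x 0 ∷ 0 ∷ [])) index-correct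
                      (derive {p = normalised} {x ∷ []} (comp (e ∷ []) (comp [] zero))))

      inW-0 : ∀ x → inW 0 x ≡ false
      inW-0 x = by-unfold 0 (4 ∷ index ∷ cons x 0 ∷ 0 ∷ [])

      inW-mono : ∀ {s t x} → s ≤ t → inW s x ≡ true → inW t x ≡ true
      inW-mono {x = x} = by-mono (4 ∷ index ∷ cons x 0 ∷ 0 ∷ [])

      c-inW : ∀ {k} {f g : Vec ℕ k → ℕ} → Comp ∅ f → Comp ∅ g → CompB ∅ (λ xs → inW (f xs) (g xs))
      c-inW cf cg = c-by cf (ev (# index) (exp cg ∷ᵉ # 0) (# 0))

      -- The stage `suc s` is the one at which an element counted by `enters s` has just appeared.
      outputs : ℕ → ℕ → ℕ → Bool
      outputs s z y = by (suc s) (4 ∷ fstᶜ z ∷ cons z 0 ∷ y ∷ [])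

      outputs-sound : ∀ s z y (r : Program 1) → ⌜ r ⌝ᵖ ≡ fstᶜ z → outputs s z y ≡ true → Eval ∅ r (z ∷ []) y
      outputs-sound s z y r e h = sound (by⇒Der (suc s) {4 ∷ fstᶜ z ∷ cons z 0 ∷ y ∷ []} h) r (z ∷ []) e refl

      outputs-intro : ∀ {t s e z y} → t ≤ suc s → fstᶜ z ≡ e → by t (4 ∷ e ∷ cons z 0 ∷ y ∷ []) ≡ true → outputs s z y ≡ true
      outputs-intro {z = z} {y} t≤ refl = by-mono (4 ∷ fstᶜ z ∷ cons z 0 ∷ y ∷ []) t≤

      c-outputs : ∀ {k} {f g : Vec ℕ k → ℕ} → Comp ∅ f → Comp ∅ g → ∀ y → CompB ∅ (λ xs → outputs (f xs) (g xs) y)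
      c-outputs cf cg y = c-by (ap₁ c-suc cf) (ev (exp (ap₁ c-fst cg)) (exp cg ∷ᵉ # 0) (# y))

    enters : ℕ → ℕ → Bool
    enters s x = inW (suc s) x ∧ not (inW s x)

    W⇒enters : ∀ {x} → W x → ∃[ s ] enters s x ≡ true
    W⇒enters {x} w with least (λ s → inW s x) (W⇒inW w)
    -- Nothing has been derived at stage 0, so the least stage is a successor.
    ... | zero  , h , _     = case trans (sym (inW-0 x)) h of λ ()
    ... | suc s , h , below = s , ∧-intro h (cong not (below s ≤-refl))

    enters⇒inW : ∀ s {x} → enters s x ≡ true → inW (suc s) x ≡ true
    enters⇒inW s h = ∧-trueˡ h

    enters-unique : ∀ {s t x} → enters s x ≡ true → enters t x ≡ true → s ≡ t
    enters-unique {s} {t} {x} h h′ with <-cmp s t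
    ... | tri≈ _ s≡t _ = s≡t
    ... | tri< s<t _ _ = contradiction (inW-mono {x = x} s<t (∧-trueˡ {inW (suc s) x} h)) (not-true (∧-trueʳ {inW (suc t) x} h′))
    ... | tri> _ _ t<s = contradiction (inW-mono {x = x} t<s (∧-trueˡ {inW (suc t) x} h′)) (not-true (∧-trueʳ {inW (suc s) x} h))

    -- Output 0 of a supposed separating program claims that `z` is not in `A`, so `z` is put into
    -- `A` to refute it; output 1 dually leads to `B`.
    left : ℕ → ℕ → Bool
    left s z = (fstᶜ z ≡ᵇ 0) ∨ outputs s z 0

    entersA entersB : ℕ → ℕ → Bool
    entersA s z = enters s (sndᶜ z) ∧ left s z
    entersB s z = enters s (sndᶜ z) ∧ (not (left s z) ∧ outputs s z 1)

    A B : Pred ℕ 0ℓ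
    A z = ∃[ s ] entersA s z ≡ true
    B z = ∃[ s ] entersB s z ≡ true

    -- Both sets consult the same unique stage, that of the entry of `sndᶜ z` into `W`, where `left`
    -- has one value.
    disjoint : ∀ {z} → A z → ¬ B z
    disjoint {z} (s , h) (t , h′)
      with refl ← enters-unique {s} {t} {sndᶜ z} (∧-trueˡ h) (∧-trueˡ h′) =
        not-true (∧-trueˡ {not (left s z)} (∧-trueʳ {enters s (sndᶜ z)} h′)) (∧-trueʳ {enters s (sndᶜ z)} h)

    module _ {k : ℕ} {f g : Vec ℕ k → ℕ} (cf : Comp ∅ f) (cg : Comp ∅ g) where
      c-left : CompB ∅ (λ xs → left (f xs) (g xs))
      c-left = c-∨ (c-≡ᵇ (ap₁ c-fst cg) (const 0)) (c-outputs cf cg 0)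

      c-enters : CompB ∅ (λ xs → enters (f xs) (g xs))
      c-enters = c-∧ (c-inW (ap₁ c-suc cf) cg) (c-not (c-inW cf cg))

    module _ {k : ℕ} {f g : Vec ℕ k → ℕ} (cf : Comp ∅ f) (cg : Comp ∅ g) where
      c-entersA : CompB ∅ (λ xs → entersA (f xs) (g xs))
      c-entersA = c-∧ (c-enters cf (ap₁ c-snd cg)) (c-left cf cg)

      c-entersB : CompB ∅ (λ xs → entersB (f xs) (g xs))
      c-entersB = c-∧ (c-enters cf (ap₁ c-snd cg)) (c-∧ (c-not (c-left cf cg)) (c-outputs cf cg 1))

    -- The oracle tells whether `sndᶜ z` ever enters `W`; if so, the unique stage of entry is found
    -- by search, and `b` can hold at no other stage.
    entersAt : ∀ (b : ℕ → ℕ → Bool) → CompB ∅ {2} (λ xs → b (lookup xs 0F) (lookup xs 1F)) →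
               (∀ s z → b s z ≡ true → enters s (sndᶜ z) ≡ true) → (λ z → ∃[ s ] b s z ≡ true) ≤ᵀ W
    entersAt b cb enters? = decides⇒≤ᵀ {χ = χ} record
      { computable = compᵇ (ext (λ { (z ∷ []) → refl }) (bodyᵇ
          (c-∧ (c-χW (ap₁ c-snd (v 0F))) (compᵇ (c-∘ {h = λ xs → stage xs ∷ lookup xs 0F ∷ []} (bodyᵇ (c-relativise cb))
            λ { zero → c-stage ; (suc zero) → v 0F })))))
      ; ∈⇒true     = λ {z} (s , h) → ∧-intro (characteristic-true em W (inW⇒W (suc s) (enters⇒inW s (enters? s z h))))
          (subst (λ t → b t z ≡ true) (enters-unique (enters? s z h) (stage-enters z (inW⇒W (suc s) (enters⇒inW s (enters? s z h))))) h)
      ; true⇒∈     = λ {z} h → stage (z ∷ []) , ∧-trueʳ {characteristic em W (sndᶜ z)} h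
      }
      where
      c-χW : ∀ {k} {f : Vec ℕ k → ℕ} → Comp W f → CompB W (λ xs → characteristic em W (f xs))
      c-χW cf = compᵇ (ap₁ (comp₁ {f = λ n → ⟨ characteristic em W n ⟩} (computes oracle λ { (n ∷ []) → run n })) cf)
        where
        run : ∀ n → Eval W oracle (n ∷ []) ⟨ characteristic em W n ⟩
        run n with em {W n}
        ... | yes w = oracle-∈ w
        ... | no ¬w = oracle-∉ ¬w
      -- The first disjunct makes the search total on elements outside `W`.
      entry : Search W (λ xs → not (characteristic em W (sndᶜ (lookup {n = 2} xs 1F))) ∨ enters (lookup xs 0F) (sndᶜ (lookup xs 1F)))
      entry = search (c-∨ (c-not (c-χW (ap₁ c-snd (v 1F)))) (c-relativise (c-enters (v 0F) (ap₁ c-snd (v 1F)))))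
        λ { (z ∷ []) → exists z }
        where
        exists : ∀ z → ∃[ s ] not (characteristic em W (sndᶜ z)) ∨ enters s (sndᶜ z) ≡ true
        exists z with em {W (sndᶜ z)}
        ... | no _  = 0 , refl
        ... | yes w = W⇒enters w
      stage : Vec ℕ 1 → ℕ
      stage = found entry
      c-stage : Comp W stage
      c-stage = c-found entry
      stage-enters : ∀ z → W (sndᶜ z) → enters (stage (z ∷ [])) (sndᶜ z) ≡ true
      stage-enters z w with ∨-true {not (characteristic em W (sndᶜ z))} (satisfies entry (z ∷ []))
      ... | inj₁ h = contradiction (characteristic-true em W w) (not-true h)
      ... | inj₂ h = h
      χ : ℕ → Bool
      χ z = characteristic em W (sndᶜ z) ∧ b (stage (z ∷ [])) z

    A≤W : A ≤ᵀ W
    A≤W = entersAt entersA (c-entersA (v 0F) (v 1F)) (λ s z h → ∧-trueˡ h)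

    B≤W : B ≤ᵀ W
    B≤W = entersAt entersB (c-entersB (v 0F) (v 1F)) (λ s z h → ∧-trueˡ h)

    W⇒A : ∀ {x} → W x → A (pair 0 x)
    W⇒A {x} w with W⇒enters w
    ... | s , h = s , ∧-intro (subst (λ y → enters s y ≡ true) (sym (sndᶜ-pair 0 x)) h)
                              (∨-introˡ (cong (_≡ᵇ 0) (fstᶜ-pair 0 x)))

    A⇒W : ∀ {x} → A (pair 0 x) → W x
    A⇒W {x} (s , h) = inW⇒W (suc s) (enters⇒inW s (subst (λ y → enters s y ≡ true) (sndᶜ-pair 0 x) (∧-trueˡ h)))

    program-code≢0 : ∀ (p : Program 1) → ⌜ p ⌝ᵖ ≢ 0
    program-code≢0 p e with programView p 0 0 e
    ... | ()

    -- If χ, with program r, separates A from B, then x cannot enter W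
    -- after r has halted on ⟨r, x⟩.
    inseparable : (χ : ℕ → Bool) → CompB ∅ {1} (λ xs → χ (lookup xs 0F)) →
                  (∀ {z} → A z → χ z ≡ true) → (∀ {z} → B z → χ z ≡ false) → Recursive W
    inseparable χ cχ A⇒χ B⇒χ = decides⇒≤ᵀ {χ = λ x → inW (stage (x ∷ [])) x} record
      { computable = c-inW (ext (λ { (x ∷ []) → refl }) (c-found halting)) (v 0F)
      ; ∈⇒true     = W⇒early
      ; true⇒∈     = λ {x} h → inW⇒W (stage (x ∷ [])) h
      }
      where
      r : Program 1
      r = program (bodyᵇ cχ)
      opaque
        e : ℕ
        e = ⌜ r ⌝ᵖ
        e≡ : ⌜ r ⌝ᵖ ≡ e
        e≡ = refl
      derivation : ∀ z → Der (4 ∷ e ∷ cons z 0 ∷ ⟨ χ z ⟩ ∷ [])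
      derivation z = subst (λ e → Der (4 ∷ e ∷ cons z 0 ∷ ⟨ χ z ⟩ ∷ [])) e≡ (derive (runs (bodyᵇ cχ) (z ∷ [])))
      halting : Search ∅ {1} (λ xs → by (lookup xs 0F) (4 ∷ e ∷ cons (pair e (lookup xs 1F)) 0 ∷ ⟨ χ (pair e (lookup xs 1F)) ⟩ ∷ []))
      halting = search (c-by (v 0F) (ev (# e) (⟪ # e , V 1F ⟫ ∷ᵉ # 0)
          (exp (ap₁ (comp₁ {f = λ z → ⟨ χ z ⟩} (bodyᵇ cχ)) (c-den ⟪ # e , V 1F ⟫)))))
        λ { (x ∷ []) → Der⇒by (derivation (pair e x)) }
      stage : Vec ℕ 1 → ℕ
      stage = found halting
      output : ∀ s x b → outputs s (pair e x) ⟨ b ⟩ ≡ true → b ≡ χ (pair e x)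
      output s x b h = ⟨⟩-injective (Eval-deterministic
        (outputs-sound s (pair e x) ⟨ b ⟩ r (trans e≡ (sym (fstᶜ-pair e x))) h) (runs (bodyᵇ cχ) (pair e x ∷ [])))
      W⇒early : ∀ {x} → W x → inW (stage (x ∷ [])) x ≡ true
      W⇒early {x} w with W⇒enters w
      ... | s , en with suc s ≤? stage (x ∷ [])
      ...   | yes le = inW-mono le (enters⇒inW s en)
      -- Here `r` has already halted on `z` when `x` enters, so its output is available and `z` is
      -- put on the side that `χ` denies.
      ...   | no  gt = ⊥-elim (late (χ z) refl)
        where
        z = pair e x
        en′ : enters s (sndᶜ z) ≡ true
        en′ = subst (λ y → enters s y ≡ true) (sym (sndᶜ-pair e x)) en
        halted : outputs s z ⟨ χ z ⟩ ≡ true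
        halted = outputs-intro (<⇒≤ (≰⇒> gt)) (fstᶜ-pair e x) (satisfies halting (x ∷ []))
        late : ∀ c → χ z ≡ c → ⊥
        late false χz = case trans (sym χz) (A⇒χ (s , ∧-intro en′
          (∨-introʳ (fstᶜ z ≡ᵇ 0) (subst (λ c → outputs s z ⟨ c ⟩ ≡ true) χz halted)))) of λ ()
        late true χz = case trans (sym χz) (B⇒χ (s , ∧-intro en′ (∧-intro (not-intro notLeft)
          (subst (λ c → outputs s z ⟨ c ⟩ ≡ true) χz halted)))) of λ ()
          where
          notLeft : left s z ≢ true
          notLeft h with ∨-true {fstᶜ z ≡ᵇ 0} h
          -- First component 0 would also make `z` go left, but `e` is the code of a unary program.
          ... | inj₁ e≡0 = program-code≢0 r (trans e≡ (trans (sym (fstᶜ-pair e x)) (≡ᵇ-true e≡0)))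
          ... | inj₂ o   = case trans (output s x false o) χz of λ ()

-- Computing the codes of the class size sentences and of their translations

module SentenceCodes where

  open Computability
  open Pairing
  open FirstOrderLogic
  open FormulaCodes
  open ClassSizes

  -- Plain coding and coding after an interpretation satisfy the same kind of clauses on the few
  -- formulas from which `classOfSize n` is built, so its code is shown to be computable in `n` once
  -- for both.
  record CodeOf (tr : ∀ {m} → Formula Lᴱ m → ℕ) : Set where
    field
      allᵗ      : ℕ → ℕ
      c-allᵗ    : Comp₁ ∅ allᵗ
      eqᵗ       : ℕ → ℕ
      c-eqᵗ     : Comp₁ ∅ eqᵗ
      relatedᵗ  : ℕ
      tr-⊥      : ∀ {m} → tr (⊥′ {n = m}) ≡ botᶜ
      tr-⇒      : ∀ {m} (φ ψ : Formula Lᴱ m) → tr (φ ⇒ ψ) ≡ impᶜ (tr φ) (tr ψ)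
      tr-∀      : ∀ {m} (φ : Formula Lᴱ (suc m)) → tr (∀′ φ) ≡ allᵗ (tr φ)
      tr-≐      : ∀ {m} (i : Fin m) → tr (var zero ≐ var (suc i)) ≡ eqᵗ (toℕ i)
      tr-related : ∀ {m} → tr (related {m}) ≡ relatedᵗ

  module _ {tr : ∀ {m} → Formula Lᴱ m → ℕ} (code : CodeOf tr) where
    open CodeOf code

    exᵗ : ℕ → ℕ
    exᵗ c = notᶜ (allᵗ (notᶜ c))

    c-exᵗ : Comp₁ ∅ exᵗ
    c-exᵗ = comp₁ (ap₁ c-notᶜ (ap₁ c-allᵗ (ap₁ c-notᶜ (v 0F))))

    oneOfᵗ : ℕ → ℕ
    oneOfᵗ zero    = botᶜ
    oneOfᵗ (suc k) = orᶜ (oneOfᵗ k) (eqᵗ k)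

    c-oneOfᵗ : Comp₁ ∅ oneOfᵗ
    c-oneOfᵗ = comp₁ (ext (λ { (k ∷ []) → step k })
        (c-rec (const botᶜ) (ap₂ c-orᶜ (v 1F) (ap₁ c-eqᵗ (v 0F))) (v 0F)))
      where
      step : ∀ k → natrec botᶜ (λ i r → orᶜ r (eqᵗ i)) k ≡ oneOfᵗ k
      step zero    = refl
      step (suc k) = cong (λ c → orᶜ c (eqᵗ k)) (step k)

    -- remainingᵗ n j is the code of remaining j (n ∸ j).
    remainingᵗ : ℕ → ℕ → ℕ
    remainingᵗ n zero    = allᵗ (impᶜ relatedᵗ (oneOfᵗ (suc n)))
    remainingᵗ n (suc j) =
      exᵗ (andᶜ relatedᵗ (andᶜ (notᶜ (oneOfᵗ (suc (n ∸ suc j)))) (remainingᵗ n j)))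

    c-remainingᵗ : Comp₂ ∅ remainingᵗ
    c-remainingᵗ = comp₂ (ext (λ { (n ∷ j ∷ []) → step n j })
        (c-rec (ap₁ c-allᵗ (ap₂ c-imp (const relatedᵗ) (ap₁ c-oneOfᵗ (ap₁ c-suc (v 0F)))))
          (ap₁ c-exᵗ (ap₂ c-andᶜ (const relatedᵗ) (ap₂ c-andᶜ
            (ap₁ c-notᶜ (ap₁ c-oneOfᵗ (ap₁ c-suc (ap₂ c-∸ (v 2F) (ap₁ c-suc (v 0F)))))) (v 1F))))
          (v 1F)))
      where
      step : ∀ n j → natrec (allᵗ (impᶜ relatedᵗ (oneOfᵗ (suc n))))
        (λ j r → exᵗ (andᶜ relatedᵗ (andᶜ (notᶜ (oneOfᵗ (suc (n ∸ suc j)))) r))) j ≡ remainingᵗ n j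
      step n zero    = refl
      step n (suc j) = cong (λ r → exᵗ (andᶜ relatedᵗ (andᶜ (notᶜ (oneOfᵗ (suc (n ∸ suc j)))) r))) (step n j)

    classOfSizeᵗ : ℕ → ℕ
    classOfSizeᵗ n = exᵗ (remainingᵗ n n)

    c-classOfSizeᵗ : Comp₁ ∅ classOfSizeᵗ
    c-classOfSizeᵗ = comp₁ (ap₁ c-exᵗ (ap₂ c-remainingᵗ (v 0F) (v 0F)))

    tr-¬ : ∀ {m} (φ : Formula Lᴱ m) → tr (¬′ φ) ≡ notᶜ (tr φ)
    tr-¬ φ = trans (tr-⇒ φ ⊥′) (cong (impᶜ (tr φ)) tr-⊥)

    tr-∧ : ∀ {m} (φ ψ : Formula Lᴱ m) → tr (φ ∧′ ψ) ≡ andᶜ (tr φ) (tr ψ)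
    tr-∧ φ ψ = trans (tr-¬ (φ ⇒ ¬′ ψ)) (cong notᶜ (trans (tr-⇒ φ (¬′ ψ)) (cong (impᶜ (tr φ)) (tr-¬ ψ))))

    tr-∨ : ∀ {m} (φ ψ : Formula Lᴱ m) → tr (φ ∨′ ψ) ≡ orᶜ (tr φ) (tr ψ)
    tr-∨ φ ψ = trans (tr-⇒ (¬′ φ) ψ) (cong (λ c → impᶜ c (tr ψ)) (tr-¬ φ))

    tr-∃ : ∀ {m} (φ : Formula Lᴱ (suc m)) → tr (∃′ φ) ≡ exᵗ (tr φ)
    tr-∃ φ = trans (tr-¬ (∀′ (¬′ φ))) (cong notᶜ (trans (tr-∀ (¬′ φ)) (cong allᵗ (tr-¬ φ))))

    tr-oneOf : ∀ {m} k (k≤m : k ≤ m) → tr (equalsOneOf k k≤m) ≡ oneOfᵗ k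
    tr-oneOf zero    _   = tr-⊥
    tr-oneOf (suc k) k<m = trans (tr-∨ (equalsOneOf k (<⇒≤ k<m)) (var zero ≐ var (suc (fromℕ< k<m))))
      (cong₂ orᶜ (tr-oneOf k (<⇒≤ k<m)) (trans (tr-≐ (fromℕ< k<m)) (cong eqᵗ (toℕ-fromℕ< k<m))))

    tr-remaining : ∀ n j m → j + m ≡ n → tr (remaining j m) ≡ remainingᵗ n j
    tr-remaining n zero m refl = trans (tr-∀ (related ⇒ equalsOneOf (suc m) ≤-refl)) (cong allᵗ
      (trans (tr-⇒ related (equalsOneOf (suc m) ≤-refl)) (cong₂ impᶜ tr-related (tr-oneOf (suc m) ≤-refl))))
    tr-remaining n (suc j) m j+m≡n = trans (tr-∃ (related ∧′ (¬′ equalsOneOf (suc m) ≤-refl ∧′ remaining j (suc m)))) (cong exᵗ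
      (trans (tr-∧ related (¬′ equalsOneOf (suc m) ≤-refl ∧′ remaining j (suc m))) (cong₂ andᶜ tr-related
      (trans (tr-∧ (¬′ equalsOneOf (suc m) ≤-refl) (remaining j (suc m))) (cong₂ andᶜ
        (trans (tr-¬ (equalsOneOf (suc m) ≤-refl)) (cong notᶜ (trans (tr-oneOf (suc m) ≤-refl) (cong (λ i → oneOfᵗ (suc i)) m≡))))
        (tr-remaining n j (suc m) (trans (+-suc j m) j+m≡n)))))))
      where
      m≡ : m ≡ n ∸ suc j
      m≡ = sym (trans (cong (_∸ suc j) (sym j+m≡n)) (m+n∸m≡n (suc j) m))

    tr-classOfSize : ∀ n → tr (classOfSize n) ≡ classOfSizeᵗ n
    tr-classOfSize n = trans (tr-∃ (remaining n 0)) (cong exᵗ (tr-remaining n n 0 (+-identityʳ n)))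

  plainCode : CodeOf ⌜_⌝
  plainCode = record
    { allᵗ = allᶜ ; c-allᵗ = c-allᶜ
    ; eqᵗ = λ i → eqᶜ 0 (pair 0 (suc i)) ; c-eqᵗ = comp₁ (ap₂ c-eqᶜ (const 0) (ap₂ c-pair (const 0) (ap₁ c-suc (v 0F))))
    ; relatedᵗ = ⌜ related {0} ⌝
    ; tr-⊥ = λ {m} → ⌜⊥⌝ {Lᴱ} {m} ; tr-⇒ = λ φ ψ → ⌜⇒⌝ (φ ⇒ ψ) refl ; tr-∀ = λ φ → ⌜∀⌝ φ ; tr-≐ = λ {m} i → ⌜≐⌝ {Lᴱ} {suc m} (var zero) (var (suc i))
    ; tr-related = refl
    }

  module _ {L : Language} where
    mutual
      c-renameᵗ : ∀ {n} (f : ℕ → Fin n → ℕ) → (∀ i → Comp₁ ∅ (λ x → f x i)) →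
                  ∀ (t : Term L n) → Comp₁ ∅ (λ x → renameᶜᵗ (f x) t)
      c-renameᵗ f cf (var i)         = comp₁ (ap₂ c-pair (const 0) (body₁ (cf i)))
      c-renameᵗ f cf (func {k} g ts) = comp₁ (ap₂ c-pair (const 1) (ap₂ c-pair (const (pair k (⌜_⌝ᶠ L g))) (body₁ (c-renameᵗˢ f cf ts))))

      c-renameᵗˢ : ∀ {n k} (f : ℕ → Fin n → ℕ) → (∀ i → Comp₁ ∅ (λ x → f x i)) →
                   ∀ (ts : Vec (Term L n) k) → Comp₁ ∅ (λ x → renameᶜᵗˢ (f x) ts)
      c-renameᵗˢ f cf []       = comp₁ (const 0)
      c-renameᵗˢ f cf (t ∷ ts) = comp₁ (ap₂ c-cons (body₁ (c-renameᵗ f cf t)) (body₁ (c-renameᵗˢ f cf ts)))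

    -- Here the formula is fixed and a variable number varies; this happens to the equality formula
    -- of an interpretation, applied to a variable that depends on `i`.
    c-rename : ∀ {n} (f : ℕ → Fin n → ℕ) → (∀ i → Comp₁ ∅ (λ x → f x i)) →
               ∀ (φ : Formula L n) → Comp₁ ∅ (λ x → renameᶜ (f x) φ)
    c-rename f cf (t ≐ s) = comp₁ (ap₂ c-pair (const 0) (ap₂ c-pair (body₁ (c-renameᵗ f cf t)) (body₁ (c-renameᵗ f cf s))))
    c-rename f cf (rel {k = k} r ts) =
      comp₁ (ap₂ c-pair (const 1) (ap₂ c-pair (const (pair k (⌜_⌝ʳ L r))) (body₁ (c-renameᵗˢ f cf ts))))
    c-rename f cf ⊥′ = comp₁ (const (pair 2 0))
    c-rename f cf (φ ⇒ ψ) = comp₁ (ap₂ c-pair (const 3) (ap₂ c-pair (body₁ (c-rename f cf φ)) (body₁ (c-rename f cf ψ))))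
    c-rename f cf (∀′ φ) = comp₁ (ap₂ c-pair (const 4) (body₁ (c-rename (λ x → liftᶜ {L} (f x))
      (λ { zero → comp₁ (const 0) ; (suc i) → comp₁ (ap₁ c-suc (body₁ (cf i))) }) φ)))

    ⌜∀⌝′ : ∀ {n} (χ : Formula L n) φ → χ ≡ ∀′ φ → ⌜ χ ⌝ ≡ allᶜ ⌜ φ ⌝
    ⌜∀⌝′ χ φ refl = ⌜∀⌝ φ

    ⌜atom⌝ : ∀ {n} (d₀ q₀ d₁ q₁ p : Formula L (suc (suc n))) χ →
      χ ≡ ∃′ (∃′ (((d₀ ∧′ q₀) ∧′ ((d₁ ∧′ q₁) ∧′ ⊤′)) ∧′ p)) →
      ⌜ χ ⌝ ≡ exᶜ (exᶜ (andᶜ (andᶜ (andᶜ ⌜ d₀ ⌝ ⌜ q₀ ⌝) (andᶜ (andᶜ ⌜ d₁ ⌝ ⌜ q₁ ⌝) (notᶜ botᶜ))) ⌜ p ⌝))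
    ⌜atom⌝ {n} d₀ q₀ d₁ q₁ p _ refl =
      trans (⌜∃⌝ (∃′ (((d₀ ∧′ q₀) ∧′ ((d₁ ∧′ q₁) ∧′ ⊤′)) ∧′ p))) (cong exᶜ
      (trans (⌜∃⌝ (((d₀ ∧′ q₀) ∧′ ((d₁ ∧′ q₁) ∧′ ⊤′)) ∧′ p)) (cong exᶜ
      (trans (⌜∧⌝ ((d₀ ∧′ q₀) ∧′ ((d₁ ∧′ q₁) ∧′ ⊤′)) p) (cong (λ c → andᶜ c ⌜ p ⌝)
      (trans (⌜∧⌝ (d₀ ∧′ q₀) ((d₁ ∧′ q₁) ∧′ ⊤′)) (cong₂ andᶜ (⌜∧⌝ d₀ q₀)
      (trans (⌜∧⌝ (d₁ ∧′ q₁) ⊤′) (cong₂ andᶜ (⌜∧⌝ d₁ q₁) (trans (⌜¬⌝ {L} {suc (suc n)} ⊥′) (cong notᶜ (⌜⊥⌝ {L} {suc (suc n)}))))))))))))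

  module TranslationCode {L : Language} (I : Translation Lᴱ L) where
    open Translation I

    firstThen : ℕ → ℕ → Fin 2 → ℕ
    firstThen x y zero    = x
    firstThen x y (suc _) = y

    domainᶜ : ℕ → ℕ
    domainᶜ y = renameᶜ (λ _ → y) domain

    equalityᶜ : ℕ → ℕ → ℕ
    equalityᶜ x y = renameᶜ (firstThen x y) equality

    atomᶜ : Formula L 2 → ℕ → ℕ → ℕ
    -- The two existential witnesses are the variables 0 and 1, so the arguments are shifted by 2.
    atomᶜ ψ i j = exᶜ (exᶜ (andᶜ (andᶜ (andᶜ (domainᶜ 0) (equalityᶜ (suc (suc i)) 0))
      (andᶜ (andᶜ (domainᶜ 1) (equalityᶜ (suc (suc j)) 1)) (notᶜ botᶜ))) (renameᶜ toℕ ψ)))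

    domain-code : ∀ {n} (x : Fin n) → ⌜ relativise I x ⌝ ≡ domainᶜ (toℕ x)
    domain-code x = rename-code (λ _ → x) (λ _ → toℕ x) (λ _ → refl) domain

    equality-code : ∀ {n} (x y : Fin n) → ⌜ rename (pairᵛ I x y) equality ⌝ ≡ equalityᶜ (toℕ x) (toℕ y)
    equality-code x y = rename-code (pairᵛ I x y) (firstThen (toℕ x) (toℕ y)) (λ { zero → refl ; (suc _) → refl }) equality

    embed-code : ∀ n (ψ : Formula L 2) → ⌜ rename (_↑ˡ n) ψ ⌝ ≡ renameᶜ toℕ ψ
    embed-code n ψ = rename-code (_↑ˡ n) toℕ (λ { zero → refl ; (suc zero) → refl }) ψ

    atom-code : ∀ {n} (ψ : Formula L 2) (i j : Fin n) χ → χ ≡ atom I (var i ∷ var j ∷ []) ψ →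
                ⌜ χ ⌝ ≡ atomᶜ ψ (toℕ i) (toℕ j)
    atom-code {n} ψ i j χ χ≡ = trans
      (⌜atom⌝ (relativise I zero) (rename (pairᵛ I (suc (suc i)) zero) equality)
              (relativise I (suc zero)) (rename (pairᵛ I (suc (suc j)) (suc zero)) equality)
              (rename (_↑ˡ n) ψ) χ χ≡)
      (cong (λ c → exᶜ (exᶜ c)) (cong₂ andᶜ (cong₂ andᶜ
        (cong₂ andᶜ (domain-code zero) (equality-code (suc (suc i)) zero))
        (cong (λ c → andᶜ c (notᶜ botᶜ)) (cong₂ andᶜ (domain-code (suc zero)) (equality-code (suc (suc j)) (suc zero)))))
        (embed-code n ψ)))

    translationCode : CodeOf (λ φ → ⌜ translate I φ ⌝)
    translationCode = record
      { allᵗ = λ c → allᶜ (impᶜ (domainᶜ 0) c)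
      ; c-allᵗ = comp₁ (ap₁ c-allᶜ (ap₂ c-imp (const (domainᶜ 0)) (v 0F)))
      ; eqᵗ = λ i → atomᶜ equality 0 (suc i)
      ; c-eqᵗ = comp₁ (ap₁ c-exᶜ (ap₁ c-exᶜ (ap₂ c-andᶜ (ap₂ c-andᶜ (const (andᶜ (domainᶜ 0) (equalityᶜ 2 0)))
          (ap₂ c-andᶜ (ap₂ c-andᶜ (const (domainᶜ 1))
            -- The argument is the variable `suc i` moved past the two witnesses: hence three
            -- successors.
            (body₁ (c-rename (λ i → firstThen (suc (suc (suc i))) 1) shifted equality)))
            (const (notᶜ botᶜ)))) (const (renameᶜ toℕ equality)))))
      ; relatedᵗ = atomᶜ (relation E) 0 1
      ; tr-⊥ = λ {m} → ⌜⊥⌝ {L} {m}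
      ; tr-⇒ = λ φ ψ → ⌜⇒⌝ (translate I (φ ⇒ ψ)) refl
      ; tr-∀ = λ φ → trans (⌜∀⌝′ (translate I (∀′ φ)) (relativise I zero ⇒ translate I φ) refl) (cong allᶜ
          (trans (⌜⇒⌝ (relativise I zero ⇒ translate I φ) refl) (cong (λ c → impᶜ c ⌜ translate I φ ⌝) (domain-code zero))))
      ; tr-≐ = λ i → atom-code equality zero (suc i) (translate I (var zero ≐ var (suc i))) refl
      ; tr-related = λ {m} → atom-code (relation E) zero (suc zero) (translate I (related {m})) refl
      }
      where
      shifted : ∀ i → Comp₁ ∅ (λ x → firstThen (suc (suc (suc x))) 1 i)
      shifted zero    = comp₁ (ap₁ c-suc (ap₁ c-suc (ap₁ c-suc (v 0F))))
      shifted (suc _) = comp₁ (const 1)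

-- The theory of all `M(X)` with `X` separating `A` from `B`

module TheoryOfPair where

  open Computability
  open Pairing
  open RuleSystems
  open FirstOrderLogic
  open FormulaCodes
  open ClassSizes
  open FiniteEvaluation
  open EvaluationSystem

  module PairTheory (em : ExcludedMiddle 0ℓ) (A B : Pred ℕ 0ℓ)
    (entersA entersB : ℕ → ℕ → Bool)
    (c-entersA : CompB ∅ {2} (λ xs → entersA (lookup xs 0F) (lookup xs 1F)))
    (c-entersB : CompB ∅ {2} (λ xs → entersB (lookup xs 0F) (lookup xs 1F)))
    (A⇒enters : ∀ {z} → A z → ∃[ s ] entersA s z ≡ true) (enters⇒A : ∀ {z} s → entersA s z ≡ true → A z)
    (B⇒enters : ∀ {z} → B z → ∃[ s ] entersB s z ≡ true) (enters⇒B : ∀ {z} s → entersB s z ≡ true → B z)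
    (disjoint : ∀ {z} → A z → ¬ B z) where

    open Values em

    byA byB : ℕ → ℕ → Bool
    byA s z = anyᵇ (λ t → entersA t z) s
    byB s z = anyᵇ (λ t → entersB t z) s

    byA⇒A : ∀ s {z} → byA s z ≡ true → A z
    byA⇒A s {z} h with anyᵇ-elim (λ t → entersA t z) s h
    ... | t , _ , e = enters⇒A t e

    byB⇒B : ∀ s {z} → byB s z ≡ true → B z
    byB⇒B s {z} h with anyᵇ-elim (λ t → entersB t z) s h
    ... | t , _ , e = enters⇒B t e

    agrees : (α β : ℕ → Bool) → ℕ → ℕ → Bool
    agrees α β a n = allᵇ (λ c → (not (α c) ∨ bit a c) ∧ (not (β c) ∨ not (bit a c))) n

    agrees-intro : ∀ α β a n → (∀ c → c < n → α c ≡ true → bit a c ≡ true) →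
                   (∀ c → c < n → β c ≡ true → bit a c ≡ false) → agrees α β a n ≡ true
    agrees-intro α β a n hα hβ = allᵇ-intro _ n λ c c<n → ∧-intro (l (α c) (hα c c<n)) (r (β c) (hβ c c<n))
      where
      l : ∀ x {y} → (x ≡ true → y ≡ true) → not x ∨ y ≡ true
      l true  h = h refl
      l false h = refl
      r : ∀ x {y} → (x ≡ true → y ≡ false) → not x ∨ not y ≡ true
      r true  h = cong not (h refl)
      r false h = refl

    agrees-elim : ∀ α β a n → agrees α β a n ≡ true → ∀ c → c < n →
                  (α c ≡ true → bit a c ≡ true) × (β c ≡ true → bit a c ≡ false)
    agrees-elim α β a n h c c<n = l (∧-trueˡ hc) , r (∧-trueʳ {not (α c) ∨ bit a c} hc)
      where
      hc : (not (α c) ∨ bit a c) ∧ (not (β c) ∨ not (bit a c)) ≡ true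
      hc = allᵇ-elim (λ c → (not (α c) ∨ bit a c) ∧ (not (β c) ∨ not (bit a c))) h c<n
      l : ∀ {x y} → not x ∨ y ≡ true → x ≡ true → y ≡ true
      l e refl = e
      r : ∀ {x y} → not x ∨ not y ≡ true → x ≡ true → y ≡ false
      r {y = false} _ refl = refl

    -- Truth in `M(X)` for all `X` that contain `α` and avoid `β`, cut down to finitely many finite
    -- sets and finite structures.
    valid : (α β : ℕ → Bool) → ℕ → Bool
    valid α β n = allᵇ (λ a → not (agrees α β a n) ∨ holds a n) (suc (setBound n))

    valid-elim : ∀ α β n → valid α β n ≡ true → ∀ a → a ≤ setBound n → agrees α β a n ≡ true → holds a n ≡ true
    valid-elim α β n h a a≤ ag with ∨-true {not (agrees α β a n)} (allᵇ-elim (λ a → not (agrees α β a n) ∨ holds a n) h (s≤s a≤))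
    ... | inj₁ e = contradiction ag (not-true e)
    ... | inj₂ e = e

    valid-intro : ∀ α β n → (∀ a → a ≤ setBound n → agrees α β a n ≡ true → holds a n ≡ true) → valid α β n ≡ true
    valid-intro α β n h = allᵇ-intro _ (suc (setBound n)) λ a a< → either a (agrees α β a n) refl (s≤s⁻¹ a<)
      where
      either : ∀ a b → agrees α β a n ≡ b → a ≤ setBound n → not b ∨ holds a n ≡ true
      either a false _ _ = refl
      either a true  e a≤ = h a a≤ e

    -- At stage `s` there are fewer constraints and hence more sets to satisfy; so a sentence that
    -- passes is true in all intended structures, and in the limit every such sentence passes.
    check : ℕ → ℕ → Bool
    check s n = valid (byA s) (byB s) n

    χA χB : ℕ → Bool
    χA = characteristic em A
    χB = characteristic em B

    χA-separates : ∀ {c} → B c → χA c ≡ false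
    χA-separates {c} b with em {A c}
    ... | yes a = contradiction b (disjoint a)
    ... | no _  = refl

    -- Craig's trick: the stage s is recorded in the shape of the axiom.
    padding : ℕ → Sentence Lᴱ
    padding zero    = ⊤′
    padding (suc s) = ⊥′ ⇒ padding s

    paddingᶜ : ℕ → ℕ
    paddingᶜ zero    = notᶜ botᶜ
    paddingᶜ (suc s) = impᶜ botᶜ (paddingᶜ s)

    padding-code : ∀ s → ⌜ padding s ⌝ ≡ paddingᶜ s
    padding-code zero    = trans (⌜¬⌝ {Lᴱ} {0} ⊥′) (cong notᶜ (⌜⊥⌝ {Lᴱ} {0}))
    padding-code (suc s) = trans (⌜⇒⌝ (⊥′ ⇒ padding s) refl) (cong₂ impᶜ (⌜⊥⌝ {Lᴱ} {0}) (padding-code s))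

    s≤padding : ∀ s → s ≤ paddingᶜ s
    s≤padding zero    = z≤n
    s≤padding (suc s) = ≤-<-trans (s≤padding s) (impᶜ-<ʳ botᶜ (paddingᶜ s))

    UAxiom : Pred (Sentence Lᴱ) 0ℓ
    UAxiom ψ = Σ ℕ λ s → Σ (Sentence Lᴱ) λ φ → ψ ≡ (padding s ⇒ φ) × check s ⌜ φ ⌝ ≡ true

    U : Theory
    U = record { language = Lᴱ ; Axiom = UAxiom }

    padding-provable : ∀ s {Γ} → UAxiom ∣ Γ ⊢ padding s
    padding-provable zero    = ⇒-intro (hyp (here refl))
    padding-provable (suc s) = ⇒-intro (padding-provable s)

    Separates : (ℕ → Bool) → Set
    Separates X = (∀ {c} → A c → X c ≡ true) × (∀ {c} → B c → X c ≡ false)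

    agrees-stage : ∀ {X} → Separates X → ∀ s a n → (∀ c → c < n → bit a c ≡ X c) → agrees (byA s) (byB s) a n ≡ true
    agrees-stage (XA , XB) s a n h = agrees-intro (byA s) (byB s) a n
      (λ c c<n e → trans (h c c<n) (XA (byA⇒A s e))) (λ c c<n e → trans (h c c<n) (XB (byB⇒B s e)))

    -- The characteristic function of `A` meets the constraints of every stage, so at least one
    -- evaluation takes place, and its success certifies the code.
    check-codes : ∀ s n → check s n ≡ true → Σ (Sentence Lᴱ) λ φ → ⌜ φ ⌝ ≡ n
    check-codes s n h with bits-exist χA n
    ... | a , a≤ , bits with holds-elim a n (valid-elim (byA s) (byB s) n h a a≤
          (agrees-stage {χA} (characteristic-true em A , χA-separates) s a n bits))
    ...   | φ , e , _ = φ , e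

    full⇔ : ∀ {X} a (φ : Sentence Lᴱ) n → ⌜ φ ⌝ ≡ n → (∀ c → c < n → bit a c ≡ X c) →
      (holds a n ≡ true → Structure.Sat (fullStructure X) φ (λ ())) ×
      (Structure.Sat (fullStructure X) φ (λ ()) → holds a n ≡ true)
    full⇔ {X} a φ n refl bits = to , λ p → holds-intro a n φ refl (proj₂ (finite⇔full em (bit a) X φ bits) p)
      where
      to : holds a n ≡ true → Structure.Sat (fullStructure X) φ (λ ())
      to h with holds-elim a n h
      ... | ψ , e , p with refl ← ⌜⌝-injective ψ φ e = proj₁ (finite⇔full em (bit a) X φ bits) p

    axiom-true : ∀ {X} → Separates X → ∀ {ψ} → UAxiom ψ → Structure.Sat (fullStructure X) ψ (λ ())
    axiom-true {X} sep (s , φ , refl , h) _ with bits-exist X ⌜ φ ⌝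
    ... | a , a≤ , bits = proj₁ (full⇔ {X} a φ ⌜ φ ⌝ refl bits)
            (valid-elim (byA s) (byB s) ⌜ φ ⌝ h a a≤ (agrees-stage {X} sep s a ⌜ φ ⌝ bits))

    U-sound : ∀ {X} → Separates X → ∀ {φ} → U ⊢ φ → Structure.Sat (fullStructure X) φ (λ ())
    U-sound {X} sep d = Structure.soundness (fullStructure X) em (axiom-true {X} sep) d (λ ()) (λ ())

    -- Excluded middle decides the finitely many memberships, and the latest stage of entry is
    -- taken; nothing claims that it can be computed from `n`.
    stable-stage : ∀ n → ∃[ s ] ∀ c → c < n → (A c → byA s c ≡ true) × (B c → byB s c ≡ true)
    stable-stage zero = 0 , λ _ ()
    stable-stage (suc n) with stable-stage n | stageA | stageB
      where
      stageA : ∃[ s ] (A n → byA s n ≡ true)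
      stageA with em {A n}
      ... | no ¬a = 0 , λ a → contradiction a ¬a
      ... | yes a with A⇒enters a
      ...   | s , h = suc s , λ _ → anyᵇ-intro (λ t → entersA t n) ≤-refl h
      stageB : ∃[ s ] (B n → byB s n ≡ true)
      stageB with em {B n}
      ... | no ¬b = 0 , λ b → contradiction b ¬b
      ... | yes b with B⇒enters b
      ...   | s , h = suc s , λ _ → anyᵇ-intro (λ t → entersB t n) ≤-refl h
    ... | s , h | sA , hA | sB , hB = s ⊔ sA ⊔ sB , settled
      where
      mono : ∀ (p : ℕ → Bool) {m l} → m ≤ l → anyᵇ p m ≡ true → anyᵇ p l ≡ true
      mono p {m} m≤l e with anyᵇ-elim p m e
      ... | i , i<m , pi = anyᵇ-intro p (≤-trans i<m m≤l) pi
      s≤  = ≤-trans (m≤m⊔n s sA) (m≤m⊔n (s ⊔ sA) sB)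
      sA≤ = ≤-trans (m≤n⊔m s sA) (m≤m⊔n (s ⊔ sA) sB)
      settled : ∀ c → c < suc n → (A c → byA (s ⊔ sA ⊔ sB) c ≡ true) × (B c → byB (s ⊔ sA ⊔ sB) c ≡ true)
      settled c c<1+n with m≤n⇒m<n∨m≡n (s≤s⁻¹ c<1+n)
      ... | inj₁ c<n  = (λ a → mono (λ t → entersA t c) s≤ (proj₁ (h c c<n) a)) ,
                        (λ b → mono (λ t → entersB t c) s≤ (proj₂ (h c c<n) b))
      ... | inj₂ refl = (λ a → mono (λ t → entersA t c) sA≤ (hA a)) ,
                        (λ b → mono (λ t → entersB t c) (m≤n⊔m (s ⊔ sA) sB) (hB b))

    -- At a stage where `A` and `B` have settled below the code, the constraints of the stage imply
    -- the true ones, so the sentence is an axiom up to padding.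
    U-complete : ∀ φ → valid χA χB ⌜ φ ⌝ ≡ true → U ⊢ φ
    U-complete φ h with stable-stage ⌜ φ ⌝
    ... | s , settled = ⇒-elim (subst (UAxiom ∣ [] ⊢_) (rename-closed (padding s ⇒ φ)) (axiom (s , φ , refl , checked)))
                              (padding-provable s)
      where
      checked : check s ⌜ φ ⌝ ≡ true
      checked = valid-intro (byA s) (byB s) ⌜ φ ⌝ λ a a≤ ag → valid-elim χA χB ⌜ φ ⌝ h a a≤
        (agrees-intro χA χB a ⌜ φ ⌝
          (λ c c<n e → proj₁ (agrees-elim (byA s) (byB s) a ⌜ φ ⌝ ag c c<n) (proj₁ (settled c c<n) (characteristic-∈ em A e)))
          (λ c c<n e → proj₂ (agrees-elim (byA s) (byB s) a ⌜ φ ⌝ ag c c<n) (proj₂ (settled c c<n) (characteristic-∈ em B e))))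

    theorem⇒valid : ∀ {n} → Theorems U n → valid χA χB n ≡ true
    theorem⇒valid {n} (φ , e , d) = valid-intro χA χB n λ a _ ag →
      proj₂ (full⇔ {extended a} a φ n e (below a)) (U-sound {extended a} (sepA a ag , sepB a ag) d)
      where
      -- Soundness requires a set that separates `A` from `B` everywhere; from `n` on the finite set
      -- is continued by `A` itself.
      extended : ℕ → ℕ → Bool
      extended a c with c <? n
      ... | yes _ = bit a c
      ... | no _  = χA c
      below : ∀ a c → c < n → bit a c ≡ extended a c
      below a c c<n with c <? n
      ... | yes _  = refl
      ... | no c≮n = contradiction c<n c≮n
      sepA : ∀ a → agrees χA χB a n ≡ true → ∀ {c} → A c → extended a c ≡ true
      sepA a ag {c} x with c <? n
      ... | yes c<n = proj₁ (agrees-elim χA χB a n ag c c<n) (characteristic-true em A x)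
      ... | no _    = characteristic-true em A x
      sepB : ∀ a → agrees χA χB a n ≡ true → ∀ {c} → B c → extended a c ≡ false
      sepB a ag {c} x with c <? n
      ... | yes c<n = proj₂ (agrees-elim χA χB a n ag c c<n) (characteristic-true em B x)
      ... | no _    = χA-separates x

    valid⇒theorem : ∀ {n} → valid χA χB n ≡ true → Theorems U n
    valid⇒theorem {n} h with bits-exist χA n
    ... | a , a≤ , bits with holds-elim a n (valid-elim χA χB n h a a≤ (agrees-intro χA χB a n
          (λ c c<n e → trans (bits c c<n) e) (λ c c<n e → trans (bits c c<n) (χA-separates (characteristic-∈ em B e)))))
    ...   | φ , refl , _ = φ , refl , U-complete φ h

    c-setBound : ∀ {O} → Comp₁ O setBound
    c-setBound = comp₁ (ext (λ { (k ∷ []) → step k }) (c-rec (const 0) (ap₂ c-cons (const 1) (v 1F)) (v 0F)))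
      where
      step : ∀ k → natrec 0 (λ _ r → cons 1 r) k ≡ setBound k
      step zero    = refl
      step (suc k) = cong (cons 1) (step k)

    c-paddingᶜ : ∀ {O} → Comp₁ O paddingᶜ
    c-paddingᶜ = comp₁ (ext (λ { (k ∷ []) → step k })
        (c-rec (const (notᶜ botᶜ)) (ap₂ c-imp (const botᶜ) (v 1F)) (v 0F)))
      where
      step : ∀ k → natrec (notᶜ botᶜ) (λ _ r → impᶜ botᶜ r) k ≡ paddingᶜ k
      step zero    = refl
      step (suc k) = cong (impᶜ botᶜ) (step k)

    module _ {O : Pred ℕ 0ℓ} (α β : ℕ → ℕ → Bool)
             (cα : CompB O {2} (λ xs → α (lookup xs 0F) (lookup xs 1F)))
             (cβ : CompB O {2} (λ xs → β (lookup xs 0F) (lookup xs 1F))) where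

      private
        ap : ∀ {γ : ℕ → ℕ → Bool} → CompB O {2} (λ xs → γ (lookup xs 0F) (lookup xs 1F)) →
             ∀ {k} {f g : Vec ℕ k → ℕ} → Comp O f → Comp O g → CompB O (λ xs → γ (f xs) (g xs))
        ap {γ} cγ cf cg = compᵇ (ap₂ (comp₂ {f = λ s c → ⟨ γ s c ⟩} (bodyᵇ cγ)) cf cg)

      c-agrees : CompB O {3} (λ xs → agrees (α (lookup xs 0F)) (β (lookup xs 0F)) (lookup xs 1F) (lookup xs 2F))
      c-agrees = c-all
        {b = λ ys → (not (α (lookup ys 1F) (lookup ys 0F)) ∨ bit (lookup ys 2F) (lookup ys 0F))
                    ∧ (not (β (lookup ys 1F) (lookup ys 0F)) ∨ not (bit (lookup ys 2F) (lookup ys 0F)))}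
        (c-∧ (c-∨ (c-not (ap {α} cα (v 1F) (v 0F))) (c-bit (v 2F) (v 0F)))
             (c-∨ (c-not (ap {β} cβ (v 1F) (v 0F))) (c-not (c-bit (v 2F) (v 0F)))))
        (v 2F)

      c-valid : CompB O {2} (λ xs → valid (α (lookup xs 0F)) (β (lookup xs 0F)) (lookup xs 1F))
      c-valid = c-all
        {b = λ ys → not (agrees (α (lookup ys 1F)) (β (lookup ys 1F)) (lookup ys 0F) (lookup ys 2F))
                    ∨ holds (lookup ys 0F) (lookup ys 2F)}
        (c-∨ (c-not (compᵇ (ap₃ (comp₃ {f = λ s a n → ⟨ agrees (α s) (β s) a n ⟩} (bodyᵇ c-agrees)) (v 1F) (v 0F) (v 2F))))
             (compᵇ (relativise-comp (bodyᵇ (c-holds (v 0F) (v 2F))))))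
        (ap₁ c-suc (ap₁ c-setBound (v 1F)))

    c-check : CompB ∅ {2} (λ xs → check (lookup xs 0F) (lookup xs 1F))
    c-check = c-valid byA byB
      (c-any {b = λ ys → entersA (lookup ys 0F) (lookup ys 2F)}
        (compᵇ (ap₂ (comp₂ {f = λ s z → ⟨ entersA s z ⟩} (bodyᵇ c-entersA)) (v 0F) (v 2F))) (v 0F))
      (c-any {b = λ ys → entersB (lookup ys 0F) (lookup ys 2F)}
        (compᵇ (ap₂ (comp₂ {f = λ s z → ⟨ entersB s z ⟩} (bodyᵇ c-entersB)) (v 0F) (v 2F))) (v 0F))

    -- Theoremhood is a bounded question about the characteristic functions of `A` and `B`; it is
    -- here that deductive closure does not raise the degree.
    theorems≤ : ∀ {O} → A ≤ᵀ O → B ≤ᵀ O → Theorems U ≤ᵀ O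
    theorems≤ {O} a b = decides⇒≤ᵀ {χ = valid χA χB} record
      { computable = compᵇ (ap₂ (comp₂ {f = λ _ n → ⟨ valid χA χB n ⟩}
          (bodyᵇ (c-valid (λ _ → χA) (λ _ → χB) (second {χA} (Decides.computable (≤ᵀ⇒decides em a)))
                                               (second {χB} (Decides.computable (≤ᵀ⇒decides em b)))))) (const 0) (v 0F))
      ; ∈⇒true = theorem⇒valid
      ; true⇒∈ = valid⇒theorem
      }
      where
      second : ∀ {χ : ℕ → Bool} → CompB O {1} (λ xs → χ (lookup xs 0F)) → CompB O {2} (λ xs → χ (lookup xs 1F))
      second {χ} c = compᵇ (ap₁ (comp₁ {f = λ n → ⟨ χ n ⟩} (bodyᵇ c)) (v 1F))

    -- The stage and the code of the sentence are both bounded by the code of the axiom; for the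
    -- stage this is the effect of the padding.
    isAxiom : ℕ → Bool
    isAxiom n = anyᵇ (λ s → anyᵇ (λ m → (impᶜ (paddingᶜ s) m ≡ᵇ n) ∧ check s m) (suc n)) (suc n)

    axioms-recursive : Recursive (codes UAxiom)
    axioms-recursive = decides⇒≤ᵀ {χ = isAxiom} record
      { computable = c-any
          {b = λ ys → anyᵇ (λ m → (impᶜ (paddingᶜ (lookup ys 0F)) m ≡ᵇ lookup ys 1F) ∧ check (lookup ys 0F) m) (suc (lookup ys 1F))}
          (c-any {b = λ ys → (impᶜ (paddingᶜ (lookup ys 1F)) (lookup ys 0F) ≡ᵇ lookup ys 2F) ∧ check (lookup ys 1F) (lookup ys 0F)}
            (c-∧ (c-≡ᵇ (ap₂ c-imp (ap₁ c-paddingᶜ (v 1F)) (v 0F)) (v 2F))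
                 (compᵇ (ap₂ (comp₂ {f = λ s m → ⟨ check s m ⟩} (bodyᵇ c-check)) (v 1F) (v 0F))))
            (ap₁ c-suc (v 1F)))
          (ap₁ c-suc (v 0F))
      ; ∈⇒true = to
      ; true⇒∈ = from
      }
      where
      code≡ : ∀ s (φ : Sentence Lᴱ) → ⌜ padding s ⇒ φ ⌝ ≡ impᶜ (paddingᶜ s) ⌜ φ ⌝
      code≡ s φ = trans (⌜⇒⌝ (padding s ⇒ φ) refl) (cong (λ c → impᶜ c ⌜ φ ⌝) (padding-code s))
      to : ∀ {n} → codes UAxiom n → isAxiom n ≡ true
      to {n} (_ , e , s , φ , refl , h) = anyᵇ-intro _ {suc n} {s} s<
        (anyᵇ-intro (λ m → (impᶜ (paddingᶜ s) m ≡ᵇ n) ∧ check s m) {suc n} {⌜ φ ⌝} φ<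
          (∧-intro (trans (cong (_≡ᵇ n) n≡) (≡ᵇ-refl n)) h))
        where
        n≡ : impᶜ (paddingᶜ s) ⌜ φ ⌝ ≡ n
        n≡ = trans (sym (code≡ s φ)) e
        s< : s < suc n
        s< = s≤s (≤-trans (s≤padding s) (≤-trans (<⇒≤ (impᶜ-<ˡ (paddingᶜ s) ⌜ φ ⌝)) (≤-reflexive n≡)))
        φ< : ⌜ φ ⌝ < suc n
        φ< = s≤s (≤-trans (<⇒≤ (impᶜ-<ʳ (paddingᶜ s) ⌜ φ ⌝)) (≤-reflexive n≡))
      from : ∀ {n} → isAxiom n ≡ true → codes UAxiom n
      from {n} h with anyᵇ-elim (λ s → anyᵇ (λ m → (impᶜ (paddingᶜ s) m ≡ᵇ n) ∧ check s m) (suc n)) (suc n) h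
      ... | s , _ , h′ with anyᵇ-elim (λ m → (impᶜ (paddingᶜ s) m ≡ᵇ n) ∧ check s m) (suc n) h′
      ...   | m , _ , h″ with check-codes s m (∧-trueʳ {impᶜ (paddingᶜ s) m ≡ᵇ n} h″)
      ...     | φ , refl = (padding s ⇒ φ) , trans (code≡ s φ) (≡ᵇ-true (∧-trueˡ h″)) ,
                           s , φ , refl , ∧-trueʳ {impᶜ (paddingᶜ s) m ≡ᵇ n} h″

    language-recursive : RecursiveLanguage Lᴱ
    language-recursive =
      decides⇒≤ᵀ {χ = λ _ → false} record { computable = compᵇ (const 0) ; ∈⇒true = λ { (_ , () , _) } ; true⇒∈ = λ () } ,
      -- `E` has arity 2 and number 0, and `pair 2 0` is 3.
      decides⇒≤ᵀ {χ = λ n → n ≡ᵇ 3} record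
        { computable = c-≡ᵇ (v 0F) (const 3) ; ∈⇒true = λ { (_ , E , refl) → refl } ; true⇒∈ = λ h → 2 , E , sym (≡ᵇ-true h) }

    recursivelyAxiomatizable : RecursivelyAxiomatizable U
    recursivelyAxiomatizable = language-recursive , UAxiom , axioms-recursive , λ φ → mk⇔ id id

    U-consistent : Consistent U
    U-consistent = U-sound {χA} (characteristic-true em A , χA-separates)

    -- The sets `bit a` that `valid` ranges over need not separate `A` from `B` beyond the code,
    -- hence the bounded condition on `X`.
    true⇒provable : ∀ φ → (∀ X → (∀ c → c < ⌜ φ ⌝ → (A c → X c ≡ true) × (B c → X c ≡ false)) →
                           Structure.Sat (fullStructure X) φ (λ ())) → UAxiom ∣ [] ⊢ φ
    true⇒provable φ h = U-complete φ (valid-intro χA χB ⌜ φ ⌝ λ a _ ag →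
      proj₂ (full⇔ {bit a} a φ ⌜ φ ⌝ refl (λ _ _ → refl)) (h (bit a) λ c c<n →
        (λ x → proj₁ (agrees-elim χA χB a ⌜ φ ⌝ ag c c<n) (characteristic-true em A x)) ,
        (λ x → proj₂ (agrees-elim χA χB a ⌜ φ ⌝ ag c c<n) (characteristic-true em B x))))

    A⇒provable : ∀ {n} → A n → UAxiom ∣ [] ⊢ classOfSize n
    A⇒provable {n} a = true⇒provable (classOfSize n) λ X h → X⇒classOfSize em X (proj₁ (h n (n<classOfSize n)) a)

    -- `A` itself is one of the separating sets, so a provable sentence holds in `M(A)`.
    provable⇒A : ∀ {n} → UAxiom ∣ [] ⊢ classOfSize n → A n
    provable⇒A {n} d = characteristic-∈ em A
      (classOfSize⇒X em χA n (U-sound {χA} (characteristic-true em A , χA-separates) {classOfSize n} d))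

    code<¬ : ∀ (φ : Sentence Lᴱ) {n} → n < ⌜ φ ⌝ → n < ⌜ ¬′ φ ⌝
    code<¬ φ lt = <-≤-trans lt (≤-trans (<⇒≤ (impᶜ-<ˡ ⌜ φ ⌝ botᶜ)) (≤-reflexive (sym (⌜¬⌝ φ))))

    B⇒refutable : ∀ {n} → B n → UAxiom ∣ [] ⊢ ¬′ classOfSize n
    B⇒refutable {n} b = true⇒provable (¬′ classOfSize n) λ X h p →
      case trans (sym (classOfSize⇒X em X n p)) (proj₂ (h n (code<¬ (classOfSize n) (n<classOfSize n))) b) of λ ()

-- Incompleteness of the theories interpreting `U`, and the degree of `U`

open Computability
open Pairing
open RuleSystems
open UniversalMachine
open FirstOrderLogic
open FormulaCodes
open ProofEnumeration
open RobinsonArithmetic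
open ClassSizes
open FiniteEvaluation
open EvaluationSystem
open TheoryOfPair
open SentenceCodes
open InseparableSets

module Completion (em : ExcludedMiddle 0ℓ) (S : Theory) (axiomatizable : RecursivelyAxiomatizable S) (consistent : Consistent S)
                  (complete : ∀ φ → (S ⊢ φ) ⊎ (S ⊢ ¬′ φ))
                  (sentence : ℕ → Sentence (language S)) (sentenceᶜ : ℕ → ℕ) (c-sentenceᶜ : Comp₁ ∅ sentenceᶜ)
                  (sentence-code : ∀ z → ⌜ sentence z ⌝ ≡ sentenceᶜ z) where

  open Provability em (proj₁ axiomatizable) (proj₁ (proj₂ axiomatizable)) (proj₁ (proj₂ (proj₂ axiomatizable)))
    using (provedBy; c-provedBy; provedBy-sound; provedBy-complete)

  proved-sound : ∀ s φ {c} → ⌜ φ ⌝ ≡ c → provedBy s c ≡ true → S ⊢ φ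
  proved-sound s φ refl h = Equivalence.from (proj₂ (proj₂ (proj₂ axiomatizable)) φ) (provedBy-sound s φ h)

  proved-complete : ∀ φ {c} → ⌜ φ ⌝ ≡ c → S ⊢ φ → ∃[ s ] provedBy s c ≡ true
  proved-complete φ refl d = provedBy-complete (Equivalence.to (proj₂ (proj₂ (proj₂ axiomatizable)) φ) d)

  negation-code : ∀ z → ⌜ ¬′ sentence z ⌝ ≡ notᶜ (sentenceᶜ z)
  negation-code z = trans (⌜¬⌝ (sentence z)) (cong notᶜ (sentence-code z))

  -- Completeness of `S` guarantees that a proof of the sentence or of its negation turns up at some
  -- stage.
  decision : Search ∅ (λ xs → provedBy (lookup {n = 2} xs 0F) (sentenceᶜ (lookup xs 1F))
                              ∨ provedBy (lookup xs 0F) (notᶜ (sentenceᶜ (lookup xs 1F))))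
  decision = search
    (c-∨ (c-provedBy (v 0F) (ap₁ c-sentenceᶜ (v 1F)))
         (c-provedBy (v 0F) (ap₁ c-notᶜ (ap₁ c-sentenceᶜ (v 1F)))))
    λ { (z ∷ []) → exists z }
    where
    exists : ∀ z → ∃[ s ] provedBy s (sentenceᶜ z) ∨ provedBy s (notᶜ (sentenceᶜ z)) ≡ true
    exists z with complete (sentence z)
    ... | inj₁ d with proved-complete (sentence z) (sentence-code z) d
    ...   | s , h = s , ∨-introˡ h
    exists z | inj₂ d with proved-complete (¬′ sentence z) (negation-code z) d
    ...   | s , h = s , ∨-introʳ (provedBy s (sentenceᶜ z)) h

  -- At the stage found at least one of the two proofs is present, so a missing proof of the
  -- sentence leaves one of its negation.
  χ : ℕ → Bool
  χ z = provedBy (found decision (z ∷ [])) (sentenceᶜ z)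

  c-χ : CompB ∅ {1} (λ xs → χ (lookup xs 0F))
  c-χ = c-provedBy (ext (λ { (z ∷ []) → refl }) (c-found decision)) (ap₁ c-sentenceᶜ (v 0F))

  χ-sound : ∀ z → χ z ≡ true → S ⊢ sentence z
  χ-sound z = proved-sound (found decision (z ∷ [])) (sentence z) (sentence-code z)

  χ-false : ∀ z → χ z ≡ false → S ⊢ ¬′ sentence z
  χ-false z e with ∨-true {χ z} (satisfies decision (z ∷ []))
  ... | inj₁ h = case trans (sym e) h of λ ()
  ... | inj₂ h = proved-sound (found decision (z ∷ [])) (¬′ sentence z) (negation-code z) h

  provable⇒χ : ∀ z → S ⊢ sentence z → χ z ≡ true
  provable⇒χ z d = decided (χ z) refl
    where
    decided : ∀ b → χ z ≡ b → χ z ≡ true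
    decided true  e = e
    decided false e = contradiction (⇒-elim (χ-false z e) d) consistent

  refutable⇒¬χ : ∀ z → S ⊢ ¬′ sentence z → χ z ≡ false
  refutable⇒¬χ z d = decided (χ z) refl
    where
    decided : ∀ b → χ z ≡ b → χ z ≡ false
    decided false e = e
    decided true  e = contradiction (⇒-elim d (χ-sound z e)) consistent

essentially-incomplete : ExcludedMiddle 0ℓ → ∀ (A B : Pred ℕ 0ℓ) (T : Pred (Sentence Lᴱ) 0ℓ) →
  (∀ {n} → A n → T ∣ [] ⊢ classOfSize n) → (∀ {n} → B n → T ∣ [] ⊢ ¬′ classOfSize n) →
  (∀ (χ : ℕ → Bool) → CompB ∅ {1} (λ xs → χ (lookup xs 0F)) →
     (∀ {z} → A z → χ z ≡ true) → (∀ {z} → B z → χ z ≡ false) → ⊥) →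
  ∀ S → RecursivelyAxiomatizable S → Consistent S → record { language = Lᴱ ; Axiom = T } InterpretableIn S → Incomplete S
essentially-incomplete em A B T A⇒provable B⇒refutable inseparable S axiomatizable consistent (I , interprets)
  with em {Incomplete S}
... | yes incomplete = incomplete
... | no ¬incomplete = ⊥-elim (inseparable χ c-χ
      (λ {z} a → provable⇒χ z (interprets (classOfSize z) (A⇒provable {z} a)))
      -- `translate` commutes with negation by definition.
      (λ {z} b → refutable⇒¬χ z (interprets (¬′ classOfSize z) (B⇒refutable {z} b))))
  where
  complete : ∀ φ → (S ⊢ φ) ⊎ (S ⊢ ¬′ φ)
  complete φ with em {S ⊢ φ} | em {S ⊢ ¬′ φ}
  ... | yes d | _     = inj₁ d
  ... | no _  | yes d = inj₂ d
  ... | no ¬d | no ¬e = contradiction (φ , ¬d , ¬e) ¬incomplete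
  open TranslationCode I using (translationCode)
  open Completion em S axiomatizable consistent complete (λ z → translate I (classOfSize z))
    (classOfSizeᵗ translationCode) (c-classOfSizeᵗ translationCode) (tr-classOfSize translationCode)
    using (χ; c-χ; provable⇒χ; refutable⇒¬χ)

module Construction (em : ExcludedMiddle 0ℓ) (W : Pred ℕ 0ℓ) (re : RecursivelyEnumerable W) (nonrecursive : ¬ Recursive W) where

  open Inseparable em W re
  open PairTheory em A B entersA entersB (c-entersA (v 0F) (v 1F)) (c-entersB (v 0F) (v 1F))
    (λ a → a) (λ s h → s , h) (λ b → b) (λ s h → s , h) disjoint public

  G1-U : G1 U
  G1-U = recursivelyAxiomatizable , U-consistent ,
    essentially-incomplete em A B UAxiom A⇒provable B⇒refutable (λ χ c-χ p q → nonrecursive (inseparable χ c-χ p q))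

  theorems≤W : Theorems U ≤ᵀ W
  theorems≤W = theorems≤ A≤W B≤W

  theorem-of-code : ∀ (φ : Sentence Lᴱ) {c} → ⌜ φ ⌝ ≡ c → Theorems U c → UAxiom ∣ [] ⊢ φ
  theorem-of-code φ e (ψ , ψ≡ , d) = subst (UAxiom ∣ [] ⊢_) (⌜⌝-injective ψ φ (trans ψ≡ (sym e))) d

  code-of-theorem : ∀ (φ : Sentence Lᴱ) {c} → ⌜ φ ⌝ ≡ c → UAxiom ∣ [] ⊢ φ → Theorems U c
  code-of-theorem φ e d = φ , e , d

  -- The pairs with first component 0 copy `W` into `A`, and `U` proves `classOfSize z` exactly for
  -- `z` in `A`.
  W≤theorems : W ≤ᵀ Theorems U
  W≤theorems = ≤ᵐ⇒≤ᵀ {f = λ x → classOfSizeᵗ plainCode (pair 0 x)}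
    (comp₁ (relativise-comp (ap₁ (c-classOfSizeᵗ plainCode) (ap₂ c-pair (const 0) (v 0F)))))
    (λ {x} w → code-of-theorem (classOfSize (pair 0 x)) (tr-classOfSize plainCode (pair 0 x)) (A⇒provable (W⇒A w)))
    (λ {x} h → A⇒W (provable⇒A (theorem-of-code (classOfSize (pair 0 x)) (tr-classOfSize plainCode (pair 0 x)) h)))

mainTheorem8 : ExcludedMiddle 0ℓ →
    (D : Pred ℕ 0ℓ) → HasREDegree D → ∅ <ᵀ D → D <ᵀ Halting →
    Σ Theory λ U → G1 U × Theorems U <ᵀ Theorems 𝐑 × Theorems U ≡ᵀ D
mainTheorem8 em D (W , re , W≤D , D≤W) (_ , D≰∅) (D≤H , H≰D) = U , G1-U ,
    -- `U` lies below `𝐑` by way of `D` and `Halting`. If it computed the theorems of `𝐑`, then `D`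
    -- would compute `Halting`.
    (≤ᵀ-trans U≤D (≤ᵀ-trans D≤H (halting≤𝐑 em)) , λ R≤U → H≰D (≤ᵀ-trans (halting≤𝐑 em) (≤ᵀ-trans R≤U U≤D))) ,
    (U≤D , ≤ᵀ-trans D≤W W≤theorems)
  where
  open Construction em W re (λ rec → D≰∅ (≤ᵀ-trans D≤W rec))
  U≤D : Theorems U ≤ᵀ D
  U≤D = ≤ᵀ-trans theorems≤W W≤D
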